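{- Let $6/13<\alpha<1/2$ be a fixed constant. Let $p$ be a prime, $1\le m\le p$ an integer, and let $A$ be a zero-sum-free sequence of $\mathbb{Z}_p$ with $m(A)\le m$ and cardinality $|A|=|A_1^m|-O((pm)^{\alpha})$. Then there exist a non-zero element $b\in\mathbb{Z}_p$ and a subsequence $A^{\flat}\subset A$ of cardinality $O((pm)^{(\alpha+1/2)/2})$ such that $b\cdot(A\setminus A^{\flat})\subset A_1^m$ (as sequences, i.e. with multiplicities).
   Context: $\mathbb{Z}_p$ is the cyclic group of prime order $p$. A sequence is a finite multiset; $m(A)$ is its maximum multiplicity (throughout, $m(A)\le p$); subsequences and cardinalities count multiplicity. $A$ is zero-sum-free if no non-empty subsequence of $A$ has sum $0$ in $\mathbb{Z}_p$. $b\cdot A=\{ba:a\in A\}$. $A_1^m$ is the sequence $\{1^{[m]},2^{[m]},\dots,(n-1)^{[m]},n^{[k]}\}$ of $\mathbb{Z}_p$ (where $x^{[j]}$ means $x$ repeated $j$ times), with $k,n$ the unique integers satisfying $1\le k\le m$ and $m(1+2+\dots+(n-1))+kn<p\le m(1+2+\dots+(n-1))+(k+1)n$. Asymptotic notation is with respect to $p\to\infty$: the hypothesis means $\big||A_1^m|-|A|\big|\le C(pm)^\alpha$ for a fixed constant $C$, and the conclusion holds with an implied constant depending only on $\alpha$ and $C$.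
   Formalization: The fixed constant α in (6/13, 1/2) is restricted to rational numbers a/q; irrational α is not covered. -}

module Defs where

open import Data.Nat using (ℕ; zero; suc; _+_; _*_; _∸_; _≤_; _<_; NonZero; _%_; _≤?_)
open import Data.Nat.Properties using (_≟_)
open import Data.Fin using (Fin; toℕ; zero; suc)
open import Data.Bool using (if_then_else_)
open import Relation.Nullary using (¬_)
open import Relation.Nullary.Decidable using (⌊_⌋)
open import Relation.Binary.PropositionalEquality using (_≡_)
open import Data.Product using (_×_)

-- A sequence (finite multiset) of ℤ_p, with ℤ_p represented by Fin p
-- (residues 0,…,p-1), is given by its multiplicity function.
Seq : ℕ → Set
Seq p = Fin p → ℕ

sumFin : (n : ℕ) → (Fin n → ℕ) → ℕ
sumFin zero    f = 0
sumFin (suc n) f = f zero + sumFin n (λ i → f (suc i))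

card : ∀ {p} → Seq p → ℕ
card {p} A = sumFin p A

-- σ(A) as a natural number: Σ_x A(x)·x  (its class mod p is the sum in ℤ_p)
seqSum : ∀ {p} → Seq p → ℕ
seqSum {p} A = sumFin p (λ x → A x * toℕ x)

_⊑_ : ∀ {p} → Seq p → Seq p → Set
B ⊑ A = ∀ x → B x ≤ A x

-- A ∖ B (for B ⊑ A)
_∖_ : ∀ {p} → Seq p → Seq p → Seq p
(A ∖ B) x = A x ∸ B x

maxMultAtMost : ∀ {p} → Seq p → ℕ → Set
maxMultAtMost A m = ∀ x → A x ≤ m

ZeroSumFree : ∀ {p} .{{_ : NonZero p}} → Seq p → Set
ZeroSumFree {p} A = ∀ (B : Seq p) → B ⊑ A → ¬ (card B ≡ 0) → ¬ (seqSum B % p ≡ 0)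

scale : ∀ {p} .{{_ : NonZero p}} → Fin p → Seq p → Seq p
scale {p} b A y = sumFin p (λ x → if ⌊ (toℕ b * toℕ x) % p ≟ toℕ y ⌋ then A x else 0)

tri : ℕ → ℕ
tri zero    = 0
tri (suc j) = suc j + tri j

A1Params : (p m k n : ℕ) → Set
A1Params p m k n =
  (1 ≤ k) × (k ≤ m) ×
  (m * tri (n ∸ 1) + k * n < p) × (p ≤ m * tri (n ∸ 1) + (suc k) * n)

-- A_1^m = {1^[m], 2^[m], …, (n-1)^[m], n^[k]} as a multiplicity function on Fin p
A1 : (p m k n : ℕ) → Seq p
A1 p m k n x with toℕ x
... | zero  = 0
... | suc j = if ⌊ suc j ≟ n ⌋ then k else (if ⌊ suc (suc j) ≤? n ⌋ then m else 0)

-- For a set B of subset sums, the number of elements of B + t outside B is subadditive in t, and its balls grow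
-- linearly.  Hence few elements of A have a small norm unless B is already large; the sums of a small part F of A
-- fill a positive proportion of ℤ/p while all other elements have norm O(p / |A|) with respect to B = Σ(F).
-- Compare B with its dilates smoothed by an interval: averaged over all dilations b (where b v is equidistributed
-- for v ≢ 0), the change D of the smoothed function under a shift by b x and by its first multiples is small
-- compared with the mean of D over ℤ/p, so this also holds for a fixed b and most elements x.  By Dirichlet's
-- theorem some small multiple q b x is then small, since otherwise its multiples would make D small everywhere.
-- Thus one dilation turns most elements of A into integers of absolute value O(p / |A|), and we may divide by
-- common factors of almost all of them.
--
-- By pigeonhole, O((p / |A|)^{1/2}) of these integers have subset sums that contain a long interval.  Each further
-- element r lengthens the interval by |r|, and the interval cannot reach length p, as A is zero-sum-free.  So
-- Σ |r| < p, and if there were many elements of both signs, a subset sum would cancel an element kept in reserve.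
-- Since A₁ has the maximal number of elements for Σ |r| < p, linear programming bounds the number of elements of
-- b·A in excess of A₁.

module Submission where

open import Defs
open import Data.Nat using (ℕ; _+_; _*_; _^_; _≤_; _<_; NonZero; ∣_-_∣)
open import Data.Nat.Primality using (Prime)
open import Data.Fin using (Fin; toℕ)
open import Data.Product using (Σ; _×_)
open import Relation.Nullary using (¬_)
open import Relation.Binary.PropositionalEquality using (_≡_)

open import Data.Bool using (Bool; true; false; _∧_; _∨_; not; if_then_else_)
open import Data.Empty using (⊥; ⊥-elim)
open import Data.Fin using (fromℕ<)
open import Data.Fin.Properties using (toℕ<n; toℕ-fromℕ<; fromℕ<-toℕ; pigeonhole)
open import Data.Integer using (ℤ; -[1+_]; ∣_∣; _%ℕ_; _/ℕ_; _⊖_) renaming (+_ to pos; _+_ to _+ᶻ_; _*_ to _*ᶻ_; _-_ to _-ᶻ_; -_ to -ᶻ_)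
open import Data.Integer.DivMod using (n%ℕd<d; a≡a%ℕn+[a/ℕn]*n)
import Data.Integer.Properties as ℤP
open import Data.Integer.Tactic.RingSolver using () renaming (solve-∀ to solveℤ)
open import Data.List using (List; []; _∷_; _++_; map; length; replicate)
import Data.List.Properties as LP
open import Data.List.Relation.Binary.Permutation.Propositional using (_↭_; prep; swap; ↭-refl; ↭-sym; ↭-trans; ↭-reflexive) renaming (refl to ↭refl; trans to ↭trans)
import Data.List.Relation.Binary.Permutation.Propositional.Properties as ↭P
open import Data.List.Relation.Unary.All using (All; []; _∷_)
import Data.List.Relation.Unary.All as AllL
import Data.List.Relation.Unary.All.Properties as AllP
open import Data.Nat using (zero; suc; _∸_; _/_; _%_; _≤?_; _<?_; z≤n; s≤s; >-nonZero; _!; _⊔_)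
open import Data.Nat.Coprimality using (prime⇒coprime; coprime-Bézout)
open import Data.Nat.DivMod using (m≡m%n+[m/n]*n; m%n<n; m/n*n≤m; m<n⇒m%n≡m; [m+kn]%n≡m%n; /-mono-≤; m*n/n≡m; m<n*o⇒m/o<n; /-monoˡ-≤; m≥n⇒m/n>0; m/n≤m)
open import Data.Nat.Divisibility using (∣⇒≤; 0∣⇒≡0)
open import Data.Nat.GCD using (module GCD; module Bézout)
open import Data.Nat.Primality using (¬prime[1])
open import Data.Nat.Properties
open import Data.Nat.Tactic.RingSolver using () renaming (solve-∀ to solveℕ)
open import Data.Product using (_,_; proj₁; proj₂; ∃-syntax)
open import Data.Sum using (_⊎_; inj₁; inj₂)
open import Data.Unit using (⊤)
open import Function using (_∘_)
open import Relation.Binary.PropositionalEquality using (refl; sym; trans; cong; cong₂; subst; subst₂; module ≡-Reasoning)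
open import Relation.Nullary using (Dec; yes; no; contradiction)
open import Relation.Nullary.Decidable using (⌊_⌋)

-- The obstacle is that the choice of a dilation loses a fixed proportion of A, far more than the
-- theorem allows. The lost elements therefore accompany the small integers through all later steps
-- as a second list, and they are recovered at the end: once the interval of sums is longer than p/2
-- it can absorb any residue, since every residue has a representative of absolute value at most
-- p/2. The average over dilations contains b = 0, where the smoothed function is degenerate.
-- Removing this term leaves a factor p - |B|, so B = Σ(F) needs a large complement. A disjoint part
-- F' with many sums provides it: Σ(F) and -Σ(F') share only 0. The exponent is that of a geometric
-- mean. Let e be the deviation of |A| plus the number of elements spent on the interval, which is
-- O((pm)^{1/4}). The elements that do not fit into A₁ have distances from n of total O(n e); at
-- most m of them share a value, so their number is O((m n e)^{1/2}), where m n = O(|A|) =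
-- O((pm)^{1/2}) and e = O((pm)^α).

-- Finite sums over ranges and lists, and counting

∑ : ℕ → (ℕ → ℕ) → ℕ
∑ zero    g = 0
∑ (suc n) g = g 0 + ∑ n (g ∘ suc)

∑-cong< : ∀ n {g h : ℕ → ℕ} → (∀ i → i < n → g i ≡ h i) → ∑ n g ≡ ∑ n h
∑-cong< zero    e = refl
∑-cong< (suc n) e = cong₂ _+_ (e 0 (s≤s z≤n)) (∑-cong< n (λ i l → e (suc i) (s≤s l)))

∑-cong : ∀ n {g h : ℕ → ℕ} → (∀ i → g i ≡ h i) → ∑ n g ≡ ∑ n h
∑-cong n e = ∑-cong< n (λ i _ → e i)

∑-mono< : ∀ n {g h : ℕ → ℕ} → (∀ i → i < n → g i ≤ h i) → ∑ n g ≤ ∑ n h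
∑-mono< zero    e = z≤n
∑-mono< (suc n) e = +-mono-≤ (e 0 (s≤s z≤n)) (∑-mono< n (λ i l → e (suc i) (s≤s l)))

∑-mono : ∀ n {g h : ℕ → ℕ} → (∀ i → g i ≤ h i) → ∑ n g ≤ ∑ n h
∑-mono n e = ∑-mono< n (λ i _ → e i)

medial : ∀ a b c d → (a + b) + (c + d) ≡ (a + c) + (b + d)
medial = solveℕ

∑-+ : ∀ n (g h : ℕ → ℕ) → ∑ n (λ i → g i + h i) ≡ ∑ n g + ∑ n h
∑-+ zero    g h = refl
∑-+ (suc n) g h = trans (cong (g 0 + h 0 +_) (∑-+ n (g ∘ suc) (h ∘ suc))) (medial (g 0) (h 0) _ _)

∑-*ˡ : ∀ n c (g : ℕ → ℕ) → ∑ n (λ i → c * g i) ≡ c * ∑ n g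
∑-*ˡ zero    c g = sym (*-zeroʳ c)
∑-*ˡ (suc n) c g = trans (cong (c * g 0 +_) (∑-*ˡ n c (g ∘ suc))) (sym (*-distribˡ-+ c (g 0) _))

∑-*ʳ : ∀ n c (g : ℕ → ℕ) → ∑ n (λ i → g i * c) ≡ ∑ n g * c
∑-*ʳ n c g = trans (∑-cong n (λ i → *-comm (g i) c)) (trans (∑-*ˡ n c g) (*-comm c _))

∑-const : ∀ n c → ∑ n (λ _ → c) ≡ n * c
∑-const zero    c = refl
∑-const (suc n) c = cong (c +_) (∑-const n c)

∑-0 : ∀ n → ∑ n (λ _ → 0) ≡ 0
∑-0 n = trans (∑-const n 0) (*-zeroʳ n)

∑-bound : ∀ n c {g : ℕ → ℕ} → (∀ i → i < n → g i ≤ c) → ∑ n g ≤ n * c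
∑-bound n c h = ≤-trans (∑-mono< n h) (≤-reflexive (∑-const n c))

∑-swap : ∀ n k (g : ℕ → ℕ → ℕ) → ∑ n (λ i → ∑ k (g i)) ≡ ∑ k (λ j → ∑ n (λ i → g i j))
∑-swap zero    k g = sym (∑-0 k)
∑-swap (suc n) k g = trans (cong (∑ k (g 0) +_) (∑-swap n k (g ∘ suc))) (sym (∑-+ k (g 0) _))

∑-last : ∀ n (g : ℕ → ℕ) → ∑ (suc n) g ≡ ∑ n g + g n
∑-last zero    g = +-comm (g 0) 0
∑-last (suc n) g = trans (cong (g 0 +_) (∑-last n (g ∘ suc))) (sym (+-assoc (g 0) _ _))

∑-split : ∀ a b (g : ℕ → ℕ) → ∑ (a + b) g ≡ ∑ a g + ∑ b (λ i → g (a + i))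
∑-split zero    b g = refl
∑-split (suc a) b g = trans (cong (g 0 +_) (∑-split a b (g ∘ suc))) (sym (+-assoc (g 0) _ _))

term≤∑ : ∀ n (g : ℕ → ℕ) i → i < n → g i ≤ ∑ n g
term≤∑ (suc n) g zero    l       = m≤m+n _ _
term≤∑ (suc n) g (suc i) (s≤s l) = ≤-trans (term≤∑ n (g ∘ suc) i l) (m≤n+m _ _)

∑-mono-len : ∀ {a b} (g : ℕ → ℕ) → a ≤ b → ∑ a g ≤ ∑ b g
∑-mono-len g z≤n     = z≤n
∑-mono-len g (s≤s l) = +-monoʳ-≤ (g 0) (∑-mono-len (g ∘ suc) l)

∑-<⇒∃ : ∀ n (g h : ℕ → ℕ) → ∑ n g < ∑ n h → ∃[ i ] (i < n × g i < h i)
∑-<⇒∃ (suc n) g h l with g 0 <? h 0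
... | yes a = 0 , s≤s z≤n , a
... | no  a with ∑-<⇒∃ n (g ∘ suc) (h ∘ suc) (+-cancelˡ-< (h 0) _ _ (≤-<-trans (+-monoˡ-≤ _ (≮⇒≥ a)) l))
...   | i , i<n , b = suc i , s≤s i<n , b

∑ᴸ : ∀ {X : Set} → (X → ℕ) → List X → ℕ
∑ᴸ g []       = 0
∑ᴸ g (x ∷ xs) = g x + ∑ᴸ g xs

∑ᴸ-++ : ∀ {X : Set} (g : X → ℕ) xs ys → ∑ᴸ g (xs ++ ys) ≡ ∑ᴸ g xs + ∑ᴸ g ys
∑ᴸ-++ g []       ys = refl
∑ᴸ-++ g (x ∷ xs) ys = trans (cong (g x +_) (∑ᴸ-++ g xs ys)) (sym (+-assoc (g x) _ _))

∑ᴸ-↭ : ∀ {X : Set} (g : X → ℕ) {xs ys} → xs ↭ ys → ∑ᴸ g xs ≡ ∑ᴸ g ys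
∑ᴸ-↭ g ↭refl = refl
∑ᴸ-↭ g (prep x r) = cong (g x +_) (∑ᴸ-↭ g r)
∑ᴸ-↭ g (swap x y r) = trans (cong (λ s → g x + (g y + s)) (∑ᴸ-↭ g r)) (x∙yz≈y∙xz (g x) (g y) _)
  where
  x∙yz≈y∙xz : ∀ a b c → a + (b + c) ≡ b + (a + c)
  x∙yz≈y∙xz = solveℕ
∑ᴸ-↭ g (↭trans r s) = trans (∑ᴸ-↭ g r) (∑ᴸ-↭ g s)

∑ᴸ-mono : ∀ {X : Set} {g h : X → ℕ} {xs} → All (λ x → g x ≤ h x) xs → ∑ᴸ g xs ≤ ∑ᴸ h xs
∑ᴸ-mono []       = z≤n
∑ᴸ-mono (a ∷ as) = +-mono-≤ a (∑ᴸ-mono as)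

∑ᴸ-cong : ∀ {X : Set} {g h : X → ℕ} → (∀ x → g x ≡ h x) → ∀ xs → ∑ᴸ g xs ≡ ∑ᴸ h xs
∑ᴸ-cong e []       = refl
∑ᴸ-cong e (x ∷ xs) = cong₂ _+_ (e x) (∑ᴸ-cong e xs)

∑ᴸ-map : ∀ {X Y : Set} (g : Y → ℕ) (f : X → Y) xs → ∑ᴸ g (map f xs) ≡ ∑ᴸ (g ∘ f) xs
∑ᴸ-map g f []       = refl
∑ᴸ-map g f (x ∷ xs) = cong (g (f x) +_) (∑ᴸ-map g f xs)

∑ᴸ-+ : ∀ {X : Set} (g h : X → ℕ) xs → ∑ᴸ (λ x → g x + h x) xs ≡ ∑ᴸ g xs + ∑ᴸ h xs
∑ᴸ-+ g h []       = refl
∑ᴸ-+ g h (x ∷ xs) = trans (cong (g x + h x +_) (∑ᴸ-+ g h xs)) (medial (g x) (h x) _ _)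

∑ᴸ-const : ∀ {X : Set} c (xs : List X) → ∑ᴸ (λ _ → c) xs ≡ length xs * c
∑ᴸ-const c []       = refl
∑ᴸ-const c (x ∷ xs) = cong (c +_) (∑ᴸ-const c xs)

∑ᴸ-*ˡ : ∀ {X : Set} c (g : X → ℕ) xs → ∑ᴸ (λ x → c * g x) xs ≡ c * ∑ᴸ g xs
∑ᴸ-*ˡ c g []       = sym (*-zeroʳ c)
∑ᴸ-*ˡ c g (x ∷ xs) = trans (cong (c * g x +_) (∑ᴸ-*ˡ c g xs)) (sym (*-distribˡ-+ c (g x) _))

∑ᴸ-∑ : ∀ {X : Set} n (g : X → ℕ → ℕ) xs → ∑ᴸ (λ x → ∑ n (g x)) xs ≡ ∑ n (λ i → ∑ᴸ (λ x → g x i) xs)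
∑ᴸ-∑ n g []       = sym (∑-0 n)
∑ᴸ-∑ n g (x ∷ xs) = trans (cong (∑ n (g x) +_) (∑ᴸ-∑ n g xs)) (sym (∑-+ n (g x) _))

ι : Bool → ℕ
ι true  = 1
ι false = 0

# : ∀ {X : Set} → (X → Bool) → List X → ℕ
# P = ∑ᴸ (ι ∘ P)

ι≤1 : ∀ b → ι b ≤ 1
ι≤1 true  = ≤-refl
ι≤1 false = z≤n

⌊⌋-yes : ∀ {P : Set} (d : Dec P) → P → ⌊ d ⌋ ≡ true
⌊⌋-yes (yes _) _ = refl
⌊⌋-yes (no ¬p) p = contradiction p ¬p

⌊⌋-no : ∀ {P : Set} (d : Dec P) → ¬ P → ⌊ d ⌋ ≡ false
⌊⌋-no (no _)  _  = refl
⌊⌋-no (yes p) ¬p = contradiction p ¬p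

⌊⌋-sound : ∀ {P : Set} (d : Dec P) → ⌊ d ⌋ ≡ true → P
⌊⌋-sound (yes p) _ = p

⌊⌋-unsound : ∀ {P : Set} (d : Dec P) → ⌊ d ⌋ ≡ false → ¬ P
⌊⌋-unsound (no ¬p) _ = ¬p

ι-yes : ∀ {P : Set} (d : Dec P) → P → ι ⌊ d ⌋ ≡ 1
ι-yes d q = cong ι (⌊⌋-yes d q)

ι-no : ∀ {P : Set} (d : Dec P) → ¬ P → ι ⌊ d ⌋ ≡ 0
ι-no d q = cong ι (⌊⌋-no d q)

filterᴸ : ∀ {X : Set} (P : X → Bool) (xs : List X) →
  ∃[ ys ] ∃[ zs ] (xs ↭ ys ++ zs × All (λ x → P x ≡ true) ys × All (λ x → P x ≡ false) zs × length ys ≡ # P xs)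
filterᴸ P [] = [] , [] , ↭-refl , [] , [] , refl
filterᴸ P (x ∷ xs) with filterᴸ P xs | P x in eq
... | ys , zs , r , a , b , l | true  = x ∷ ys , zs , prep x r , eq ∷ a , b , cong suc l
... | ys , zs , r , a , b , l | false = ys , x ∷ zs , ↭-trans (prep x r) (↭-sym (↭P.shift x ys zs)) , a , eq ∷ b , l

-- Pigeonhole by double counting: the numbers of elements with key `i` add up to the length of the
-- list.
popular : ∀ {X : Set} (key : X → ℕ) K c (xs : List X) → All (λ x → key x < K) xs → K * c < length xs →
  ∃[ i ] (i < K × c < # (λ x → ⌊ key x ≟ i ⌋) xs)
popular key K c xs bd l = ∑-<⇒∃ K (λ _ → c) (λ i → # (λ x → ⌊ key x ≟ i ⌋) xs)
  (subst₂ _<_ (sym (∑-const K c)) (sym e) l)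
  where
  one : ∀ K k → k < K → ∑ K (λ i → ι ⌊ k ≟ i ⌋) ≡ 1
  one (suc K) zero    _       = cong suc (trans (∑-cong K (λ i → ι-no (0 ≟ suc i) λ ())) (∑-0 K))
  one (suc K) (suc k) (s≤s q) = trans (cong (_+ ∑ K (λ i → ι ⌊ suc k ≟ suc i ⌋)) (ι-no (suc k ≟ 0) λ ()))
    (trans (∑-cong K (λ i → lem i)) (one K k q))
    where
    lem : ∀ i → ι ⌊ suc k ≟ suc i ⌋ ≡ ι ⌊ k ≟ i ⌋
    lem i with k ≟ i
    ... | yes refl = ι-yes (suc k ≟ suc k) refl
    ... | no  ne   = ι-no (suc k ≟ suc i) (ne ∘ suc-injective)
  go : ∀ xs → All (λ x → key x < K) xs → ∑ᴸ (λ x → ∑ K (λ i → ι ⌊ key x ≟ i ⌋)) xs ≡ length xs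
  go []       []       = refl
  go (x ∷ xs) (a ∷ as) = cong₂ _+_ (one K (key x) a) (go xs as)
  e : ∑ K (λ i → # (λ x → ⌊ key x ≟ i ⌋) xs) ≡ length xs
  e = trans (sym (∑ᴸ-∑ K (λ x i → ι ⌊ key x ≟ i ⌋) xs)) (go xs bd)

-- Subset sums of a list of integers

-- SS zs v: the integer v is the sum of a (possibly empty) subsequence of zs.
data SS : List ℤ → ℤ → Set where
  []   : SS [] (pos 0)
  skip : ∀ {z zs v} → SS zs v → SS (z ∷ zs) v
  take : ∀ {z zs v} → SS zs v → SS (z ∷ zs) (z +ᶻ v)

SS-empty : ∀ zs → SS zs (pos 0)
SS-empty []       = []
SS-empty (z ∷ zs) = skip (SS-empty zs)

SS-≡ : ∀ {zs u v} → u ≡ v → SS zs u → SS zs v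
SS-≡ refl s = s

SS-++ : ∀ {xs ys v w} → SS xs v → SS ys w → SS (xs ++ ys) (v +ᶻ w)
SS-++ {w = w} [] t = SS-≡ (sym (ℤP.+-identityˡ w)) t
SS-++ (skip s) t = skip (SS-++ s t)
SS-++ {w = w} (take {z} {v = v} s) t = SS-≡ (sym (ℤP.+-assoc z v w)) (take (SS-++ s t))

SS-↭ : ∀ {xs ys v} → xs ↭ ys → SS xs v → SS ys v
SS-↭ ↭refl s = s
SS-↭ (prep x r) (skip s) = skip (SS-↭ r s)
SS-↭ (prep x r) (take s) = take (SS-↭ r s)
SS-↭ (swap x y r) (skip (skip s)) = skip (skip (SS-↭ r s))
SS-↭ (swap x y r) (skip (take s)) = take (skip (SS-↭ r s))
SS-↭ (swap x y r) (take (skip s)) = skip (take (SS-↭ r s))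
SS-↭ (swap x y r) (take (take {v = v} s)) = SS-≡ (e x y v) (take (take (SS-↭ r s)))
  where
  e : ∀ x y v → y +ᶻ (x +ᶻ v) ≡ x +ᶻ (y +ᶻ v)
  e = solveℤ
SS-↭ (↭trans r r') s = SS-↭ r' (SS-↭ r s)

SS-weakenˡ : ∀ xs {ys v} → SS ys v → SS (xs ++ ys) v
SS-weakenˡ xs {v = v} s = SS-≡ (ℤP.+-identityˡ v) (SS-++ (SS-empty xs) s)

-- Zero-sum-freeness concerns non-empty subsequences, whereas `SS` admits the empty one. The second
-- alternative exhibits a chosen element.
SS-split : ∀ {zs v} → SS zs v → (v ≡ pos 0) ⊎ ∃[ z ] ∃[ zs' ] ∃[ v' ] (zs ↭ z ∷ zs' × SS zs' v' × v ≡ z +ᶻ v')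
SS-split [] = inj₁ refl
SS-split (take {z} {zs} {v} s) = inj₂ (z , zs , v , ↭-refl , s , refl)
SS-split (skip {z} {zs} s) with SS-split s
... | inj₁ e = inj₁ e
... | inj₂ (y , zs' , v' , r , t , e) = inj₂ (y , z ∷ zs' , v' , ↭-trans (prep z r) (swap z y ↭-refl) , skip t , e)

first : ∀ {X : Set} (P : X → Bool) (xs : List X) → (∃[ x ] ∃[ ys ] (xs ↭ x ∷ ys × P x ≡ true)) ⊎ All (λ x → P x ≡ false) xs
first P [] = inj₂ []
first P (x ∷ xs) with P x in eq
... | true  = inj₁ (x , xs , ↭-refl , eq)
... | false with first P xs
...   | inj₁ (y , ys , r , e) = inj₁ (y , x ∷ ys , ↭-trans (prep x r) (swap x y ↭-refl) , e)
...   | inj₂ a = inj₂ (eq ∷ a)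

shift↭ : ∀ {X : Set} {F R : List X} {x R'} → R ↭ x ∷ R' → F ++ R ↭ (x ∷ F) ++ R'
shift↭ {F = F} {x = x} {R'} r = ↭-trans (↭P.++⁺ˡ F r) (↭P.shift x F R')

↭-length : ∀ {X : Set} {xs ys : List X} → xs ↭ ys → length xs ≡ length ys
↭-length = ↭P.↭-length

#-↭ : ∀ {X : Set} (P : X → Bool) {xs ys} → xs ↭ ys → # P xs ≡ # P ys
#-↭ P = ∑ᴸ-↭ (ι ∘ P)

#-≤-length : ∀ {X : Set} (P : X → Bool) xs → # P xs ≤ length xs
#-≤-length P []       = z≤n
#-≤-length P (x ∷ xs) = +-mono-≤ (ι≤1 (P x)) (#-≤-length P xs)

#-++ : ∀ {X : Set} (P : X → Bool) xs ys → # P (xs ++ ys) ≡ # P xs + # P ys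
#-++ P = ∑ᴸ-++ (ι ∘ P)

#-none : ∀ {X : Set} (P : X → Bool) {xs} → All (λ x → P x ≡ false) xs → # P xs ≡ 0
#-none P []       = refl
#-none P (a ∷ as) = cong₂ _+_ (cong ι a) (#-none P as)

div-upper : ∀ a b .{{_ : NonZero b}} → a < suc (a / b) * b
div-upper a b = subst (_< suc (a / b) * b) (sym (m≡m%n+[m/n]*n a b)) (+-monoˡ-< (a / b * b) (m%n<n a b))

-- Numerical parameters of the concentration argument

-- The numerical choices of the concentration argument for a sequence of length N; one y-th of N is negligible.
record Parameters (y Q κ N p m : ℕ) .{{_ : NonZero Q}} : Set where
  field
    ny t k' k₂ J E W : ℕ
    1≤ny      : 1 ≤ ny
    ny*y≤N    : ny * y ≤ N
    2T₁≤p     : 2 * suc t ≤ p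
    T₁≤       : suc t ≤ ny * suc k'
    8k'≤ny    : 8 * k' ≤ ny
    room      : 5 * ny + 5 + 16 * (m * k') < N
    k₂-lower  : suc p ≤ ny * suc k₂
    1≤Q       : 1 ≤ Q
    Q<p       : Q < p
    1≤J       : 1 ≤ J
    weight    : ∀ {r s c} → r ≤ N → t ≤ s → t ≤ c → 136 * p * r * (J * suc k₂) ≤ ny * (s * c)
    p≤QE      : p ≤ Q * suc E
    smoothing : ∀ {c Λ} → t ≤ c → p * p ≤ 9 * Λ → 136 * Q * (suc E * suc E) * p < c * Λ
    W-bound   : ∀ a → a * (J / Q) < p → a ≤ W
    mW≤       : m * W ≤ κ * N

-- The numerals are read off from the estimates below, where undoing the rounding of a quotient that
-- is at least 1 costs a factor 2: 1024 = 2 · 4 · 2 · 64 in `T₁≤`, 544 = 136 · 2 · 2 in `weight`,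
-- 9792 = 9 · 136 · 4 · 2 in `smoothing`. The size of `K` yields `Q ≤ J`.
module Constants (y : ℕ) (8≤y : 8 ≤ y) where

  h Q K κ : ℕ
  h = 1024 * (y * y)
  Q = 9792 * h
  K = 2 * h * (Q * (544 * h * y))
  κ = 4 * K

  instance
    y≢0 : NonZero y
    y≢0 = >-nonZero (≤-trans (s≤s z≤n) 8≤y)
    h≢0 : NonZero h
    h≢0 = >-nonZero (*-mono-≤ {1} {1024} {1} (s≤s z≤n) (*-mono-≤ {1} {y} {1} (≤-trans (s≤s z≤n) 8≤y) (≤-trans (s≤s z≤n) 8≤y)))
    Q≢0 : NonZero Q
    Q≢0 = m*n≢0 9792 h
    544hy≢0 : NonZero (544 * h * y)
    544hy≢0 = m*n≢0 (544 * h) y {{m*n≢0 544 h}}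

  K>0 : 1 ≤ K
  K>0 = *-mono-≤ {1} {2 * h} {1} (*-mono-≤ {1} {2} {1} (s≤s z≤n) (>-nonZero⁻¹ h)) (*-mono-≤ {1} {Q} {1} (>-nonZero⁻¹ Q) (>-nonZero⁻¹ (544 * h * y)))
    where
    >-nonZero⁻¹ : ∀ n .{{_ : NonZero n}} → 1 ≤ n
    >-nonZero⁻¹ (suc n) = s≤s z≤n

  N₀ : ℕ
  N₀ = 16 * (y * K)

  module Bounds (N p m : ℕ) (N₀≤N : N₀ ≤ N) (1≤m : 1 ≤ m) (pm≤ : p * m ≤ 4 * (N * N)) (m≤2N : m ≤ 2 * N) (N≤2p : N ≤ 2 * p) where
    open ≤-Reasoning

    16K≤N : 16 * K ≤ N
    16K≤N = ≤-trans (*-monoʳ-≤ 16 (≤-trans (≤-reflexive (sym (*-identityˡ K))) (*-monoˡ-≤ K (≤-trans (s≤s z≤n) 8≤y)))) N₀≤N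

    8y≤16K : 8 * y ≤ 16 * K
    8y≤16K = *-mono-≤ {8} {16} (≤ᵇ⇒≤ 8 16 _) (begin
      y                       ≤⟨ m≤n*m y (544 * h) {{m*n≢0 544 h}} ⟩
      544 * h * y             ≤⟨ m≤n*m (544 * h * y) Q ⟩
      Q * (544 * h * y)       ≤⟨ m≤n*m (Q * (544 * h * y)) (2 * h) {{m*n≢0 2 h}} ⟩
      K                       ∎)

    16≤N : 16 ≤ N
    16≤N = ≤-trans (≤-trans (≤-reflexive (sym (*-identityʳ 16))) (*-monoʳ-≤ 16 K>0)) 16K≤N

    instance
      N≢0 : NonZero N
      N≢0 = >-nonZero (≤-trans (s≤s z≤n) 16≤N)
      m≢0 : NonZero m
      m≢0 = >-nonZero 1≤m
      64ym≢0 : NonZero (64 * y * m)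
      64ym≢0 = m*n≢0 (64 * y) m {{m*n≢0 64 y}}

    1≤p : 1 ≤ p
    1≤p = *-cancelˡ-< 2 0 p (≤-trans (≤-trans (s≤s z≤n) 16≤N) N≤2p)

    8K≤p : 8 * K ≤ p
    8K≤p = *-cancelˡ-≤ 2 (≤-trans (≤-reflexive (sym (*-assoc 2 8 K))) (≤-trans 16K≤N N≤2p))

    h≤K : 2 * h ≤ K
    h≤K = m≤m*n (2 * h) (Q * (544 * h * y)) {{m*n≢0 Q (544 * h * y)}}

    h≤p : h ≤ p
    h≤p = ≤-trans (≤-trans (m≤m+n h _) h≤K) (≤-trans (m≤m+n K _) 8K≤p)

    Q≤K : 2 * Q ≤ K
    Q≤K = *-mono-≤ {2} {2 * h} {Q} {Q * (544 * h * y)} (m≤m*n 2 h) (m≤m*n Q (544 * h * y))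

    Q<p : Q < p
    Q<p = ≤-trans (s≤s (≤-refl {Q})) (≤-trans (≤-trans (+-monoˡ-≤ Q (>-nz Q)) (≤-reflexive (e Q))) (≤-trans Q≤K (≤-trans (m≤m+n K _) 8K≤p)))
      where
      >-nz : ∀ n .{{_ : NonZero n}} → 1 ≤ n
      >-nz (suc n) = s≤s z≤n
      e : ∀ q → q + q ≡ 2 * q
      e = solveℕ

    -- `ny` elements are negligible. `t` is the number of sums aimed at, a constant proportion of
    -- `p`, and `k'` is the norm that an element must exceed to be used for this growth. `k₂` has
    -- order p / N: at most about `ny` elements can each add `k₂` new sums. `J` is the number of
    -- multiples of an element that enter the average, `E` the width of a box in Dirichlet's
    -- theorem, `W` the resulting bound before multiplication by a factorial.
    ny t k' T₁ k₂ J E W : ℕ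
    ny = N / y
    t  = p / h
    k' = N / (64 * y * m)
    T₁ = suc t
    k₂ = suc (2 * y * suc p / N)
    instance
      cJ≢0 : NonZero (544 * h * y * k₂)
      cJ≢0 = m*n≢0 (544 * h * y) k₂
    J  = t / (544 * h * y * k₂)
    E  = suc (p / Q)
    W  = κ * k₂

    1≤ny : 1 ≤ ny
    1≤ny = m≥n⇒m/n>0 (≤-trans (m≤n*m y 8) (≤-trans 8y≤16K 16K≤N))

    1≤t : 1 ≤ t
    1≤t = m≥n⇒m/n>0 h≤p

    ny*y≤N : ny * y ≤ N
    ny*y≤N = m/n*n≤m N y

    double : ∀ {a} c b → 1 ≤ a → b < suc a * c → b ≤ 2 * a * c
    double {a} c b 1≤a l = ≤-trans (<⇒≤ l) (*-monoˡ-≤ c (≤-trans (+-monoˡ-≤ a 1≤a) (≤-reflexive (cong (a +_) (sym (+-identityʳ a))))))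

    N≤ny : N ≤ 2 * ny * y
    N≤ny = double y N 1≤ny (div-upper N y)

    p≤t : p ≤ 2 * t * h
    p≤t = double h p 1≤t (div-upper p h)

    th≤p : t * h ≤ p
    th≤p = m/n*n≤m p h

    2T₁≤p : 2 * T₁ ≤ p
    2T₁≤p = begin
      2 * suc t       ≤⟨ *-monoʳ-≤ 2 (+-monoˡ-≤ t 1≤t) ⟩
      2 * (t + t)     ≡⟨ e t ⟩
      t * 4           ≤⟨ *-monoʳ-≤ t (≤-trans (≤ᵇ⇒≤ 4 1024 _) (m≤m*n 1024 (y * y) {{m*n≢0 y y}})) ⟩
      t * h           ≤⟨ th≤p ⟩
      p               ∎
      where
      e : ∀ t → 2 * (t + t) ≡ t * 4
      e = solveℕ

    T₁≤ : T₁ ≤ ny * suc k'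
    T₁≤ = *-cancelˡ-≤ h (begin
      h * suc t                                     ≤⟨ *-monoʳ-≤ h (+-monoˡ-≤ t 1≤t) ⟩
      h * (t + t)                                   ≡⟨ e1 h t ⟩
      2 * (t * h)                                   ≤⟨ *-monoʳ-≤ 2 th≤p ⟩
      2 * p                                         ≤⟨ *-monoʳ-≤ 2 p≤ ⟩
      2 * (512 * (y * y) * (ny * suc k'))           ≡⟨ e2 (y * y) (ny * suc k') ⟩
      h * (ny * suc k')                             ∎)
      where
      e1 : ∀ h t → h * (t + t) ≡ 2 * (t * h)
      e1 = solveℕ
      e2 : ∀ y n → 2 * (512 * y * n) ≡ 1024 * y * n
      e2 = solveℕ
      e3 : ∀ n y k m → 4 * (2 * n * y * (k * (64 * y * m))) ≡ 512 * (y * y) * (n * k) * m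
      e3 = solveℕ
      p≤ : p ≤ 512 * (y * y) * (ny * suc k')
      p≤ = *-cancelʳ-≤ p _ m (begin
        p * m                                              ≤⟨ pm≤ ⟩
        4 * (N * N)                                        ≤⟨ *-monoʳ-≤ 4 (*-mono-≤ N≤ny (<⇒≤ (div-upper N (64 * y * m)))) ⟩
        4 * (2 * ny * y * (suc k' * (64 * y * m)))         ≡⟨ e3 ny y (suc k') m ⟩
        512 * (y * y) * (ny * suc k') * m                  ∎)

    8k'≤ny : 8 * k' ≤ ny
    8k'≤ny = ≤-pred (*-cancelʳ-< y (8 * k') (suc ny) (begin-strict
      8 * k' * y               ≡⟨ e k' y ⟩
      k' * (8 * y * 1)         ≤⟨ *-monoʳ-≤ k' (*-mono-≤ (*-monoˡ-≤ y (≤ᵇ⇒≤ 8 64 _)) 1≤m) ⟩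
      k' * (64 * y * m)        ≤⟨ m/n*n≤m N (64 * y * m) ⟩
      N                        <⟨ div-upper N y ⟩
      suc ny * y               ∎))
      where
      e : ∀ k y → 8 * k * y ≡ k * (8 * y * 1)
      e = solveℕ

    room : 5 * ny + 5 + 16 * (m * k') < N
    room = *-cancelˡ-< 32 _ _ (begin-strict
      32 * (5 * ny + 5 + 16 * (m * k'))              ≡⟨ e1 ny (m * k') ⟩
      20 * (8 * ny) + 160 + 512 * (m * k')           ≤⟨ +-mono-≤ (+-monoˡ-≤ 160 (*-monoʳ-≤ 20 (≤-trans (≤-trans (≤-reflexive (*-comm 8 ny)) (*-monoʳ-≤ ny 8≤y)) ny*y≤N))) (≤-trans (≤-trans (≤-reflexive (e2 m k')) (*-monoʳ-≤ k' (*-monoˡ-≤ m (*-monoʳ-≤ 64 8≤y)))) (m/n*n≤m N (64 * y * m))) ⟩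
      20 * N + 160 + N                               ≡⟨ e3 N ⟩
      21 * N + 160                                   <⟨ +-monoʳ-< (21 * N) (<-≤-trans (≤ᵇ⇒≤ 161 176 _) (*-monoʳ-≤ 11 16≤N)) ⟩
      21 * N + 11 * N                                ≡⟨ e4 N ⟩
      32 * N                                         ∎)
      where
      e1 : ∀ n k → 32 * (5 * n + 5 + 16 * k) ≡ 20 * (8 * n) + 160 + 512 * k
      e1 = solveℕ
      e2 : ∀ m k → 512 * (m * k) ≡ k * (64 * 8 * m)
      e2 = solveℕ
      e3 : ∀ n → 20 * n + 160 + n ≡ 21 * n + 160
      e3 = solveℕ
      e4 : ∀ n → 21 * n + 11 * n ≡ 32 * n
      e4 = solveℕ

    k₂-lower : suc p ≤ ny * k₂
    k₂-lower = *-cancelˡ-≤ (2 * y) {{m*n≢0 2 y}} (begin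
      2 * y * suc p            ≤⟨ <⇒≤ (div-upper (2 * y * suc p) N) ⟩
      k₂ * N                   ≤⟨ *-monoʳ-≤ k₂ N≤ny ⟩
      k₂ * (2 * ny * y)        ≡⟨ e k₂ ny y ⟩
      2 * y * (ny * k₂)        ∎)
      where
      e : ∀ k n y → k * (2 * n * y) ≡ 2 * y * (n * k)
      e = solveℕ

    suc-p≤ : suc p ≤ 2 * p
    suc-p≤ = ≤-trans (+-monoˡ-≤ p 1≤p) (≤-reflexive (cong (p +_) (sym (+-identityʳ p))))

    k₂N≤ : k₂ * N ≤ N + 4 * y * p
    k₂N≤ = +-monoʳ-≤ N (≤-trans (m/n*n≤m (2 * y * suc p) N) (≤-trans (*-monoʳ-≤ (2 * y) suc-p≤) (≤-reflexive (e y p))))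
      where
      e : ∀ y p → 2 * y * (2 * p) ≡ 4 * y * p
      e = solveℕ

    mk₂≤ : m * k₂ ≤ (2 + 16 * y) * N
    mk₂≤ = *-cancelʳ-≤ _ _ N (begin
      m * k₂ * N                             ≡⟨ *-assoc m k₂ N ⟩
      m * (k₂ * N)                           ≤⟨ *-monoʳ-≤ m k₂N≤ ⟩
      m * (N + 4 * y * p)                    ≡⟨ e1 m N y p ⟩
      m * N + 4 * y * (p * m)                ≤⟨ +-mono-≤ (*-monoˡ-≤ N m≤2N) (*-monoʳ-≤ (4 * y) pm≤) ⟩
      2 * N * N + 4 * y * (4 * (N * N))      ≡⟨ e2 N y ⟩
      (2 + 16 * y) * N * N                   ∎)
      where
      e1 : ∀ m n y p → m * (n + 4 * y * p) ≡ m * n + 4 * y * (p * m)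
      e1 = solveℕ
      e2 : ∀ n y → 2 * n * n + 4 * y * (4 * (n * n)) ≡ (2 + 16 * y) * n * n
      e2 = solveℕ

    Kk₂≤p : K * k₂ ≤ p
    Kk₂≤p = *-cancelʳ-≤ _ _ (2 * N) {{m*n≢0 2 N}} (begin
      K * k₂ * (2 * N)                         ≡⟨ e1 K k₂ N ⟩
      2 * K * (k₂ * N)                         ≤⟨ *-monoʳ-≤ (2 * K) k₂N≤ ⟩
      2 * K * (N + 4 * y * p)                  ≡⟨ e2 K N y p ⟩
      (2 * K) * N + p * (8 * (y * K))          ≤⟨ +-mono-≤ (*-monoˡ-≤ N (≤-trans (*-monoˡ-≤ K (≤ᵇ⇒≤ 2 8 _)) 8K≤p)) (*-monoʳ-≤ p (≤-trans (*-monoˡ-≤ (y * K) (≤ᵇ⇒≤ 8 16 _)) N₀≤N)) ⟩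
      p * N + p * N                            ≡⟨ e3 p N ⟩
      p * (2 * N)                              ∎)
      where
      e1 : ∀ K k N → K * k * (2 * N) ≡ 2 * K * (k * N)
      e1 = solveℕ
      e2 : ∀ K N y p → 2 * K * (N + 4 * y * p) ≡ (2 * K) * N + p * (8 * (y * K))
      e2 = solveℕ
      e3 : ∀ p N → p * N + p * N ≡ p * (2 * N)
      e3 = solveℕ

    Q≤J : Q ≤ J
    Q≤J = ≤-trans (≤-reflexive (sym (m*n/n≡m Q (544 * h * y * k₂)))) (/-monoˡ-≤ (544 * h * y * k₂) (*-cancelˡ-≤ (2 * h) {{m*n≢0 2 h}} (begin
      2 * h * (Q * (544 * h * y * k₂))   ≡⟨ e1 (2 * h) Q (544 * h * y) k₂ ⟩
      K * k₂                             ≤⟨ Kk₂≤p ⟩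
      p                                  ≤⟨ p≤t ⟩
      2 * t * h                          ≡⟨ e2 t h ⟩
      2 * h * t                          ∎)))
      where
      e1 : ∀ a b c k → a * (b * (c * k)) ≡ a * (b * c) * k
      e1 = solveℕ
      e2 : ∀ t h → 2 * t * h ≡ 2 * h * t
      e2 = solveℕ

    1≤Q : 1 ≤ Q
    1≤Q = *-mono-≤ {1} {9792} {1} (s≤s z≤n) (≤-trans (s≤s z≤n) (>-nz h))
      where
      >-nz : ∀ n .{{_ : NonZero n}} → 1 ≤ n
      >-nz (suc n) = s≤s z≤n

    1≤J : 1 ≤ J
    1≤J = ≤-trans 1≤Q Q≤J

    weight : ∀ {r s c} → r ≤ N → t ≤ s → t ≤ c → 136 * p * r * (J * k₂) ≤ ny * (s * c)
    weight {r} {s} {c} r≤ s≥ c≥ = begin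
      136 * p * r * (J * k₂)                                   ≤⟨ *-monoˡ-≤ (J * k₂) (*-mono-≤ (*-monoʳ-≤ 136 p≤t) (≤-trans r≤ N≤ny)) ⟩
      136 * (2 * t * h) * (2 * ny * y) * (J * k₂)              ≡⟨ e t h ny y J k₂ ⟩
      ny * (t * (J * (544 * h * y * k₂)))                      ≤⟨ *-monoʳ-≤ ny (*-mono-≤ s≥ (≤-trans (m/n*n≤m t (544 * h * y * k₂)) c≥)) ⟩
      ny * (s * c)                                             ∎
      where
      e : ∀ t h n y j k → 136 * (2 * t * h) * (2 * n * y) * (j * k) ≡ n * (t * (j * (544 * h * y * k)))
      e = solveℕ

    p≤QE : p ≤ Q * E
    p≤QE = ≤-trans (<⇒≤ (div-upper p Q)) (≤-reflexive (*-comm E Q))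

    QE≤ : Q * E ≤ 2 * p
    QE≤ = begin
      Q * suc (p / Q)      ≡⟨ *-suc Q (p / Q) ⟩
      Q + Q * (p / Q)      ≤⟨ +-mono-≤ (<⇒≤ Q<p) (≤-trans (≤-reflexive (*-comm Q (p / Q))) (m/n*n≤m p Q)) ⟩
      p + p                ≡⟨ cong (p +_) (sym (+-identityʳ p)) ⟩
      2 * p                ∎

    smoothing : ∀ {c Λ} → t ≤ c → p * p ≤ 9 * Λ → 136 * Q * (E * E) * p < c * Λ
    smoothing {c} {Λ} t≤c pp≤ = *-cancelˡ-< (9 * Q) _ _ (begin-strict
      9 * Q * (136 * Q * (E * E) * p)       ≡⟨ e1 Q E p ⟩
      1224 * p * (Q * E * (Q * E))          ≤⟨ *-monoʳ-≤ (1224 * p) (*-mono-≤ QE≤ QE≤) ⟩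
      1224 * p * (2 * p * (2 * p))          ≡⟨ e2 p ⟩
      (p * p) * (4896 * p)                  <⟨ *-monoʳ-< (p * p) {{m*n≢0 p p {{>-nonZero 1≤p}} {{>-nonZero 1≤p}}}} (*-monoʳ-< 4896 (<-≤-trans (div-upper p h) (≤-reflexive refl))) ⟩
      (p * p) * (4896 * (suc t * h))        ≤⟨ *-monoʳ-≤ (p * p) (*-monoʳ-≤ 4896 (*-monoˡ-≤ h (+-monoˡ-≤ t 1≤t))) ⟩
      (p * p) * (4896 * ((t + t) * h))      ≡⟨ e3 (p * p) t h ⟩
      Q * t * (p * p)                       ≤⟨ *-mono-≤ (*-monoʳ-≤ Q t≤c) pp≤ ⟩
      Q * c * (9 * Λ)                       ≡⟨ e4 Q c Λ ⟩
      9 * Q * (c * Λ)                       ∎)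
      where
      e1 : ∀ q e p → 9 * q * (136 * q * (e * e) * p) ≡ 1224 * p * (q * e * (q * e))
      e1 = solveℕ
      e2 : ∀ p → 1224 * p * (2 * p * (2 * p)) ≡ (p * p) * (4896 * p)
      e2 = solveℕ
      e3 : ∀ q t h → q * (4896 * ((t + t) * h)) ≡ (9792 * h) * t * q
      e3 = solveℕ
      e4 : ∀ q c l → q * c * (9 * l) ≡ 9 * q * (c * l)
      e4 = solveℕ

    -- Undoing three roundings costs a factor 8, of which `K` contains 2 and `κ` the remaining 4.
    W-bound : ∀ a → a * (J / Q) < p → a ≤ W
    W-bound a l = *-cancelʳ-≤ a W u {{>-nonZero 1≤u}} (begin
      a * u                                                   ≤⟨ <⇒≤ l ⟩
      p                                                       ≤⟨ p≤t ⟩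
      2 * t * h                                               ≤⟨ *-monoˡ-≤ h (*-monoʳ-≤ 2 t≤) ⟩
      2 * (2 * J * (544 * h * y * k₂)) * h                    ≤⟨ *-monoˡ-≤ h (*-monoʳ-≤ 2 (*-monoˡ-≤ (544 * h * y * k₂) (*-monoʳ-≤ 2 J≤))) ⟩
      2 * (2 * (2 * u * Q) * (544 * h * y * k₂)) * h          ≡⟨ e u Q h (544 * h * y) k₂ ⟩
      W * u                                                   ∎)
      where
      u = J / Q
      1≤u : 1 ≤ u
      1≤u = m≥n⇒m/n>0 Q≤J
      J≤ : J ≤ 2 * u * Q
      J≤ = double Q J 1≤u (div-upper J Q)
      t≤ : t ≤ 2 * J * (544 * h * y * k₂)
      t≤ = double (544 * h * y * k₂) t 1≤J (div-upper t (544 * h * y * k₂))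
      e : ∀ u q h c k → 2 * (2 * (2 * u * q) * (c * k)) * h ≡ 4 * (2 * h * (q * c)) * k * u
      e = solveℕ

    mW≤ : m * W ≤ κ * (2 + 16 * y) * N
    mW≤ = begin
      m * (κ * k₂)                ≡⟨ e m κ k₂ ⟩
      κ * (m * k₂)                ≤⟨ *-monoʳ-≤ κ mk₂≤ ⟩
      κ * ((2 + 16 * y) * N)      ≡⟨ *-assoc κ (2 + 16 * y) N ⟨
      κ * (2 + 16 * y) * N        ∎
      where
      e : ∀ m κ k → m * (κ * k) ≡ κ * (m * k)
      e = solveℕ

    parameters : Parameters y Q (κ * (2 + 16 * y)) N p m
    -- The fields `k₂` and `E` of the record are the predecessors of the numbers used here, so that
    -- positivity is visible in `suc k₂` and `suc E`.
    parameters = record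
      { ny = ny ; t = t ; k' = k' ; k₂ = 2 * y * suc p / N ; J = J ; E = p / Q ; W = W
      ; 1≤ny = 1≤ny ; ny*y≤N = ny*y≤N ; 2T₁≤p = 2T₁≤p ; T₁≤ = T₁≤ ; 8k'≤ny = 8k'≤ny ; room = room ; k₂-lower = k₂-lower
      ; 1≤Q = 1≤Q ; Q<p = Q<p ; 1≤J = 1≤J ; weight = weight ; p≤QE = p≤QE ; smoothing = smoothing ; W-bound = W-bound ; mW≤ = mW≤ }

-- Arithmetic progressions among subset sums

opaque
  _≟ᶻ_ : (a b : ℤ) → Dec (a ≡ b)
  _≟ᶻ_ = ℤP._≟_

-- F represents an arithmetic progression of length ℓ + 1 and difference d by its subsequence sums.
AP : List ℤ → ℕ → ℕ → Set
AP F d ℓ = ∃[ u ] (∀ i → i ≤ ℓ → SS F (u +ᶻ pos (i * d)))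

AP-mono : ∀ {F d ℓ ℓ'} → ℓ' ≤ ℓ → AP F d ℓ → AP F d ℓ'
AP-mono l (u , s) = u , λ i i≤ → s i (≤-trans i≤ l)

-- The translates of the old progression by `v` and by `v + c d` follow each other without a gap
-- because `c ≤ suc ℓ`.
AP-extend : ∀ {F G d ℓ v} c → SS G v → SS G (v +ᶻ pos (c * d)) → c ≤ suc ℓ → AP F d ℓ → AP (G ++ F) d (ℓ + c)
AP-extend {d = d} {ℓ} {v} c g₀ g₁ c≤ (u , s) = v +ᶻ u , go
  where
  e0 : ∀ v u x → v +ᶻ (u +ᶻ x) ≡ (v +ᶻ u) +ᶻ x
  e0 = solveℤ
  e1 : ∀ v u x y → (v +ᶻ y) +ᶻ (u +ᶻ x) ≡ (v +ᶻ u) +ᶻ (y +ᶻ x)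
  e1 = solveℤ
  go : ∀ i → i ≤ ℓ + c → SS _ ((v +ᶻ u) +ᶻ pos (i * d))
  go i i≤ with i ≤? ℓ
  ... | yes l = SS-≡ (e0 v u (pos (i * d))) (SS-++ g₀ (s i l))
  ... | no nl with m≤n⇒∃[o]m+o≡n (≤-trans c≤ (≰⇒> nl))
  ... | o , refl = SS-≡ (trans (e1 v u (pos (o * d)) (pos (c * d))) (cong (λ w → (v +ᶻ u) +ᶻ pos w) (sym (*-distribʳ-+ d c o))))
                     (SS-++ g₁ (s o (+-cancelˡ-≤ c _ _ (≤-trans i≤ (≤-reflexive (+-comm ℓ c))))))

-- Two subset sums at distance `c`: a single element against the empty sum, or one of two close
-- elements against the other. Only `C` distances are possible, so many gadgets share one of them.
record Gadget (C : ℕ) : Set where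
  field
    els  : List ℤ
    c    : ℕ
    1≤c  : 1 ≤ c
    c≤C  : c ≤ C
    base : ℤ
    low  : SS els base
    high : SS els (base +ᶻ pos c)
    size : length els ≤ 2

elements : ∀ {C} → List (Gadget C) → List ℤ
elements []       = []
elements (g ∷ gs) = Gadget.els g ++ elements gs

elements-++ : ∀ {C} (gs hs : List (Gadget C)) → elements (gs ++ hs) ≡ elements gs ++ elements hs
elements-++ []       hs = refl
elements-++ (g ∷ gs) hs = trans (cong (Gadget.els g ++_) (elements-++ gs hs)) (sym (LP.++-assoc (Gadget.els g) _ _))

elements-↭ : ∀ {C} {gs hs : List (Gadget C)} → gs ↭ hs → elements gs ↭ elements hs
elements-↭ ↭refl = ↭-refl
elements-↭ (prep g r) = ↭P.++⁺ˡ (Gadget.els g) (elements-↭ r)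
elements-↭ (swap {xs} {ys} g h r) = ↭-trans (↭P.++⁺ˡ (Gadget.els g) (↭P.++⁺ˡ (Gadget.els h) (elements-↭ r)))
  (↭-trans (↭-reflexive (sym (LP.++-assoc (Gadget.els g) (Gadget.els h) _))) (↭-trans (↭P.++⁺ʳ (elements ys) (↭P.++-comm (Gadget.els g) (Gadget.els h))) (↭-reflexive (LP.++-assoc (Gadget.els h) (Gadget.els g) _))))
elements-↭ (↭trans r s) = ↭-trans (elements-↭ r) (elements-↭ s)

elements-length : ∀ {C} (gs : List (Gadget C)) → length (elements gs) ≤ 2 * length gs
elements-length []       = z≤n
elements-length (g ∷ gs) = ≤-trans (≤-reflexive (LP.length-++ (Gadget.els g))) (≤-trans (+-mono-≤ (Gadget.size g) (elements-length gs)) (≤-reflexive (sym (*-suc 2 (length gs)))))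

elements-AP : ∀ {C} d (gs : List (Gadget C)) → All (λ g → Gadget.c g ≡ d) gs → AP (elements gs) d (length gs)
elements-AP d [] [] = pos 0 , λ { zero _ → [] }
elements-AP d (g ∷ gs) (refl ∷ al) = subst (AP _ d) (+-comm (length gs) 1)
  (AP-extend 1 (Gadget.low g) (SS-≡ (cong (λ w → Gadget.base g +ᶻ pos w) (sym (+-identityʳ (Gadget.c g)))) (Gadget.high g)) (s≤s z≤n) (elements-AP d gs al))

-- Pairs of elements in a common residue class

VMult : ℕ → List ℤ → Set
VMult m R = ∀ a → # (λ z → ⌊ z ≟ᶻ a ⌋) R ≤ m

record Box (W m : ℕ) (R : List ℤ) : Set where
  field
    bounded : All (λ r → ∣ r ∣ ≤ W) R
    nonzero : All (λ r → 1 ≤ ∣ r ∣) R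
    mult    : VMult m R

All-↭ : ∀ {P : ℤ → Set} {xs ys} → xs ↭ ys → All P xs → All P ys
All-↭ = ↭P.All-resp-↭

Box-rest : ∀ {W m R} X {R'} → R ↭ X ++ R' → Box W m R → Box W m R'
Box-rest X r b = record
  { bounded = AllP.++⁻ʳ X (All-↭ r (Box.bounded b))
  ; nonzero = AllP.++⁻ʳ X (All-↭ r (Box.nonzero b))
  ; mult = λ a → ≤-trans (≤-trans (m≤n+m _ _) (≤-reflexive (sym (trans (#-↭ _ r) (#-++ _ X _))))) (Box.mult b a) }

Box-part : ∀ {W m R X} R' → R ↭ X ++ R' → Box W m R → Box W m X
Box-part {X = X} R' r b = Box-rest R' (↭-trans r (↭P.++-comm X R')) b

shifted : ∀ {W} z → ∣ z ∣ ≤ W → ∃[ v ] (v ≤ 2 * W × z +ᶻ pos W ≡ pos v)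
shifted {W} (pos n) l = n + W , ≤-trans (+-monoˡ-≤ W l) (≤-reflexive (cong (W +_) (sym (+-identityʳ W)))) , refl
shifted {W} -[1+ n ] l with m≤n⇒∃[o]m+o≡n l
... | o , refl = o , ≤-trans (m≤n+m o (suc n)) (m≤m+n W _) , e (pos (suc n)) (pos o)
  where
  e : ∀ a o → -ᶻ a +ᶻ (a +ᶻ o) ≡ o
  e = solveℤ

split-unique : ∀ {d r r' q q'} → r < d → r' < d → r + q * d ≡ r' + q' * d → r ≡ r' × q ≡ q'
split-unique {d} {r} {r'} {q} {q'} r< r'< e = r≡ , *-cancelʳ-≡ q q' d (+-cancelˡ-≡ r' _ _ (trans (cong (_+ q * d) (sym r≡)) e))
  where
  instance
    d≢0 : NonZero d
    d≢0 = >-nonZero (≤-trans (s≤s z≤n) r<)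
  r≡ : r ≡ r'
  r≡ = trans (sym (m<n⇒m%n≡m r<)) (trans (sym ([m+kn]%n≡m%n r q d)) (trans (cong (_% d) e) (trans ([m+kn]%n≡m%n r' q' d) (m<n⇒m%n≡m r'<))))

-- Two elements of R in the same residue class modulo d, at distance between h d and ℓ d: the interval
-- [-W, W] is cut into windows of length ℓ d, and some class in some window contains more than 2 h m elements.
module Pair {W m R} (box : Box W m R) (d h ℓ : ℕ) (0<h : 0 < h) .{{_ : NonZero d}} .{{_ : NonZero (ℓ * d)}}
  (many : suc (2 * W / (ℓ * d)) * d * (2 * h * m) < length R) where

  v : ℤ → ℕ
  v z = ∣ z +ᶻ pos W ∣

  v-eq : ∀ {z} → ∣ z ∣ ≤ W → pos (v z) ≡ z +ᶻ pos W
  v-eq {z} l with shifted z l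
  ... | v , _ , e = trans (cong (λ w → pos ∣ w ∣) e) (sym e)

  v≤ : ∀ {z} → ∣ z ∣ ≤ W → v z ≤ 2 * W
  v≤ {z} l with shifted z l
  ... | v , b , e = ≤-trans (≤-reflexive (cong ∣_∣ e)) b

  -- Encodes the residue modulo `d` and the window as a single number, in the form required by
  -- `popular`.
  key : ℤ → ℕ
  key z = v z % d + (v z / (ℓ * d)) * d

  key< : ∀ {z} → ∣ z ∣ ≤ W → key z < suc (2 * W / (ℓ * d)) * d
  key< {z} l = +-mono-<-≤ (m%n<n (v z) d) (*-monoˡ-≤ d (/-monoˡ-≤ (ℓ * d) (v≤ {z} l)))

  key-unique : ∀ x y → key x ≡ key y → v x % d ≡ v y % d × v x / (ℓ * d) ≡ v y / (ℓ * d)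
  key-unique x y = split-unique (m%n<n (v x) d) (m%n<n (v y) d)

  apart : ∀ x y → ∣ x ∣ ≤ W → ∣ y ∣ ≤ W → key x ≡ key y → v x ≤ v y → ∃[ c ] (c < ℓ × y ≡ x +ᶻ pos (c * d))
  apart x y lx ly k x≤y with m≤n⇒∃[o]m+o≡n (/-monoˡ-≤ d x≤y)
  ... | c , e = c , c<ℓ , y≡
    where
    v≡ : v y ≡ v x + c * d
    v≡ = begin
      v y                                     ≡⟨ m≡m%n+[m/n]*n (v y) d ⟩
      v y % d + v y / d * d                   ≡⟨ cong₂ (λ a b → a + b * d) (sym (proj₁ (key-unique x y k))) (sym e) ⟩
      v x % d + (v x / d + c) * d             ≡⟨ e3 (v x % d) (v x / d) c d ⟩
      v x % d + v x / d * d + c * d           ≡⟨ cong (_+ c * d) (m≡m%n+[m/n]*n (v x) d) ⟨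
      v x + c * d                             ∎
      where
      open ≡-Reasoning
      e3 : ∀ r q c d → r + (q + c) * d ≡ r + q * d + c * d
      e3 = solveℕ
    c<ℓ : c < ℓ
    c<ℓ = *-cancelʳ-< d c ℓ (+-cancelʳ-< (v x / (ℓ * d) * (ℓ * d)) _ _ (begin-strict
      c * d + v x / (ℓ * d) * (ℓ * d)               ≤⟨ +-monoʳ-≤ (c * d) (m/n*n≤m (v x) (ℓ * d)) ⟩
      c * d + v x                                   ≡⟨ trans (+-comm (c * d) _) (sym v≡) ⟩
      v y                                           <⟨ div-upper (v y) (ℓ * d) ⟩
      ℓ * d + v y / (ℓ * d) * (ℓ * d)               ≡⟨ cong (λ q → ℓ * d + q * (ℓ * d)) (proj₂ (key-unique x y k)) ⟨
      ℓ * d + v x / (ℓ * d) * (ℓ * d)               ∎))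
      where open ≤-Reasoning
    e1 : ∀ y w → y ≡ (y +ᶻ w) -ᶻ w
    e1 = solveℤ
    e2 : ∀ x c w → ((x +ᶻ w) +ᶻ c) -ᶻ w ≡ x +ᶻ c
    e2 = solveℤ
    y≡ : y ≡ x +ᶻ pos (c * d)
    y≡ = trans (e1 y (pos W)) (trans (cong (_-ᶻ pos W) (trans (sym (v-eq {y} ly)) (trans (cong pos v≡) (cong (_+ᶻ pos (c * d)) (v-eq {x} lx))))) (e2 x (pos (c * d)) (pos W)))

  Result : Set
  Result = ∃[ x ] ∃[ y ] ∃[ R' ] ∃[ c ] (R ↭ x ∷ y ∷ R' × y ≡ x +ᶻ pos (c * d) × h ≤ c × c ≤ ℓ)

  far : ℤ → ℤ → Bool
  far x y = ⌊ h * d ≤? ∣ y -ᶻ x ∣ ⌋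

  e4 : ∀ x c → (x +ᶻ c) -ᶻ x ≡ c
  e4 = solveℤ
  e5 : ∀ x c → x -ᶻ (x +ᶻ c) ≡ -ᶻ c
  e5 = solveℤ

  h≤ : ∀ {c} → h * d ≤ c * d → h ≤ c
  h≤ {c} = *-cancelʳ-≤ h c d

  found : ∀ x y R' → R ↭ x ∷ y ∷ R' → ∣ x ∣ ≤ W → ∣ y ∣ ≤ W → key x ≡ key y → far x y ≡ true → Result
  found x y R' r lx ly k f with ≤-total (v x) (v y)
  ... | inj₁ le with apart x y lx ly k le
  ...   | c , c< , refl = x , y , R' , c , r , refl , h≤ (≤-trans (⌊⌋-sound (h * d ≤? _) f) (≤-reflexive (cong ∣_∣ (e4 x (pos (c * d)))))) , <⇒≤ c<
  found x y R' r lx ly k f | inj₂ ge with apart y x ly lx (sym k) ge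
  ...   | c , c< , refl = y , x , R' , c , ↭-trans r (swap x y ↭-refl) , refl , h≤ (≤-trans (⌊⌋-sound (h * d ≤? _) f) (≤-reflexive (trans (cong ∣_∣ (e5 y (pos (c * d)))) (ℤP.∣-i∣≡∣i∣ (pos (c * d)))))) , <⇒≤ c<

  -- The index is shifted by `h`, so that natural numbers below `2 h` cover both signs of the
  -- difference.
  near : ∀ x y → ∣ x ∣ ≤ W → ∣ y ∣ ≤ W → key x ≡ key y → far x y ≡ false → ∃[ i ] (i < 2 * h × y ≡ x +ᶻ pos (i * d) -ᶻ pos (h * d))
  near x y lx ly k f with ≤-total (v x) (v y)
  ... | inj₁ le with apart x y lx ly k le
  ...   | c , _ , refl = c + h , ≤-trans (+-monoˡ-< h (*-cancelʳ-< d c h (≤-<-trans (≤-reflexive (sym (cong ∣_∣ (e4 x (pos (c * d)))))) (≰⇒> (⌊⌋-unsound (h * d ≤? _) f))))) (≤-reflexive (cong (h +_) (sym (+-identityʳ h))))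
          , trans (e6 x (pos (c * d)) (pos (h * d))) (cong (λ w → x +ᶻ pos w -ᶻ pos (h * d)) (sym (*-distribʳ-+ d c h)))
    where
    e6 : ∀ x c h → x +ᶻ c ≡ x +ᶻ (c +ᶻ h) -ᶻ h
    e6 = solveℤ
  near x y lx ly k f | inj₂ ge with apart y x ly lx (sym k) ge
  ...   | c , _ , refl with m≤n⇒∃[o]m+o≡n (<⇒≤ (*-cancelʳ-< d c h (≤-<-trans (≤-reflexive (sym (trans (cong ∣_∣ (e5 y (pos (c * d)))) (ℤP.∣-i∣≡∣i∣ (pos (c * d)))))) (≰⇒> (⌊⌋-unsound (h * d ≤? _) f)))))
  ...     | o , e = o , ≤-<-trans (m≤n+m o c) (subst (_< 2 * h) (sym e) h<2h)
          , trans (e6 y (pos (c * d)) (pos (o * d))) (cong (λ w → (y +ᶻ pos (c * d)) +ᶻ pos (o * d) -ᶻ pos w) (trans (sym (*-distribʳ-+ d c o)) (cong (_* d) e)))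
    where
    e6 : ∀ y c o → y ≡ (y +ᶻ c) +ᶻ o -ᶻ (c +ᶻ o)
    e6 = solveℤ
    c<h : c < h
    c<h = *-cancelʳ-< d c h (≤-<-trans (≤-reflexive (sym (trans (cong ∣_∣ (e5 y (pos (c * d)))) (ℤP.∣-i∣≡∣i∣ (pos (c * d)))))) (≰⇒> (⌊⌋-unsound (h * d ≤? _) f)))
    h<2h : h < 2 * h
    h<2h = ≤-trans (+-monoʳ-≤ 1 (≤-refl {h})) (≤-trans (+-monoˡ-≤ h (≤-trans (s≤s z≤n) c<h)) (≤-reflexive (cong (h +_) (sym (+-identityʳ h)))))

  -- There are only `2 h` possible values, each taken at most `m` times. A class with more than
  -- `2 h m` elements thus contains one that is far from `x`.
  crowded : ∀ x ys zs → R ↭ ys ++ zs → All (λ y → ∃[ i ] (i < 2 * h × y ≡ x +ᶻ pos (i * d) -ᶻ pos (h * d))) ys → length ys ≤ 2 * h * m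
  crowded x ys zs r al = begin
    length ys                                                      ≡⟨ trans (∑ᴸ-const 1 ys) (*-identityʳ _) ⟨
    ∑ᴸ (λ _ → 1) ys                                                ≤⟨ ∑ᴸ-mono (AllL.map hit al) ⟩
    ∑ᴸ (λ y → ∑ (2 * h) (λ i → ι ⌊ y ≟ᶻ val i ⌋)) ys               ≡⟨ ∑ᴸ-∑ (2 * h) (λ y i → ι ⌊ y ≟ᶻ val i ⌋) ys ⟩
    ∑ (2 * h) (λ i → # (λ y → ⌊ y ≟ᶻ val i ⌋) ys)                  ≤⟨ ∑-bound (2 * h) m (λ i _ → Box.mult (Box-part zs r box) (val i)) ⟩
    2 * h * m                                                      ∎
    where
    open ≤-Reasoning
    val : ℕ → ℤ
    val i = x +ᶻ pos (i * d) -ᶻ pos (h * d)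
    hit : ∀ {y} → ∃[ i ] (i < 2 * h × y ≡ val i) → 1 ≤ ∑ (2 * h) (λ i → ι ⌊ y ≟ᶻ val i ⌋)
    hit {y} (i , i< , e) = ≤-trans (≤-reflexive (sym (ι-yes (y ≟ᶻ val i) e))) (term≤∑ (2 * h) (λ i → ι ⌊ y ≟ᶻ val i ⌋) i i<)

  pair : Result
  pair with popular key (suc (2 * W / (ℓ * d)) * d) (2 * h * m) R (AllL.map (λ {z} → key< {z}) (Box.bounded box)) many
  ... | i , i< , cnt with filterᴸ (λ x → ⌊ key x ≟ i ⌋) R
  ... | [] , zs , r , al , _ , len = contradiction (subst (2 * h * m <_) (sym len) cnt) λ ()
  ... | x ∷ ys , zs , r , (kx ∷ al) , _ , len with first (far x) ys | AllP.++⁻ˡ (x ∷ ys) (All-↭ r (Box.bounded box))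
  ... | inj₁ (y , ys' , r' , f) | lx ∷ ly = found x y (ys' ++ zs) (↭-trans r (prep x (↭P.++⁺ʳ zs r'))) lx (AllL.head (All-↭ r' ly))
          (trans (⌊⌋-sound (key x ≟ i) kx) (sym (⌊⌋-sound (key y ≟ i) (AllL.head (All-↭ r' al))))) f
  ... | inj₂ none | lx ∷ ly = contradiction (subst (2 * h * m <_) (sym len) cnt) (≤⇒≯ (crowded x (x ∷ ys) zs r (self ∷ rest ys al ly none)))
    where
    rest : ∀ ys → All (λ y → ⌊ key y ≟ i ⌋ ≡ true) ys → All (λ y → ∣ y ∣ ≤ W) ys → All (λ y → far x y ≡ false) ys → All (λ y → ∃[ i ] (i < 2 * h × y ≡ x +ᶻ pos (i * d) -ᶻ pos (h * d))) ys
    rest [] [] [] [] = []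
    rest (y ∷ ys) (a ∷ as) (b ∷ bs) (f ∷ fs) = near x y lx b (trans (⌊⌋-sound (key x ≟ i) kx) (sym (⌊⌋-sound (key y ≟ i) a))) f ∷ rest ys as bs fs
    e7 : ∀ x h → x ≡ x +ᶻ h -ᶻ h
    e7 = solveℤ
    self : ∃[ i ] (i < 2 * h × x ≡ x +ᶻ pos (i * d) -ᶻ pos (h * d))
    self = h , ≤-trans (+-monoˡ-≤ h 0<h) (≤-reflexive (cong (h +_) (sym (+-identityʳ h)))) , e7 x (pos (h * d))

-- Lowering the difference of a progression

-- The coefficient `j` is natural because it will be a number of summands. A coefficient `- x` of
-- `c` is replaced by `x (d - 1)`, which is congruent to it modulo `d`.
bezout : ∀ c d → 1 ≤ c → 1 ≤ d → ∃[ g ] ∃[ j ] ∃[ q ] (1 ≤ g × g ≤ c × pos j *ᶻ pos c ≡ pos g +ᶻ q *ᶻ pos d)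
bezout c d@(suc d') 1≤c _ with Bézout.lemma c d
... | Bézout.result g gcd b = g , go b
  where
  1≤g : 1 ≤ g
  1≤g = n≢0⇒n>0 λ { refl → contradiction (subst (1 ≤_) (0∣⇒≡0 (GCD.GCD.gcd∣m gcd)) 1≤c) λ () }
  g≤c : g ≤ c
  g≤c = ∣⇒≤ {{>-nonZero 1≤c}} (GCD.GCD.gcd∣m gcd)
  e : ∀ x c d' g y → g +ᶻ x *ᶻ c ≡ y *ᶻ (pos 1 +ᶻ d') → (x *ᶻ d') *ᶻ c ≡ g +ᶻ (x *ᶻ c -ᶻ y) *ᶻ (pos 1 +ᶻ d')
  e x c d' g y q = trans (e1 x c d' g) (trans (cong (λ w → g +ᶻ (x *ᶻ c) *ᶻ (pos 1 +ᶻ d') -ᶻ w) q) (e2 x c d' g y))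
    where
    e1 : ∀ x c d' g → (x *ᶻ d') *ᶻ c ≡ g +ᶻ (x *ᶻ c) *ᶻ (pos 1 +ᶻ d') -ᶻ (g +ᶻ x *ᶻ c)
    e1 = solveℤ
    e2 : ∀ x c d' g y → g +ᶻ (x *ᶻ c) *ᶻ (pos 1 +ᶻ d') -ᶻ y *ᶻ (pos 1 +ᶻ d') ≡ g +ᶻ (x *ᶻ c -ᶻ y) *ᶻ (pos 1 +ᶻ d')
    e2 = solveℤ
  go : Bézout.Identity g c d → ∃[ j ] ∃[ q ] (1 ≤ g × g ≤ c × pos j *ᶻ pos c ≡ pos g +ᶻ q *ᶻ pos d)
  go (Bézout.+- x y eq) = x , pos y , 1≤g , g≤c , trans (sym (ℤP.pos-* x c)) (trans (cong pos (sym eq)) (cong (pos g +ᶻ_) (ℤP.pos-* y d)))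
  go (Bézout.-+ x y eq) = x * d' , pos x *ᶻ pos c -ᶻ pos y , 1≤g , g≤c , trans (cong (_*ᶻ pos c) (ℤP.pos-* x d'))
    (e (pos x) (pos c) (pos d') (pos g) (pos y) (trans (cong (pos g +ᶻ_) (sym (ℤP.pos-* x c))) (trans (cong pos eq) (ℤP.pos-* y d))))

nonneg-quotient : ∀ i d n .{{_ : NonZero d}} → i *ᶻ pos d ≡ pos n → ∃[ I ] (i ≡ pos I × I * d ≡ n)
nonneg-quotient (pos I)  d n e = I , refl , ℤP.+-injective (trans (ℤP.pos-* I d) e)
nonneg-quotient -[1+ k ] (suc d) n ()

residue-eq : ∀ z d .{{_ : NonZero d}} → z ≡ pos (z %ℕ d) +ᶻ (z /ℕ d) *ᶻ pos d
residue-eq z d = a≡a%ℕn+[a/ℕn]*n z d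

prefix-sum : ∀ {W c d X} .{{_ : NonZero d}} → All (λ z → (z %ℕ d ≡ c) × ∣ z ∣ ≤ W) X → ∀ j → j ≤ length X →
  ∃[ s ] ∃[ q ] (SS X s × s ≡ pos j *ᶻ pos c +ᶻ q *ᶻ pos d × ∣ s ∣ ≤ j * W)
prefix-sum {c = c} {d} {X} al zero _ = pos 0 , pos 0 , SS-empty X , refl , z≤n
prefix-sum {W} {c} {d} {z ∷ X} ((zc , zW) ∷ al) (suc j) (s≤s l) with prefix-sum al j l
... | s , q , ss , e , b = z +ᶻ s , (z /ℕ d) +ᶻ q , take ss
    , trans (cong₂ _+ᶻ_ (trans (residue-eq z d) (cong (λ w → pos w +ᶻ (z /ℕ d) *ᶻ pos d) zc)) e) (e1 (pos c) (z /ℕ d) (pos d) (pos j) q)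
    , ≤-trans (ℤP.∣i+j∣≤∣i∣+∣j∣ z s) (+-mono-≤ zW b)
  where
  e1 : ∀ c a d j q → (c +ᶻ a *ᶻ d) +ᶻ (j *ᶻ c +ᶻ q *ᶻ d) ≡ (pos 1 +ᶻ j) *ᶻ c +ᶻ (a +ᶻ q) *ᶻ d
  e1 = solveℤ

-- The term z of the refined progression: s is a sum of j elements of the class c, and the quotient
-- by d of what is left lies in the range of the old progression.
refined-term : ∀ {W d ℓ z g c j₀ j a o v s q q₀} .{{_ : NonZero d}} → z * g ≤ ℓ * d → v ≤ 2 * (j * W) → j * W + o ≡ d * W →
  -ᶻ s +ᶻ pos (j * W) ≡ pos v → s ≡ pos j *ᶻ pos c +ᶻ q *ᶻ pos d → pos j₀ *ᶻ pos z ≡ pos j +ᶻ pos a *ᶻ pos d →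
  pos j₀ *ᶻ pos c ≡ pos g +ᶻ q₀ *ᶻ pos d → ∀ u →
  ∃[ I ] (I ≤ 2 * W + ℓ × s +ᶻ (u +ᶻ pos (I * d)) ≡ (u +ᶻ pos (W * d)) +ᶻ pos (z * g))
refined-term {W} {d} {ℓ} {z} {g} {c} {j₀} {j} {a} {o} {v} {s} {q} {q₀} zg≤ v≤ slack ve e split bz u =
  let (I , _ , Id) = nonneg-quotient i d n id-pos
  in I , *-cancelʳ-≤ I _ d (≤-trans (≤-reflexive Id) n≤) , sum I Id
  where
  i : ℤ
  i = pos W -ᶻ (pos z *ᶻ q₀ -ᶻ pos a *ᶻ pos c +ᶻ q)
  n : ℕ
  n = v + o + z * g
  f1 : ∀ W z q₀ a c q d j j₀ g s → s ≡ j *ᶻ c +ᶻ q *ᶻ d → j₀ *ᶻ z ≡ j +ᶻ a *ᶻ d → j₀ *ᶻ c ≡ g +ᶻ q₀ *ᶻ d →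
    (W -ᶻ (z *ᶻ q₀ -ᶻ a *ᶻ c +ᶻ q)) *ᶻ d ≡ W *ᶻ d -ᶻ s +ᶻ z *ᶻ g
  f1 W z q₀ a c q d j j₀ g s e₁ e₂ e₃ = trans (g1 W z q₀ a c q d j g) (trans (cong₂ (λ x y → W *ᶻ d -ᶻ x +ᶻ z *ᶻ g +ᶻ y) (sym e₁) zero') (ℤP.+-identityʳ _))
    where
    g1 : ∀ W z q₀ a c q d j g → (W -ᶻ (z *ᶻ q₀ -ᶻ a *ᶻ c +ᶻ q)) *ᶻ d ≡ W *ᶻ d -ᶻ (j *ᶻ c +ᶻ q *ᶻ d) +ᶻ z *ᶻ g +ᶻ ((j +ᶻ a *ᶻ d) *ᶻ c -ᶻ z *ᶻ (g +ᶻ q₀ *ᶻ d))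
    g1 = solveℤ
    g2 : ∀ j₀ z c → (j₀ *ᶻ z) *ᶻ c -ᶻ z *ᶻ (j₀ *ᶻ c) ≡ pos 0
    g2 = solveℤ
    zero' : (j +ᶻ a *ᶻ d) *ᶻ c -ᶻ z *ᶻ (g +ᶻ q₀ *ᶻ d) ≡ pos 0
    zero' = trans (cong₂ (λ x y → x *ᶻ c -ᶻ z *ᶻ y) (sym e₂) (sym e₃)) (g2 j₀ z c)
  id≡ : i *ᶻ pos d ≡ pos W *ᶻ pos d -ᶻ s +ᶻ pos z *ᶻ pos g
  id≡ = f1 (pos W) (pos z) q₀ (pos a) (pos c) q (pos d) (pos j) (pos j₀) (pos g) s e split bz
  f2 : ∀ s jw o zg → (jw +ᶻ o) -ᶻ s +ᶻ zg ≡ (-ᶻ s +ᶻ jw) +ᶻ o +ᶻ zg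
  f2 = solveℤ
  id-pos : i *ᶻ pos d ≡ pos n
  id-pos = trans id≡ (trans (cong₂ (λ x y → x -ᶻ s +ᶻ y) (trans (sym (ℤP.pos-* W d)) (cong pos (trans (*-comm W d) (sym slack)))) (sym (ℤP.pos-* z g)))
    (trans (f2 s (pos (j * W)) (pos o) (pos (z * g))) (cong (λ w → w +ᶻ pos o +ᶻ pos (z * g)) ve)))
  n≤ : n ≤ (2 * W + ℓ) * d
  n≤ = ≤-trans (+-mono-≤ (≤-trans (+-mono-≤ v≤ (m≤n*m o 2)) (≤-reflexive (trans (sym (*-distribˡ-+ 2 (j * W) o)) (trans (cong (2 *_) (trans slack (*-comm d W))) (sym (*-assoc 2 W d)))))) zg≤)
     (≤-reflexive (sym (*-distribʳ-+ d (2 * W) ℓ)))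
  f3 : ∀ s u w zg → s +ᶻ (u +ᶻ (w -ᶻ s +ᶻ zg)) ≡ (u +ᶻ w) +ᶻ zg
  f3 = solveℤ
  sum : ∀ I → I * d ≡ n → s +ᶻ (u +ᶻ pos (I * d)) ≡ (u +ᶻ pos (W * d)) +ᶻ pos (z * g)
  sum I Id = trans (cong (λ w → s +ᶻ (u +ᶻ w)) (trans (cong pos Id) (trans (sym id-pos) id≡)))
    (trans (f3 s u (pos W *ᶻ pos d) (pos z *ᶻ pos g)) (cong₂ (λ x y → (u +ᶻ x) +ᶻ y) (sym (ℤP.pos-* W d)) (sym (ℤP.pos-* z g))))

-- Sums of `j` elements of `X` lie in the class of `j c` modulo `d`, so a suitable `j < d` hits the
-- class of `z g`. Such a sum has absolute value at most `d W`. What is missing to the target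
-- `u + W d + z g` is therefore a multiple of `d` between 0 and `(2 W + ℓ) d`, a term of the old
-- progression; this costs `2 W` terms.
AP-refine : ∀ {W c d ℓ F X} .{{_ : NonZero d}} → 1 ≤ c → c < d → length X ≡ d → All (λ z → (z %ℕ d ≡ c) × ∣ z ∣ ≤ W) X →
  AP F d (2 * W + ℓ) → ∃[ g ] (1 ≤ g × g < d × AP (X ++ F) g ℓ)
AP-refine {W} {c} {d} {ℓ} {F} {X} 1≤c c<d len al (u , ap) =
  let (g , j₀ , q₀ , 1≤g , g≤c , bz) = bezout c d 1≤c (≤-trans (s≤s z≤n) c<d)
  in g , 1≤g , ≤-<-trans g≤c c<d , u +ᶻ pos (W * d) , go g j₀ q₀ g≤c bz
  where
  term : ∀ g j₀ q₀ → g ≤ c → pos j₀ *ᶻ pos c ≡ pos g +ᶻ q₀ *ᶻ pos d → ∀ z → z ≤ ℓ → ∀ j a → j < d → j₀ * z ≡ j + a * d →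
    SS (X ++ F) ((u +ᶻ pos (W * d)) +ᶻ pos (z * g))
  term g j₀ q₀ g≤c bz z z≤ j a j<d div =
    let (s , q , ss , e , b) = prefix-sum {W} {c} {d} {X} al j (≤-trans (<⇒≤ j<d) (≤-reflexive (sym len)))
        (v , v≤ , ve) = shifted {j * W} (-ᶻ s) (≤-trans (≤-reflexive (ℤP.∣-i∣≡∣i∣ s)) b)
        (o , slack) = m≤n⇒∃[o]m+o≡n (*-monoˡ-≤ W (<⇒≤ j<d))
        (I , I≤ , sum) = refined-term {W} {d} {ℓ} {z} {g} {c} {j₀} {j} {a} {o} {v} {s} {q} {q₀} (*-mono-≤ z≤ (≤-trans g≤c (<⇒≤ c<d))) v≤ slack ve e split bz u
    in SS-≡ sum (SS-++ ss (ap I I≤))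
    where
    split : pos j₀ *ᶻ pos z ≡ pos j +ᶻ pos a *ᶻ pos d
    split = trans (sym (ℤP.pos-* j₀ z)) (trans (cong pos div) (cong (pos j +ᶻ_) (ℤP.pos-* a d)))
  go : ∀ g j₀ q₀ → g ≤ c → pos j₀ *ᶻ pos c ≡ pos g +ᶻ q₀ *ᶻ pos d → ∀ z → z ≤ ℓ → SS (X ++ F) ((u +ᶻ pos (W * d)) +ᶻ pos (z * g))
  go g j₀ q₀ g≤c bz z z≤ = term g j₀ q₀ g≤c bz z z≤ ((j₀ * z) % d) ((j₀ * z) / d) (m%n<n (j₀ * z) d) (m≡m%n+[m/n]*n (j₀ * z) d)

-- The value at `g = 0` is a dummy: the moduli of interest are at least 2.
nondiv : ℕ → ℤ → Bool
nondiv zero      z = false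
nondiv (suc g) z = not ⌊ z %ℕ suc g ≟ 0 ⌋

take-drop : ∀ {X : Set} n (xs : List X) → n ≤ length xs → ∃[ ys ] ∃[ zs ] (xs ≡ ys ++ zs × length ys ≡ n)
take-drop zero    xs       _       = [] , xs , refl , refl
take-drop (suc n) (x ∷ xs) (s≤s l) with take-drop n xs l
... | ys , zs , refl , e = x ∷ ys , zs , refl , cong suc e

not-true : ∀ {b} → not b ≡ true → b ≡ false
not-true {false} _ = refl

module Refine {W m C Bd : ℕ} {R : List ℤ} (box : Box W m R)
  (generic : ∀ g → 2 ≤ g → g ≤ C → Bd + C * C < # (nondiv g) R) where

  -- More than `d * d` elements outside `F` are not multiples of `d`, so one of the classes contains
  -- more than `d` of them, and it is not the class of 0.
  class : ∀ d F R' → R ↭ F ++ R' → 2 ≤ d → d ≤ C → length F ≤ Bd → .{{_ : NonZero d}} →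
    ∃[ c ] ∃[ X ] ∃[ R'' ] (1 ≤ c × c < d × length X ≡ d × R' ↭ X ++ R'' × All (λ z → (z %ℕ d ≡ c) × ∣ z ∣ ≤ W) X)
  class d@(suc d') F R' r 2≤d d≤C F≤ with filterᴸ (nondiv d) R'
  ... | ys , zs , r₁ , al₁ , _ , len₁ with popular (λ z → z %ℕ d) d d ys (AllL.universal (λ z → n%ℕd<d z d) ys) d²<
    where
    d²< : d * d < length ys
    d²< = ≤-<-trans (*-mono-≤ d≤C d≤C) (subst (C * C <_) (sym len₁) (+-cancelˡ-< Bd _ _ (<-≤-trans (generic d 2≤d d≤C)
      (≤-trans (≤-reflexive (trans (#-↭ (nondiv d) r) (#-++ (nondiv d) F R'))) (+-monoˡ-≤ _ (≤-trans (#-≤-length (nondiv d) F) F≤))))))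
  ... | c , c<d , cnt with filterᴸ (λ z → ⌊ z %ℕ d ≟ c ⌋) ys
  ... | xs , ws , r₂ , al₂ , _ , len₂ with take-drop d xs (<⇒≤ (subst (d <_) (sym len₂) cnt))
  ... | X , X' , refl , lenX = c , X , X' ++ ws ++ zs , 1≤c X lenX allX , c<d , lenX , perm , AllL.zipWith (λ (a , b) → ⌊⌋-sound (_ ≟ c) a , b) (AllP.++⁻ˡ X al₂ , bdX)
    where
    perm : R' ↭ X ++ X' ++ ws ++ zs
    perm = ↭-trans r₁ (↭-trans (↭P.++⁺ʳ zs r₂) (↭-reflexive (trans (LP.++-assoc (X ++ X') ws zs) (LP.++-assoc X X' (ws ++ zs)))))
    bdX : All (λ z → ∣ z ∣ ≤ W) X
    bdX = AllP.++⁻ˡ X (All-↭ perm (Box.bounded (Box-rest F r box)))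
    allX : All (λ z → (nondiv d z ≡ true) × (⌊ z %ℕ d ≟ c ⌋ ≡ true)) X
    allX = AllL.zip (AllP.++⁻ˡ X (AllP.++⁻ˡ (X ++ X') (All-↭ r₂ al₁)) , AllP.++⁻ˡ X al₂)
    1≤c : ∀ X → length X ≡ d → All (λ z → (nondiv d z ≡ true) × (⌊ z %ℕ d ≟ c ⌋ ≡ true)) X → 1 ≤ c
    1≤c (z ∷ X) _ ((nd , k) ∷ _) = n≢0⇒n>0 λ { refl → contradiction (trans (sym k) (not-true nd)) λ () }

  step : ∀ d F R' ℓ → R ↭ F ++ R' → 2 ≤ d → d ≤ C → length F ≤ Bd → .{{_ : NonZero d}} → AP F d (2 * W + ℓ) →
    ∃[ g ] ∃[ X ] ∃[ R'' ] (1 ≤ g × g < d × length X ≡ d × R ↭ (X ++ F) ++ R'' × AP (X ++ F) g ℓ)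
  step d F R' ℓ r 2≤d d≤C F≤ ap =
    let (c , X , R'' , 1≤c , c<d , lenX , r' , al) = class d F R' r 2≤d d≤C F≤
        (g , 1≤g , g<d , ap') = AP-refine {W} {c} {d} {ℓ} {F} {X} 1≤c c<d lenX al ap
    in g , X , R'' , 1≤g , g<d , lenX
       , ↭-trans r (↭-trans (↭P.++⁺ˡ F r') (↭-trans (↭-reflexive (sym (LP.++-assoc F X R''))) (↭P.++⁺ʳ R'' (↭P.++-comm F X)))) , ap'

  Refined : Set
  Refined = ∃[ F' ] ∃[ R'' ] (R ↭ F' ++ R'' × AP F' 1 W × length F' ≤ Bd)

  e₁ : ∀ W d' → 2 * W + (W + 2 * W * d') ≡ W + 2 * W * (1 + d')
  e₁ = solveℕ
  e₂ : ∀ C f d' → C + f + d' * C ≡ f + (1 + d') * C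
  e₂ = solveℕ

  -- The difference falls strictly until it is 1. A step spends at most `C` elements and `2 W`
  -- terms, which the budgets `d * C` and `2 * W * d` provide for.
  refine : ∀ fuel d F R' ℓ → d ≤ fuel → 1 ≤ d → d ≤ C → R ↭ F ++ R' → W + 2 * W * d ≤ ℓ → AP F d ℓ → length F + d * C ≤ Bd → Refined
  continue : ∀ fuel d F → d ≤ fuel → suc d ≤ C → length F + suc d * C ≤ Bd →
    ∃[ g ] ∃[ X ] ∃[ R'' ] (1 ≤ g × g < suc d × length X ≡ suc d × R ↭ (X ++ F) ++ R'' × AP (X ++ F) g (W + 2 * W * d)) → Refined
  refine fuel 1 F R' ℓ _ _ _ r ℓ≥ ap F≤ = F , R' , r , AP-mono (≤-trans (m≤m+n W _) ℓ≥) ap , ≤-trans (m≤m+n _ _) F≤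
  refine (suc fuel) (suc (suc d)) F R' ℓ d≤ 1≤d d≤C r ℓ≥ ap F≤ = continue fuel (suc d) F (≤-pred d≤) d≤C F≤
    (step (suc (suc d)) F R' (W + 2 * W * suc d) r (s≤s (s≤s z≤n)) d≤C (≤-trans (m≤m+n _ _) F≤) (AP-mono (≤-trans (≤-reflexive (e₁ W (suc d))) ℓ≥) ap))
  continue fuel d F d≤ d≤C F≤ (g , X , R'' , 1≤g , g<d , lenX , r , ap) = refine fuel g (X ++ F) R'' (W + 2 * W * d)
    (≤-trans (≤-pred g<d) d≤) 1≤g (≤-trans (<⇒≤ g<d) d≤C) r (+-monoʳ-≤ W (*-monoʳ-≤ (2 * W) (≤-pred g<d))) ap
    (≤-trans (+-mono-≤ (≤-reflexive (LP.length-++ X)) (*-monoˡ-≤ C (≤-pred g<d)))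
    (≤-trans (+-monoˡ-≤ _ (+-monoˡ-≤ (length F) (≤-trans (≤-reflexive lenX) d≤C))) (≤-trans (≤-reflexive (e₂ C (length F) d)) F≤)))

-- Long progressions from few elements of a dense set

module Extract {W m τ n₀ : ℕ} (1≤τ : 1 ≤ τ) (1≤m : 1 ≤ m) (1≤W : 1 ≤ W) (dense : m * W ≤ 2 * τ * n₀) where
  C : ℕ
  C = 16 * τ

  instance
    τ≢0 : NonZero τ
    τ≢0 = >-nonZero 1≤τ
    m≢0 : NonZero m
    m≢0 = >-nonZero 1≤m
    C≢0 : NonZero C
    C≢0 = m*n≢0 16 τ
    C1≢0 : NonZero (C * 1)
    C1≢0 = m*n≢0 C 1

  mW>0 : 0 < m * W
  mW>0 = *-mono-≤ {1} {m} {1} 1≤m 1≤W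

  n₀>0 : 0 < n₀
  n₀>0 = n≢0⇒n>0 λ e → <-irrefl refl (<-≤-trans mW>0 (≤-trans dense (≤-reflexive (trans (cong (2 * τ *_) e) (*-zeroʳ (2 * τ))))))

  single : ∀ {R} → Box W m R → W ≤ C → 0 < length R → ∃[ g ] ∃[ R' ] (R ↭ Gadget.els {C} g ++ R')
  single {pos n ∷ R} box W≤C _ = record
    { els = pos n ∷ [] ; c = n ; 1≤c = AllL.head (Box.nonzero box) ; c≤C = ≤-trans (AllL.head (Box.bounded box)) W≤C
    ; base = pos 0 ; low = skip [] ; high = SS-≡ (ℤP.+-comm (pos n) (pos 0)) (take []) ; size = s≤s z≤n } , R , ↭-refl
  single { -[1+ n ] ∷ R} box W≤C _ = record
    { els = -[1+ n ] ∷ [] ; c = suc n ; 1≤c = s≤s z≤n ; c≤C = ≤-trans (AllL.head (Box.bounded box)) W≤C ; base = -[1+ n ]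
    ; low = SS-≡ (ℤP.+-identityʳ -[1+ n ]) (take []) ; high = SS-≡ (sym (ℤP.+-inverseˡ (pos (suc n)))) (skip []) ; size = s≤s z≤n } , R , ↭-refl

  close-many : 8 * τ < W → suc (2 * W / (C * 1)) * 1 * (2 * 1 * m) < n₀
  close-many 8τ<W = *-cancelˡ-< (8 * τ) _ _ (begin-strict
    8 * τ * (suc q * 1 * (2 * 1 * m))       ≡⟨ e1 τ q m ⟩
    m * (q * (16 * τ * 1)) + 2 * (m * (8 * τ)) <⟨ +-mono-≤-< (*-monoʳ-≤ m (m/n*n≤m (2 * W) (C * 1))) (*-monoʳ-< 2 (*-monoʳ-< m 8τ<W)) ⟩
    m * (2 * W) + 2 * (m * W)               ≡⟨ e2 m W ⟩
    4 * (m * W)                             ≤⟨ *-monoʳ-≤ 4 dense ⟩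
    4 * (2 * τ * n₀)                        ≡⟨ e3 τ n₀ ⟩
    8 * τ * n₀                              ∎)
    where
    open ≤-Reasoning
    q = 2 * W / (C * 1)
    e1 : ∀ τ q m → 8 * τ * ((1 + q) * 1 * (2 * 1 * m)) ≡ m * (q * (16 * τ * 1)) + 2 * (m * (8 * τ))
    e1 = solveℕ
    e2 : ∀ m W → m * (2 * W) + 2 * (m * W) ≡ 4 * (m * W)
    e2 = solveℕ
    e3 : ∀ τ n → 4 * (2 * τ * n) ≡ 8 * τ * n
    e3 = solveℕ

  from-pair : ∀ {R} → ∃[ x ] ∃[ y ] ∃[ R' ] ∃[ c ] (R ↭ x ∷ y ∷ R' × y ≡ x +ᶻ pos (c * 1) × 1 ≤ c × c ≤ C) → ∃[ g ] ∃[ R' ] (R ↭ Gadget.els {C} g ++ R')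
  from-pair (x , y , R' , c , r , e , 1≤c , c≤) = record
    { els = x ∷ y ∷ [] ; c = c ; 1≤c = 1≤c ; c≤C = c≤ ; base = x ; low = SS-≡ (ℤP.+-identityʳ x) (take (skip []))
    ; high = SS-≡ (trans (ℤP.+-identityʳ y) (trans e (cong (λ w → x +ᶻ pos w) (*-identityʳ c)))) (skip (take [])) ; size = ≤-refl } , R' , r

  -- If `W` is bounded in terms of `τ`, any single element is a gadget. Otherwise the density forces
  -- two different elements at distance at most `C`.
  gadget : ∀ {R} → Box W m R → n₀ ≤ length R → ∃[ g ] ∃[ R' ] (R ↭ Gadget.els {C} g ++ R')
  gadget {R} box n₀≤ with W ≤? 8 * τ
  ... | yes l = single box (≤-trans l (*-monoˡ-≤ τ (≤ᵇ⇒≤ 8 16 _))) (≤-trans n₀>0 n₀≤)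
  ... | no nl = from-pair (Pair.pair box 1 1 C (s≤s z≤n) (<-≤-trans (close-many (≰⇒> nl)) n₀≤))

  gadgets : ∀ n {R} → Box W m R → n₀ + 2 * n ≤ length R → ∃[ gs ] ∃[ R' ] (R ↭ elements {C} gs ++ R' × length gs ≡ n)
  gadgets zero    {R} box _ = [] , R , ↭-refl , refl
  gadgets (suc n) {R} box l = more (gadget box (≤-trans (m≤m+n n₀ _) l))
    where
    more : ∃[ g ] ∃[ R' ] (R ↭ Gadget.els {C} g ++ R') → ∃[ gs ] ∃[ R' ] (R ↭ elements {C} gs ++ R' × length gs ≡ suc n)
    more (g , R' , r) = extend (gadgets n (Box-rest (Gadget.els g) r box) len)
      where
      e : ∀ a n → a + 2 * (1 + n) ≡ 2 + (a + 2 * n)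
      e = solveℕ
      len : n₀ + 2 * n ≤ length R'
      len = +-cancelˡ-≤ 2 _ _ (≤-trans (≤-trans (≤-reflexive (sym (e n₀ n))) l) (≤-trans (≤-reflexive (trans (↭-length r) (LP.length-++ (Gadget.els g)))) (+-monoˡ-≤ (length R') (Gadget.size g))))
      extend : ∃[ gs ] ∃[ R'' ] (R' ↭ elements {C} gs ++ R'' × length gs ≡ n) → ∃[ gs ] ∃[ R' ] (R ↭ elements {C} gs ++ R' × length gs ≡ suc n)
      extend (gs , R'' , r' , e') = g ∷ gs , R'' , ↭-trans r (↭-trans (↭P.++⁺ˡ (Gadget.els g) r') (↭-reflexive (sym (LP.++-assoc (Gadget.els g) _ _)))) , cong suc e'

  -- More than `t` of the gadgets share one difference `d`, and each of these lengthens the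
  -- progression by one term.
  level₁ : ∀ t {R} → Box W m R → n₀ + 2 * suc (suc C * t) ≤ length R →
    ∃[ d ] ∃[ F ] ∃[ R' ] (1 ≤ d × d ≤ C × R ↭ F ++ R' × AP F d t × length F ≤ 2 * suc (suc C * t))
  level₁ t {R} box l with gadgets (suc (suc C * t)) box l
  ... | gs , R' , r , len with popular Gadget.c (suc C) t gs (AllL.universal (λ g → s≤s (Gadget.c≤C g)) gs) (≤-reflexive (sym len))
  ... | d , d< , cnt with filterᴸ (λ g → ⌊ Gadget.c g ≟ d ⌋) gs
  ... | hs , ks , r' , al , _ , len' = d , elements hs , elements ks ++ R' , 1≤d hs al (subst (t <_) (sym len') cnt) , ≤-pred d<
      , ↭-trans r (↭-trans (↭P.++⁺ʳ R' (↭-trans (elements-↭ r') (↭-reflexive (elements-++ hs ks)))) (↭-reflexive (LP.++-assoc (elements hs) (elements ks) R')))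
      , AP-mono (<⇒≤ (subst (t <_) (sym len') cnt)) (elements-AP d hs (AllL.map (λ {g} → ⌊⌋-sound (Gadget.c g ≟ d)) al))
      , ≤-trans (elements-length hs) (*-monoʳ-≤ 2 (≤-trans (≤-trans (m≤m+n (length hs) (length ks)) (≤-reflexive (sym (trans (↭-length r') (LP.length-++ hs))))) (≤-reflexive len)))
    where
    1≤d : ∀ hs → All (λ g → ⌊ Gadget.c g ≟ d ⌋ ≡ true) hs → t < length hs → 1 ≤ d
    1≤d (g ∷ hs) (e ∷ _) _ = subst (1 ≤_) (⌊⌋-sound (Gadget.c g ≟ d) e) (Gadget.1≤c g)

  -- A progression of length `ℓ₀`, of order `h`, has room for pairs at distance `c d` with
  -- `h ≤ c ≤ ℓ₀`, and each such pair gains at least `h` terms for two elements. With `h` about the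
  -- square root of `W`, a number of elements of order `h` suffices for length `W`; gadgets alone,
  -- gaining one term each, would need about `W`.
  module Level₂ {R : List ℤ} (box : Box W m R) (d h : ℕ) (1≤d : 1 ≤ d) (d≤C : d ≤ C) (h≥ : 128 * τ * τ ≤ h) (hh≤W : h * h ≤ W) where
    instance
      d≢0 : NonZero d
      d≢0 = >-nonZero 1≤d
      h≢0 : NonZero h
      h≢0 = >-nonZero (≤-trans (*-mono-≤ {1} {128 * τ} {1} (*-mono-≤ {1} {128} {1} (s≤s z≤n) 1≤τ) 1≤τ) h≥)
      ℓ₀d≢0 : NonZero (32 * τ * h * d)
      ℓ₀d≢0 = m*n≢0 (32 * τ * h) d {{m*n≢0 (32 * τ) h {{m*n≢0 32 τ}}}}

    ℓ₀ : ℕ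
    ℓ₀ = 32 * τ * h

    class-many : suc (2 * W / (ℓ₀ * d)) * d * (2 * h * m) < n₀
    class-many = *-cancelˡ-< (16 * τ) _ _ (begin-strict
      16 * τ * (suc q * d * (2 * h * m))                 ≡⟨ e1 τ q d h m ⟩
      m * (q * (32 * τ * h * d)) + 32 * τ * (h * m) * d  ≤⟨ +-mono-≤ (*-monoʳ-≤ m (m/n*n≤m (2 * W) (ℓ₀ * d))) (*-monoʳ-≤ (32 * τ * (h * m)) d≤C) ⟩
      m * (2 * W) + 32 * τ * (h * m) * (16 * τ)          ≡⟨ e2 m W τ h ⟩
      2 * (m * W) + 4 * (m * (128 * τ * τ * h))          ≤⟨ +-monoʳ-≤ (2 * (m * W)) (*-monoʳ-≤ 4 (*-monoʳ-≤ m (≤-trans (*-monoˡ-≤ h h≥) hh≤W))) ⟩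
      2 * (m * W) + 4 * (m * W)                          <⟨ +-monoʳ-< (2 * (m * W)) (*-monoˡ-< (m * W) {{>-nonZero mW>0}} (≤ᵇ⇒≤ 5 6 _)) ⟩
      2 * (m * W) + 6 * (m * W)                          ≡⟨ e3 (m * W) ⟩
      8 * (m * W)                                        ≤⟨ *-monoʳ-≤ 8 dense ⟩
      8 * (2 * τ * n₀)                                   ≡⟨ e4 τ n₀ ⟩
      16 * τ * n₀                                        ∎)
      where
      open ≤-Reasoning
      q = 2 * W / (ℓ₀ * d)
      e1 : ∀ τ q d h m → 16 * τ * ((1 + q) * d * (2 * h * m)) ≡ m * (q * (32 * τ * h * d)) + 32 * τ * (h * m) * d
      e1 = solveℕ
      e2 : ∀ m W τ h → m * (2 * W) + 32 * τ * (h * m) * (16 * τ) ≡ 2 * (m * W) + 4 * (m * (128 * τ * τ * h))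
      e2 = solveℕ
      e3 : ∀ w → 2 * w + 6 * w ≡ 8 * w
      e3 = solveℕ
      e4 : ∀ τ n → 8 * (2 * τ * n) ≡ 16 * τ * n
      e4 = solveℕ

    Grown : ℕ → List ℤ → ℕ → Set
    Grown t F ℓ = ∃[ F' ] ∃[ R'' ] (R ↭ F' ++ R'' × AP F' d (ℓ + t * h) × length F' ≡ length F + 2 * t)

    level₂ : ∀ t F R' ℓ → R ↭ F ++ R' → AP F d ℓ → ℓ₀ ≤ ℓ → n₀ + 2 * t ≤ length R' → Grown t F ℓ
    level₂ zero F R' ℓ r ap _ _ = F , R' , r , subst (AP F d) (sym (+-identityʳ ℓ)) ap , sym (+-identityʳ _)
    level₂ (suc t) F R' ℓ r ap ℓ₀≤ l = more (Pair.pair (Box-rest F r box) d h ℓ₀ (>-nonZero⁻¹' h) (<-≤-trans class-many (≤-trans (m≤m+n n₀ _) l)))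
      where
      >-nonZero⁻¹' : ∀ n .{{_ : NonZero n}} → 0 < n
      >-nonZero⁻¹' (suc n) = s≤s z≤n
      more : ∃[ x ] ∃[ y ] ∃[ R'' ] ∃[ c ] (R' ↭ x ∷ y ∷ R'' × y ≡ x +ᶻ pos (c * d) × h ≤ c × c ≤ ℓ₀) → Grown (suc t) F ℓ
      more (x , y , R'' , c , r' , e , h≤c , c≤) = finish (level₂ t (x ∷ y ∷ F) R'' (ℓ + h)
          (↭-trans r (↭-trans (↭P.++⁺ˡ F r') (↭-trans (↭P.shift x F (y ∷ R'')) (prep x (↭P.shift y F R'')))))
          (AP-mono (+-monoʳ-≤ ℓ h≤c) (AP-extend {F} {x ∷ y ∷ []} {d} {ℓ} {x} c (SS-≡ (ℤP.+-identityʳ x) (take (skip []))) (SS-≡ (trans (ℤP.+-identityʳ y) e) (skip (take []))) (≤-trans c≤ (≤-trans ℓ₀≤ (n≤1+n ℓ))) ap))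
          (≤-trans ℓ₀≤ (m≤m+n ℓ h))
          (+-cancelˡ-≤ 2 _ _ (≤-trans (≤-reflexive (sym (e₁ n₀ t))) (≤-trans l (≤-reflexive (↭-length r'))))))
        where
        e₁ : ∀ a n → a + 2 * (1 + n) ≡ 2 + (a + 2 * n)
        e₁ = solveℕ
        e₂ : ∀ f t → 2 + f + 2 * t ≡ f + 2 * (1 + t)
        e₂ = solveℕ
        finish : Grown t (x ∷ y ∷ F) (ℓ + h) → Grown (suc t) F ℓ
        finish (F' , R₃ , r₃ , ap₃ , len) = F' , R₃ , r₃ , subst (AP F' d) (+-assoc ℓ h (t * h)) ap₃ , trans len (e₂ (length F) t)

-- A dense set of integers contains a small subset whose sums contain an interval of length W + 1, unless
-- almost all its elements have a common factor.
module Interval (τ : ℕ) (1≤τ : 1 ≤ τ) where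
  C H K : ℕ
  C = 16 * τ
  H = 128 * τ * τ
  -- Both cases need `2 + C * C`, where `C * C` pays for the refinement. The first product belongs
  -- to `small-case`, the final bracket to `large-case`.
  K = 2 + 2 * (suc C * ((1 + 2 * C) * H)) + C * C + (2 * (suc C * (32 * τ)) + 264 * τ)

  Found : ℕ → ℕ → List ℤ → Set
  Found W h R = ∃[ F ] ∃[ R' ] (R ↭ F ++ R' × AP F 1 W × length F ≤ K * suc h)

  module _ {W m h : ℕ} {R : List ℤ} (box : Box W m R) (1≤m : 1 ≤ m) (1≤W : 1 ≤ W) (dense : m * W ≤ τ * length R)
    (hh≤W : h * h ≤ W) (W<hh : W < suc h * suc h) (long : 2 * (K * suc h) ≤ length R)
    (generic : ∀ g → 2 ≤ g → g ≤ C → K * suc h + C * C < # (nondiv g) R) where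

    B : ℕ
    B = K * suc h

    -- At most `B` elements are ever spent and `n₀ ≥ B` others remain, so the density persists
    -- throughout with `τ` doubled.
    supply : ∃[ n₀ ] (B + n₀ ≡ length R)
    supply = m≤n⇒∃[o]m+o≡n (≤-trans (m≤m+n B _) long)

    n₀ : ℕ
    n₀ = proj₁ supply

    B≤n₀ : B ≤ n₀
    B≤n₀ = +-cancelˡ-≤ B _ _ (≤-trans (≤-reflexive (cong (B +_) (sym (+-identityʳ B)))) (≤-trans long (≤-reflexive (sym (proj₂ supply)))))

    dense' : m * W ≤ 2 * τ * n₀
    dense' = ≤-trans dense (≤-trans (*-monoʳ-≤ τ (≤-trans (≤-reflexive (sym (proj₂ supply))) (+-monoˡ-≤ n₀ B≤n₀))) (≤-reflexive (e τ n₀)))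
      where
      e : ∀ τ n → τ * (n + n) ≡ 2 * τ * n
      e = solveℕ

    module E = Extract {W} {m} {τ} {n₀} 1≤τ 1≤m 1≤W dense'

    room : ∀ {a} → a ≤ B → n₀ + a ≤ length R
    room {a} l = ≤-trans (+-monoʳ-≤ n₀ l) (≤-reflexive (trans (+-comm n₀ B) (proj₂ supply)))

    finish : ∀ d F R' ℓ → 1 ≤ d → d ≤ C → R ↭ F ++ R' → W + 2 * W * C ≤ ℓ → AP F d ℓ → length F + C * C ≤ B → Found W h R
    finish d F R' ℓ 1≤d d≤C r ℓ≥ ap F≤ = Refine.refine box generic d d F R' ℓ ≤-refl 1≤d d≤C r (≤-trans (+-monoʳ-≤ W (*-monoʳ-≤ (2 * W) d≤C)) ℓ≥) ap
      (≤-trans (+-monoʳ-≤ (length F) (*-monoˡ-≤ C d≤C)) F≤)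

    small-case : suc h ≤ H → Found W h R
    small-case l = go (E.level₁ t box (room (≤-trans (m≤m+n _ (C * C)) bd)))
      where
      t : ℕ
      t = W + 2 * W * C
      open ≤-Reasoning
      e1 : ∀ C a s → 2 * (1 + (1 + C) * (a * s)) + C * C ≡ 2 + C * C + 2 * ((1 + C) * a) * s
      e1 = solveℕ
      e2 : ∀ W C → W + 2 * W * C ≡ (1 + 2 * C) * W
      e2 = solveℕ
      e3 : ∀ c a s → (2 + c) * s + a * s ≡ (2 + a + c) * s
      e3 = solveℕ
      bd : 2 * suc (suc C * t) + C * C ≤ B
      bd = begin
        2 * suc (suc C * t) + C * C                                   ≤⟨ +-monoˡ-≤ (C * C) (*-monoʳ-≤ 2 (s≤s (*-monoʳ-≤ (suc C) (≤-trans (≤-reflexive (e2 W C)) (≤-trans (*-monoʳ-≤ (1 + 2 * C) (≤-trans (<⇒≤ W<hh) (*-monoˡ-≤ (suc h) l))) (≤-reflexive (sym (*-assoc (1 + 2 * C) H (suc h))))))))) ⟩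
        2 * suc (suc C * ((1 + 2 * C) * H * suc h)) + C * C           ≡⟨ e1 C ((1 + 2 * C) * H) (suc h) ⟩
        2 + C * C + 2 * (suc C * ((1 + 2 * C) * H)) * suc h           ≤⟨ +-monoˡ-≤ _ (m≤m*n (2 + C * C) (suc h)) ⟩
        (2 + C * C) * suc h + 2 * (suc C * ((1 + 2 * C) * H)) * suc h ≡⟨ e3 (C * C) (2 * (suc C * ((1 + 2 * C) * H))) (suc h) ⟩
        (2 + 2 * (suc C * ((1 + 2 * C) * H)) + C * C) * suc h         ≤⟨ *-monoˡ-≤ (suc h) (m≤m+n (2 + 2 * (suc C * ((1 + 2 * C) * H)) + C * C) (2 * (suc C * (32 * τ)) + 264 * τ)) ⟩
        K * suc h                                                     ∎
      go : ∃[ d ] ∃[ F ] ∃[ R' ] (1 ≤ d × d ≤ C × R ↭ F ++ R' × AP F d t × length F ≤ 2 * suc (suc C * t)) → Found W h R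
      go (d , F , R' , 1≤d , d≤C , r , ap , F≤) = finish d F R' t 1≤d d≤C r ≤-refl ap (≤-trans (+-monoˡ-≤ (C * C) F≤) bd)

    large-case : H ≤ h → Found W h R
    large-case H≤h = go (E.level₁ t₁ box (room (≤-trans (≤-trans (m≤m+n _ (2 * t₂)) (m≤m+n _ (C * C))) bd)))
      where
      t₁ t₂ : ℕ
      t₁ = 32 * τ * h
      -- 132 = 4 · 33: as `W` is below `(2 h) (2 h)`, this many gains of `h` reach `(1 + 32 τ) W`.
      t₂ = 132 * τ * h
      open ≤-Reasoning
      1≤h : 1 ≤ h
      1≤h = ≤-trans (*-mono-≤ {1} {128 * τ} {1} (*-mono-≤ {1} {128} {1} (s≤s z≤n) 1≤τ) 1≤τ) H≤h
      e1 : ∀ C τ h → 2 * (1 + (1 + C) * (32 * τ * h)) + 2 * (132 * τ * h) + C * C ≡ 2 + C * C + (2 * ((1 + C) * (32 * τ)) + 264 * τ) * h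
      e1 = solveℕ
      e2 : ∀ a b c s → (2 + c) * s + b * s + a * s ≡ (2 + a + c + b) * s
      e2 = solveℕ
      bd : 2 * suc (suc C * t₁) + 2 * t₂ + C * C ≤ B
      bd = begin
        2 * suc (suc C * t₁) + 2 * t₂ + C * C                       ≡⟨ e1 C τ h ⟩
        2 + C * C + (2 * (suc C * (32 * τ)) + 264 * τ) * h          ≤⟨ +-mono-≤ (m≤m*n (2 + C * C) (suc h)) (*-monoʳ-≤ (2 * (suc C * (32 * τ)) + 264 * τ) (n≤1+n h)) ⟩
        (2 + C * C) * suc h + (2 * (suc C * (32 * τ)) + 264 * τ) * suc h ≤⟨ m≤m+n _ (2 * (suc C * ((1 + 2 * C) * H)) * suc h) ⟩
        (2 + C * C) * suc h + (2 * (suc C * (32 * τ)) + 264 * τ) * suc h + 2 * (suc C * ((1 + 2 * C) * H)) * suc h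
          ≡⟨ e2 (2 * (suc C * ((1 + 2 * C) * H))) (2 * (suc C * (32 * τ)) + 264 * τ) (C * C) (suc h) ⟩
        K * suc h                                                   ∎
      e3 : ∀ W τ → W + 2 * W * (16 * τ) ≡ (1 + 32 * τ) * W
      e3 = solveℕ
      e4 : ∀ τ h → (τ + 32 * τ) * ((h + h) * (h + h)) ≡ 132 * τ * h * h
      e4 = solveℕ
      target : W + 2 * W * C ≤ t₁ + t₂ * h
      target = begin
        W + 2 * W * C                         ≡⟨ e3 W τ ⟩
        (1 + 32 * τ) * W                      ≤⟨ *-mono-≤ (+-monoˡ-≤ (32 * τ) 1≤τ) (≤-trans (<⇒≤ W<hh) (*-mono-≤ (+-monoˡ-≤ h 1≤h) (+-monoˡ-≤ h 1≤h))) ⟩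
        (τ + 32 * τ) * ((h + h) * (h + h))    ≡⟨ e4 τ h ⟩
        t₂ * h                                ≤⟨ m≤n+m _ t₁ ⟩
        t₁ + t₂ * h                           ∎
      go : ∃[ d ] ∃[ F ] ∃[ R' ] (1 ≤ d × d ≤ C × R ↭ F ++ R' × AP F d t₁ × length F ≤ 2 * suc (suc C * t₁)) → Found W h R
      go (d , F , R' , 1≤d , d≤C , r , ap , F≤) = go₂ (E.Level₂.level₂ box d h 1≤d d≤C H≤h hh≤W t₂ F R' t₁ r ap ≤-refl
          (+-cancelˡ-≤ (length F) _ _ (≤-trans (≤-reflexive (e5 (length F) n₀ (2 * t₂))) (≤-trans (room (≤-trans (+-monoˡ-≤ (2 * t₂) F≤) (≤-trans (m≤m+n _ (C * C)) bd))) (≤-reflexive (trans (↭-length r) (LP.length-++ F)))))))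
        where
        e5 : ∀ f n t → f + (n + t) ≡ n + (f + t)
        e5 = solveℕ
        go₂ : E.Level₂.Grown box d h 1≤d d≤C H≤h hh≤W t₂ F t₁ → Found W h R
        go₂ (F' , R'' , r' , ap' , len) = finish d F' R'' (t₁ + t₂ * h) 1≤d d≤C r' target ap'
          (≤-trans (+-monoˡ-≤ (C * C) (≤-trans (≤-reflexive len) (+-monoˡ-≤ (2 * t₂) F≤))) bd)

    interval-sums : Found W h R
    interval-sums with suc h ≤? H
    ... | yes l = small-case l
    ... | no nl = large-case (≤-pred (≰⇒> nl))

-- Linear programming: number of elements against total weight

tri-double : ∀ q → 2 * tri q ≡ q * suc q
tri-double zero    = refl
tri-double (suc q) = trans (e q (tri q)) (trans (cong (2 * suc q +_) (tri-double q)) (e' q))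
  where
  e : ∀ q t → 2 * (suc q + t) ≡ 2 * suc q + 2 * t
  e = solveℕ
  e' : ∀ q → 2 * suc q + q * suc q ≡ suc q * suc (suc q)
  e' = solveℕ

∑-tri : ∀ n → ∑ n suc ≡ tri n
∑-tri zero    = refl
∑-tri (suc n) = trans (∑-last n suc) (trans (cong (_+ suc n) (∑-tri n)) (+-comm (tri n) (suc n)))

∑-∸-tri : ∀ L q → ∑ L (q ∸_) ≤ tri q
∑-∸-tri zero    q       = z≤n
∑-∸-tri (suc L) zero    = ≤-reflexive (trans (∑-cong L (λ i → refl)) (∑-0 L))
∑-∸-tri (suc L) (suc q) = +-monoʳ-≤ (suc q) (∑-∸-tri L q)

∑-reverse : ∀ n (g : ℕ → ℕ) → ∑ n (λ i → g (n ∸ suc i)) ≡ ∑ n g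
∑-reverse zero    g = refl
∑-reverse (suc n) g = trans (cong (g n +_) (∑-reverse n g)) (trans (+-comm (g n) _) (sym (∑-last n g)))

-- Linear programming duality, where y i ≤ m elements have weight i + 1.
crowd : ∀ L m q (y : ℕ → ℕ) → (∀ i → y i ≤ m) → suc q * ∑ L y ≤ ∑ L (λ i → suc i * y i) + m * tri q
crowd L m q y y≤ = begin
  suc q * ∑ L y                                          ≡⟨ ∑-*ˡ L (suc q) y ⟨
  ∑ L (λ i → suc q * y i)                                ≤⟨ ∑-mono L (λ i → ≤-trans (*-monoˡ-≤ (y i) (s≤s (m≤n+m∸n q i))) (≤-reflexive (*-distribʳ-+ (y i) (suc i) (q ∸ i)))) ⟩
  ∑ L (λ i → suc i * y i + (q ∸ i) * y i)                ≡⟨ ∑-+ L (λ i → suc i * y i) (λ i → (q ∸ i) * y i) ⟩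
  ∑ L (λ i → suc i * y i) + ∑ L (λ i → (q ∸ i) * y i)    ≤⟨ +-monoʳ-≤ (∑ L (λ i → suc i * y i)) (≤-trans (∑-mono L (λ i → ≤-trans (*-monoʳ-≤ (q ∸ i) (y≤ i)) (≤-reflexive (*-comm (q ∸ i) m)))) (≤-trans (≤-reflexive (∑-*ˡ L m (q ∸_))) (*-monoʳ-≤ m (∑-∸-tri L q)))) ⟩
  ∑ L (λ i → suc i * y i) + m * tri q                    ∎
  where open ≤-Reasoning

-- `crowd` for the integral part `q` of `Y / m`, the number of levels that `Y` elements fill when
-- packed as low as possible.
crowd² : ∀ L m .{{_ : NonZero m}} (y : ℕ → ℕ) → (∀ i → y i ≤ m) → ∑ L y * ∑ L y ≤ 2 * (m * ∑ L (λ i → suc i * y i))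
crowd² L m y y≤ = begin
  Y * Y                ≤⟨ *-monoʳ-≤ Y (<⇒≤ (subst (_< suc q * m) (sym (m≡m%n+[m/n]*n Y m)) (+-monoˡ-< (q * m) (m%n<n Y m)))) ⟩
  Y * (suc q * m)      ≡⟨ e1 Y (suc q) m ⟩
  m * (suc q * Y)      ≤⟨ *-monoʳ-≤ m (+-cancelʳ-≤ (suc q * Y) _ _ half) ⟩
  m * (2 * S)          ≡⟨ e2 m S ⟩
  2 * (m * S)          ∎
  where
  open ≤-Reasoning
  Y = ∑ L y
  S = ∑ L (λ i → suc i * y i)
  q = Y / m
  e1 : ∀ y q m → y * (q * m) ≡ m * (q * y)
  e1 = solveℕ
  e2 : ∀ m s → m * (2 * s) ≡ 2 * (m * s)
  e2 = solveℕ
  e3 : ∀ a → a + a ≡ 2 * a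
  e3 = solveℕ
  e4 : ∀ s m t → 2 * (s + m * t) ≡ 2 * s + m * (2 * t)
  e4 = solveℕ
  e5 : ∀ m q → m * (q * suc q) ≡ suc q * (q * m)
  e5 = solveℕ
  half : suc q * Y + suc q * Y ≤ 2 * S + suc q * Y
  half = begin
    suc q * Y + suc q * Y        ≡⟨ e3 (suc q * Y) ⟩
    2 * (suc q * Y)              ≤⟨ *-monoʳ-≤ 2 (crowd L m q y y≤) ⟩
    2 * (S + m * tri q)          ≡⟨ e4 S m (tri q) ⟩
    2 * S + m * (2 * tri q)      ≡⟨ cong (λ w → 2 * S + m * w) (tri-double q) ⟩
    2 * S + m * (q * suc q)      ≡⟨ cong (2 * S +_) (e5 m q) ⟩
    2 * S + suc q * (q * m)      ≤⟨ +-monoʳ-≤ (2 * S) (*-monoʳ-≤ (suc q) (m/n*n≤m Y m)) ⟩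
    2 * S + suc q * Y            ∎

-- Here `c i` counts the elements of weight `i + 1`, and weights are compared with `n`. There are
-- `X` elements beyond `n` and `Y` vacant places below `n`; `XS` and `YS` are the sums of their
-- distances from `n`. For the extremal sequence all four vanish, so a total weight below `p` leaves
-- little room for `XS + YS`, and `crowd²` turns this into bounds for `X` and `Y`.
module Counting (m k n₁ o p E E' : ℕ) (1≤m : 1 ≤ m) (c : ℕ → ℕ) (c≤m : ∀ i → c i ≤ m)
  (p≤ : p ≤ m * tri n₁ + suc k * suc n₁)
  (S<p : ∑ (suc n₁ + o) (λ i → suc i * c i) < p)
  (low : m * n₁ + k ≤ ∑ (suc n₁ + o) c + E') (high : ∑ (suc n₁ + o) c ≤ m * n₁ + k + E) where

  instance
    m≢0 : NonZero m
    m≢0 = >-nonZero 1≤m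

  n N' S X XS Y YS C₀ : ℕ
  n  = suc n₁
  N' = ∑ (n + o) c
  S  = ∑ (n + o) (λ i → suc i * c i)
  X  = ∑ o (λ j → c (n + j))
  XS = ∑ o (λ j → suc j * c (n + j))
  C₀ = ∑ n₁ c

  ĉ y : ℕ → ℕ
  ĉ j = c (n₁ ∸ suc j)
  y j = m ∸ ĉ j
  Y  = ∑ n₁ y
  YS = ∑ n₁ (λ j → suc j * y j)

  N'-split : N' ≡ C₀ + c n₁ + X
  N'-split = trans (∑-split n o c) (cong (_+ X) (∑-last n₁ c))

  C₀+Y : C₀ + Y ≡ n₁ * m
  C₀+Y = trans (cong (_+ Y) (sym (∑-reverse n₁ c))) (trans (sym (∑-+ n₁ ĉ y)) (trans (∑-cong n₁ (λ j → m+[n∸m]≡n (c≤m (n₁ ∸ suc j)))) (∑-const n₁ m)))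

  S-split : S ≡ ∑ n₁ (λ i → suc i * c i) + n * c n₁ + (n * X + XS)
  S-split = trans (∑-split n o (λ i → suc i * c i)) (cong₂ _+_ (∑-last n₁ (λ i → suc i * c i))
    (trans (∑-cong o (λ j → e n j (c (n + j)))) (trans (∑-+ o (λ j → n * c (n + j)) (λ j → suc j * c (n + j))) (cong (_+ XS) (∑-*ˡ o n (λ j → c (n + j)))))))
    where
    e : ∀ n j c → suc (n + j) * c ≡ n * c + suc j * c
    e = solveℕ

  low-part : ∑ n₁ (λ i → suc i * c i) + m * tri n₁ ≡ n * C₀ + YS
  low-part = begin
    ∑ n₁ (λ i → suc i * c i) + m * tri n₁                           ≡⟨ cong₂ _+_ (sym (∑-reverse n₁ (λ i → suc i * c i))) (trans (cong (m *_) (sym (∑-tri n₁))) (sym (∑-*ˡ n₁ m suc))) ⟩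
    ∑ n₁ (λ j → suc (n₁ ∸ suc j) * ĉ j) + ∑ n₁ (λ j → m * suc j)    ≡⟨ ∑-+ n₁ (λ j → suc (n₁ ∸ suc j) * ĉ j) (λ j → m * suc j) ⟨
    ∑ n₁ (λ j → suc (n₁ ∸ suc j) * ĉ j + m * suc j)                 ≡⟨ ∑-cong< n₁ pw ⟩
    ∑ n₁ (λ j → n * ĉ j + suc j * y j)                              ≡⟨ ∑-+ n₁ (λ j → n * ĉ j) (λ j → suc j * y j) ⟩
    ∑ n₁ (λ j → n * ĉ j) + YS                                       ≡⟨ cong (_+ YS) (trans (∑-*ˡ n₁ n ĉ) (cong (n *_) (∑-reverse n₁ c))) ⟩
    n * C₀ + YS                                                     ∎
    where
    open ≡-Reasoning
    e : ∀ i j x y → suc i * x + (x + y) * suc j ≡ suc (i + suc j) * x + suc j * y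
    e = solveℕ
    pw : ∀ j → j < n₁ → suc (n₁ ∸ suc j) * ĉ j + m * suc j ≡ n * ĉ j + suc j * y j
    pw j j< = trans (cong (λ w → suc (n₁ ∸ suc j) * ĉ j + w * suc j) (sym (m+[n∸m]≡n (c≤m (n₁ ∸ suc j)))))
      (trans (e (n₁ ∸ suc j) j (ĉ j) (y j)) (cong (λ w → suc w * ĉ j + suc j * y j) (m∸n+n≡m j<)))

  -- Every weight is written as `n` plus a signed distance. The elements below `n` contribute minus
  -- the distances of a full triangle, `m * tri n₁`, plus those of the vacant places.
  balance : S + m * tri n₁ ≡ n * N' + XS + YS
  balance = begin
    S + m * tri n₁                                                          ≡⟨ cong (_+ m * tri n₁) S-split ⟩
    ∑ n₁ (λ i → suc i * c i) + n * c n₁ + (n * X + XS) + m * tri n₁         ≡⟨ e1 (∑ n₁ (λ i → suc i * c i)) (n * c n₁) (n * X) XS (m * tri n₁) ⟩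
    ∑ n₁ (λ i → suc i * c i) + m * tri n₁ + n * c n₁ + (n * X + XS)         ≡⟨ cong (λ w → w + n * c n₁ + (n * X + XS)) low-part ⟩
    n * C₀ + YS + n * c n₁ + (n * X + XS)                                   ≡⟨ e2 n C₀ YS (c n₁) X XS ⟩
    n * (C₀ + c n₁ + X) + XS + YS                                           ≡⟨ cong (λ w → n * w + XS + YS) N'-split ⟨
    n * N' + XS + YS                                                        ∎
    where
    open ≡-Reasoning
    e1 : ∀ a b c d t → a + b + (c + d) + t ≡ a + t + b + (c + d)
    e1 = solveℕ
    e2 : ∀ n a ys b x xs → n * a + ys + n * b + (n * x + xs) ≡ n * (a + b + x) + xs + ys
    e2 = solveℕ

  slack : XS + YS ≤ n * suc E'
  slack = +-cancelˡ-≤ (n * N') _ _ (begin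
    n * N' + (XS + YS)                                    ≡⟨ +-assoc (n * N') XS YS ⟨
    n * N' + XS + YS                                      ≡⟨ balance ⟨
    S + m * tri n₁                                        ≤⟨ +-monoˡ-≤ (m * tri n₁) (≤-trans (<⇒≤ S<p) p≤) ⟩
    m * tri n₁ + suc k * n + m * tri n₁                   ≡⟨ e1 m (tri n₁) k n ⟩
    m * (2 * tri n₁) + suc k * n                          ≡⟨ cong (λ w → m * w + suc k * n) (tri-double n₁) ⟩
    m * (n₁ * n) + suc k * n                              ≡⟨ e2 m n₁ k n ⟩
    n * suc (m * n₁ + k)                                  ≤⟨ *-monoʳ-≤ n (s≤s low) ⟩
    n * suc (N' + E')                                     ≡⟨ e3 n N' E' ⟩
    n * N' + n * suc E'                                   ∎)
    where
    open ≤-Reasoning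
    e1 : ∀ m t k n → m * t + suc k * n + m * t ≡ m * (2 * t) + suc k * n
    e1 = solveℕ
    e2 : ∀ m n₁ k n → m * (n₁ * n) + suc k * n ≡ n * suc (m * n₁ + k)
    e2 = solveℕ
    e3 : ∀ n a e → n * suc (a + e) ≡ n * a + n * suc e
    e3 = solveℕ

  X² : X * X ≤ 2 * (m * (n * suc E'))
  X² = ≤-trans (crowd² o m (λ j → c (n + j)) (λ j → c≤m (n + j))) (*-monoʳ-≤ 2 (*-monoʳ-≤ m (≤-trans (m≤m+n XS YS) slack)))

  Y² : Y * Y ≤ 2 * (m * (n * suc E'))
  Y² = ≤-trans (crowd² n₁ m y (λ j → m∸n≤m m (ĉ j))) (*-monoʳ-≤ 2 (*-monoʳ-≤ m (≤-trans (m≤n+m YS XS) slack)))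

  top : c n₁ ≤ k + (E + Y)
  top = +-cancelˡ-≤ (n₁ * m) _ _ (begin
    n₁ * m + c n₁             ≡⟨ cong (_+ c n₁) C₀+Y ⟨
    C₀ + Y + c n₁             ≤⟨ m≤m+n _ X ⟩
    C₀ + Y + c n₁ + X         ≡⟨ e1 C₀ Y (c n₁) X ⟩
    C₀ + c n₁ + X + Y         ≡⟨ cong (_+ Y) N'-split ⟨
    N' + Y                    ≤⟨ +-monoˡ-≤ Y high ⟩
    m * n₁ + k + E + Y        ≡⟨ e2 m n₁ k E Y ⟩
    n₁ * m + (k + (E + Y))    ∎)
    where
    open ≤-Reasoning
    e1 : ∀ a b c d → a + b + c + d ≡ a + c + d + b
    e1 = solveℕ
    e2 : ∀ m n k e y → m * n + k + e + y ≡ n * m + (k + (e + y))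
    e2 = solveℕ

  excess : ∀ (a : ℕ → ℕ) → (∀ i → i < n₁ → a i ≡ m) → a n₁ ≡ k → ∑ (n + o) (λ i → c i ∸ a i) ≤ E + Y + X
  excess a a< a≡ = begin
    ∑ (n + o) (λ i → c i ∸ a i)                                                       ≡⟨ trans (∑-split n o (λ i → c i ∸ a i)) (cong (_+ ∑ o (λ j → c (n + j) ∸ a (n + j))) (∑-last n₁ (λ i → c i ∸ a i))) ⟩
    ∑ n₁ (λ i → c i ∸ a i) + (c n₁ ∸ a n₁) + ∑ o (λ j → c (n + j) ∸ a (n + j))        ≤⟨ +-mono-≤ (+-mono-≤ (≤-reflexive (trans (∑-cong< n₁ (λ i i< → m≤n⇒m∸n≡0 (≤-trans (c≤m i) (≤-reflexive (sym (a< i i<)))))) (∑-0 n₁))) (≤-trans (∸-mono top (≤-reflexive (sym a≡))) (≤-reflexive (m+n∸m≡n k (E + Y))))) (∑-mono o (λ j → m∸n≤m (c (n + j)) (a (n + j)))) ⟩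
    0 + (E + Y) + X                                                                   ∎
    where open ≤-Reasoning

-- Histograms of weights

hist : ∀ L w → w ≤ L → ∑ L (λ i → suc i * ι ⌊ w ≟ suc i ⌋) ≡ w
hist zero    zero    _ = refl
hist (suc L) w w≤ with m≤n⇒m<n∨m≡n w≤
... | inj₁ (s≤s l) = trans (∑-last L _) (trans (cong₂ _+_ (hist L w l) (trans (cong (suc L *_) (ι-no (w ≟ suc L) (<⇒≢ (s≤s l)))) (*-zeroʳ (suc L)))) (+-identityʳ w))
... | inj₂ refl = trans (∑-last L _) (cong₂ _+_ (trans (∑-cong< L (λ i i< → trans (cong (suc i *_) (ι-no (suc L ≟ suc i) (λ e → <-irrefl (sym (suc-injective e)) i<))) (*-zeroʳ (suc i)))) (∑-0 L))
    (trans (cong (suc L *_) (ι-yes (suc L ≟ suc L) refl)) (*-identityʳ (suc L))))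

hist₁ : ∀ L w → w ≤ L → ∑ L (λ i → ι ⌊ w ≟ suc i ⌋) ≡ ι ⌊ 1 ≤? w ⌋
hist₁ zero    zero    _ = refl
hist₁ (suc L) w w≤ with m≤n⇒m<n∨m≡n w≤
... | inj₁ (s≤s l) = trans (∑-last L _) (trans (cong₂ _+_ (hist₁ L w l) (ι-no (w ≟ suc L) (<⇒≢ (s≤s l)))) (+-identityʳ _))
... | inj₂ refl = trans (∑-last L _) (cong₂ _+_ (trans (∑-cong< L (λ i i< → ι-no (suc L ≟ suc i) (λ e → <-irrefl (sym (suc-injective e)) i<))) (∑-0 L)) (ι-yes (suc L ≟ suc L) refl))

module _ {X : Set} (w : X → ℕ) (L : ℕ) where
  histogram : List X → ℕ → ℕ
  histogram xs i = # (λ x → ⌊ w x ≟ suc i ⌋) xs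

  histogram-sum : ∀ {xs} → All (λ x → w x ≤ L) xs → ∑ L (λ i → suc i * histogram xs i) ≡ ∑ᴸ w xs
  histogram-sum {[]}     []       = trans (∑-cong L (λ i → *-zeroʳ (suc i))) (∑-0 L)
  histogram-sum {x ∷ xs} (l ∷ ls) = trans (∑-cong L (λ i → *-distribˡ-+ (suc i) (ι ⌊ w x ≟ suc i ⌋) (histogram xs i)))
    (trans (∑-+ L (λ i → suc i * ι ⌊ w x ≟ suc i ⌋) (λ i → suc i * histogram xs i)) (cong₂ _+_ (hist L (w x) l) (histogram-sum ls)))

  histogram-count : ∀ {xs} → All (λ x → w x ≤ L) xs → ∑ L (histogram xs) ≡ # (λ x → ⌊ 1 ≤? w x ⌋) xs
  histogram-count {[]}     []       = ∑-0 L
  histogram-count {x ∷ xs} (l ∷ ls) = trans (∑-+ L (λ i → ι ⌊ w x ≟ suc i ⌋) (histogram xs)) (cong₂ _+_ (hist₁ L (w x) l) (histogram-count ls))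

#-all : ∀ {X : Set} (P : X → Bool) {xs} → All (λ x → P x ≡ true) xs → # P xs ≡ length xs
#-all P []       = refl
#-all P (a ∷ as) = cong₂ _+_ (cong ι a) (#-all P as)

-- Growing intervals of subset sums, and elementary estimates

negpart : ℤ → ℕ
negpart (pos n)  = 0
negpart -[1+ n ] = suc n

pospart : ℤ → ℕ
pospart (pos n)  = n
pospart -[1+ n ] = 0

parts : ∀ z → negpart z + pospart z ≡ ∣ z ∣
parts (pos n)  = refl
parts -[1+ n ] = +-identityʳ (suc n)

member≤∑ᴸ : ∀ {X : Set} (w : X → ℕ) xs → All (λ x → w x ≤ ∑ᴸ w xs) xs
member≤∑ᴸ w []       = []
member≤∑ᴸ w (x ∷ xs) = m≤m+n (w x) _ ∷ AllL.map (λ l → ≤-trans l (m≤n+m _ (w x))) (member≤∑ᴸ w xs)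

Covers : List ℤ → ℤ → ℕ → Set
Covers F u ℓ = ∀ i → i ≤ ℓ → SS F (u +ᶻ pos i)

-- Since `∣ r ∣ ≤ suc ℓ`, the interval and its translate by `r` leave no gap. A negative `r` moves
-- the left end, whence the correction of `u`. The bound may refer to the initial `ℓ` for all of
-- `rs`, because the interval only grows.
covers-extend : ∀ rs {F ℓ u} → Covers F u ℓ → All (λ r → ∣ r ∣ ≤ suc ℓ) rs → Covers (rs ++ F) (u -ᶻ pos (∑ᴸ negpart rs)) (ℓ + ∑ᴸ ∣_∣ rs)
covers-extend [] {u = u} cv [] i i≤ = SS-≡ (cong (_+ᶻ pos i) (sym (ℤP.+-identityʳ u))) (cv i (≤-trans i≤ (≤-reflexive (+-identityʳ _))))
covers-extend (r ∷ rs) {F} {ℓ} {u} cv (l ∷ ls) = go r l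
  where
  s = ∑ᴸ ∣_∣ rs
  M = ∑ᴸ negpart rs
  cv' : Covers (rs ++ F) (u -ᶻ pos M) (ℓ + s)
  cv' = covers-extend rs {F} {ℓ} {u} cv ls
  e1 : ∀ n u o → n +ᶻ (u +ᶻ o) ≡ u +ᶻ (n +ᶻ o)
  e1 = solveℤ
  e2 : ∀ u M n o → u -ᶻ M +ᶻ o ≡ u -ᶻ (n +ᶻ M) +ᶻ (n +ᶻ o)
  e2 = solveℤ
  e3 : ∀ u M n i → -ᶻ n +ᶻ (u -ᶻ M +ᶻ i) ≡ u -ᶻ (n +ᶻ M) +ᶻ i
  e3 = solveℤ
  f : ∀ ℓ n s → ℓ + (n + s) ≡ n + (ℓ + s)
  f = solveℕ
  go : ∀ r → ∣ r ∣ ≤ suc ℓ → Covers (r ∷ rs ++ F) (u -ᶻ pos (negpart r + M)) (ℓ + (∣ r ∣ + s))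
  go (pos n) l i i≤ with i ≤? ℓ + s
  ... | yes le = skip (cv' i le)
  ... | no nle with m≤n⇒∃[o]m+o≡n (≤-trans l (≤-trans (s≤s (m≤m+n ℓ s)) (≰⇒> nle)))
  ...   | o , refl = SS-≡ (e1 (pos n) (u -ᶻ pos M) (pos o)) (take (cv' o (+-cancelˡ-≤ n _ _ (≤-trans i≤ (≤-reflexive (f ℓ n s))))))
  go -[1+ n ] l i i≤ with suc n ≤? i
  ... | yes le with m≤n⇒∃[o]m+o≡n le
  ...   | o , refl = SS-≡ (e2 u (pos M) (pos (suc n)) (pos o)) (skip (cv' o (+-cancelˡ-≤ (suc n) _ _ (≤-trans i≤ (≤-reflexive (f ℓ (suc n) s))))))
  go -[1+ n ] l i i≤ | no nle = SS-≡ (e3 u (pos M) (pos (suc n)) (pos i)) (take (cv' i (≤-trans (≤-pred (≤-trans (≰⇒> nle) l)) (m≤m+n ℓ s))))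

SS-bound : ∀ {W F v} → All (λ r → ∣ r ∣ ≤ W) F → SS F v → ∣ v ∣ ≤ length F * W
SS-bound [] [] = z≤n
SS-bound {W} (l ∷ ls) (skip s) = ≤-trans (SS-bound ls s) (m≤n+m _ W)
SS-bound (l ∷ ls) (take {z} {v = v} s) = ≤-trans (ℤP.∣i+j∣≤∣i∣+∣j∣ z v) (+-mono-≤ l (SS-bound ls s))

isqrt : ∀ W → ∃[ h ] (h * h ≤ W × W < suc h * suc h)
isqrt zero = 0 , z≤n , s≤s z≤n
isqrt (suc W) with isqrt W
... | h , a , b with suc h * suc h ≤? suc W
...   | yes c = suc h , c , ≤-trans (s≤s b) (≤-trans (≤-reflexive (e h)) (≤-trans (m≤m+n (suc h * suc h + 1) (2 * h + 2)) (≤-reflexive (e' h))))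
  where
  e : ∀ h → suc (suc h * suc h) ≡ suc h * suc h + 1
  e = solveℕ
  e' : ∀ h → suc h * suc h + 1 + (2 * h + 2) ≡ suc (suc h) * suc (suc h)
  e' = solveℕ
...   | no nc = h , ≤-trans a (n≤1+n W) , ≰⇒> nc

sq-cancel : ∀ {a b} → a * a ≤ b * b → a ≤ b
sq-cancel {a} {b} l with a ≤? b
... | yes q = q
... | no nq = contradiction l (<⇒≱ (*-mono-< (≰⇒> nq) (≰⇒> nq)))

two-sq : ∀ a b → (a + b) * (a + b) ≤ 2 * (a * a + b * b)
two-sq a b with ≤-total a b
... | inj₁ l with m≤n⇒∃[o]m+o≡n l
...   | o , refl = ≤-trans (m≤m+n _ (o * o)) (≤-reflexive (e a o))
  where
  e : ∀ a o → (a + (a + o)) * (a + (a + o)) + o * o ≡ 2 * (a * a + (a + o) * (a + o))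
  e = solveℕ
two-sq a b | inj₂ l with m≤n⇒∃[o]m+o≡n l
...   | o , refl = ≤-trans (m≤m+n _ (o * o)) (≤-reflexive (e b o))
  where
  e : ∀ b o → (b + o + b) * (b + o + b) + o * o ≡ 2 * ((b + o) * (b + o) + b * b)
  e = solveℕ

four-sq : ∀ {x a b c d e} → x ≤ (a + b) + (c + d) → a * a ≤ e → b * b ≤ e → c * c ≤ e → d * d ≤ e → x * x ≤ 16 * e
four-sq {x} {a} {b} {c} {d} {e} l la lb lc ld = begin
  x * x                                                ≤⟨ *-mono-≤ l l ⟩
  (a + b + (c + d)) * (a + b + (c + d))                ≤⟨ two-sq (a + b) (c + d) ⟩
  2 * ((a + b) * (a + b) + (c + d) * (c + d))          ≤⟨ *-monoʳ-≤ 2 (+-mono-≤ (≤-trans (two-sq a b) (*-monoʳ-≤ 2 (+-mono-≤ la lb))) (≤-trans (two-sq c d) (*-monoʳ-≤ 2 (+-mono-≤ lc ld)))) ⟩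
  2 * (2 * (e + e) + 2 * (e + e))                      ≡⟨ q e ⟩
  16 * e                                               ∎
  where
  open ≤-Reasoning
  q : ∀ e → 2 * (2 * (e + e) + 2 * (e + e)) ≡ 16 * e
  q = solveℕ

n<2^n : ∀ n → n < 2 ^ n
n<2^n zero    = s≤s z≤n
n<2^n (suc n) = ≤-trans (+-mono-≤ (≤-trans (s≤s z≤n) (n<2^n n)) (n<2^n n)) (≤-reflexive (cong (2 ^ n +_) (sym (+-identityʳ (2 ^ n)))))

-- Bundled constants and thresholds

-- Only these inequalities between the constants are visible later, not their values. The factor 2
-- before `τ` in `intervals` accounts for the exceptional elements: at least half of the sequence
-- consists of small integers.
record Toolbox (y : ℕ) : Set where
  field
    Q κ τ C K N₁ : ℕ
    1≤Q : 1 ≤ Q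
    1≤τ : 1 ≤ τ
    Q!κ≤τ : Q ! * κ ≤ τ
    parameters : ∀ N p m → N₁ ≤ N → 1 ≤ m → p * m ≤ 4 * (N * N) → m ≤ 2 * N → N ≤ 2 * p → Parameters y Q κ N p m {{>-nonZero 1≤Q}}
    intervals : ∀ {W m h R} → Box W m R → 1 ≤ m → 1 ≤ W → m * W ≤ 2 * τ * length R → h * h ≤ W → W < suc h * suc h → 2 * (K * suc h) ≤ length R →
      (∀ g → 2 ≤ g → g ≤ C → K * suc h + C * C < # (nondiv g) R) → ∃[ F ] ∃[ R' ] (R ↭ F ++ R' × AP F 1 W × length F ≤ K * suc h)

toolbox : ∀ y → 8 ≤ y → Toolbox y
toolbox y 8≤y = record
  { Q = Con.Q ; κ = Con.κ * (2 + 16 * y) ; τ = τ₁ ; C = Int.C ; K = Int.K ; N₁ = Con.N₀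
  ; 1≤Q = >-nonZero⁻¹' Con.Q {{Con.Q≢0}} ; 1≤τ = s≤s z≤n ; Q!κ≤τ = n≤1+n _
  ; parameters = λ N p m a b c d e → Con.Bounds.parameters N p m a b c d e
  ; intervals = λ bx a b c d e f g → Int.interval-sums bx a b c d e f g }
  where
  module Con = Constants y 8≤y
  τ₁ : ℕ
  τ₁ = suc (Con.Q ! * (Con.κ * (2 + 16 * y)))
  module Int = Interval (2 * τ₁) (s≤s z≤n)
  >-nonZero⁻¹' : ∀ n .{{_ : NonZero n}} → 1 ≤ n
  >-nonZero⁻¹' (suc n) = s≤s z≤n

module Scale (y : ℕ) (100≤y : 100 ≤ y) (T : Toolbox y) where
  open Toolbox T public

  f Df a N₀ : ℕ
  -- `f` bounds the number of divisions by common factors: each at least halves the bound `W`, and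
  -- `4 * τ < 2 ^ f`. Every division may lose `N / Df` elements, hence all of them at most `N / y`.
  f  = 4 * τ
  Df = y * f
  a  = Df * (K + C * C + 1)
  N₀ = N₁ + 4 * τ * (a * a)

  instance
    y≢0 : NonZero y
    y≢0 = >-nonZero (≤-trans (s≤s z≤n) 100≤y)
    τ≢0 : NonZero τ
    τ≢0 = >-nonZero 1≤τ
    f≢0 : NonZero f
    f≢0 = m*n≢0 4 τ
    Df≢0 : NonZero Df
    Df≢0 = m*n≢0 y f

  module Large (N : ℕ) (N₀≤N : N₀ ≤ N) where
    t : ℕ
    t = N / Df

    instance
      K+≢0 : NonZero (K + C * C + 1)
      K+≢0 = >-nonZero (m≤n+m 1 (K + C * C))
      a≢0 : NonZero a
      a≢0 = m*n≢0 Df (K + C * C + 1)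

    4τaa≤N : 4 * τ * (a * a) ≤ N
    4τaa≤N = ≤-trans (m≤n+m _ N₁) N₀≤N

    1≤N : 1 ≤ N
    1≤N = ≤-trans (*-mono-≤ {1} {4 * τ} {1} (nz f) (*-mono-≤ {1} {a} {1} (nz a) (nz a))) 4τaa≤N
      where
      nz : ∀ n .{{_ : NonZero n}} → 1 ≤ n
      nz (suc n) = s≤s z≤n

    t-small : y * (f * t) ≤ N
    t-small = ≤-trans (≤-reflexive (trans (sym (*-assoc y f t)) (*-comm Df t))) (m/n*n≤m N Df)

    -- The left side is of order at most the square root of `N` while `t` is linear in `N`; squaring
    -- reduces the comparison to `4τaa≤N`.
    t-large : ∀ h → h * h ≤ τ * N → K * suc h + C * C + 1 ≤ t
    t-large h hh≤ = ≤-trans (≤-reflexive (sym (m*n/n≡m (K * suc h + C * C + 1) Df))) (/-monoˡ-≤ Df (≤-trans step (sq-cancel (begin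
      a * suc h * (a * suc h)                 ≡⟨ e1 a (suc h) ⟩
      a * a * (suc h * suc h)                 ≤⟨ *-monoʳ-≤ (a * a) (≤-trans (≤-reflexive (cong (λ w → w * w) (+-comm 1 h))) (two-sq h 1)) ⟩
      a * a * (2 * (h * h + 1))               ≤⟨ *-monoʳ-≤ (a * a) (*-monoʳ-≤ 2 (+-mono-≤ hh≤ (*-mono-≤ {1} {τ} {1} 1≤τ 1≤N))) ⟩
      a * a * (2 * (τ * N + τ * N))           ≡⟨ e2 (a * a) τ N ⟩
      4 * τ * (a * a) * N                     ≤⟨ *-monoˡ-≤ N 4τaa≤N ⟩
      N * N                                   ∎))))
      where
      open ≤-Reasoning
      e1 : ∀ a h → a * h * (a * h) ≡ a * a * (h * h)
      e1 = solveℕ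
      e2 : ∀ a t n → a * (2 * (t * n + t * n)) ≡ 4 * t * a * n
      e2 = solveℕ
      e3 : ∀ k c h d → (k * (1 + h) + c + 1) * d + h * d * (c + 1) ≡ d * (k + c + 1) * (1 + h)
      e3 = solveℕ
      step : (K * suc h + C * C + 1) * Df ≤ a * suc h
      step = ≤-trans (m≤m+n _ (h * Df * (C * C + 1))) (≤-reflexive (e3 K (C * C) h Df))

-- Fractional exponents, cleared of denominators

^-*-distrib : ∀ m n o → (m * n) ^ o ≡ m ^ o * n ^ o
^-*-distrib m n zero    = refl
^-*-distrib m n (suc o) = trans (cong (m * n *_) (^-*-distrib m n o)) (e m n (m ^ o) (n ^ o))
  where
  e : ∀ a b c d → a * b * (c * d) ≡ a * c * (b * d)
  e = solveℕ

^-cancel-≤ : ∀ q .{{_ : NonZero q}} {a b} → a ^ q ≤ b ^ q → a ≤ b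
^-cancel-≤ q {a} {b} l with a ≤? b
... | yes h = h
... | no nh = contradiction l (<⇒≱ (^-monoˡ-< q (≰⇒> nh)))

sq≡^2 : ∀ x → x * x ≡ x ^ 2
sq≡^2 x = cong (x *_) (sym (*-identityʳ x))

^-double : ∀ x q → x ^ (2 * q) ≡ (x * x) ^ q
^-double x q = trans (sym (^-*-assoc x 2 q)) (cong (_^ q) (sym (sq≡^2 x)))

^-double' : ∀ x q → x ^ (2 * q) ≡ x ^ q * x ^ q
^-double' x q = trans (^-double x q) (^-*-distrib x x q)

1≤^ : ∀ x n → 1 ≤ x → 1 ≤ x ^ n
1≤^ x n l = m^n>0 x {{>-nonZero l}} n

-- ε := E / N is small once p m is large: C (p m)^{a/q} is eventually below any multiple of (p m)^{1/2}.
deviation-small : ∀ q a C c E x → 2 * a < q → 1 ≤ x → E ^ q ≤ C ^ q * x ^ a → (c * C) ^ (2 * q) ≤ x → (c * E) * (c * E) ≤ x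
deviation-small q a C c E x 2a<q 1≤x E≤ big = ^-cancel-≤ q {{>-nonZero (≤-trans (s≤s z≤n) 2a<q)}} (begin
  ((c * E) * (c * E)) ^ q                              ≡⟨ trans (^-*-distrib (c * E) (c * E) q) (cong₂ _*_ (^-*-distrib c E q) (^-*-distrib c E q)) ⟩
  (c ^ q * E ^ q) * (c ^ q * E ^ q)                    ≤⟨ *-mono-≤ (*-monoʳ-≤ (c ^ q) E≤) (*-monoʳ-≤ (c ^ q) E≤) ⟩
  (c ^ q * (C ^ q * x ^ a)) * (c ^ q * (C ^ q * x ^ a)) ≡⟨ e (c ^ q) (C ^ q) (x ^ a) ⟩
  (c ^ q * C ^ q) * (c ^ q * C ^ q) * (x ^ a * x ^ a)  ≡⟨ cong₂ _*_ (trans (cong₂ _*_ (sym (^-*-distrib c C q)) (sym (^-*-distrib c C q))) (sym (^-double' (c * C) q))) (sym (^-double' x a)) ⟩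
  (c * C) ^ (2 * q) * x ^ (2 * a)                      ≤⟨ *-monoˡ-≤ (x ^ (2 * a)) big ⟩
  x ^ suc (2 * a)                                      ≤⟨ ^-monoʳ-≤ x {{>-nonZero 1≤x}} 2a<q ⟩
  x ^ q                                                ∎)
  where
  open ≤-Reasoning
  e : ∀ c C x → (c * (C * x)) * (c * (C * x)) ≡ (c * C) * (c * C) * (x * x)
  e = solveℕ

module Sizes (q a C τ K : ℕ) (6q<13a : 6 * q < 13 * a) (2a<q : 2 * a < q) (1≤τ : 1 ≤ τ) where

  q≤4a : q ≤ 4 * a
  q≤4a = *-cancelˡ-≤ 6 (≤-trans (<⇒≤ 6q<13a) (≤-trans (*-monoˡ-≤ a (≤ᵇ⇒≤ 13 24 _)) (≤-reflexive (*-assoc 6 4 a))))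

  instance
    q≢0 : NonZero q
    q≢0 = >-nonZero (≤-trans (s≤s z≤n) 2a<q)

  c₁ M D₀ : ℕ
  c₁ = 16 * (8 + 2 * τ)
  M  = 2 * (C + suc (suc K) * (128 * (τ * τ)))
  D₀ = 8 * c₁ * M

  1≤M : 1 ≤ M
  1≤M = *-mono-≤ {1} {2} {1} (s≤s z≤n) (≤-trans (*-mono-≤ {1} {suc (suc K)} {1} (s≤s z≤n) (*-mono-≤ {1} {128} {1} (s≤s z≤n) (*-mono-≤ {1} {τ} {1} 1≤τ 1≤τ))) (m≤n+m _ C))

  1≤D₀ : 1 ≤ D₀
  1≤D₀ = *-mono-≤ {1} {8 * c₁} {1} (s≤s z≤n) 1≤M

  -- Here `x` is `p m`. The root `h` is at most of order N^{1/2}, that is x^{1/4}, and `q ≤ 4 a`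
  -- says that α = a / q is at least 1/4. Fourth powers keep the argument integral.
  root-bound : ∀ {h N x m} → 1 ≤ m → 1 ≤ x → m * (h * h) ≤ τ * N → N * N ≤ 8 * x → suc h ^ q ≤ (128 * (τ * τ)) ^ q * x ^ a
  root-bound {h} {N} {x} {m} 1≤m 1≤x mhh NN≤ = ^-cancel-≤ 4 (begin
    (suc h ^ q) ^ 4                                  ≡⟨ trans (^-*-assoc (suc h) q 4) (trans (cong (suc h ^_) (*-comm q 4)) (sym (^-*-assoc (suc h) 4 q))) ⟩
    (suc h ^ 4) ^ q                                  ≤⟨ ^-monoˡ-≤ q four ⟩
    (128 * (τ * τ) * x) ^ q                          ≡⟨ ^-*-distrib (128 * (τ * τ)) x q ⟩
    u * x ^ q                                        ≤⟨ *-mono-≤ (≤-trans (≤-reflexive (sym (^-identityʳ u))) (^-monoʳ-≤ u {{>-nonZero 1≤u}} {1} {4} (s≤s z≤n))) (≤-trans (^-monoʳ-≤ x {{>-nonZero 1≤x}} q≤4a) (≤-reflexive (trans (cong (x ^_) (*-comm 4 a)) (sym (^-*-assoc x a 4))))) ⟩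
    u ^ 4 * (x ^ a) ^ 4                              ≡⟨ ^-*-distrib u (x ^ a) 4 ⟨
    (u * x ^ a) ^ 4                                  ∎)
    where
    open ≤-Reasoning
    u = (128 * (τ * τ)) ^ q
    1≤u : 1 ≤ u
    1≤u = 1≤^ (128 * (τ * τ)) q (*-mono-≤ {1} {128} {1} (s≤s z≤n) (*-mono-≤ {1} {τ} {1} 1≤τ 1≤τ))
    e1 : ∀ h → suc h * (suc h * (suc h * (suc h * 1))) ≡ (suc h * suc h) * (suc h * suc h)
    e1 = solveℕ
    e2 : ∀ w → 2 * (w + w) * (2 * (w + w)) ≡ 16 * (w * w)
    e2 = solveℕ
    e3 : ∀ t n → t * n * (t * n) ≡ t * t * (n * n)
    e3 = solveℕ
    e4 : ∀ t x → 16 * (t * (8 * x)) ≡ 128 * t * x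
    e4 = solveℕ
    hh≤ : h * h ≤ τ * N
    hh≤ = ≤-trans (≤-trans (≤-reflexive (sym (*-identityˡ (h * h)))) (*-monoˡ-≤ (h * h) 1≤m)) mhh
    pos-case : 1 ≤ N → (suc h * suc h) * (suc h * suc h) ≤ 128 * (τ * τ) * x
    pos-case 1≤N = begin
      (suc h * suc h) * (suc h * suc h)                ≤⟨ *-mono-≤ half half ⟩
      2 * (τ * N + τ * N) * (2 * (τ * N + τ * N))      ≡⟨ e2 (τ * N) ⟩
      16 * (τ * N * (τ * N))                           ≡⟨ cong (16 *_) (e3 τ N) ⟩
      16 * (τ * τ * (N * N))                           ≤⟨ *-monoʳ-≤ 16 (*-monoʳ-≤ (τ * τ) NN≤) ⟩
      16 * (τ * τ * (8 * x))                           ≡⟨ e4 (τ * τ) x ⟩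
      128 * (τ * τ) * x                                ∎
      where
      half : suc h * suc h ≤ 2 * (τ * N + τ * N)
      half = ≤-trans (≤-reflexive (cong (λ w → w * w) (+-comm 1 h))) (≤-trans (two-sq h 1) (*-monoʳ-≤ 2 (+-mono-≤ hh≤ (*-mono-≤ {1} {τ} {1} 1≤τ 1≤N))))
    zero-case : N ≡ 0 → (suc h * suc h) * (suc h * suc h) ≤ 128 * (τ * τ) * x
    zero-case z = subst (λ h → (suc h * suc h) * (suc h * suc h) ≤ 128 * (τ * τ) * x) (sym (h0 h (≤-trans hh≤ (≤-reflexive (trans (cong (τ *_) z) (*-zeroʳ τ))))))
      (*-mono-≤ {1} {128 * (τ * τ)} {1} (*-mono-≤ {1} {128} {1} (s≤s z≤n) (*-mono-≤ {1} {τ} {1} 1≤τ 1≤τ)) 1≤x)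
      where
      h0 : ∀ h → h * h ≤ 0 → h ≡ 0
      h0 zero _ = refl
    four : suc h ^ 4 ≤ 128 * (τ * τ) * x
    four with N ≟ 0
    ... | no nz = ≤-trans (≤-reflexive (e1 h)) (pos-case (n≢0⇒n>0 nz))
    ... | yes z = ≤-trans (≤-reflexive (e1 h)) (zero-case z)

  e₀-bound : ∀ {E h N x m} → 1 ≤ m → 1 ≤ x → E ^ q ≤ C ^ q * x ^ a → m * (h * h) ≤ τ * N → N * N ≤ 8 * x → (E + K * suc h + 2) ^ q ≤ M ^ q * x ^ a
  e₀-bound {E} {h} {N} {x} {m} 1≤m 1≤x E≤ mhh NN≤ = begin
    (E + K * suc h + 2) ^ q                 ≤⟨ ^-monoˡ-≤ q le ⟩
    (E + w) ^ q                             ≤⟨ sum-bound (≤-total E w) ⟩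
    (2 ^ q) * ((C + V) ^ q * x ^ a)         ≡⟨ *-assoc (2 ^ q) ((C + V) ^ q) (x ^ a) ⟨
    2 ^ q * (C + V) ^ q * x ^ a             ≡⟨ cong (_* x ^ a) (^-*-distrib 2 (C + V) q) ⟨
    M ^ q * x ^ a                           ∎
    where
    open ≤-Reasoning
    w = suc (suc K) * suc h
    V = suc (suc K) * (128 * (τ * τ))
    r : ∀ E K h → (E + K * suc h + 2) + 2 * h ≡ E + suc (suc K) * suc h
    r = solveℕ
    le : E + K * suc h + 2 ≤ E + w
    le = ≤-trans (m≤m+n _ (2 * h)) (≤-reflexive (r E K h))
    dbl : ∀ x → x + x ≡ 2 * x
    dbl = solveℕ
    w^≤ : w ^ q ≤ (C + V) ^ q * x ^ a
    w^≤ = begin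
      w ^ q                                                  ≡⟨ ^-*-distrib (suc (suc K)) (suc h) q ⟩
      suc (suc K) ^ q * suc h ^ q                            ≤⟨ *-monoʳ-≤ (suc (suc K) ^ q) (root-bound {h} {N} {x} {m} 1≤m 1≤x mhh NN≤) ⟩
      suc (suc K) ^ q * ((128 * (τ * τ)) ^ q * x ^ a)        ≡⟨ *-assoc (suc (suc K) ^ q) ((128 * (τ * τ)) ^ q) (x ^ a) ⟨
      suc (suc K) ^ q * (128 * (τ * τ)) ^ q * x ^ a          ≡⟨ cong (_* x ^ a) (^-*-distrib (suc (suc K)) (128 * (τ * τ)) q) ⟨
      V ^ q * x ^ a                                          ≤⟨ *-monoˡ-≤ (x ^ a) (^-monoˡ-≤ q (m≤n+m V C)) ⟩
      (C + V) ^ q * x ^ a                                    ∎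
    E^≤ : E ^ q ≤ (C + V) ^ q * x ^ a
    E^≤ = ≤-trans E≤ (*-monoˡ-≤ (x ^ a) (^-monoˡ-≤ q (m≤m+n C V)))
    sum-bound : (E ≤ w) ⊎ (w ≤ E) → (E + w) ^ q ≤ 2 ^ q * ((C + V) ^ q * x ^ a)
    sum-bound (inj₁ l) = ≤-trans (^-monoˡ-≤ q (≤-trans (+-monoˡ-≤ w l) (≤-reflexive (dbl w)))) (≤-trans (≤-reflexive (^-*-distrib 2 w q)) (*-monoʳ-≤ (2 ^ q) w^≤))
    sum-bound (inj₂ l) = ≤-trans (^-monoˡ-≤ q (≤-trans (+-monoʳ-≤ E l) (≤-reflexive (dbl E)))) (≤-trans (≤-reflexive (^-*-distrib 2 E q)) (*-monoʳ-≤ (2 ^ q) E^≤))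

  -- The square of `X` is of order `N e₀`, where `N` is of order x^{1/2} and `e₀` of order x^α. The
  -- square root has the exponent (α + 1/2) / 2, whose denominator is cleared by the power `4 * q`.
  final-bound : ∀ {X E h N x m D} → 1 ≤ m → 1 ≤ x → E ^ q ≤ C ^ q * x ^ a → m * (h * h) ≤ τ * N → N * N ≤ 8 * x →
    X * X ≤ 16 * ((8 + 2 * τ) * (N * (E + K * suc h + 2))) → D₀ ≤ D → X ^ (4 * q) ≤ D ^ (4 * q) * x ^ (2 * a + q)
  final-bound {X} {E} {h} {N} {x} {m} {D} 1≤m 1≤x E≤ mhh NN≤ XX≤ D₀≤ = begin
    X ^ (4 * q)                                             ≡⟨ trans (cong (X ^_) (*-assoc 2 2 q)) (^-double X (2 * q)) ⟩
    (X * X) ^ (2 * q)                                       ≤⟨ ^-monoˡ-≤ (2 * q) (≤-trans XX≤ (≤-reflexive (sym (*-assoc 16 (8 + 2 * τ) (N * e₀))))) ⟩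
    (c₁ * (N * e₀)) ^ (2 * q)                               ≡⟨ trans (^-*-distrib c₁ (N * e₀) (2 * q)) (cong (c₁ ^ (2 * q) *_) (^-*-distrib N e₀ (2 * q))) ⟩
    c₁ ^ (2 * q) * (N ^ (2 * q) * e₀ ^ (2 * q))             ≤⟨ *-monoʳ-≤ (c₁ ^ (2 * q)) (*-mono-≤ N^≤ e^≤) ⟩
    c₁ ^ (2 * q) * (8 ^ (2 * q) * x ^ q * (M ^ (2 * q) * x ^ (2 * a))) ≡⟨ e (c₁ ^ (2 * q)) (8 ^ (2 * q)) (x ^ q) (M ^ (2 * q)) (x ^ (2 * a)) ⟩
    8 ^ (2 * q) * c₁ ^ (2 * q) * M ^ (2 * q) * (x ^ (2 * a) * x ^ q) ≡⟨ cong₂ _*_ (trans (cong (_* M ^ (2 * q)) (sym (^-*-distrib 8 c₁ (2 * q)))) (sym (^-*-distrib (8 * c₁) M (2 * q)))) (sym (^-distribˡ-+-* x (2 * a) q)) ⟩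
    D₀ ^ (2 * q) * x ^ (2 * a + q)                          ≤⟨ *-monoˡ-≤ (x ^ (2 * a + q)) (≤-trans (^-monoʳ-≤ D₀ {{>-nonZero 1≤D₀}} (*-monoˡ-≤ q (≤ᵇ⇒≤ 2 4 _))) (^-monoˡ-≤ (4 * q) D₀≤)) ⟩
    D ^ (4 * q) * x ^ (2 * a + q)                           ∎
    where
    open ≤-Reasoning
    e₀ = E + K * suc h + 2
    e : ∀ c g xq m xa → c * (g * xq * (m * xa)) ≡ g * c * m * (xa * xq)
    e = solveℕ
    sq4 : ∀ a b → (a * b) * (a * b) ≡ (a * a) * (b * b)
    sq4 = solveℕ
    N^≤ : N ^ (2 * q) ≤ 8 ^ (2 * q) * x ^ q
    N^≤ = begin
      N ^ (2 * q)                   ≡⟨ ^-double N q ⟩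
      (N * N) ^ q                   ≤⟨ ^-monoˡ-≤ q NN≤ ⟩
      (8 * x) ^ q                   ≡⟨ ^-*-distrib 8 x q ⟩
      8 ^ q * x ^ q                 ≤⟨ *-monoˡ-≤ (x ^ q) (^-monoʳ-≤ 8 (m≤n*m q 2)) ⟩
      8 ^ (2 * q) * x ^ q           ∎
    e^≤ : e₀ ^ (2 * q) ≤ M ^ (2 * q) * x ^ (2 * a)
    e^≤ = begin
      e₀ ^ (2 * q)                            ≡⟨ ^-double' e₀ q ⟩
      e₀ ^ q * e₀ ^ q                         ≤⟨ *-mono-≤ b b ⟩
      M ^ q * x ^ a * (M ^ q * x ^ a)         ≡⟨ sq4 (M ^ q) (x ^ a) ⟩
      M ^ q * M ^ q * (x ^ a * x ^ a)         ≡⟨ cong₂ _*_ (sym (^-double' M q)) (sym (^-double' x a)) ⟩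
      M ^ (2 * q) * x ^ (2 * a)               ∎
      where
      b : e₀ ^ q ≤ M ^ q * x ^ a
      b = e₀-bound {E} {h} {N} {x} {m} 1≤m 1≤x E≤ mhh NN≤

-- The extremal sequence and its size

-- The multiplicities of A₁ as a function on ℕ, so that they can be summed over ranges and evaluated
-- at residues of integers.
extremal : (m k n : ℕ) → ℕ → ℕ
extremal m k n zero    = 0
extremal m k n (suc j) = if ⌊ suc j ≟ n ⌋ then k else (if ⌊ suc (suc j) ≤? n ⌋ then m else 0)

A1≡extremal : ∀ p m k n x → A1 p m k n x ≡ extremal m k n (toℕ x)
A1≡extremal p m k n x with toℕ x
... | zero  = refl
... | suc j = refl

extremal-< : ∀ m k n₁ i → i < n₁ → extremal m k (suc n₁) (suc i) ≡ m
extremal-< m k n₁ i i< rewrite ⌊⌋-no (suc i ≟ suc n₁) (<⇒≢ (s≤s i<)) | ⌊⌋-yes (suc (suc i) ≤? suc n₁) (s≤s i<) = refl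

extremal-≡ : ∀ m k n₁ → extremal m k (suc n₁) (suc n₁) ≡ k
extremal-≡ m k n₁ rewrite ⌊⌋-yes (suc n₁ ≟ suc n₁) refl = refl

extremal-> : ∀ m k n₁ i → n₁ < i → extremal m k (suc n₁) (suc i) ≡ 0
extremal-> m k n₁ i i> rewrite ⌊⌋-no (suc i ≟ suc n₁) (<⇒≢ (s≤s i>) ∘ sym) | ⌊⌋-no (suc (suc i) ≤? suc n₁) (<⇒≱ (≤-trans (s≤s i>) (n≤1+n (suc i)))) = refl

extremal-total : ∀ m k n₁ o → ∑ (suc (suc n₁ + o)) (extremal m k (suc n₁)) ≡ m * n₁ + k
extremal-total m k n₁ o = begin
  ∑ (suc n₁ + o) c                                            ≡⟨ ∑-split (suc n₁) o c ⟩
  ∑ (suc n₁) c + ∑ o (λ j → c (suc n₁ + j))                   ≡⟨ cong₂ _+_ (trans (∑-last n₁ c) (cong₂ _+_ (trans (∑-cong< n₁ (extremal-< m k n₁)) (trans (∑-const n₁ m) (*-comm n₁ m))) (extremal-≡ m k n₁)))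
                                                                   (trans (∑-cong o (λ j → extremal-> m k n₁ (suc n₁ + j) (m≤m+n (suc n₁) j))) (∑-0 o)) ⟩
  m * n₁ + k + 0                                              ≡⟨ +-identityʳ _ ⟩
  m * n₁ + k                                                  ∎
  where
  open ≡-Reasoning
  c : ℕ → ℕ
  c i = extremal m k (suc n₁) (suc i)

module Extremal (p m k n₁ : ℕ) (1≤m : 1 ≤ m) (m≤p : m ≤ p) (k≤m : k ≤ m)
  (p> : m * tri n₁ + k * suc n₁ < p) (p≤ : p ≤ m * tri n₁ + suc k * suc n₁) where
  open ≤-Reasoning

  N₁ : ℕ
  N₁ = m * n₁ + k

  -- The elements of A₁ are at least `n / 2` on average, and their sum is below `p`.
  nN₁ : suc n₁ * N₁ < 2 * p
  nN₁ = begin-strict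
    suc n₁ * N₁                              ≡⟨ e1 n₁ m k ⟩
    m * (n₁ * suc n₁) + k * suc n₁           ≡⟨ cong (λ w → m * w + k * suc n₁) (tri-double n₁) ⟨
    m * (2 * tri n₁) + k * suc n₁            ≤⟨ m≤m+n _ (k * suc n₁) ⟩
    m * (2 * tri n₁) + k * suc n₁ + k * suc n₁ ≡⟨ e2 m (tri n₁) (k * suc n₁) ⟩
    2 * (m * tri n₁ + k * suc n₁)            <⟨ *-monoʳ-< 2 p> ⟩
    2 * p                                    ∎
    where
    e1 : ∀ n₁ m k → suc n₁ * (m * n₁ + k) ≡ m * (n₁ * suc n₁) + k * suc n₁
    e1 = solveℕ
    e2 : ∀ m t x → m * (2 * t) + x + x ≡ 2 * (m * t + x)
    e2 = solveℕ

  p≤n : p ≤ suc n₁ * suc N₁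
  p≤n = begin
    p                                               ≤⟨ p≤ ⟩
    m * tri n₁ + suc k * suc n₁                     ≤⟨ +-monoˡ-≤ _ (*-monoʳ-≤ m (m≤n*m (tri n₁) 2)) ⟩
    m * (2 * tri n₁) + suc k * suc n₁               ≡⟨ cong (λ w → m * w + suc k * suc n₁) (tri-double n₁) ⟩
    m * (n₁ * suc n₁) + suc k * suc n₁              ≡⟨ e m n₁ k ⟩
    suc n₁ * suc N₁                                 ∎
    where
    e : ∀ m n₁ k → m * (n₁ * suc n₁) + suc k * suc n₁ ≡ suc n₁ * suc (m * n₁ + k)
    e = solveℕ

  m≤N₁+1 : m ≤ suc N₁
  m≤N₁+1 with n₁ ≟ 0
  -- For n = 1 the sequence consists of `k` ones, and the maximality of `k` gives `p ≤ k + 1`; so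
  -- `m ≤ p` suffices.
  ... | yes z = ≤-trans m≤p (≤-trans p≤n (≤-reflexive (trans (cong (λ w → suc w * suc N₁) z) (+-identityʳ (suc N₁)))))
  ... | no nz = ≤-trans (m≤m*n m n₁ {{>-nonZero (n≢0⇒n>0 nz)}}) (≤-trans (m≤m+n (m * n₁) k) (n≤1+n N₁))

  mn≤ : m * suc n₁ ≤ 2 * suc N₁
  mn≤ = begin
    m * suc n₁                 ≡⟨ *-suc m n₁ ⟩
    m + m * n₁                 ≤⟨ +-mono-≤ m≤N₁+1 (≤-trans (m≤m+n (m * n₁) k) (n≤1+n N₁)) ⟩
    suc N₁ + suc N₁            ≡⟨ cong (suc N₁ +_) (sym (+-identityʳ (suc N₁))) ⟩
    2 * suc N₁                 ∎

  pm≤ : p * m ≤ 2 * (suc N₁ * suc N₁)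
  pm≤ = begin
    p * m                          ≤⟨ *-monoˡ-≤ m p≤n ⟩
    suc n₁ * suc N₁ * m            ≡⟨ e (suc n₁) (suc N₁) m ⟩
    m * suc n₁ * suc N₁            ≤⟨ *-monoˡ-≤ (suc N₁) mn≤ ⟩
    2 * suc N₁ * suc N₁            ≡⟨ *-assoc 2 (suc N₁) (suc N₁) ⟩
    2 * (suc N₁ * suc N₁)          ∎
    where
    e : ∀ a b m → a * b * m ≡ m * a * b
    e = solveℕ

  N₁N₁≤ : N₁ * N₁ ≤ 2 * (p * m)
  N₁N₁≤ = begin
    N₁ * N₁                        ≤⟨ *-monoˡ-≤ N₁ (≤-trans (+-monoʳ-≤ (m * n₁) k≤m) (≤-reflexive (trans (+-comm (m * n₁) m) (sym (*-suc m n₁))))) ⟩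
    m * suc n₁ * N₁                ≡⟨ *-assoc m (suc n₁) N₁ ⟩
    m * (suc n₁ * N₁)              ≤⟨ *-monoʳ-≤ m (<⇒≤ nN₁) ⟩
    m * (2 * p)                    ≡⟨ e m p ⟩
    2 * (p * m)                    ∎
    where
    e : ∀ m p → m * (2 * p) ≡ 2 * (p * m)
    e = solveℕ

  module Near (N E N₀ y : ℕ) (100≤y : 100 ≤ y) (low : N₁ ≤ N + E) (high : N ≤ N₁ + E)
    (E-small : (4 * suc y * E) * (4 * suc y * E) ≤ p * m) (large : 2 * ((2 * N₀ + 16) * (2 * N₀ + 16)) < p * m) where

    E≤ : 2 * suc y * E ≤ suc N₁
    E≤ = *-cancelˡ-≤ 2 (≤-trans (≤-reflexive (e1 y E)) (sq-cancel (≤-trans E-small (≤-trans pm≤ (≤-trans (*-monoˡ-≤ (suc N₁ * suc N₁) (≤ᵇ⇒≤ 2 4 _)) (≤-reflexive (e2 (suc N₁))))))))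
      where
      e1 : ∀ y E → 2 * (2 * suc y * E) ≡ 4 * suc y * E
      e1 = solveℕ
      e2 : ∀ a → 4 * (a * a) ≡ 2 * a * (2 * a)
      e2 = solveℕ

    N₁-large : 2 * N₀ + 16 < suc N₁
    N₁-large = ≰⇒> λ l → <⇒≱ large (≤-trans pm≤ (*-monoʳ-≤ 2 (*-mono-≤ l l)))

    N-large : N₀ + 7 < N
    N-large = *-cancelˡ-< 2 _ _ (+-cancelʳ-< 2 _ _ (begin-strict
      2 * (N₀ + 7) + 2           ≡⟨ e1 N₀ ⟩
      2 * N₀ + 16                <⟨ N₁-large ⟩
      suc N₁                     ≤⟨ s≤s half ⟩
      suc (2 * N + 1)            ≡⟨ e2 N ⟩
      2 * N + 2                  ∎))
      where
      e1 : ∀ n → 2 * (n + 7) + 2 ≡ 2 * n + 16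
      e1 = solveℕ
      e2 : ∀ n → suc (2 * n + 1) ≡ 2 * n + 2
      e2 = solveℕ
      e3 : ∀ n → n + n ≡ 2 * n
      e3 = solveℕ
      e5 : ∀ N n → 2 * N + suc n ≡ 2 * N + 1 + n
      e5 = solveℕ
      half : N₁ ≤ 2 * N + 1
      half = +-cancelʳ-≤ N₁ _ _ (begin
        N₁ + N₁                  ≡⟨ e3 N₁ ⟩
        2 * N₁                   ≤⟨ *-monoʳ-≤ 2 low ⟩
        2 * (N + E)              ≡⟨ *-distribˡ-+ 2 N E ⟩
        2 * N + 2 * E            ≤⟨ +-monoʳ-≤ (2 * N) (≤-trans (*-monoˡ-≤ E (m≤m*n 2 (suc y))) E≤) ⟩
        2 * N + suc N₁           ≡⟨ e5 N N₁ ⟩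
        2 * N + 1 + N₁           ∎)

    7<N : 7 < N
    7<N = ≤-<-trans (m≤n+m 7 N₀) N-large

    yE≤N : y * E ≤ N
    yE≤N = *-cancelˡ-≤ 2 (+-cancelʳ-≤ E _ _ (begin
      2 * (y * E) + E            ≤⟨ +-monoʳ-≤ (2 * (y * E)) (m≤n*m E 2) ⟩
      2 * (y * E) + 2 * E        ≡⟨ e1 y E ⟩
      2 * suc y * E              ≤⟨ E≤ ⟩
      suc N₁                     ≤⟨ s≤s low ⟩
      suc (N + E)                ≤⟨ +-monoˡ-≤ (N + E) (≤-trans (s≤s z≤n) 7<N) ⟩
      N + (N + E)                ≡⟨ e2 N E ⟩
      2 * N + E                  ∎))
      where
      e1 : ∀ y E → 2 * (y * E) + 2 * E ≡ 2 * suc y * E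
      e1 = solveℕ
      e2 : ∀ n e → n + (n + e) ≡ 2 * n + e
      e2 = solveℕ

    100E≤N : 100 * E ≤ N
    100E≤N = ≤-trans (*-monoˡ-≤ E 100≤y) yE≤N

    5N₁≤6N : 5 * suc N₁ ≤ 6 * N
    5N₁≤6N = *-cancelˡ-≤ 20 (begin
      20 * (5 * suc N₁)               ≤⟨ *-monoʳ-≤ 20 (*-monoʳ-≤ 5 (s≤s low)) ⟩
      20 * (5 * suc (N + E))          ≡⟨ e1 N E ⟩
      100 * N + 100 + 100 * E         ≤⟨ +-mono-≤ (+-monoʳ-≤ (100 * N) (≤-trans (≤ᵇ⇒≤ 100 152 _) (*-monoʳ-≤ 19 7<N))) 100E≤N ⟩
      100 * N + 19 * N + N            ≡⟨ e2 N ⟩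
      20 * (6 * N)                    ∎)
      where
      e1 : ∀ n e → 20 * (5 * suc (n + e)) ≡ 100 * n + 100 + 100 * e
      e1 = solveℕ
      e2 : ∀ n → 100 * n + 19 * n + n ≡ 20 * (6 * n)
      e2 = solveℕ

    pm≤4NN : p * m ≤ 4 * (N * N)
    pm≤4NN = *-cancelˡ-≤ 25 (begin
      25 * (p * m)                             ≤⟨ *-monoʳ-≤ 25 pm≤ ⟩
      25 * (2 * (suc N₁ * suc N₁))             ≡⟨ e1 (suc N₁) ⟩
      2 * (5 * suc N₁ * (5 * suc N₁))          ≤⟨ *-monoʳ-≤ 2 (*-mono-≤ 5N₁≤6N 5N₁≤6N) ⟩
      2 * (6 * N * (6 * N))                    ≡⟨ e2 N ⟩
      72 * (N * N)                             ≤⟨ *-monoˡ-≤ (N * N) (≤ᵇ⇒≤ 72 100 _) ⟩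
      100 * (N * N)                            ≡⟨ *-assoc 25 4 (N * N) ⟩
      25 * (4 * (N * N))                       ∎)
      where
      e1 : ∀ a → 25 * (2 * (a * a)) ≡ 2 * (5 * a * (5 * a))
      e1 = solveℕ
      e2 : ∀ n → 2 * (6 * n * (6 * n)) ≡ 72 * (n * n)
      e2 = solveℕ

    m≤2N : m ≤ 2 * N
    m≤2N = *-cancelˡ-≤ 5 (≤-trans (*-monoʳ-≤ 5 m≤N₁+1) (≤-trans 5N₁≤6N (≤-trans (*-monoˡ-≤ N (≤ᵇ⇒≤ 6 10 _)) (≤-reflexive (*-assoc 5 2 N)))))

    NN≤8pm : N * N ≤ 8 * (p * m)
    NN≤8pm = begin
      N * N                       ≤⟨ *-mono-≤ N≤2N₁ N≤2N₁ ⟩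
      2 * N₁ * (2 * N₁)           ≡⟨ e1 N₁ ⟩
      4 * (N₁ * N₁)               ≤⟨ *-monoʳ-≤ 4 N₁N₁≤ ⟩
      4 * (2 * (p * m))           ≡⟨ *-assoc 4 2 (p * m) ⟨
      8 * (p * m)                 ∎
      where
      e1 : ∀ a → 2 * a * (2 * a) ≡ 4 * (a * a)
      e1 = solveℕ
      e2 : ∀ a → 99 * a + a ≡ 100 * a
      e2 = solveℕ
      e3 : ∀ a → 50 * (2 * a) ≡ 100 * a
      e3 = solveℕ
      N≤2N₁ : N ≤ 2 * N₁
      N≤2N₁ = *-cancelˡ-≤ 50 (begin
        50 * N                    ≤⟨ *-monoˡ-≤ N (≤ᵇ⇒≤ 50 99 _) ⟩
        99 * N                    ≤⟨ +-cancelʳ-≤ N _ _ (≤-trans (≤-reflexive (e2 N)) (≤-trans (*-monoʳ-≤ 100 high) (≤-trans (≤-reflexive (*-distribˡ-+ 100 N₁ E)) (+-monoʳ-≤ (100 * N₁) 100E≤N)))) ⟩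
        100 * N₁                  ≡⟨ e3 N₁ ⟨
        50 * (2 * N₁)             ∎)

-- Integers modulo p and sums over all residues

module Residues (p' : ℕ) (pr : Prime (suc p')) where

  p : ℕ
  p = suc p'

  infix 4 _≈_ _⨾_
  -- Elements of ℤ_p are represented by arbitrary integers, so that ring identities over ℤ apply
  -- directly and small representatives can be chosen at will.
  record _≈_ (x y : ℤ) : Set where
    constructor _⨾_
    field
      quotient : ℤ
      equality : x ≡ y +ᶻ quotient *ᶻ pos p

  ≈-reflexive : ∀ {x y} → x ≡ y → x ≈ y
  ≈-reflexive {x} refl = pos 0 ⨾ sym (ℤP.+-identityʳ x)

  ≈-refl : ∀ {x} → x ≈ x
  ≈-refl = ≈-reflexive refl

  ≈-sym : ∀ {x y} → x ≈ y → y ≈ x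
  ≈-sym {y = y} (k ⨾ refl) = -ᶻ k ⨾ e y k (pos p)
    where
    e : ∀ y k q → y ≡ (y +ᶻ k *ᶻ q) +ᶻ (-ᶻ k) *ᶻ q
    e = solveℤ

  ≈-trans : ∀ {x y z} → x ≈ y → y ≈ z → x ≈ z
  ≈-trans {z = z} (k ⨾ refl) (l ⨾ refl) = l +ᶻ k ⨾ e z k l (pos p)
    where
    e : ∀ z k l q → (z +ᶻ l *ᶻ q) +ᶻ k *ᶻ q ≡ z +ᶻ (l +ᶻ k) *ᶻ q
    e = solveℤ

  ≈-+ : ∀ {x y u v} → x ≈ y → u ≈ v → x +ᶻ u ≈ y +ᶻ v
  ≈-+ {y = y} {v = v} (k ⨾ refl) (l ⨾ refl) = k +ᶻ l ⨾ e y v k l (pos p)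
    where
    e : ∀ y v k l q → (y +ᶻ k *ᶻ q) +ᶻ (v +ᶻ l *ᶻ q) ≡ (y +ᶻ v) +ᶻ (k +ᶻ l) *ᶻ q
    e = solveℤ

  ≈-*ˡ : ∀ c {x y} → x ≈ y → c *ᶻ x ≈ c *ᶻ y
  ≈-*ˡ c {y = y} (k ⨾ refl) = c *ᶻ k ⨾ e c y k (pos p)
    where
    e : ∀ c y k q → c *ᶻ (y +ᶻ k *ᶻ q) ≡ c *ᶻ y +ᶻ (c *ᶻ k) *ᶻ q
    e = solveℤ

  ≈-*ʳ : ∀ c {x y} → x ≈ y → x *ᶻ c ≈ y *ᶻ c
  ≈-*ʳ c {x} {y} e = ≈-trans (≈-reflexive (ℤP.*-comm x c)) (≈-trans (≈-*ˡ c e) (≈-reflexive (ℤP.*-comm c y)))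

  ≈-neg : ∀ {x y} → x ≈ y → -ᶻ x ≈ -ᶻ y
  ≈-neg {y = y} (k ⨾ refl) = -ᶻ k ⨾ e y k (pos p)
    where
    e : ∀ y k q → -ᶻ (y +ᶻ k *ᶻ q) ≡ -ᶻ y +ᶻ (-ᶻ k) *ᶻ q
    e = solveℤ

  ≈-minus : ∀ {x y u v} → x ≈ y → u ≈ v → x -ᶻ u ≈ y -ᶻ v
  ≈-minus a b = ≈-+ a (≈-neg b)

  ≈-residue : ∀ x → x ≈ pos (x %ℕ p)
  ≈-residue x = (x /ℕ p) ⨾ a≡a%ℕn+[a/ℕn]*n x p

  residue<p : ∀ x → x %ℕ p < p
  residue<p x = n%ℕd<d x p

  small-unique : ∀ {i j} → i < p → j < p → pos i ≈ pos j → i ≡ j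
  small-unique {i} {j} i<p j<p (pos k ⨾ e) = go k (ℤP.+-injective (trans e (cong (pos j +ᶻ_) (sym (ℤP.pos-* k p)))))
    where
    go : ∀ k → i ≡ j + k * p → i ≡ j
    go zero    e = trans e (+-identityʳ j)
    go (suc k) e = contradiction i<p (≤⇒≯ (subst (p ≤_) (sym e) (≤-trans (m≤m+n p (k * p)) (m≤n+m (p + k * p) j))))
  small-unique {i} {j} i<p j<p (-[1+ k ] ⨾ e) = sym (go' (ℤP.+-injective (trans (f (pos j) -[1+ k ] (pos p)) (trans (cong (_+ᶻ pos (suc k) *ᶻ pos p) (sym e)) (cong (pos i +ᶻ_) (sym (ℤP.pos-* (suc k) p)))))))
    where
    f : ∀ y k q → y ≡ (y +ᶻ k *ᶻ q) +ᶻ (-ᶻ k) *ᶻ q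
    f = solveℤ
    go' : j ≡ i + suc k * p → j ≡ i
    go' e = contradiction j<p (≤⇒≯ (subst (p ≤_) (sym e) (≤-trans (m≤m+n p (k * p)) (m≤n+m (p + k * p) i))))

  residue-cong : ∀ {x y} → x ≈ y → x %ℕ p ≡ y %ℕ p
  residue-cong {x} {y} e = small-unique (residue<p x) (residue<p y)
    (≈-trans (≈-sym (≈-residue x)) (≈-trans e (≈-residue y)))

  residue-≈ : ∀ {x y} → x %ℕ p ≡ y %ℕ p → x ≈ y
  residue-≈ {x} {y} e = ≈-trans (≈-residue x) (≈-trans (≈-reflexive (cong pos e)) (≈-sym (≈-residue y)))

  _≈?_ : ∀ x y → Dec (x ≈ y)
  x ≈? y with x %ℕ p ≟ y %ℕ p
  ... | yes e = yes (residue-≈ e)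
  ... | no ne = no (ne ∘ residue-cong)

  opaque
    δ : ℤ → Bool
    δ x = ⌊ x %ℕ p ≟ 0 ⌋

  opaque
    unfolding δ

    δ-true : ∀ {x} → x ≈ pos 0 → δ x ≡ true
    δ-true {x} e = ⌊⌋-yes (x %ℕ p ≟ 0) (residue-cong e)

    δ-sound : ∀ {x} → δ x ≡ true → x ≈ pos 0
    δ-sound {x} e with x %ℕ p ≟ 0
    ... | yes q = residue-≈ q

    δ-false : ∀ {x} → ¬ (x ≈ pos 0) → δ x ≡ false
    δ-false {x} ne with δ x in eq
    ... | true  = contradiction (δ-sound eq) ne
    ... | false = refl

  ≈0⇒≈ : ∀ {x y} → x -ᶻ y ≈ pos 0 → x ≈ y
  ≈0⇒≈ {x} {y} e = ≈-trans (≈-reflexive (f x y)) (≈-trans (≈-+ e (≈-refl {y})) (≈-reflexive (ℤP.+-identityˡ y)))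
    where
    f : ∀ x y → x ≡ (x -ᶻ y) +ᶻ y
    f = solveℤ

  ≈⇒≈0 : ∀ {x y} → x ≈ y → x -ᶻ y ≈ pos 0
  ≈⇒≈0 {x} {y} e = ≈-trans (≈-minus e ≈-refl) (≈-reflexive (ℤP.+-inverseʳ y))

  Per : {X : Set} → (ℤ → X) → Set
  Per g = ∀ {x y} → x ≈ y → g x ≡ g y

  opaque
    unfolding δ

    δ-per : Per δ
    δ-per e = cong (λ r → ⌊ r ≟ 0 ⌋) (residue-cong e)

  opaque
    Σp : (ℤ → ℕ) → ℕ
    Σp g = ∑ p (λ i → g (pos i))

  opaque
    unfolding Σp

    Σp-def : ∀ g → Σp g ≡ ∑ p (λ i → g (pos i))
    Σp-def g = refl

    Σp-cong : ∀ {g h : ℤ → ℕ} → (∀ x → g x ≡ h x) → Σp g ≡ Σp h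
    Σp-cong e = ∑-cong p (λ i → e (pos i))

    Σp-mono : ∀ {g h : ℤ → ℕ} → (∀ x → g x ≤ h x) → Σp g ≤ Σp h
    Σp-mono e = ∑-mono p (λ i → e (pos i))

    Σp-+ : ∀ (g h : ℤ → ℕ) → Σp (λ x → g x + h x) ≡ Σp g + Σp h
    Σp-+ g h = ∑-+ p (λ i → g (pos i)) (λ i → h (pos i))

    Σp-swap : ∀ (g : ℤ → ℤ → ℕ) → Σp (λ x → Σp (g x)) ≡ Σp (λ y → Σp (λ x → g x y))
    Σp-swap g = ∑-swap p p (λ i j → g (pos i) (pos j))

    Σp-*ˡ : ∀ c (g : ℤ → ℕ) → Σp (λ x → c * g x) ≡ c * Σp g
    Σp-*ˡ c g = ∑-*ˡ p c (λ i → g (pos i))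

    Σp-*ʳ : ∀ c (g : ℤ → ℕ) → Σp (λ x → g x * c) ≡ Σp g * c
    Σp-*ʳ c g = ∑-*ʳ p c (λ i → g (pos i))

    Σp-const : ∀ c → Σp (λ _ → c) ≡ p * c
    Σp-const c = ∑-const p c

    Σp-shift1 : ∀ {g : ℤ → ℕ} → Per g → Σp (λ x → g (x +ᶻ pos 1)) ≡ Σp g
    Σp-shift1 {g} per = +-cancelˡ-≡ (g (pos 0)) _ _ (trans (cong (g (pos 0) +_) (∑-cong p (λ i → cong (λ j → g (pos j)) (+-comm i 1))))
      (trans (∑-last p (λ i → g (pos i))) (trans (cong (Σp g +_) (per (pos 1 ⨾ sym (trans (ℤP.+-identityˡ _) (ℤP.*-identityˡ (pos p)))))) (+-comm (Σp g) _))))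

    Σp-δ0 : ∀ (g : ℤ → ℕ) → Σp (λ u → g u * ι (δ u)) ≡ g (pos 0)
    Σp-δ0 g = trans (cong₂ _+_ (trans (cong (g (pos 0) *_) (cong ι (δ-true (≈-refl {pos 0})))) (*-identityʳ _))
        (trans (∑-cong< p' (λ i l → trans (cong (g (pos (suc i)) *_) (cong ι (δ-false (λ e → contradiction (small-unique (s≤s l) (s≤s z≤n) e) λ ())))) (*-zeroʳ (g (pos (suc i)))))) (∑-0 p')))
      (+-identityʳ _)

  private
    assoc+ : ∀ x y z → (x +ᶻ y) +ᶻ z ≡ x +ᶻ (y +ᶻ z)
    assoc+ = ℤP.+-assoc

  Σp-shiftℕ : ∀ {g : ℤ → ℕ} → Per g → ∀ n → Σp (λ x → g (x +ᶻ pos n)) ≡ Σp g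
  Σp-shiftℕ {g} per zero    = Σp-cong (λ x → cong g (ℤP.+-identityʳ x))
  Σp-shiftℕ {g} per (suc n) = trans (Σp-cong (λ x → cong g (sym (assoc+ x (pos 1) (pos n)))))
    (trans (Σp-shift1 {λ x → g (x +ᶻ pos n)} (λ e → per (≈-+ e ≈-refl))) (Σp-shiftℕ per n))

  Σp-shift : ∀ {g : ℤ → ℕ} → Per g → ∀ a → Σp (λ x → g (x +ᶻ a)) ≡ Σp g
  Σp-shift {g} per a = trans (Σp-cong (λ x → per (≈-+ (≈-refl {x}) (≈-residue a)))) (Σp-shiftℕ per (a %ℕ p))

  Σp-δ : ∀ {g : ℤ → ℕ} → Per g → ∀ a → Σp (λ u → g u * ι (δ (u -ᶻ a))) ≡ g a
  Σp-δ {g} per a = trans (sym (Σp-shift {λ u → g u * ι (δ (u -ᶻ a))} (λ e → cong₂ _*_ (per e) (cong ι (δ-per (≈-minus e ≈-refl)))) a))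
    (trans (Σp-cong (λ u → cong (λ w → g (u +ᶻ a) * ι (δ w)) (f u a)))
    (trans (Σp-δ0 (λ u → g (u +ᶻ a))) (cong g (ℤP.+-identityˡ a))))
    where
    f : ∀ u a → (u +ᶻ a) -ᶻ a ≡ u
    f = solveℤ

  Σp-δ1 : ∀ a → Σp (λ u → ι (δ (u -ᶻ a))) ≡ 1
  Σp-δ1 a = trans (Σp-cong (λ u → sym (+-identityʳ _))) (Σp-δ {λ _ → 1} (λ _ → refl) a)

  Unit : ℤ → Set
  Unit v = ¬ (v ≈ pos 0)

  inverse : ∀ {v} → Unit v → ∃[ w ] (v *ᶻ w ≈ pos 1)
  inverse {v} u with v %ℕ p in eq
  ... | zero = contradiction (residue-≈ {v} {pos 0} eq) u
  ... | suc r with coprime-Bézout (prime⇒coprime {n = suc r} pr (subst (_< p) eq (residue<p v)))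
  ... | Bézout.+- x y e = -ᶻ pos y , ≈-trans (≈-*ʳ (-ᶻ pos y) (≈-trans (≈-residue v) (≈-reflexive (cong pos eq))))
      (-ᶻ pos x ⨾ f (pos (suc r)) (pos x) (pos y) (pos p)
         (trans (cong (pos 1 +ᶻ_) (sym (ℤP.pos-* y (suc r)))) (trans (cong pos e) (ℤP.pos-* x p))))
    where
    f : ∀ r x y q → pos 1 +ᶻ y *ᶻ r ≡ x *ᶻ q → r *ᶻ (-ᶻ y) ≡ pos 1 +ᶻ (-ᶻ x) *ᶻ q
    f r x y q e = trans (g r y) (trans (cong (λ t → pos 1 -ᶻ t) e) (h x q))
      where
      g : ∀ r y → r *ᶻ (-ᶻ y) ≡ pos 1 -ᶻ (pos 1 +ᶻ y *ᶻ r)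
      g = solveℤ
      h : ∀ x q → pos 1 -ᶻ x *ᶻ q ≡ pos 1 +ᶻ (-ᶻ x) *ᶻ q
      h = solveℤ
  ... | Bézout.-+ x y e = pos y , ≈-trans (≈-*ʳ (pos y) (≈-trans (≈-residue v) (≈-reflexive (cong pos eq))))
      (pos x ⨾ trans (ℤP.*-comm (pos (suc r)) (pos y)) (trans (sym (ℤP.pos-* y (suc r))) (trans (cong pos (sym e)) (cong (pos 1 +ᶻ_) (ℤP.pos-* x p)))))

  inverse-cancel : ∀ v w → v *ᶻ w ≈ pos 1 → ∀ x → (x *ᶻ v) *ᶻ w ≈ x
  inverse-cancel v w e x = ≈-trans (≈-reflexive (ℤP.*-assoc x v w)) (≈-trans (≈-*ˡ x e) (≈-reflexive (ℤP.*-identityʳ x)))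

  Unit-* : ∀ {u v} → Unit u → Unit v → Unit (u *ᶻ v)
  Unit-* {u} {v} a b e with inverse b
  ... | w , vw = a (≈-trans (≈-sym (inverse-cancel v w vw u)) (≈-trans (≈-*ʳ w e) (≈-reflexive (ℤP.*-zeroˡ w))))

  -- `g (b v)` is written as the sum over `u` of `g u` times the indicator of `u ≈ b v`. After
  -- exchanging the sums, each `u` is counted once, for `b ≈ u w`.
  Σp-dilate : ∀ {g : ℤ → ℕ} → Per g → ∀ {v} → Unit v → Σp (λ b → g (b *ᶻ v)) ≡ Σp g
  Σp-dilate {g} per {v} un with inverse un
  ... | w , vw = begin
    Σp (λ b → g (b *ᶻ v))                                  ≡⟨ Σp-cong (λ b → sym (Σp-δ per (b *ᶻ v))) ⟩
    Σp (λ b → Σp (λ u → g u * ι (δ (u -ᶻ b *ᶻ v))))        ≡⟨ Σp-swap (λ b u → g u * ι (δ (u -ᶻ b *ᶻ v))) ⟩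
    Σp (λ u → Σp (λ b → g u * ι (δ (u -ᶻ b *ᶻ v))))        ≡⟨ Σp-cong (λ u → Σp-*ˡ (g u) (λ b → ι (δ (u -ᶻ b *ᶻ v)))) ⟩
    Σp (λ u → g u * Σp (λ b → ι (δ (u -ᶻ b *ᶻ v))))        ≡⟨ Σp-cong (λ u → cong (g u *_) (trans (Σp-cong (λ b → cong ι (same u b))) (Σp-δ1 (u *ᶻ w)))) ⟩
    Σp (λ u → g u * 1)                                     ≡⟨ Σp-cong (λ u → *-identityʳ (g u)) ⟩
    Σp g                                                   ∎
    where
    open ≡-Reasoning
    same : ∀ u b → δ (u -ᶻ b *ᶻ v) ≡ δ (b -ᶻ u *ᶻ w)
    wv : w *ᶻ v ≈ pos 1
    wv = ≈-trans (≈-reflexive (ℤP.*-comm w v)) vw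
    same u b with (u -ᶻ b *ᶻ v) ≈? pos 0
    ... | yes e = trans (δ-true e) (sym (δ-true (≈⇒≈0 {b} {u *ᶻ w} (≈-trans (≈-sym (inverse-cancel v w vw b)) (≈-*ʳ w {b *ᶻ v} {u} (≈-sym (≈0⇒≈ {u} {b *ᶻ v} e)))))))
    ... | no ne = trans (δ-false ne) (sym (δ-false (λ e → ne (≈⇒≈0 {u} {b *ᶻ v} (≈-trans (≈-sym (inverse-cancel w v wv u)) (≈-*ʳ v {u *ᶻ w} {b} (≈-sym (≈0⇒≈ {b} {u *ᶻ w} e))))))))

  -- The norm of a shift with respect to a set

  size : (ℤ → Bool) → ℕ
  size f = Σp (λ x → ι (f x))

  ∧-not : ∀ a b → ι (a ∧ b) + ι (a ∧ not b) ≡ ι a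
  ∧-not true  true  = refl
  ∧-not true  false = refl
  ∧-not false b     = refl

  ∧-not-trans : ∀ a b c → ι (a ∧ not c) ≤ ι (a ∧ not b) + ι (b ∧ not c)
  ∧-not-trans false b     c     = z≤n
  ∧-not-trans true  true  c     = ≤-refl
  ∧-not-trans true  false true  = z≤n
  ∧-not-trans true  false false = ≤-refl

  ∧-self : ∀ a → ι (a ∧ not a) ≡ 0
  ∧-self true  = refl
  ∧-self false = refl

  ι-∧ : ∀ a b → ι (a ∧ b) ≡ ι a * ι b
  ι-∧ true  b = sym (+-identityʳ (ι b))
  ι-∧ false b = refl

  ∧-comm' : ∀ a b → a ∧ b ≡ b ∧ a
  ∧-comm' true  true  = refl
  ∧-comm' true  false = refl
  ∧-comm' false true  = refl
  ∧-comm' false false = refl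

  +ᶻ-invʳ : ∀ x t → (x +ᶻ -ᶻ t) +ᶻ t ≡ x
  +ᶻ-invʳ = solveℤ

  -- `nrm` is Olson's function λ from the theory of subset sums: it counts the elements that leave
  -- the set under a shift by `t`. `cor` is its complement, the autocorrelation of the set.
  module Norm (f : ℤ → Bool) (fp : Per f) where

    cor nrm : ℤ → ℕ
    cor t = Σp (λ x → ι (f x ∧ f (x +ᶻ t)))
    nrm t = Σp (λ x → ι (f x ∧ not (f (x +ᶻ t))))

    cor-per : Per cor
    cor-per e = Σp-cong (λ x → cong (λ b → ι (f x ∧ b)) (fp (≈-+ (≈-refl {x}) e)))

    nrm-per : Per nrm
    nrm-per e = Σp-cong (λ x → cong (λ b → ι (f x ∧ not b)) (fp (≈-+ (≈-refl {x}) e)))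

    cor+nrm : ∀ t → cor t + nrm t ≡ size f
    cor+nrm t = trans (sym (Σp-+ _ _)) (Σp-cong (λ x → ∧-not (f x) (f (x +ᶻ t))))

    nrm-0 : nrm (pos 0) ≡ 0
    nrm-0 = trans (Σp-cong (λ x → trans (cong (λ y → ι (f x ∧ not (f y))) (ℤP.+-identityʳ x)) (∧-self (f x)))) (trans (Σp-const 0) (*-zeroʳ p))

    nrm-tri : ∀ s t → nrm (s +ᶻ t) ≤ nrm s + nrm t
    nrm-tri s t = begin
      nrm (s +ᶻ t) ≤⟨ Σp-mono (λ x → ∧-not-trans (f x) (f (x +ᶻ s)) (f (x +ᶻ (s +ᶻ t)))) ⟩
      Σp (λ x → ι (f x ∧ not (f (x +ᶻ s))) + ι (f (x +ᶻ s) ∧ not (f (x +ᶻ (s +ᶻ t))))) ≡⟨ Σp-+ _ _ ⟩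
      nrm s + Σp (λ x → ι (f (x +ᶻ s) ∧ not (f (x +ᶻ (s +ᶻ t)))))
        ≡⟨ cong (nrm s +_) (Σp-cong (λ x → cong (λ y → ι (f (x +ᶻ s) ∧ not (f y))) (sym (ℤP.+-assoc x s t)))) ⟩
      nrm s + Σp (λ x → ι (f (x +ᶻ s) ∧ not (f ((x +ᶻ s) +ᶻ t))))
        ≡⟨ cong (nrm s +_) (Σp-shift {λ y → ι (f y ∧ not (f (y +ᶻ t)))} (λ e → cong₂ (λ a b → ι (a ∧ not b)) (fp e) (fp (≈-+ e ≈-refl))) s) ⟩
      nrm s + nrm t ∎
      where open ≤-Reasoning

    cor-neg : ∀ t → cor (-ᶻ t) ≡ cor t
    cor-neg t = begin
      Σp (λ x → ι (f x ∧ f (x +ᶻ -ᶻ t)))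
        ≡⟨ Σp-cong (λ x → cong (λ y → ι y) (trans (∧-comm' (f x) _) (cong (λ y → f (x +ᶻ -ᶻ t) ∧ f y) (sym (+ᶻ-invʳ x t))))) ⟩
      Σp (λ x → ι (f (x +ᶻ -ᶻ t) ∧ f ((x +ᶻ -ᶻ t) +ᶻ t)))
        ≡⟨ Σp-shift {λ y → ι (f y ∧ f (y +ᶻ t))} (λ e → cong₂ (λ a b → ι (a ∧ b)) (fp e) (fp (≈-+ e ≈-refl))) (-ᶻ t) ⟩
      cor t ∎
      where open ≡-Reasoning

    nrm-neg : ∀ t → nrm (-ᶻ t) ≡ nrm t
    nrm-neg t = +-cancelˡ-≡ (cor t) _ _ (trans (cong (_+ nrm (-ᶻ t)) (sym (cor-neg t))) (trans (cor+nrm (-ᶻ t)) (sym (cor+nrm t))))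

    nrm-mul : ∀ j t → nrm (pos j *ᶻ t) ≤ j * nrm t
    nrm-mul zero    t = ≤-reflexive (trans (cong nrm (ℤP.*-zeroˡ t)) nrm-0)
    nrm-mul (suc j) t = ≤-trans (≤-reflexive (cong nrm (ℤP.suc-* (pos j) t))) (≤-trans (nrm-tri t (pos j *ᶻ t)) (+-monoʳ-≤ (nrm t) (nrm-mul j t)))

    Σcor : Σp cor ≡ size f * size f
    Σcor = begin
      Σp (λ t → Σp (λ x → ι (f x ∧ f (x +ᶻ t))))     ≡⟨ Σp-swap _ ⟩
      Σp (λ x → Σp (λ t → ι (f x ∧ f (x +ᶻ t))))     ≡⟨ Σp-cong (λ x → Σp-cong (λ t → trans (ι-∧ (f x) _) (cong (λ y → ι (f x) * ι (f y)) (ℤP.+-comm x t)))) ⟩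
      Σp (λ x → Σp (λ t → ι (f x) * ι (f (t +ᶻ x)))) ≡⟨ Σp-cong (λ x → trans (Σp-*ˡ (ι (f x)) _) (cong (ι (f x) *_) (Σp-shift {λ y → ι (f y)} (λ e → cong ι (fp e)) x))) ⟩
      Σp (λ x → ι (f x) * size f)                    ≡⟨ Σp-*ʳ (size f) _ ⟩
      size f * size f                                ∎
      where open ≡-Reasoning

    vol : ℕ → ℕ
    vol r = Σp (λ x → ι ⌊ nrm x ≤? r ⌋)

    -- An element of the ball has correlation at least `size f - r`, and all correlations add up to
    -- the square of `size f`.
    vol-upper : ∀ r → vol r * size f ≤ size f * size f + vol r * r
    vol-upper r = begin
      vol r * size f                                    ≡⟨ Σp-*ʳ (size f) _ ⟨
      Σp (λ x → ι ⌊ nrm x ≤? r ⌋ * size f)              ≤⟨ Σp-mono pw ⟩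
      Σp (λ x → cor x + ι ⌊ nrm x ≤? r ⌋ * r)           ≡⟨ Σp-+ _ _ ⟩
      Σp cor + Σp (λ x → ι ⌊ nrm x ≤? r ⌋ * r)          ≡⟨ cong₂ _+_ Σcor (Σp-*ʳ r _) ⟩
      size f * size f + vol r * r                       ∎
      where
      open ≤-Reasoning
      pw : ∀ x → ι ⌊ nrm x ≤? r ⌋ * size f ≤ cor x + ι ⌊ nrm x ≤? r ⌋ * r
      pw x with nrm x ≤? r
      ... | yes l = subst₂ _≤_ (trans (cor+nrm x) (sym (+-identityʳ _))) (cong (cor x +_) (sym (+-identityʳ r))) (+-monoʳ-≤ (cor x) l)
      ... | no _  = z≤n

    multiple : ∀ {x₀} → Unit x₀ → ∀ y → ∃[ n ] (y ≈ pos n *ᶻ x₀)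
    multiple {x₀} u y with inverse u
    ... | w , e = (y *ᶻ w) %ℕ p , ≈-trans (≈-sym (inverse-cancel w x₀ (≈-trans (≈-reflexive (ℤP.*-comm w x₀)) e) y)) (≈-*ʳ x₀ (≈-residue (y *ᶻ w)))

    -- Walking along the multiples of x₀, the norm changes by at most k per step.
    crossing : ∀ {x₀ k r} → Unit x₀ → nrm x₀ ≤ k → ∀ {y} → r < nrm y → ∃[ z ] (r < nrm z × nrm z ≤ r + k)
    crossing {x₀} {k} {r} u l {y} gt with multiple u y
    ... | n , e = go n (subst (r <_) (nrm-per e) gt)
      where
      go : ∀ n → r < nrm (pos n *ᶻ x₀) → ∃[ z ] (r < nrm z × nrm z ≤ r + k)
      go zero    g = contradiction (subst (r <_) (trans (cong nrm (ℤP.*-zeroˡ x₀)) nrm-0) g) λ ()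
      go (suc n) g with r <? nrm (pos n *ᶻ x₀)
      ... | yes h = go n h
      ... | no  h = pos (suc n) *ᶻ x₀ , g , ≤-trans (≤-reflexive (cong nrm (ℤP.suc-* (pos n) x₀)))
                      (≤-trans (nrm-tri x₀ _) (≤-trans (+-mono-≤ l (≮⇒≥ h)) (≤-reflexive (+-comm k r))))

    -- `crossing` finds `z` with norm above `r + k` and at most `r + 2 k`. The ball of radius `r`
    -- about 0 and that of radius `k` about `z` are disjoint and lie in the ball of radius
    -- `r + 3 k`.
    vol-step : ∀ {x₀ k r} → Unit x₀ → nrm x₀ ≤ k → ∀ {y} → r + k < nrm y → vol r + vol k ≤ vol (r + 3 * k)
    vol-step {x₀} {k} {r} u l gt with crossing u l gt
    ... | z , z> , z≤ = begin
      vol r + vol k                                               ≡⟨ cong (vol r +_) (Σp-shift {λ x → ι ⌊ nrm x ≤? k ⌋} (λ e → cong (λ v → ι ⌊ v ≤? k ⌋) (nrm-per e)) (-ᶻ z)) ⟨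
      vol r + Σp (λ x → ι ⌊ nrm (x -ᶻ z) ≤? k ⌋)                  ≡⟨ Σp-+ _ _ ⟨
      Σp (λ x → ι ⌊ nrm x ≤? r ⌋ + ι ⌊ nrm (x -ᶻ z) ≤? k ⌋)       ≤⟨ Σp-mono pw ⟩
      vol (r + 3 * k)                                             ∎
      where
      open ≤-Reasoning
      e1 : ∀ x z → x ≡ (x -ᶻ z) +ᶻ z
      e1 = solveℤ
      e2 : ∀ x z → z ≡ x +ᶻ -ᶻ (x -ᶻ z)
      e2 = solveℤ
      arith : ∀ r k → k + (r + k + k) ≡ r + 3 * k
      arith = solveℕ
      pw : ∀ x → ι ⌊ nrm x ≤? r ⌋ + ι ⌊ nrm (x -ᶻ z) ≤? k ⌋ ≤ ι ⌊ nrm x ≤? (r + 3 * k) ⌋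
      pw x with nrm x ≤? r | nrm (x -ᶻ z) ≤? k
      ... | yes a | yes b = contradiction z> (≤⇒≯ (≤-trans (≤-reflexive (cong nrm (e2 x z))) (≤-trans (nrm-tri x _) (+-mono-≤ a (≤-trans (≤-reflexive (nrm-neg (x -ᶻ z))) b)))))
      ... | yes a | no _  = ≤-reflexive (sym (ι-yes (nrm x ≤? (r + 3 * k)) (≤-trans a (m≤m+n r _))))
      ... | no _  | yes b = ≤-reflexive (sym (ι-yes (nrm x ≤? (r + 3 * k)) (≤-trans (≤-reflexive (cong nrm (e1 x z))) (≤-trans (nrm-tri (x -ᶻ z) z) (≤-trans (+-mono-≤ b z≤) (≤-reflexive (arith r k)))))))
      ... | no _  | no _  = z≤n

    -- If a unit had norm 0, so would all its multiples, that is all residues. Every correlation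
    -- would equal the size of the set, and their sum would force this size to be `p`.
    nrm-positive : ∀ {x₀} → Unit x₀ → 0 < size f → size f < p → 1 ≤ nrm x₀
    nrm-positive {x₀} u 0<s s<p with nrm x₀ in eq
    ... | suc _ = s≤s z≤n
    ... | zero = contradiction s<p (<-irrefl (sym (*-cancelʳ-≡ p (size f) (size f) {{>-nonZero 0<s}} (trans (sym (Σp-const (size f))) (trans (Σp-cong (sym ∘ all)) Σcor)))))
      where
      all : ∀ y → cor y ≡ size f
      all y with multiple u y
      ... | n , e = trans (sym (+-identityʳ _)) (trans (cong (cor y +_) (sym (n≤0⇒n≡0 (≤-trans (≤-reflexive (nrm-per e)) (≤-trans (nrm-mul n x₀) (≤-reflexive (trans (cong (n *_) eq) (*-zeroʳ n)))))))) (cor+nrm y))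

    vol-half : ∀ R → 2 * R ≤ size f → 0 < size f → vol R ≤ 2 * size f
    vol-half R 2R≤s 0<s = *-cancelʳ-≤ (vol R) (2 * s) s {{>-nonZero 0<s}} (+-cancelʳ-≤ (vol R * s) _ _ (≤-trans (≤-reflexive (f2 (vol R * s))) (≤-trans arith (≤-reflexive (cong (_+ vol R * s) (sym (*-assoc 2 s s)))))))
      where
      s = size f
      f2 : ∀ a → a + a ≡ 2 * a
      f2 = solveℕ
      arith : 2 * (vol R * s) ≤ 2 * (s * s) + vol R * s
      arith = ≤-trans (*-monoʳ-≤ 2 (vol-upper R)) (≤-trans (≤-reflexive (*-distribˡ-+ 2 (s * s) _))
         (+-monoʳ-≤ (2 * (s * s)) (≤-trans (≤-reflexive (trans (sym (*-assoc 2 (vol R) R)) (trans (cong (_* R) (*-comm 2 (vol R))) (*-assoc (vol R) 2 R)))) (*-monoʳ-≤ (vol R) 2R≤s))))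

    far : ∀ R → 2 * R ≤ size f → 0 < size f → 2 * size f < p → ∃[ y ] (R < nrm y)
    far R 2R≤s 0<s 2s<p with ∑-<⇒∃ p (λ i → ι ⌊ nrm (pos i) ≤? R ⌋) (λ _ → 1)
      (subst₂ _<_ (Σp-def _) (sym (trans (∑-const p 1) (*-identityʳ p))) (≤-<-trans (vol-half R 2R≤s 0<s) 2s<p))
    ... | i , _ , l = pos i , ≰⇒> (λ le → contradiction (subst (_< 1) (ι-yes (nrm (pos i) ≤? R) le) l) (<-irrefl refl))

    vol-iterate : ∀ {x₀ k R} → Unit x₀ → nrm x₀ ≤ k → ∃[ y ] (R < nrm y) → ∀ j → (3 * j + 1) * k ≤ R → suc j * vol k ≤ vol ((3 * j + 1) * k)
    vol-iterate {k = k} u l far zero    le = ≤-reflexive (trans (+-identityʳ (vol k)) (cong vol (sym (+-identityʳ k))))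
    vol-iterate {x₀} {k} {R} u l (y , far) (suc j) le = begin
      vol k + suc j * vol k            ≡⟨ +-comm (vol k) _ ⟩
      suc j * vol k + vol k            ≤⟨ +-monoˡ-≤ (vol k) (vol-iterate u l (y , far) j (≤-trans (≤-trans (m≤m+n _ k) k≤) le)) ⟩
      vol ((3 * j + 1) * k) + vol k    ≤⟨ vol-step u l (≤-<-trans (≤-trans k≤ le) far) ⟩
      vol ((3 * j + 1) * k + 3 * k)    ≡⟨ cong vol (e j k) ⟩
      vol ((3 * suc j + 1) * k)        ∎
      where
      open ≤-Reasoning
      e : ∀ j k → (3 * j + 1) * k + 3 * k ≡ (3 * suc j + 1) * k
      e = solveℕ
      e2 : ∀ j k → (3 * suc j + 1) * k ≡ ((3 * j + 1) * k + k) + 2 * k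
      e2 = solveℕ
      k≤ : (3 * j + 1) * k + k ≤ (3 * suc j + 1) * k
      k≤ = ≤-trans (m≤m+n _ (2 * k)) (≤-reflexive (sym (e2 j k)))

    -- By `vol-iterate` about `s / (8 k)` times the volume of the ball of radius `k` fits into a
    -- ball of radius at most `s / 2`, which has at most `2 s` elements by `vol-half`.
    vol-linear : ∀ {x₀ k} → Unit x₀ → nrm x₀ ≤ k → 8 * k ≤ size f → 0 < size f → 2 * size f < p → vol k ≤ 16 * k
    vol-linear {k = zero} u l _ 0<s 2s<p = contradiction (≤-trans (nrm-positive u 0<s (≤-<-trans (m≤m+n (size f) _) 2s<p)) l) λ ()
    vol-linear {k = k@(suc k')} u l 8k≤s 0<s 2s<p = <⇒≤ (*-cancelˡ-< (suc j) (vol k) (16 * k) (≤-<-trans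
        (≤-trans (vol-iterate {R = R} u l (far R 2R≤s 0<s 2s<p) j ≤-refl) (vol-half R 2R≤s 0<s))
        (<-≤-trans (*-monoʳ-< 2 s<) (≤-reflexive (e j k)))))
      where
      open ≤-Reasoning
      s = size f
      j = s / (8 * k)
      R = (3 * j + 1) * k
      e : ∀ j k → 2 * (suc j * (8 * k)) ≡ suc j * (16 * k)
      e = solveℕ
      s< : s < suc j * (8 * k)
      s< = begin-strict
        s                                    ≡⟨ m≡m%n+[m/n]*n s (8 * k) ⟩
        s % (8 * k) + j * (8 * k)            <⟨ +-monoˡ-< (j * (8 * k)) (m%n<n s (8 * k)) ⟩
        8 * k + j * (8 * k)                  ∎
      e3 : ∀ j k → 4 * (2 * ((3 * j + 1) * k)) ≡ 3 * (j * (8 * k)) + 8 * k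
      e3 = solveℕ
      2R≤s : 2 * R ≤ s
      2R≤s = *-cancelˡ-≤ 4 (begin
        4 * (2 * R)                  ≡⟨ e3 j k ⟩
        3 * (j * (8 * k)) + 8 * k    ≤⟨ +-mono-≤ (*-monoʳ-≤ 3 (m/n*n≤m s (8 * k))) 8k≤s ⟩
        3 * s + s                    ≡⟨ +-comm (3 * s) s ⟩
        4 * s                        ∎)

  -- Zero-sum-free lists and their sets of sums

  -- A subsequence is non-empty if some z in it can be moved to the front of zs.
  ZSF : List ℤ → Set
  ZSF zs = ∀ {z zs' v} → zs ↭ z ∷ zs' → SS zs' v → ¬ (z +ᶻ v ≈ pos 0)

  Mult : ℕ → List ℤ → Set
  Mult m zs = ∀ a → # (λ z → δ (z -ᶻ a)) zs ≤ m

  ZSF-↭ : ∀ {xs ys} → xs ↭ ys → ZSF xs → ZSF ys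
  ZSF-↭ r zsf r' = zsf (↭-trans r r')

  ZSF-++ʳ : ∀ xs {ys} → ZSF (xs ++ ys) → ZSF ys
  ZSF-++ʳ xs {ys} zsf {z} {zs'} r s = zsf {z} {xs ++ zs'} (↭-trans (↭P.++⁺ˡ xs r) (↭P.shift z xs zs')) (SS-weakenˡ xs s)

  ZSF-++ˡ : ∀ {xs} ys → ZSF (xs ++ ys) → ZSF xs
  ZSF-++ˡ {xs} ys zsf = ZSF-++ʳ ys (ZSF-↭ (↭P.++-comm xs ys) zsf)

  ZSF-unit : ∀ {zs} → ZSF zs → All Unit zs
  ZSF-unit {[]} zsf = []
  ZSF-unit {z ∷ zs} zsf = (λ e → zsf {z} {zs} ↭-refl (SS-empty zs) (≈-trans (≈-reflexive (ℤP.+-identityʳ z)) e)) ∷ ZSF-unit (ZSF-++ʳ (z ∷ []) zsf)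

  Mult-↭ : ∀ {m xs ys} → xs ↭ ys → Mult m xs → Mult m ys
  Mult-↭ r mu a = ≤-trans (≤-reflexive (#-↭ _ (↭-sym r))) (mu a)

  Mult-++ʳ : ∀ {m} xs {ys} → Mult m (xs ++ ys) → Mult m ys
  Mult-++ʳ xs {ys} mu a = ≤-trans (≤-trans (m≤n+m _ _) (≤-reflexive (sym (#-++ _ xs ys)))) (mu a)

  Mult-++ˡ : ∀ {m xs} ys → Mult m (xs ++ ys) → Mult m xs
  Mult-++ˡ {xs = xs} ys mu a = ≤-trans (≤-trans (m≤m+n _ _) (≤-reflexive (sym (#-++ _ xs ys)))) (mu a)

  sums : List ℤ → ℤ → Bool
  sums []      x = δ x
  sums (z ∷ F) x = sums F x ∨ sums F (x -ᶻ z)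

  sums-per : ∀ F → Per (sums F)
  sums-per []      e = δ-per e
  sums-per (z ∷ F) e = cong₂ _∨_ (sums-per F e) (sums-per F (≈-minus e ≈-refl))

  sums-sound : ∀ F {x} → sums F x ≡ true → ∃[ v ] (SS F v × v ≈ x)
  sums-sound [] e = pos 0 , [] , ≈-sym (δ-sound e)
  sums-sound (z ∷ F) {x} e with sums F x in eq
  ... | true with sums-sound F eq
  ...   | v , s , q = v , skip s , q
  sums-sound (z ∷ F) {x} e | false with sums-sound F e
  ...   | v , s , q = z +ᶻ v , take s , ≈-trans (≈-+ (≈-refl {z}) q) (≈-reflexive (f z x))
    where
    f : ∀ z x → z +ᶻ (x -ᶻ z) ≡ x
    f = solveℤ

  module NormOf (F : List ℤ) = Norm (sums F) (sums-per F)
  open NormOf using () renaming (nrm to nrmOf) public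

  ∣Σ_∣ : List ℤ → ℕ
  ∣Σ F ∣ = size (sums F)

  ∣Σ[]∣ : ∣Σ [] ∣ ≡ 1
  ∣Σ[]∣ = trans (Σp-cong (λ x → cong (λ y → ι (δ y)) (sym (ℤP.+-identityʳ x)))) (Σp-δ1 (pos 0))

  -- The sums that use `z` form a shifted copy of the old set, and the norm of `z` counts those that
  -- are new.
  ∣Σ∷∣ : ∀ z F → ∣Σ z ∷ F ∣ ≡ ∣Σ F ∣ + nrmOf F z
  ∣Σ∷∣ z F = begin
    Σp (λ x → ι (f x ∨ f (x -ᶻ z)))                    ≡⟨ Σp-cong (λ x → ∨-not (f x) (f (x -ᶻ z))) ⟩
    Σp (λ x → ι (f x) + ι (f (x -ᶻ z) ∧ not (f x)))    ≡⟨ Σp-+ _ _ ⟩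
    ∣Σ F ∣ + Σp (λ x → ι (f (x -ᶻ z) ∧ not (f x)))     ≡⟨ cong (∣Σ F ∣ +_) (Σp-cong (λ x → cong (λ y → ι (f (x -ᶻ z) ∧ not (f y))) (sym (+ᶻ-invʳ x z)))) ⟩
    ∣Σ F ∣ + Σp (λ x → ι (f (x -ᶻ z) ∧ not (f ((x -ᶻ z) +ᶻ z))))
      ≡⟨ cong (∣Σ F ∣ +_) (Σp-shift {λ y → ι (f y ∧ not (f (y +ᶻ z)))} (λ e → cong₂ (λ a b → ι (a ∧ not b)) (sums-per F e) (sums-per F (≈-+ e ≈-refl))) (-ᶻ z)) ⟩
    ∣Σ F ∣ + nrmOf F z                                 ∎
    where
    open ≡-Reasoning
    f = sums F
    ∨-not : ∀ a b → ι (a ∨ b) ≡ ι a + ι (b ∧ not a)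
    ∨-not true  true  = refl
    ∨-not true  false = refl
    ∨-not false true  = refl
    ∨-not false false = refl

  size≤p : ∀ f → size f ≤ p
  size≤p f = ≤-trans (Σp-mono (λ x → ι≤1 (f x))) (≤-reflexive (trans (Σp-const 1) (*-identityʳ p)))

  ∣Σ∣>0 : ∀ F → 0 < ∣Σ F ∣
  ∣Σ∣>0 []      = subst (0 <_) (sym ∣Σ[]∣) (s≤s z≤n)
  ∣Σ∣>0 (z ∷ F) = <-≤-trans (∣Σ∣>0 F) (≤-trans (m≤m+n _ _) (≤-reflexive (sym (∣Σ∷∣ z F))))

  1≉0 : ¬ (pos 1 ≈ pos 0)
  1≉0 = go p' pr {refl}
    where
    go : ∀ q → Prime (suc q) → {_ : q ≡ p'} → ¬ (pos 1 ≈ pos 0)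
    go zero    pr' _ = ¬prime[1] pr'
    go (suc q) pr' {e} c = contradiction (small-unique (s≤s (subst (1 ≤_) e (s≤s z≤n))) (s≤s z≤n) c) λ ()

  -1-unit : Unit (-ᶻ pos 1)
  -1-unit e = 1≉0 (≈-neg { -ᶻ pos 1} {pos 0} e)

  -- The sums of F and the negatives of the sums of R only have 0 in common.
  ∣Σ∣-disjoint : ∀ F R → ZSF (F ++ R) → ∣Σ F ∣ + ∣Σ R ∣ ≤ p + 1
  ∣Σ∣-disjoint F R zsf = begin
    ∣Σ F ∣ + ∣Σ R ∣                                          ≡⟨ cong (∣Σ F ∣ +_) (Σp-dilate {λ x → ι (sums R x)} (λ e → cong ι (sums-per R e)) -1-unit) ⟨
    ∣Σ F ∣ + Σp (λ x → ι (sums R (x *ᶻ (-ᶻ pos 1))))         ≡⟨ Σp-+ _ _ ⟨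
    Σp (λ x → ι (sums F x) + ι (sums R (x *ᶻ (-ᶻ pos 1))))   ≤⟨ Σp-mono pw ⟩
    Σp (λ x → 1 + ι (δ x))                                   ≡⟨ Σp-+ _ _ ⟩
    Σp (λ _ → 1) + ∣Σ [] ∣                                   ≡⟨ cong₂ _+_ (trans (Σp-const 1) (*-identityʳ p)) ∣Σ[]∣ ⟩
    p + 1                                                    ∎
    where
    open ≤-Reasoning
    neg : ∀ x → x *ᶻ (-ᶻ pos 1) ≡ -ᶻ x
    neg = solveℤ
    e0 : ∀ z v w → z +ᶻ (v +ᶻ w) ≡ (z +ᶻ v) +ᶻ w
    e0 = solveℤ
    pw : ∀ x → ι (sums F x) + ι (sums R (x *ᶻ (-ᶻ pos 1))) ≤ 1 + ι (δ x)
    pw x with sums F x in eF | sums R (x *ᶻ (-ᶻ pos 1)) in eR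
    ... | false | b     = ≤-trans (ι≤1 b) (s≤s z≤n)
    ... | true  | false = s≤s z≤n
    ... | true  | true with sums-sound F eF | sums-sound R eR
    ... | v , sF , vx | w , sR , wx with SS-split sF
    ... | inj₁ refl = s≤s (≤-reflexive (sym (cong ι (δ-true {x} (≈-sym vx)))))
    ... | inj₂ (z , F' , v' , r , s , refl) = contradiction
        (≈-trans (≈-reflexive (e0 z v' w)) (≈-trans (≈-+ vx (≈-trans wx (≈-reflexive (neg x)))) (≈-reflexive (ℤP.+-inverseʳ x))))
        (zsf {z} {F' ++ R} (↭P.++⁺ʳ R r) (SS-++ s sR))

  length≤m*vol : ∀ {m R} f (fp : Per f) k → Mult m R → All (λ z → Norm.nrm f fp z ≤ k) R → length R ≤ m * Norm.vol f fp k
  length≤m*vol {m} {R} f fp k mu al = begin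
    length R                                                           ≡⟨ trans (∑ᴸ-const 1 R) (*-identityʳ _) ⟨
    ∑ᴸ (λ _ → 1) R                                                     ≤⟨ ∑ᴸ-mono (AllL.map (λ {z} l → ≤-reflexive (sym (one z l))) al) ⟩
    ∑ᴸ (λ z → Σp (λ x → ι ⌊ nrm x ≤? k ⌋ * ι (δ (z -ᶻ x)))) R          ≡⟨ trans (∑ᴸ-cong (λ z → Σp-def _) R) (∑ᴸ-∑ p (λ z i → ι ⌊ nrm (pos i) ≤? k ⌋ * ι (δ (z -ᶻ pos i))) R) ⟩
    ∑ p (λ i → ∑ᴸ (λ z → ι ⌊ nrm (pos i) ≤? k ⌋ * ι (δ (z -ᶻ pos i))) R) ≤⟨ ∑-mono p (λ i → ≤-trans (≤-reflexive (∑ᴸ-*ˡ (ι ⌊ nrm (pos i) ≤? k ⌋) _ R)) (*-monoʳ-≤ (ι ⌊ nrm (pos i) ≤? k ⌋) (mu (pos i)))) ⟩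
    ∑ p (λ i → ι ⌊ nrm (pos i) ≤? k ⌋ * m)                             ≡⟨ trans (∑-*ʳ p m (λ i → ι ⌊ nrm (pos i) ≤? k ⌋)) (trans (*-comm _ m) (cong (m *_) (sym (Σp-def _)))) ⟩
    m * vol k                                                          ∎
    where
    open Norm f fp
    open ≤-Reasoning
    sym-δ : ∀ z x → δ (z -ᶻ x) ≡ δ (x -ᶻ z)
    sym-δ z x with (z -ᶻ x) ≈? pos 0
    ... | yes e = trans (δ-true e) (sym (δ-true (≈⇒≈0 (≈-sym (≈0⇒≈ {z} {x} e)))))
    ... | no ne = trans (δ-false ne) (sym (δ-false (λ e → ne (≈⇒≈0 (≈-sym (≈0⇒≈ {x} {z} e))))))
    one : ∀ z → nrm z ≤ k → Σp (λ x → ι ⌊ nrm x ≤? k ⌋ * ι (δ (z -ᶻ x))) ≡ 1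
    one z l = trans (Σp-cong (λ x → cong (λ b → ι ⌊ nrm x ≤? k ⌋ * ι b) (sym-δ z x)))
      (trans (Σp-δ {λ x → ι ⌊ nrm x ≤? k ⌋} (λ e → cong (λ v → ι ⌊ v ≤? k ⌋) (nrm-per e)) z) (ι-yes (nrm z ≤? k) l))

  -- `cost` says that at most `T / k + 1` elements are moved: each contributes at least `k` sums,
  -- and there are fewer than `T` before the last move.
  record Stage (k T : ℕ) (F R : List ℤ) : Set where
    field
      F' R'  : List ℤ
      perm   : F ++ R ↭ F' ++ R'
      cost   : length F' * k ≤ length F * k + (T + k)
      mono   : ∣Σ F ∣ ≤ ∣Σ F' ∣
      goal   : (T ≤ ∣Σ F' ∣) ⊎ All (λ z → nrmOf F' z < k) R'

  -- Elements that enlarge the set of sums by at least k are moved from R to F until this set has T elements.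
  stage : ∀ k T F R → Stage k T F R
  stage k T F R = finish (go (length R) F R refl)
    where
    -- The induction needs the summand `∣Σ F ∣` on the left. It may be too large if nothing is
    -- moved, hence the second alternative.
    Bound : List ℤ → List ℤ → Set
    Bound F F' = (length F' * k + ∣Σ F ∣ ≤ length F * k + (T + k)) ⊎ (F' ≡ F)
    Res : List ℤ → List ℤ → Set
    Res F R = ∃[ F' ] ∃[ R' ] (F ++ R ↭ F' ++ R' × Bound F F' × ∣Σ F ∣ ≤ ∣Σ F' ∣ × ((T ≤ ∣Σ F' ∣) ⊎ All (λ z → nrmOf F' z < k) R'))
    finish : Res F R → Stage k T F R
    finish (F' , R' , r , inj₁ b , mo , g) = record { F' = F' ; R' = R' ; perm = r ; cost = ≤-trans (m≤m+n _ _) b ; mono = mo ; goal = g }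
    finish (F' , R' , r , inj₂ refl , mo , g) = record { F' = F' ; R' = R' ; perm = r ; cost = m≤m+n _ _ ; mono = mo ; goal = g }
    go : ∀ n F R → length R ≡ n → Res F R
    go n F R len with T ≤? ∣Σ F ∣
    ... | yes l = F , R , ↭-refl , inj₂ refl , ≤-refl , inj₁ l
    ... | no nl with first (λ z → ⌊ k ≤? nrmOf F z ⌋) R
    ... | inj₂ al = F , R , ↭-refl , inj₂ refl , ≤-refl , inj₂ (AllL.map (λ {z} e → ≰⇒> (⌊⌋-unsound (k ≤? nrmOf F z) e)) al)
    go zero F R len | no nl | inj₁ (z , R₁ , r , e) = contradiction (trans (sym (↭-length r)) len) λ ()
    go (suc n) F R len | no nl | inj₁ (z , R₁ , r , e) with go n (z ∷ F) R₁ (suc-injective (trans (sym (↭-length r)) len))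
    ... | F' , R' , r' , b , mo , g = F' , R' , ↭-trans (shift↭ {F = F} r) r' , inj₁ (bd b) , ≤-trans (≤-trans (m≤m+n _ k) grow) mo , g
      where
      grow : ∣Σ F ∣ + k ≤ ∣Σ z ∷ F ∣
      grow = ≤-trans (+-monoʳ-≤ ∣Σ F ∣ (⌊⌋-sound (k ≤? nrmOf F z) e)) (≤-reflexive (sym (∣Σ∷∣ z F)))
      ea : ∀ a k b → a + (b + k) ≡ (a + b) + k
      ea = solveℕ
      eb : ∀ k a c → (k + a) + c ≡ (a + c) + k
      eb = solveℕ
      ec : ∀ k a c → (k + a) + c ≡ a + (c + k)
      ec = solveℕ
      bd : Bound (z ∷ F) F' → length F' * k + ∣Σ F ∣ ≤ length F * k + (T + k)
      bd (inj₂ refl) = ≤-trans (≤-reflexive (ec k (length F * k) ∣Σ F ∣)) (+-monoʳ-≤ (length F * k) (+-monoˡ-≤ k (<⇒≤ (≰⇒> nl))))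
      bd (inj₁ h) = +-cancelʳ-≤ k _ _ (≤-trans (≤-reflexive (sym (ea (length F' * k) k ∣Σ F ∣))) (≤-trans (+-monoʳ-≤ (length F' * k) grow) (≤-trans h (≤-reflexive (eb k (length F * k) (T + k))))))

  -- Smoothed dilates of a set and their averages

  sq : ℕ → ℕ
  sq a = a * a

  sq-diff : ∀ a b → sq ∣ a - b ∣ + 2 * (a * b) ≡ a * a + b * b
  sq-diff a b with ≤-total a b
  ... | inj₁ l with m≤n⇒∃[o]m+o≡n l
  ...   | o , refl = trans (cong (λ d → sq d + 2 * (a * (a + o))) (∣m-m+n∣≡n a o)) (e a o)
    where
    e : ∀ a o → o * o + 2 * (a * (a + o)) ≡ a * a + (a + o) * (a + o)
    e = solveℕ
  sq-diff a b | inj₂ l with m≤n⇒∃[o]m+o≡n l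
  ...   | o , refl = trans (cong (λ d → sq d + 2 * ((b + o) * b)) (trans (∣-∣-comm (b + o) b) (∣m-m+n∣≡n b o))) (e b o)
    where
    e : ∀ b o → o * o + 2 * ((b + o) * b) ≡ (b + o) * (b + o) + b * b
    e = solveℕ

  sq-triangle : ∀ a b c → sq ∣ a - c ∣ ≤ 2 * sq ∣ a - b ∣ + 2 * sq ∣ b - c ∣
  sq-triangle a b c = ≤-trans (*-mono-≤ (∣-∣-triangle a b c) (∣-∣-triangle a b c)) (two ∣ a - b ∣ ∣ b - c ∣)
    where
    e : ∀ x y → (x + y) * (x + y) ≡ x * x + y * y + 2 * (x * y)
    e = solveℕ
    e' : ∀ x y → 2 * (x * x) + 2 * (y * y) ≡ x * x + y * y + (x * x + y * y)
    e' = solveℕ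
    two : ∀ x y → (x + y) * (x + y) ≤ 2 * sq x + 2 * sq y
    two x y = ≤-trans (≤-reflexive (e x y)) (≤-trans (+-monoʳ-≤ (x * x + y * y) (≤-trans (m≤n+m _ (sq ∣ x - y ∣)) (≤-reflexive (sq-diff x y)))) (≤-reflexive (sym (e' x y))))

  Σp-prod : ∀ (g h : ℤ → ℕ) → Σp g * Σp h ≡ Σp (λ x → Σp (λ y → g x * h y))
  Σp-prod g h = trans (sym (Σp-*ʳ (Σp h) g)) (Σp-cong (λ x → sym (Σp-*ˡ (g x) h)))

  -- The set f is compared with its dilates b·f through the smoothed functions G b; the shape g of the
  -- smoothing kernel only matters through its norm.  The averages over b are computed from the
  -- fact that b ↦ b v is equidistributed for every v ≢ 0.
  module Smooth (f : ℤ → Bool) (fp : Per f) (g : ℤ → Bool) (gp : Per g) where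
    open Norm f fp using () renaming (cor to corF; nrm to nrmF; cor+nrm to cor+nrmF; nrm-0 to nrmF-0; cor-neg to corF-neg)
    open Norm g gp using () renaming (cor to corG; nrm to nrmG; cor+nrm to cor+nrmG; Σcor to ΣcorG; nrm-0 to nrmG-0; cor-per to corG-per)

    s L Λ : ℕ
    s = size f
    L = size g
    Λ = Σp nrmG

    F I : ℤ → ℕ
    F x = ι (f x)
    I x = ι (g x)

    Iper : Per I
    Iper e = cong ι (gp e)

    G : ℤ → ℤ → ℕ
    G b z = Σp (λ x → F x * I (b *ᶻ x +ᶻ z))

    G-per : ∀ b → Per (G b)
    G-per b e = Σp-cong (λ x → cong (F x *_) (Iper (≈-+ (≈-refl {b *ᶻ x}) e)))

    -- `D b t` is the squared L²-distance of `G b` from its shift by `t`, and `R b` is the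
    -- autocorrelation of `G b`. Squares cost a factor 2 in the triangle inequality, but their
    -- averages over `b` can be computed exactly.
    D R : ℤ → ℤ → ℕ
    D b t = Σp (λ z → sq ∣ G b z - G b (z +ᶻ t) ∣)
    R b t = Σp (λ z → G b z * G b (z +ᶻ t))

    D-per : ∀ b → Per (D b)
    D-per b e = Σp-cong (λ z → cong (λ w → sq ∣ G b z - w ∣) (G-per b (≈-+ (≈-refl {z}) e)))

    D-tri : ∀ b t u → D b (t +ᶻ u) ≤ 2 * D b t + 2 * D b u
    D-tri b t u = begin
      D b (t +ᶻ u) ≤⟨ Σp-mono (λ z → sq-triangle (G b z) (G b (z +ᶻ t)) (G b (z +ᶻ (t +ᶻ u)))) ⟩
      Σp (λ z → 2 * sq ∣ G b z - G b (z +ᶻ t) ∣ + 2 * sq ∣ G b (z +ᶻ t) - G b (z +ᶻ (t +ᶻ u)) ∣) ≡⟨ trans (Σp-+ _ _) (cong₂ _+_ (Σp-*ˡ 2 _) (Σp-*ˡ 2 _)) ⟩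
      2 * D b t + 2 * Σp (λ z → sq ∣ G b (z +ᶻ t) - G b (z +ᶻ (t +ᶻ u)) ∣)
        ≡⟨ cong (λ w → 2 * D b t + 2 * w) (trans (Σp-cong (λ z → cong (λ w → sq ∣ G b (z +ᶻ t) - G b w ∣) (sym (ℤP.+-assoc z t u))))
            (Σp-shift {λ z → sq ∣ G b z - G b (z +ᶻ u) ∣} (λ e → cong₂ (λ v w → sq ∣ v - w ∣) (G-per b e) (G-per b (≈-+ e ≈-refl))) t)) ⟩
      2 * D b t + 2 * D b u ∎
      where open ≤-Reasoning

    D-neg : ∀ b t → D b (-ᶻ t) ≡ D b t
    D-neg b t = begin
      Σp (λ z → sq ∣ G b z - G b (z +ᶻ -ᶻ t) ∣)
        ≡⟨ Σp-cong (λ z → trans (cong sq (∣-∣-comm (G b z) _)) (cong (λ y → sq ∣ G b (z +ᶻ -ᶻ t) - G b y ∣) (sym (+ᶻ-invʳ z t)))) ⟩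
      Σp (λ z → sq ∣ G b (z +ᶻ -ᶻ t) - G b ((z +ᶻ -ᶻ t) +ᶻ t) ∣)
        ≡⟨ Σp-shift {λ z → sq ∣ G b z - G b (z +ᶻ t) ∣} (λ e → cong₂ (λ v w → sq ∣ v - w ∣) (G-per b e) (G-per b (≈-+ e ≈-refl))) (-ᶻ t) ⟩
      D b t ∎
      where open ≡-Reasoning

    D-R : ∀ b t → D b t + 2 * R b t ≡ 2 * R b (pos 0)
    D-R b t = begin
      D b t + 2 * R b t ≡⟨ cong (D b t +_) (sym (Σp-*ˡ 2 _)) ⟩
      D b t + Σp (λ z → 2 * (G b z * G b (z +ᶻ t))) ≡⟨ sym (Σp-+ _ _) ⟩
      Σp (λ z → sq ∣ G b z - G b (z +ᶻ t) ∣ + 2 * (G b z * G b (z +ᶻ t))) ≡⟨ Σp-cong (λ z → sq-diff (G b z) (G b (z +ᶻ t))) ⟩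
      Σp (λ z → sq (G b z) + sq (G b (z +ᶻ t))) ≡⟨ Σp-+ _ _ ⟩
      Σp (λ z → sq (G b z)) + Σp (λ z → sq (G b (z +ᶻ t))) ≡⟨ cong (Σp (λ z → sq (G b z)) +_) (Σp-shift {λ z → sq (G b z)} (λ e → cong sq (G-per b e)) t) ⟩
      Σp (λ z → sq (G b z)) + Σp (λ z → sq (G b z)) ≡⟨ cong₂ _+_ q (trans q (sym (+-identityʳ _))) ⟩
      2 * R b (pos 0) ∎
      where
      open ≡-Reasoning
      q : Σp (λ z → sq (G b z)) ≡ R b (pos 0)
      q = Σp-cong (λ z → cong (λ y → G b z * G b y) (sym (ℤP.+-identityʳ z)))

    R-expand : ∀ b t e → R b (b *ᶻ t +ᶻ e) ≡ Σp (λ x → Σp (λ x' → F x * F x' * corG (b *ᶻ (x' -ᶻ (x -ᶻ t)) +ᶻ e)))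
    R-expand b t e = begin
      Σp (λ z → G b z * G b (z +ᶻ u)) ≡⟨ Σp-cong (λ z → Σp-prod _ _) ⟩
      Σp (λ z → Σp (λ x → Σp (λ x' → (F x * I (b *ᶻ x +ᶻ z)) * (F x' * I (b *ᶻ x' +ᶻ (z +ᶻ u)))))) ≡⟨ Σp-swap _ ⟩
      Σp (λ x → Σp (λ z → Σp (λ x' → (F x * I (b *ᶻ x +ᶻ z)) * (F x' * I (b *ᶻ x' +ᶻ (z +ᶻ u)))))) ≡⟨ Σp-cong (λ x → Σp-swap _) ⟩
      Σp (λ x → Σp (λ x' → Σp (λ z → (F x * I (b *ᶻ x +ᶻ z)) * (F x' * I (b *ᶻ x' +ᶻ (z +ᶻ u))))))
        ≡⟨ Σp-cong (λ x → Σp-cong (λ x' → trans (Σp-cong (λ z → e1 (F x) (I (b *ᶻ x +ᶻ z)) (F x') (I (b *ᶻ x' +ᶻ (z +ᶻ u))))) (trans (Σp-*ˡ (F x * F x') _) (cong (F x * F x' *_) (inner x x'))))) ⟩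
      Σp (λ x → Σp (λ x' → F x * F x' * corG (b *ᶻ (x' -ᶻ (x -ᶻ t)) +ᶻ e))) ∎
      where
      open ≡-Reasoning
      u = b *ᶻ t +ᶻ e
      e1 : ∀ a b c d → (a * b) * (c * d) ≡ a * c * (b * d)
      e1 = solveℕ
      e2 : ∀ b x x' z t e → b *ᶻ x' +ᶻ (z +ᶻ (b *ᶻ t +ᶻ e)) ≡ (z +ᶻ b *ᶻ x) +ᶻ (b *ᶻ (x' -ᶻ (x -ᶻ t)) +ᶻ e)
      e2 = solveℤ
      inner : ∀ x x' → Σp (λ z → I (b *ᶻ x +ᶻ z) * I (b *ᶻ x' +ᶻ (z +ᶻ u))) ≡ corG (b *ᶻ (x' -ᶻ (x -ᶻ t)) +ᶻ e)
      inner x x' = begin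
        Σp (λ z → I (b *ᶻ x +ᶻ z) * I (b *ᶻ x' +ᶻ (z +ᶻ u))) ≡⟨ Σp-cong (λ z → trans (cong₂ (λ v w → I v * I w) (ℤP.+-comm (b *ᶻ x) z) (e2 b x x' z t e)) (sym (ι-∧ (g (z +ᶻ b *ᶻ x)) _))) ⟩
        Σp (λ z → ι (g (z +ᶻ b *ᶻ x) ∧ g ((z +ᶻ b *ᶻ x) +ᶻ w))) ≡⟨ Σp-shift {λ z → ι (g z ∧ g (z +ᶻ w))} (λ q → cong₂ (λ a b → ι (a ∧ b)) (gp q) (gp (≈-+ q ≈-refl))) (b *ᶻ x) ⟩
        corG w ∎
        where w = b *ᶻ (x' -ᶻ (x -ᶻ t)) +ᶻ e

    K : ℤ → ℤ → ℕ
    K e v = Σp (λ b → corG (b *ᶻ v +ᶻ e))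

    -- For `v ≢ 0` the points `b v + e` run through all residues, and the correlations add up to
    -- `L * L`; for `v ≈ 0` all terms equal `corG e`. Both cases are stated as one identity without
    -- subtraction.
    K-value : ∀ e v → K e v + ι (δ v) * (L * L) ≡ L * L + ι (δ v) * (p * corG e)
    K-value e v with v ≈? pos 0
    ... | yes q = begin
      K e v + ι (δ v) * (L * L)          ≡⟨ cong₂ (λ a d → a + ι d * (L * L)) (trans (Σp-cong (λ b → corG-per (≈-trans (≈-+ (≈-trans (≈-*ˡ b q) (≈-reflexive (ℤP.*-zeroʳ b))) (≈-refl {e})) (≈-reflexive (ℤP.+-identityˡ e))))) (Σp-const (corG e))) (δ-true q) ⟩
      p * corG e + 1 * (L * L)           ≡⟨ e0 (p * corG e) (L * L) ⟩
      L * L + 1 * (p * corG e)           ≡⟨ cong (λ d → L * L + ι d * (p * corG e)) (sym (δ-true q)) ⟩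
      L * L + ι (δ v) * (p * corG e)     ∎
      where
      open ≡-Reasoning
      e0 : ∀ a b → a + 1 * b ≡ b + 1 * a
      e0 = solveℕ
    ... | no nq = begin
      K e v + ι (δ v) * (L * L)          ≡⟨ cong₂ (λ a d → a + ι d * (L * L)) (trans (Σp-dilate {λ x → corG (x +ᶻ e)} (λ q → corG-per (≈-+ q ≈-refl)) nq) (trans (Σp-shift corG-per e) ΣcorG)) (δ-false nq) ⟩
      L * L + 0 * (L * L)                ≡⟨⟩
      L * L + 0 * (p * corG e)           ≡⟨ cong (λ d → L * L + ι d * (p * corG e)) (sym (δ-false nq)) ⟩
      L * L + ι (δ v) * (p * corG e)     ∎
      where open ≡-Reasoning

    row : ∀ e a → Σp (λ x' → F x' * K e (x' -ᶻ a)) + F a * (L * L) ≡ s * (L * L) + F a * (p * corG e)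
    row e a = begin
      Σp (λ x' → F x' * K e (x' -ᶻ a)) + F a * (L * L)
        ≡⟨ cong (Σp (λ x' → F x' * K e (x' -ᶻ a)) +_) (pick (L * L)) ⟨
      Σp (λ x' → F x' * K e (x' -ᶻ a)) + Σp (λ x' → F x' * (ι (δ (x' -ᶻ a)) * (L * L)))
        ≡⟨ Σp-+ _ _ ⟨
      Σp (λ x' → F x' * K e (x' -ᶻ a) + F x' * (ι (δ (x' -ᶻ a)) * (L * L)))
        ≡⟨ Σp-cong (λ x' → trans (sym (*-distribˡ-+ (F x') _ _)) (trans (cong (F x' *_) (K-value e (x' -ᶻ a))) (*-distribˡ-+ (F x') _ _))) ⟩
      Σp (λ x' → F x' * (L * L) + F x' * (ι (δ (x' -ᶻ a)) * (p * corG e)))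
        ≡⟨ trans (Σp-+ _ _) (cong₂ _+_ (Σp-*ʳ (L * L) F) (pick (p * corG e))) ⟩
      s * (L * L) + F a * (p * corG e) ∎
      where
      open ≡-Reasoning
      pick : ∀ c → Σp (λ x' → F x' * (ι (δ (x' -ᶻ a)) * c)) ≡ F a * c
      pick c = trans (Σp-cong (λ x' → sym (*-assoc (F x') _ c))) (trans (Σp-*ʳ c _) (cong (_* c) (Σp-δ {F} (λ e → cong ι (fp e)) a)))

    -- Once both factors are expanded, only pairs with `x' ≈ x - t` deviate from the equidistributed
    -- value; there are `corF t` of them.
    ΣR : ∀ t e → Σp (λ b → R b (b *ᶻ t +ᶻ e)) + corF t * (L * L) ≡ s * s * (L * L) + corF t * (p * corG e)
    ΣR t e = begin
      Σp (λ b → R b (b *ᶻ t +ᶻ e)) + corF t * (L * L)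
        ≡⟨ cong₂ _+_ left (sym (diag (L * L))) ⟩
      Σp (λ x → F x * Σp (λ x' → F x' * K e (x' -ᶻ (x -ᶻ t)))) + Σp (λ x → F x * (F (x -ᶻ t) * (L * L)))
        ≡⟨ Σp-+ _ _ ⟨
      Σp (λ x → F x * Σp (λ x' → F x' * K e (x' -ᶻ (x -ᶻ t))) + F x * (F (x -ᶻ t) * (L * L)))
        ≡⟨ Σp-cong (λ x → trans (sym (*-distribˡ-+ (F x) _ _)) (trans (cong (F x *_) (row e (x -ᶻ t))) (*-distribˡ-+ (F x) _ _))) ⟩
      Σp (λ x → F x * (s * (L * L)) + F x * (F (x -ᶻ t) * (p * corG e)))
        ≡⟨ trans (Σp-+ _ _) (cong₂ _+_ (trans (Σp-*ʳ (s * (L * L)) F) (sym (*-assoc s s (L * L)))) (diag (p * corG e))) ⟩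
      s * s * (L * L) + corF t * (p * corG e) ∎
      where
      open ≡-Reasoning
      diag : ∀ c → Σp (λ x → F x * (F (x -ᶻ t) * c)) ≡ corF t * c
      diag c = trans (Σp-cong (λ x → trans (sym (*-assoc (F x) _ c)) (cong (_* c) (sym (ι-∧ (f x) _))))) (trans (Σp-*ʳ c _) (cong (_* c) (corF-neg t)))
      left : Σp (λ b → R b (b *ᶻ t +ᶻ e)) ≡ Σp (λ x → F x * Σp (λ x' → F x' * K e (x' -ᶻ (x -ᶻ t))))
      left = begin
        Σp (λ b → R b (b *ᶻ t +ᶻ e)) ≡⟨ Σp-cong (λ b → R-expand b t e) ⟩
        Σp (λ b → Σp (λ x → Σp (λ x' → F x * F x' * corG (b *ᶻ (x' -ᶻ (x -ᶻ t)) +ᶻ e)))) ≡⟨ Σp-swap _ ⟩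
        Σp (λ x → Σp (λ b → Σp (λ x' → F x * F x' * corG (b *ᶻ (x' -ᶻ (x -ᶻ t)) +ᶻ e)))) ≡⟨ Σp-cong (λ x → Σp-swap _) ⟩
        Σp (λ x → Σp (λ x' → Σp (λ b → F x * F x' * corG (b *ᶻ (x' -ᶻ (x -ᶻ t)) +ᶻ e))))
          ≡⟨ Σp-cong (λ x → trans (Σp-cong (λ x' → trans (Σp-*ˡ (F x * F x') _) (*-assoc (F x) (F x') _))) (Σp-*ˡ (F x) _)) ⟩
        Σp (λ x → F x * Σp (λ x' → F x' * K e (x' -ᶻ (x -ᶻ t)))) ∎

    Λ-value : Λ + L * L ≡ p * L
    Λ-value = trans (cong (Λ +_) (sym ΣcorG)) (trans (+-comm Λ _) (trans (sym (Σp-+ corG nrmG)) (trans (Σp-cong cor+nrmG) (Σp-const L))))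

    corG-0 : corG (pos 0) ≡ L
    corG-0 = trans (sym (+-identityʳ _)) (trans (cong (corG (pos 0) +_) (sym nrmG-0)) (cor+nrmG (pos 0)))

    corF-0 : corF (pos 0) ≡ s
    corF-0 = trans (sym (+-identityʳ _)) (trans (cong (corF (pos 0) +_) (sym nrmF-0)) (cor+nrmF (pos 0)))

    b*0+e : ∀ b e → b *ᶻ pos 0 +ᶻ e ≡ e
    b*0+e b e = trans (cong (_+ᶻ e) (ℤP.*-zeroʳ b)) (ℤP.+-identityˡ e)

    ΣR-const : ∀ e → Σp (λ b → R b e) + s * (L * L) ≡ s * s * (L * L) + s * (p * corG e)
    ΣR-const e = trans (cong₂ _+_ (Σp-cong (λ b → cong (R b) (sym (b*0+e b e)))) (cong (_* (L * L)) (sym corF-0)))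
      (trans (ΣR (pos 0) e) (cong (λ c → s * s * (L * L) + c * (p * corG e)) corF-0))

    ΣR-base : Σp (λ b → R b (pos 0)) ≡ s * s * (L * L) + s * Λ
    ΣR-base = +-cancelʳ-≡ (s * (L * L)) _ _ (trans (ΣR-const (pos 0)) (trans (cong (λ c → s * s * (L * L) + s * c) (trans (cong (p *_) corG-0) (sym Λ-value))) (e (s * s * (L * L)) s Λ (L * L))))
      where
      e : ∀ a s l q → a + s * (l + q) ≡ a + s * l + s * q
      e = solveℕ

    ΣR-dilate : ∀ t → Σp (λ b → R b (b *ᶻ t)) ≡ s * s * (L * L) + corF t * Λ
    ΣR-dilate t = +-cancelʳ-≡ (corF t * (L * L)) _ _ (trans (cong (_+ corF t * (L * L)) (Σp-cong (λ b → cong (R b) (sym (ℤP.+-identityʳ (b *ᶻ t))))))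
       (trans (ΣR t (pos 0)) (trans (cong (λ c → s * s * (L * L) + corF t * c) (trans (cong (p *_) corG-0) (sym Λ-value))) (e (s * s * (L * L)) (corF t) Λ (L * L)))))
      where
      e : ∀ a s l q → a + s * (l + q) ≡ a + s * l + s * q
      e = solveℕ

    ΣD+2ΣR : ∀ (t : ℤ → ℤ) → Σp (λ b → D b (t b)) + 2 * Σp (λ b → R b (t b)) ≡ 2 * Σp (λ b → R b (pos 0))
    ΣD+2ΣR t = trans (cong (Σp (λ b → D b (t b)) +_) (sym (Σp-*ˡ 2 _))) (trans (sym (Σp-+ _ _)) (trans (Σp-cong (λ b → D-R b (t b))) (Σp-*ˡ 2 _)))

    -- The main term `s * s * (L * L)` cancels between the shifts by 0 and by `b t`. What is left
    -- measures exactly the norm of `t` with respect to `f`.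
    ΣD-dilate : ∀ t → Σp (λ b → D b (b *ᶻ t)) ≡ 2 * (nrmF t * Λ)
    ΣD-dilate t = +-cancelʳ-≡ (2 * Σp (λ b → R b (b *ᶻ t))) _ _ (trans (ΣD+2ΣR (λ b → b *ᶻ t))
      (trans (cong (2 *_) (trans ΣR-base (cong (λ w → s * s * (L * L) + w * Λ) (sym (cor+nrmF t)))))
      (trans (e (s * s * (L * L)) (corF t) (nrmF t) Λ) (cong (λ w → 2 * (nrmF t * Λ) + 2 * w) (sym (ΣR-dilate t))))))
      where
      e : ∀ a c n l → 2 * (a + (c + n) * l) ≡ 2 * (n * l) + 2 * (a + c * l)
      e = solveℕ

    ΣD-const : ∀ e → Σp (λ b → D b e) ≡ 2 * (s * (p * nrmG e))
    ΣD-const t = +-cancelʳ-≡ (2 * (Y + q)) _ _ (begin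
      X + 2 * (Y + q)                                ≡⟨ e1 X Y q ⟩
      X + 2 * Y + 2 * q                              ≡⟨ cong (_+ 2 * q) (ΣD+2ΣR (λ _ → t)) ⟩
      2 * Z + 2 * q                                  ≡⟨ e2 Z q ⟩
      2 * (Z + q)                                    ≡⟨ cong (2 *_) (trans (ΣR-const (pos 0)) (cong (λ c → s * s * (L * L) + s * (p * c)) (trans corG-0 (sym (cor+nrmG t))))) ⟩
      2 * (s * s * (L * L) + s * (p * (corG t + nrmG t))) ≡⟨ e3 (s * s * (L * L)) s p (corG t) (nrmG t) ⟩
      2 * (s * (p * nrmG t)) + 2 * (s * s * (L * L) + s * (p * corG t)) ≡⟨ cong (λ w → 2 * (s * (p * nrmG t)) + 2 * w) (sym (ΣR-const t)) ⟩
      2 * (s * (p * nrmG t)) + 2 * (Y + q)           ∎)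
      where
      open ≡-Reasoning
      X = Σp (λ b → D b t)
      Y = Σp (λ b → R b t)
      Z = Σp (λ b → R b (pos 0))
      q = s * (L * L)
      e1 : ∀ x y q → x + 2 * (y + q) ≡ x + 2 * y + 2 * q
      e1 = solveℕ
      e2 : ∀ z q → 2 * z + 2 * q ≡ 2 * (z + q)
      e2 = solveℕ
      e3 : ∀ a s p c n → 2 * (a + s * (p * (c + n))) ≡ 2 * (s * (p * n)) + 2 * (a + s * (p * c))
      e3 = solveℕ

    T : ℤ → ℕ
    T b = Σp (D b)

    ΣT : Σp T ≡ 2 * (s * (p * Λ))
    ΣT = trans (Σp-swap D) (trans (Σp-cong ΣD-const) (trans (Σp-*ˡ 2 _) (cong (2 *_) (trans (Σp-*ˡ s _) (cong (s *_) (Σp-*ˡ p nrmG))))))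

    -- The dilation by 0 makes `G` a multiple of the kernel. This term has to be removed to obtain
    -- an invertible `b`; the other terms keep the factor `p - s`.
    T-0 : T (pos 0) ≡ 2 * (s * s * Λ)
    T-0 = trans (Σp-cong d0) (trans (Σp-*ˡ 2 _) (cong (2 *_) (Σp-*ˡ (s * s) nrmG)))
      where
      open ≡-Reasoning
      g0 : ∀ z → G (pos 0) z ≡ s * I z
      g0 z = trans (Σp-cong (λ x → cong (λ y → F x * I y) (trans (cong (_+ᶻ z) (ℤP.*-zeroˡ x)) (ℤP.+-identityˡ z)))) (Σp-*ʳ (I z) F)
      r0 : ∀ t → R (pos 0) t ≡ s * s * corG t
      r0 t = trans (Σp-cong (λ z → trans (cong₂ _*_ (g0 z) (g0 (z +ᶻ t))) (trans (e s (I z) (I (z +ᶻ t))) (cong (s * s *_) (sym (ι-∧ (g z) _)))))) (Σp-*ˡ (s * s) _)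
        where
        e : ∀ s a b → s * a * (s * b) ≡ s * s * (a * b)
        e = solveℕ
      d0 : ∀ t → D (pos 0) t ≡ 2 * (s * s * nrmG t)
      d0 t = +-cancelʳ-≡ (2 * (s * s * corG t)) _ _ (begin
        D (pos 0) t + 2 * (s * s * corG t)   ≡⟨ cong (λ w → D (pos 0) t + 2 * w) (r0 t) ⟨
        D (pos 0) t + 2 * R (pos 0) t        ≡⟨ D-R (pos 0) t ⟩
        2 * R (pos 0) (pos 0)                ≡⟨ cong (2 *_) (trans (r0 (pos 0)) (cong (s * s *_) (trans corG-0 (sym (cor+nrmG t))))) ⟩
        2 * (s * s * (corG t + nrmG t))      ≡⟨ e (s * s) (corG t) (nrmG t) ⟩
        2 * (s * s * nrmG t) + 2 * (s * s * corG t) ∎)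
        where
        e : ∀ a c n → 2 * (a * (c + n)) ≡ 2 * (a * n) + 2 * (a * c)
        e = solveℕ

    ΣT-nonzero : ∑ p' (λ i → T (pos (suc i))) + 2 * (s * s * Λ) ≡ 2 * (s * (p * Λ))
    ΣT-nonzero = trans (cong (∑ p' (λ i → T (pos (suc i))) +_) (sym T-0)) (trans (+-comm _ (T (pos 0))) (trans (sym (Σp-def T)) ΣT))

  -- Intervals as smoothing kernels

  interval : ℕ → ℤ → Bool
  interval L x = ⌊ x %ℕ p <? L ⌋

  interval-per : ∀ L → Per (interval L)
  interval-per L e = cong (λ r → ⌊ r <? L ⌋) (residue-cong e)

  residue-small : ∀ {i} → i < p → pos i %ℕ p ≡ i
  residue-small l = m<n⇒m%n≡m l

  size-interval : ∀ {L} → L ≤ p → size (interval L) ≡ L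
  size-interval {L} L≤p with m≤n⇒∃[o]m+o≡n L≤p
  ... | r , e = begin
    size (interval L)                                            ≡⟨ Σp-def _ ⟩
    ∑ p (λ i → ι (interval L (pos i)))                           ≡⟨ ∑-cong< p (λ i l → cong (λ w → ι ⌊ w <? L ⌋) (residue-small l)) ⟩
    ∑ p (λ i → ι ⌊ i <? L ⌋)                                     ≡⟨ cong (λ w → ∑ w (λ i → ι ⌊ i <? L ⌋)) (sym e) ⟩
    ∑ (L + r) (λ i → ι ⌊ i <? L ⌋)                               ≡⟨ ∑-split L r _ ⟩
    ∑ L (λ i → ι ⌊ i <? L ⌋) + ∑ r (λ i → ι ⌊ L + i <? L ⌋)      ≡⟨ cong₂ _+_ (∑-cong< L (λ i l → ι-yes (i <? L) l)) (∑-cong r (λ i → ι-no (L + i <? L) (≤⇒≯ (m≤m+n L i)))) ⟩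
    ∑ L (λ _ → 1) + ∑ r (λ _ → 0)                                ≡⟨ cong₂ _+_ (trans (∑-const L 1) (*-identityʳ L)) (∑-0 r) ⟩
    L + 0                                                        ≡⟨ +-identityʳ L ⟩
    L                                                            ∎
    where open ≡-Reasoning

  -- Only `L - 1` can leave the interval under the shift by 1.
  nrm-interval : ∀ {L} → L ≤ p → Norm.nrm (interval L) (interval-per L) (pos 1) ≤ 1
  nrm-interval {L} L≤p = begin
    Norm.nrm (interval L) (interval-per L) (pos 1)                  ≡⟨ Σp-def _ ⟩
    ∑ p (λ i → ι (interval L (pos i) ∧ not (interval L (pos i +ᶻ pos 1)))) ≤⟨ ∑-mono< p pw ⟩
    ∑ p (λ i → ι (δ (pos i -ᶻ a)))                                  ≡⟨ trans (sym (Σp-def _)) (Σp-δ1 a) ⟩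
    1                                                               ∎
    where
    open ≤-Reasoning
    a = pos L -ᶻ pos 1
    e1 : ∀ i l → i -ᶻ (l -ᶻ pos 1) ≡ (i +ᶻ pos 1) -ᶻ l
    e1 = solveℤ
    pw : ∀ i → i < p → ι (interval L (pos i) ∧ not (interval L (pos i +ᶻ pos 1))) ≤ ι (δ (pos i -ᶻ a))
    pw i i<p with pos i %ℕ p <? L | (pos i +ᶻ pos 1) %ℕ p <? L
    ... | no _ | _ = z≤n
    ... | yes l | yes l' = z≤n
    ... | yes l | no nl = ≤-reflexive (sym (cong ι (δ-true {pos i -ᶻ a} (≈-trans (≈-reflexive (e1 (pos i) (pos L))) (≈⇒≈0 {pos i +ᶻ pos 1} (≈-reflexive (cong pos (trans (+-comm i 1) suc≡))))))))
      where
      i<L : i < L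
      i<L = subst (_< L) (residue-small i<p) l
      suc≡ : suc i ≡ L
      suc≡ with m≤n⇒m<n∨m≡n i<L
      ... | inj₂ e = e
      ... | inj₁ lt = contradiction (subst (_< L) (sym (trans (cong (_% p) (+-comm i 1)) (residue-small (<-≤-trans lt L≤p)))) lt) nl

  -- Dirichlet approximation with a quasi-norm

  module Quasi (D : ℤ → ℕ) (D-per : Per D) (D-neg : ∀ t → D (-ᶻ t) ≡ D t)
               (D-tri : ∀ t u → D (t +ᶻ u) ≤ 2 * D t + 2 * D u) where

    -- D (j t) is compared with D ((j + l) t) and D (l t) for every l < J.
    average : ∀ J t j → j ≤ J → J * D (pos j *ᶻ t) ≤ 4 * ∑ (2 * J) (λ l → D (pos l *ᶻ t))
    average J t j j≤J = begin
      J * D (pos j *ᶻ t)                                              ≡⟨ ∑-const J _ ⟨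
      ∑ J (λ _ → D (pos j *ᶻ t))                                      ≤⟨ ∑-mono J pw ⟩
      ∑ J (λ l → 2 * d (j + l) + 2 * d l)                             ≡⟨ trans (∑-+ J _ _) (cong₂ _+_ (∑-*ˡ J 2 (λ l → d (j + l))) (∑-*ˡ J 2 d)) ⟩
      2 * ∑ J (λ l → d (j + l)) + 2 * ∑ J d                           ≤⟨ +-mono-≤ (*-monoʳ-≤ 2 (≤-trans (≤-trans (m≤n+m _ (∑ j d)) (≤-reflexive (sym (∑-split j J d)))) (∑-mono-len d (≤-trans (+-monoˡ-≤ J j≤J) (≤-reflexive (e2 J)))))) (*-monoʳ-≤ 2 (∑-mono-len d (m≤m+n J _))) ⟩
      2 * ∑ (2 * J) d + 2 * ∑ (2 * J) d                               ≡⟨ e4 (∑ (2 * J) d) ⟩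
      4 * ∑ (2 * J) d                                                 ∎
      where
      open ≤-Reasoning
      d : ℕ → ℕ
      d l = D (pos l *ᶻ t)
      e2 : ∀ J → J + J ≡ 2 * J
      e2 = solveℕ
      e4 : ∀ a → 2 * a + 2 * a ≡ 4 * a
      e4 = solveℕ
      e5 : ∀ a b t → a *ᶻ t ≡ (a +ᶻ b) *ᶻ t +ᶻ -ᶻ (b *ᶻ t)
      e5 = solveℤ
      pw : ∀ l → D (pos j *ᶻ t) ≤ 2 * d (j + l) + 2 * d l
      pw l = ≤-trans (≤-reflexive (cong D (e5 (pos j) (pos l) t))) (≤-trans (D-tri (pos (j + l) *ᶻ t) (-ᶻ (pos l *ᶻ t))) (≤-reflexive (cong (λ w → 2 * d (j + l) + 2 * w) (D-neg (pos l *ᶻ t)))))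

    average1 : ∀ E e → e ≤ E → E * D (pos e) ≤ 4 * ∑ (2 * E) (λ l → D (pos l))
    average1 E e e≤E = ≤-trans (≤-reflexive (cong (λ w → E * D w) (sym (ℤP.*-identityʳ (pos e))))) (≤-trans (average E (pos 1) e e≤E) (≤-reflexive (cong (4 *_) (∑-cong (2 * E) (λ l → cong D (ℤP.*-identityʳ (pos l)))))))

    D-abs : ∀ z → D (pos ∣ z ∣) ≡ D z
    D-abs (pos n)  = refl
    D-abs -[1+ n ] = sym (D-neg (pos (suc n)))

    -- Dirichlet's theorem gives q; if q t were not small, its multiples together with short
    -- intervals would reach every residue, and D would be below its average everywhere.
    small-multiple : ∀ t J E Q .{{_ : NonZero Q}} .{{_ : NonZero E}} → p ≤ Q * E →
      (∀ j → j ≤ J → 17 * p * D (pos j *ᶻ t) < 4 * Σp D) → (∀ e → e ≤ E → 17 * p * D (pos e) < 4 * Σp D) →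
      ∃[ q ] ∃[ r ] (1 ≤ q × q ≤ Q × pos q *ᶻ t ≈ r × ∣ r ∣ * (J / Q) < p)
    small-multiple t J E Q p≤QE hJ hE with pigeonhole {Q} {suc Q} ≤-refl (λ i → fromℕ< (m<n*o⇒m/o<n {(pos (toℕ i) *ᶻ t) %ℕ p} {Q} {E} (<-≤-trans (residue<p (pos (toℕ i) *ᶻ t)) p≤QE)))
    ... | i , j , i<j , e = q , r , m<n⇒0<n∸m i<j , ≤-trans (m∸n≤m (toℕ j) (toℕ i)) (≤-pred (toℕ<n j)) , qt≈r , ≰⇒> absurd
      where
      ρ : ℕ → ℕ
      ρ i = (pos i *ᶻ t) %ℕ p
      q : ℕ
      q = toℕ j ∸ toℕ i
      r : ℤ
      r = pos (ρ (toℕ j)) -ᶻ pos (ρ (toℕ i))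
      q≤Q : q ≤ Q
      q≤Q = ≤-trans (m∸n≤m (toℕ j) (toℕ i)) (≤-pred (toℕ<n j))
      e6 : ∀ a b t → a *ᶻ t ≡ (b +ᶻ a) *ᶻ t -ᶻ b *ᶻ t
      e6 = solveℤ
      qt≈r : pos q *ᶻ t ≈ r
      qt≈r = ≈-trans (≈-reflexive (trans (e6 (pos q) (pos (toℕ i)) t) (cong (λ w → pos w *ᶻ t -ᶻ pos (toℕ i) *ᶻ t) (m+[n∸m]≡n (<⇒≤ i<j)))))
        (≈-minus (≈-residue (pos (toℕ j) *ᶻ t)) (≈-residue (pos (toℕ i) *ᶻ t)))
      quot≡ : ρ (toℕ i) / E ≡ ρ (toℕ j) / E
      quot≡ = trans (sym (toℕ-fromℕ< _)) (trans (cong toℕ e) (toℕ-fromℕ< _))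
      close : ∀ a b → a / E ≡ b / E → ∣ pos b -ᶻ pos a ∣ ≤ E
      close a b eq = begin
        ∣ pos b -ᶻ pos a ∣                                           ≡⟨ cong ∣_∣ (cong₂ _-ᶻ_ (cong pos (m≡m%n+[m/n]*n b E)) (cong pos (trans (m≡m%n+[m/n]*n a E) (cong (λ w → a % E + w * E) eq)))) ⟩
        ∣ pos (b % E + c) -ᶻ pos (a % E + c) ∣                       ≡⟨ cong ∣_∣ (cancel (pos (b % E)) (pos (a % E)) (pos c)) ⟩
        ∣ pos (b % E) -ᶻ pos (a % E) ∣                               ≡⟨ cong ∣_∣ (ℤP.m-n≡m⊖n (b % E) (a % E)) ⟩
        ∣ (b % E) ⊖ (a % E) ∣                                        ≤⟨ ℤP.∣m⊝n∣≤m⊔n (b % E) (a % E) ⟩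
        (b % E) ⊔ (a % E)                                            ≤⟨ ⊔-lub (<⇒≤ (m%n<n b E)) (<⇒≤ (m%n<n a E)) ⟩
        E                                                            ∎
        where
        open ≤-Reasoning
        c = (b / E) * E
        cancel : ∀ x y c → (x +ᶻ c) -ᶻ (y +ᶻ c) ≡ x -ᶻ y
        cancel = solveℤ
      r≤E : ∣ r ∣ ≤ E
      r≤E = close (ρ (toℕ i)) (ρ (toℕ j)) quot≡
      absurd : ¬ (p ≤ ∣ r ∣ * (J / Q))
      absurd big = contradiction (*-cancelʳ-≤ 17 16 (p * Σp D) {{>-nonZero pT>0}} total) (<-irrefl refl)
        where
        s = ∣ r ∣
        pT>0 : 0 < p * Σp D
        pT>0 = *-mono-≤ {1} {p} {1} (s≤s z≤n) (*-cancelˡ-< 4 0 (Σp D) (≤-<-trans z≤n (hE 0 z≤n)))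
        instance
          s≢0 : NonZero s
          s≢0 = >-nonZero (n≢0⇒n>0 (λ s0 → contradiction (subst (λ w → p ≤ w * (J / Q)) s0 big) λ ()))
        e7 : ∀ a q t → a *ᶻ (q *ᶻ t) ≡ (a *ᶻ q) *ᶻ t
        e7 = solveℤ
        D-mult : ∀ a → D (pos (a * s)) ≡ D (pos (a * q) *ᶻ t)
        D-mult a = trans (cong D (ℤP.pos-* a s)) (trans (D-as a) (trans (D-per (≈-*ˡ (pos a) (≈-sym qt≈r))) (cong D (trans (e7 (pos a) (pos q) t) (cong (_*ᶻ t) (sym (ℤP.pos-* a q)))))))
          where
          D-as : ∀ a → D (pos a *ᶻ pos s) ≡ D (pos a *ᶻ r)
          D-as a = trans (cong D (sym (ℤP.pos-* a s))) (trans (cong (λ w → D (pos w)) (sym (ℤP.∣i*j∣≡∣i∣*∣j∣ (pos a) r))) (D-abs (pos a *ᶻ r)))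
        -- `w` is divided by `s`. The quotient `a` is at most `J / Q`, so `a q ≤ J` and `hJ` applies
        -- to `a s`, which is congruent to `a q t` up to sign; the remainder is at most `E`. Two
        -- terms with factor 2 · 4 give 16, and any constant above 16 in place of 17 leads to the
        -- contradiction.
        pw : ∀ w → w < p → 17 * p * D (pos w) ≤ 16 * Σp D
        pw w w<p = begin
          17 * p * D (pos w)                                              ≡⟨ cong (λ v → 17 * p * D (pos v)) (trans (m≡m%n+[m/n]*n w s) (+-comm (w % s) _)) ⟩
          17 * p * D (pos (a * s) +ᶻ pos (w % s))                         ≤⟨ *-monoʳ-≤ (17 * p) (D-tri (pos (a * s)) (pos (w % s))) ⟩
          17 * p * (2 * D (pos (a * s)) + 2 * D (pos (w % s)))            ≡⟨ e8 (17 * p) (D (pos (a * s))) (D (pos (w % s))) ⟩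
          2 * (17 * p * D (pos (a * s))) + 2 * (17 * p * D (pos (w % s))) ≤⟨ +-mono-≤ (*-monoʳ-≤ 2 (<⇒≤ (subst (λ v → 17 * p * v < 4 * Σp D) (sym (D-mult a)) (hJ (a * q) aq≤J)))) (*-monoʳ-≤ 2 (<⇒≤ (hE (w % s) (≤-trans (<⇒≤ (m%n<n w s)) r≤E)))) ⟩
          2 * (4 * Σp D) + 2 * (4 * Σp D)                                 ≡⟨ e9 (Σp D) ⟩
          16 * Σp D                                                       ∎
          where
          open ≤-Reasoning
          a = w / s
          e8 : ∀ c x y → c * (2 * x + 2 * y) ≡ 2 * (c * x) + 2 * (c * y)
          e8 = solveℕ
          e9 : ∀ x → 2 * (4 * x) + 2 * (4 * x) ≡ 16 * x
          e9 = solveℕ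
          aq≤J : a * q ≤ J
          aq≤J = ≤-trans (*-mono-≤ (<⇒≤ (m<n*o⇒m/o<n {w} {J / Q} {s} (<-≤-trans w<p (≤-trans big (≤-reflexive (*-comm s (J / Q))))))) q≤Q) (m/n*n≤m J Q)
        total : 17 * (p * Σp D) ≤ 16 * (p * Σp D)
        total = begin
          17 * (p * Σp D)                      ≡⟨ *-assoc 17 p (Σp D) ⟨
          17 * p * Σp D                        ≡⟨ cong (17 * p *_) (Σp-def D) ⟩
          17 * p * ∑ p (λ i → D (pos i))       ≡⟨ ∑-*ˡ p (17 * p) (λ i → D (pos i)) ⟨
          ∑ p (λ i → 17 * p * D (pos i))       ≤⟨ ∑-bound p (16 * Σp D) pw ⟩
          p * (16 * Σp D)                      ≡⟨ e10 p (Σp D) ⟩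
          16 * (p * Σp D)                      ∎
          where
          open ≤-Reasoning
          e10 : ∀ p d → p * (16 * d) ≡ 16 * (p * d)
          e10 = solveℕ

  -- One dilation for most elements

  small-unit : ∀ {i} → 1 ≤ i → i < p → Unit (pos i)
  small-unit 1≤i i<p e = contradiction (subst (1 ≤_) (small-unique i<p (s≤s z≤n) e) 1≤i) λ ()

  factorial-unit : ∀ Q → Q < p → Unit (pos (Q !))
  factorial-unit zero    l = 1≉0
  factorial-unit (suc Q) l e = Unit-* (small-unit (s≤s z≤n) l) (factorial-unit Q (<-trans (n<1+n Q) l)) (≈-trans (≈-reflexive (sym (ℤP.pos-* (suc Q) (Q !)))) e)

  ∣-! : ∀ {q} Q → 1 ≤ q → q ≤ Q → ∃[ c ] (c * q ≡ Q ! × c ≤ Q !)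
  ∣-! zero () z≤n
  ∣-! {q} (suc Q) 1≤q q≤ with m≤n⇒m<n∨m≡n q≤
  ... | inj₂ refl = Q ! , *-comm (Q !) (suc Q) , m≤m+n (Q !) _
  ... | inj₁ (s≤s l) with ∣-! Q 1≤q l
  ...   | c , e , le = suc Q * c , trans (*-assoc (suc Q) c q) (cong (suc Q *_) e) , *-monoʳ-≤ (suc Q) le

  Small : ℕ → ℤ → ℤ → Set
  Small w b' x = ∃[ r ] (b' *ᶻ x ≈ r × ∣ r ∣ ≤ w)

  -- The multiplier `q` from Dirichlet's theorem depends on `x`. The common multiple `Q !` serves
  -- all elements simultaneously and enlarges the bound by a constant factor.
  small-factorial : ∀ {Q q b x r w} → 1 ≤ q → q ≤ Q → pos q *ᶻ (b *ᶻ x) ≈ r → ∣ r ∣ ≤ w → Small (Q ! * w) (pos (Q !) *ᶻ b) x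
  small-factorial {Q} {q} {b} {x} {r} 1≤q q≤Q e l with ∣-! Q 1≤q q≤Q
  ... | d , dq , d≤ = pos d *ᶻ r
      , ≈-trans (≈-reflexive (trans (cong (λ w → w *ᶻ b *ᶻ x) (trans (cong pos (sym dq)) (ℤP.pos-* d q))) (e1 (pos d) (pos q) b x))) (≈-*ˡ (pos d) e)
      , ≤-trans (≤-reflexive (ℤP.∣i*j∣≡∣i∣*∣j∣ (pos d) r)) (*-mono-≤ d≤ l)
    where
    e1 : ∀ c q y x → (c *ᶻ q) *ᶻ y *ᶻ x ≡ c *ᶻ (q *ᶻ (y *ᶻ x))
    e1 = solveℤ

  ∑ᴸ-Σp : ∀ {X : Set} (g : X → ℤ → ℕ) xs → ∑ᴸ (λ x → Σp (g x)) xs ≡ Σp (λ b → ∑ᴸ (λ x → g x b) xs)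
  ∑ᴸ-Σp g xs = trans (∑ᴸ-cong (λ x → Σp-def (g x)) xs) (trans (∑ᴸ-∑ p (λ x i → g x (pos i)) xs) (sym (Σp-def _)))

  ∑-Σp : ∀ n (g : ℕ → ℤ → ℕ) → ∑ n (λ j → Σp (g j)) ≡ Σp (λ b → ∑ n (λ j → g j b))
  ∑-Σp n g = trans (∑-cong n (λ j → Σp-def (g j))) (trans (∑-swap n p (λ j i → g j (pos i))) (sym (Σp-def _)))

  -- Two conditions on `b` are needed: small changes under multiples of most elements (`Φ`) and
  -- under short shifts (`W`). They are joined with the weights `B` and `C` into one inequality. By
  -- `h1` and `h2`, where 136 = 17 · 8, each uses up half of the average of `T` over the nonzero
  -- `b`, so some `b` satisfies it.
  module Choose (f : ℤ → Bool) (fp : Per f) (g : ℤ → Bool) (gp : Per g) (nrmG1 : Norm.nrm g gp (pos 1) ≤ 1)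
    (R : List ℤ) (k Mb J Q E c : ℕ) (s+c : size f + c ≡ p) (Mb>0 : 0 < Mb) (J>0 : 0 < J) (s>0 : 0 < size f)
    (al : All (λ x → Norm.nrm f fp x ≤ k) R)
    (h1 : 136 * p * length R * (J * k) ≤ Mb * (size f * c))
    (h2 : 136 * Q * (E * E) * p < c * Σp (Norm.nrm g gp)) where
    open Smooth f fp g gp hiding (R)
    open Norm f fp using () renaming (nrm to nrmF; nrm-mul to nrmF-mul)
    open Norm g gp using () renaming (nrm to nrmG; nrm-mul to nrmG-mul)

    φ : ℤ → ℤ → ℕ
    φ b x = ∑ (2 * J) (λ j → D b (b *ᶻ (pos j *ᶻ x)))

    Φ W : ℤ → ℕ
    Φ b = ∑ᴸ (φ b) R
    W b = ∑ (2 * E) (λ e → D b (pos e))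

    A B C : ℕ
    A = J * Mb
    B = 17 * p
    C = 17 * Q * A

    ΣΦ≤ : Σp Φ ≤ 8 * (length R * (J * (J * (k * Λ))))
    ΣΦ≤ = begin
      Σp Φ ≡⟨ ∑ᴸ-Σp (λ x b → φ b x) R ⟨
      ∑ᴸ (λ x → Σp (λ b → φ b x)) R ≤⟨ ∑ᴸ-mono (AllL.map (λ {x} l → one x l) al) ⟩
      ∑ᴸ (λ _ → 8 * (J * (J * (k * Λ)))) R ≡⟨ ∑ᴸ-const _ R ⟩
      length R * (8 * (J * (J * (k * Λ)))) ≡⟨ e1 (length R) _ ⟩
      8 * (length R * (J * (J * (k * Λ)))) ∎
      where
      open ≤-Reasoning
      e1 : ∀ a b → a * (8 * b) ≡ 8 * (a * b)
      e1 = solveℕ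
      e2 : ∀ j k l → 2 * j * (2 * (2 * j * k * l)) ≡ 8 * (j * (j * (k * l)))
      e2 = solveℕ
      one : ∀ x → nrmF x ≤ k → Σp (λ b → φ b x) ≤ 8 * (J * (J * (k * Λ)))
      one x l = begin
        Σp (λ b → φ b x) ≡⟨ ∑-Σp (2 * J) (λ j b → D b (b *ᶻ (pos j *ᶻ x))) ⟨
        ∑ (2 * J) (λ j → Σp (λ b → D b (b *ᶻ (pos j *ᶻ x)))) ≡⟨ ∑-cong (2 * J) (λ j → ΣD-dilate (pos j *ᶻ x)) ⟩
        ∑ (2 * J) (λ j → 2 * (nrmF (pos j *ᶻ x) * Λ)) ≤⟨ ∑-bound (2 * J) (2 * (2 * J * k * Λ)) (λ j j< → *-monoʳ-≤ 2 (*-monoˡ-≤ Λ (≤-trans (nrmF-mul j x) (*-mono-≤ (<⇒≤ j<) l)))) ⟩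
        2 * J * (2 * (2 * J * k * Λ)) ≡⟨ e2 J k Λ ⟩
        8 * (J * (J * (k * Λ))) ∎

    ΣW≤ : Σp W ≤ 8 * (E * (E * (size f * p)))
    ΣW≤ = begin
      Σp W ≡⟨ ∑-Σp (2 * E) (λ e b → D b (pos e)) ⟨
      ∑ (2 * E) (λ e → Σp (λ b → D b (pos e))) ≡⟨ ∑-cong (2 * E) (λ e → ΣD-const (pos e)) ⟩
      ∑ (2 * E) (λ e → 2 * (size f * (p * nrmG (pos e)))) ≤⟨ ∑-bound (2 * E) (2 * (size f * (p * (2 * E)))) (λ e e< → *-monoʳ-≤ 2 (*-monoʳ-≤ (size f) (*-monoʳ-≤ p (≤-trans (nrmG≤ e) (<⇒≤ e<))))) ⟩
      2 * E * (2 * (size f * (p * (2 * E)))) ≡⟨ e2 E (size f) p ⟩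
      8 * (E * (E * (size f * p))) ∎
      where
      open ≤-Reasoning
      e2 : ∀ e s p → 2 * e * (2 * (s * (p * (2 * e)))) ≡ 8 * (e * (e * (s * p)))
      e2 = solveℕ
      nrmG≤ : ∀ e → nrmG (pos e) ≤ e
      nrmG≤ e = ≤-trans (≤-reflexive (cong nrmG (sym (ℤP.*-identityʳ (pos e))))) (≤-trans (nrmG-mul e (pos 1)) (≤-trans (*-monoʳ-≤ e nrmG1) (≤-reflexive (*-identityʳ e))))

    ΣT' : ∑ p' (λ i → T (pos (suc i))) ≡ 2 * (size f * (c * Λ))
    ΣT' = +-cancelʳ-≡ (2 * (s * s * Λ)) _ _ (trans ΣT-nonzero (trans (cong (λ q → 2 * (s * (q * Λ))) (sym s+c)) (e s c Λ)))
      where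
      e : ∀ s c l → 2 * (s * ((s + c) * l)) ≡ 2 * (s * (c * l)) + 2 * (s * s * l)
      e = solveℕ

    nonzero≤Σp : ∀ (h : ℤ → ℕ) → ∑ p' (λ i → h (pos (suc i))) ≤ Σp h
    nonzero≤Σp h = ≤-trans (m≤n+m _ (h (pos 0))) (≤-reflexive (sym (Σp-def h)))

    opaque
      chosen : ∃[ i ] (i < p' × B * Φ (pos (suc i)) + C * W (pos (suc i)) < A * T (pos (suc i)))
      chosen = ∑-<⇒∃ p' _ _ (begin-strict
        ∑ p' (λ i → B * Φ (pos (suc i)) + C * W (pos (suc i)))
          ≡⟨ trans (∑-+ p' (λ i → B * Φ (pos (suc i))) _) (cong₂ _+_ (∑-*ˡ p' B (λ i → Φ (pos (suc i)))) (∑-*ˡ p' C (λ i → W (pos (suc i))))) ⟩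
        B * ∑ p' (λ i → Φ (pos (suc i))) + C * ∑ p' (λ i → W (pos (suc i)))
          ≤⟨ +-mono-≤ (*-monoʳ-≤ B (≤-trans (nonzero≤Σp Φ) ΣΦ≤)) (*-monoʳ-≤ C (≤-trans (nonzero≤Σp W) ΣW≤)) ⟩
        B * (8 * (length R * (J * (J * (k * Λ))))) + C * (8 * (E * (E * (s * p))))
          ≡⟨ cong₂ _+_ (e1 p (length R) J k Λ) (e2 Q A E s p) ⟩
        136 * p * length R * (J * k) * (J * Λ) + A * s * (136 * Q * (E * E) * p)
          <⟨ +-mono-≤-< (*-monoˡ-≤ (J * Λ) h1) (*-monoʳ-< (A * s) {{>-nonZero As>0}} h2) ⟩
        Mb * (s * c) * (J * Λ) + A * s * (c * Λ)
          ≡⟨ e3 J Mb s c Λ ⟩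
        A * (2 * (s * (c * Λ)))
          ≡⟨ cong (A *_) ΣT' ⟨
        A * ∑ p' (λ i → T (pos (suc i)))
          ≡⟨ ∑-*ˡ p' A (λ i → T (pos (suc i))) ⟨
        ∑ p' (λ i → A * T (pos (suc i))) ∎)
        where
        open ≤-Reasoning
        As>0 : 0 < A * s
        As>0 = *-mono-≤ {1} {A} {1} (*-mono-≤ {1} {J} {1} J>0 Mb>0) s>0
        e1 : ∀ p r j k l → 17 * p * (8 * (r * (j * (j * (k * l))))) ≡ 136 * p * r * (j * k) * (j * l)
        e1 = solveℕ
        e2 : ∀ q a e s p → 17 * q * a * (8 * (e * (e * (s * p)))) ≡ a * s * (136 * q * (e * e) * p)
        e2 = solveℕ
        e3 : ∀ j m s c l → m * (s * c) * (j * l) + j * m * s * (c * l) ≡ j * m * (2 * (s * (c * l)))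
        e3 = solveℕ

    b : ℤ
    b = pos (suc (proj₁ chosen))

    b-unit : Unit b
    b-unit = small-unit (s≤s z≤n) (s≤s (proj₁ (proj₂ chosen)))

    b-bound : B * Φ b + C * W b < A * T b
    b-bound = proj₂ (proj₂ chosen)

    module Q' = Quasi (D b) (D-per b) (D-neg b) (D-tri b)

    smooth-small : p ≤ Q * E → ∀ e → e ≤ E → 17 * p * D b (pos e) < 4 * T b
    smooth-small p≤QE e e≤E = *-cancelˡ-< A _ _ (begin-strict
      A * (17 * p * D b (pos e))                ≤⟨ *-monoʳ-≤ A (*-monoˡ-≤ (D b (pos e)) (*-monoʳ-≤ 17 p≤QE)) ⟩
      A * (17 * (Q * E) * D b (pos e))          ≡⟨ e1 A Q E (D b (pos e)) ⟩
      C * (E * D b (pos e))                     ≤⟨ *-monoʳ-≤ C (Q'.average1 E e e≤E) ⟩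
      C * (4 * W b)                             ≡⟨ e2 C (W b) ⟩
      4 * (C * W b)                             <⟨ *-monoʳ-< 4 (≤-<-trans (m≤n+m (C * W b) (B * Φ b)) b-bound) ⟩
      4 * (A * T b)                             ≡⟨ e2' A (T b) ⟩
      A * (4 * T b)                             ∎)
      where
      open ≤-Reasoning
      e1 : ∀ a q e d → a * (17 * (q * e) * d) ≡ 17 * q * a * (e * d)
      e1 = solveℕ
      e2 : ∀ c w → c * (4 * w) ≡ 4 * (c * w)
      e2 = solveℕ
      e2' : ∀ c w → 4 * (c * w) ≡ c * (4 * w)
      e2' = solveℕ

    good : ℤ → Bool
    good x = ⌊ B * φ b x <? J * T b ⌋

    good-small : ∀ {x} → good x ≡ true → ∀ j → j ≤ J → 17 * p * D b (pos j *ᶻ (b *ᶻ x)) < 4 * T b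
    good-small {x} gd j j≤J = *-cancelˡ-< J _ _ (begin-strict
      J * (B * D b (pos j *ᶻ (b *ᶻ x)))              ≡⟨ e1 J B _ ⟩
      B * (J * D b (pos j *ᶻ (b *ᶻ x)))              ≤⟨ *-monoʳ-≤ B (Q'.average J (b *ᶻ x) j j≤J) ⟩
      B * (4 * ∑ (2 * J) (λ l → D b (pos l *ᶻ (b *ᶻ x)))) ≡⟨ cong (λ w → B * (4 * w)) (∑-cong (2 * J) (λ l → cong (D b) (e2 (pos l) b x))) ⟩
      B * (4 * φ b x)                                ≡⟨ e3 B (φ b x) ⟩
      4 * (B * φ b x)                                <⟨ *-monoʳ-< 4 (⌊⌋-sound (B * φ b x <? J * T b) gd) ⟩
      4 * (J * T b)                                  ≡⟨ e4 J (T b) ⟩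
      J * (4 * T b)                                  ∎)
      where
      open ≤-Reasoning
      e1 : ∀ j b d → j * (b * d) ≡ b * (j * d)
      e1 = solveℕ
      e2 : ∀ l b x → l *ᶻ (b *ᶻ x) ≡ b *ᶻ (l *ᶻ x)
      e2 = solveℤ
      e3 : ∀ c w → c * (4 * w) ≡ 4 * (c * w)
      e3 = solveℕ
      e4 : ∀ c w → 4 * (c * w) ≡ c * (4 * w)
      e4 = solveℕ

    -- Each bad element contributes at least `J * T b` to `B * Φ b`, which is below `Mb` times this
    -- amount.
    bad≤ : ∀ {bad} good' → R ↭ good' ++ bad → All (λ x → good x ≡ false) bad → length bad ≤ Mb
    bad≤ {bad} good' r al' = <⇒≤ (*-cancelʳ-< (J * T b) (length bad) Mb (begin-strict
      length bad * (J * T b)          ≡⟨ ∑ᴸ-const (J * T b) bad ⟨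
      ∑ᴸ (λ _ → J * T b) bad          ≤⟨ ∑ᴸ-mono (AllL.map (λ {x} q → ≮⇒≥ (⌊⌋-unsound (B * φ b x <? J * T b) q)) al') ⟩
      ∑ᴸ (λ x → B * φ b x) bad        ≤⟨ m≤n+m _ (∑ᴸ (λ x → B * φ b x) good') ⟩
      ∑ᴸ (λ x → B * φ b x) good' + ∑ᴸ (λ x → B * φ b x) bad ≡⟨ trans (sym (∑ᴸ-++ _ good' bad)) (trans (sym (∑ᴸ-↭ _ r)) (∑ᴸ-*ˡ B (φ b) R)) ⟩
      B * Φ b                         ≤⟨ m≤m+n _ (C * W b) ⟩
      B * Φ b + C * W b               <⟨ b-bound ⟩
      J * Mb * T b                    ≡⟨ e J Mb (T b) ⟩
      Mb * (J * T b)                  ∎))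
      where
      open ≤-Reasoning
      e : ∀ j m t → j * m * t ≡ m * (j * t)
      e = solveℕ

    good→small : ∀ w .{{_ : NonZero Q}} .{{_ : NonZero E}} → p ≤ Q * E → (∀ a → a * (J / Q) < p → a ≤ w) →
      ∀ {x} → good x ≡ true → Small (Q ! * w) (pos (Q !) *ᶻ b) x
    good→small w p≤QE hw {x} gd =
      let (q , r , 1≤q , q≤Q , e , l) = Q'.small-multiple (b *ᶻ x) J E Q p≤QE (good-small gd) (smooth-small p≤QE)
      in small-factorial {Q} {q} {b} {x} {r} {w} 1≤q q≤Q e (hw ∣ r ∣ l)

    concentrated : ∀ w .{{_ : NonZero Q}} .{{_ : NonZero E}} → p ≤ Q * E → Q < p → (∀ a → a * (J / Q) < p → a ≤ w) →
      ∃[ b' ] ∃[ R₁ ] ∃[ R₂ ] (Unit b' × R ↭ R₁ ++ R₂ × length R₂ ≤ Mb × All (Small (Q ! * w) b') R₁)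
    concentrated w p≤QE Q<p hw =
      let (R₁ , R₂ , r , al₁ , al₂ , _) = filterᴸ good R
      in pos (Q !) *ᶻ b , R₁ , R₂ , Unit-* (factorial-unit Q Q<p) b-unit , r , bad≤ R₁ r al₂ , AllL.map (good→small w p≤QE hw) al₁

  -- Growth of the set of sums

  cons-out : ∀ {R : List ℤ} → 0 < length R → ∃[ z ] ∃[ R' ] (R ≡ z ∷ R')
  cons-out {z ∷ R} _ = z , R , refl

  ++-length : ∀ {X : Set} (xs {ys} : List X) → length (xs ++ ys) ≡ length xs + length ys
  ++-length xs = LP.length-++ xs

  ∣Σ∣≤p : ∀ F → ∣Σ F ∣ ≤ p
  ∣Σ∣≤p F = size≤p (sums F)

  -- The growth continues up to T₁, because only O(m k) elements have norm at most k.
  growth : ∀ {m zs} T₀ T₁ k X → ZSF zs → Mult m zs → 8 * k ≤ T₀ → T₀ ≤ p → 2 * T₁ ≤ p → T₁ ≤ X * suc k →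
    T₀ + 2 + X + 16 * (m * k) < length zs →
    ∃[ F ] ∃[ R ] (zs ↭ F ++ R × T₁ ≤ ∣Σ F ∣ × length F ≤ T₀ + 2 + X)
  growth {m} {zs} T₀ T₁ k X zsf mult 8k≤T₀ T₀≤p 2T₁≤p T₁≤X room = F₁ , R₁ , perm , ≮⇒≥ big₁ , F₁≤
    where
    -- The first stage, with threshold 1, provides the `8 * k` sums that `vol-linear` presupposes.
    module S₀ = Stage (stage 1 T₀ [] zs)
    F₀ = S₀.F'
    R₀ = S₀.R'
    F₀≤ : length F₀ ≤ T₀ + 1
    F₀≤ = ≤-trans (≤-reflexive (sym (*-identityʳ (length F₀)))) S₀.cost
    room₀ : T₀ + 1 < length zs
    room₀ = ≤-<-trans (≤-trans (+-monoʳ-≤ T₀ (s≤s z≤n)) (≤-trans (m≤m+n _ X) (m≤m+n _ (16 * (m * k))))) room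
    rest : ∀ {F R} → zs ↭ F ++ R → ∀ {b} → length F ≤ b → b < length zs → 0 < length R
    rest {F} {R} r F≤ b< = n≢0⇒n>0 (λ e → <-irrefl refl (<-≤-trans b< (≤-trans (≤-reflexive (trans (trans (↭-length r) (++-length F)) (trans (cong (length F +_) e) (+-identityʳ _)))) F≤)))
    big₀ : T₀ ≤ ∣Σ F₀ ∣
    big₀ with S₀.goal
    ... | inj₁ l = l
    ... | inj₂ al with cons-out (rest {F₀} {R₀} S₀.perm F₀≤ room₀) | ZSF-unit (ZSF-++ʳ F₀ (ZSF-↭ S₀.perm zsf))
    ... | z , R' , e | un = ≤-trans T₀≤p (≮⇒≥ (λ s<p → ¬0 s<p))
      where
      ¬0 : ∣Σ F₀ ∣ < p → ⊥
      ¬0 s<p with subst (All _) e al | subst (All _) e un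
      ... | a ∷ _ | u ∷ _ = contradiction (≤-trans (NormOf.nrm-positive F₀ u (∣Σ∣>0 F₀) s<p) (≤-pred a)) λ ()
    module S₁ = Stage (stage (suc k) T₁ F₀ R₀)
    F₁ = S₁.F'
    R₁ = S₁.R'
    perm : zs ↭ F₁ ++ R₁
    perm = ↭-trans S₀.perm S₁.perm
    F₁≤ : length F₁ ≤ T₀ + 2 + X
    F₁≤ = *-cancelʳ-≤ (length F₁) _ (suc k) (≤-trans S₁.cost (≤-trans (+-mono-≤ (*-monoˡ-≤ (suc k) F₀≤) (+-monoˡ-≤ (suc k) T₁≤X)) (≤-reflexive (e T₀ X (suc k)))))
      where
      e : ∀ t x k → (t + 1) * k + (x * k + k) ≡ (t + 2 + x) * k
      e = solveℕ
    room₁ : T₀ + 2 + X < length zs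
    room₁ = ≤-<-trans (m≤m+n _ (16 * (m * k))) room
    big₁ : ¬ (∣Σ F₁ ∣ < T₁)
    big₁ lt with S₁.goal
    ... | inj₁ l = <-irrefl refl (<-≤-trans lt l)
    ... | inj₂ al with cons-out (rest {F₁} {R₁} perm F₁≤ room₁) | ZSF-unit (ZSF-++ʳ F₁ (ZSF-↭ perm zsf))
    ... | z , R' , e | un with subst (All _) e al | subst (All _) e un
    ... | a ∷ _ | u ∷ _ = <-irrefl refl (<-≤-trans room (begin
        length zs                                                     ≡⟨ trans (↭-length perm) (++-length F₁) ⟩
        length F₁ + length R₁                                         ≤⟨ +-mono-≤ F₁≤ (length≤m*vol (sums F₁) (sums-per F₁) k (Mult-++ʳ F₁ (Mult-↭ perm mult)) (AllL.map ≤-pred al)) ⟩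
        T₀ + 2 + X + m * NormOf.vol F₁ k                              ≤⟨ +-monoʳ-≤ (T₀ + 2 + X) (*-monoʳ-≤ m (NormOf.vol-linear F₁ u (≤-pred a) (≤-trans 8k≤T₀ (≤-trans big₀ S₁.mono)) (∣Σ∣>0 F₁) (<-≤-trans (*-monoʳ-< 2 lt) 2T₁≤p))) ⟩
        T₀ + 2 + X + m * (16 * k)                                     ≡⟨ cong (T₀ + 2 + X +_) (e' m k) ⟩
        T₀ + 2 + X + 16 * (m * k)                                     ∎))
      where
      open ≤-Reasoning
      e' : ∀ m k → m * (16 * k) ≡ 16 * (m * k)
      e' = solveℕ

  ZSF-length : ∀ zs → ZSF zs → 2 ≤ p → suc (length zs) ≤ p
  ZSF-length zs zsf 2≤p = ≤-trans (grow zs zsf) (∣Σ∣≤p zs)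
    where
    grow : ∀ zs → ZSF zs → suc (length zs) ≤ ∣Σ zs ∣
    grow [] _ = ≤-reflexive (sym ∣Σ[]∣)
    grow (z ∷ zs) zsf = ≤-trans (step (∣Σ zs ∣ <? p) (ZSF-unit zsf)) (≤-reflexive (sym (∣Σ∷∣ z zs)))
      where
      step : Dec (∣Σ zs ∣ < p) → All Unit (z ∷ zs) → suc (suc (length zs)) ≤ ∣Σ zs ∣ + nrmOf zs z
      step (yes l) (u ∷ _) = ≤-trans (≤-reflexive (+-comm 1 (suc (length zs)))) (+-mono-≤ (grow zs (ZSF-++ʳ (z ∷ []) zsf)) (NormOf.nrm-positive zs u (∣Σ∣>0 zs) l))
      -- The sums of `zs` would fill ℤ_p, while `z` alone has two sums, 0 and itself; `∣Σ∣-disjoint`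
      -- excludes this.
      step (no nl) (u ∷ _) = contradiction (≤-trans (+-mono-≤ two (≮⇒≥ nl)) (≤-trans (∣Σ∣-disjoint (z ∷ []) zs zsf) (≤-reflexive (+-comm p 1)))) (<-irrefl refl)
        where
        two : 2 ≤ ∣Σ z ∷ [] ∣
        two = ≤-trans (+-mono-≤ (≤-reflexive (sym ∣Σ[]∣)) (NormOf.nrm-positive [] u (∣Σ∣>0 []) (subst (_< p) (sym ∣Σ[]∣) 2≤p))) (≤-reflexive (sym (∣Σ∷∣ z [])))

  -- By `Λ-value` the sum is `L (p - L)`, and each factor is at least p / 3.
  ΣnrmG≥ : ∀ L → L + L ≤ p → p ≤ 3 * L → p * p ≤ 9 * Σp (Norm.nrm (interval L) (interval-per L))
  ΣnrmG≥ L 2L≤p p≤3L with m≤n⇒∃[o]m+o≡n 2L≤p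
  ... | r , e = begin
    p * p                                    ≤⟨ *-mono-≤ p≤3L p≤3L ⟩
    3 * L * (3 * L)                          ≡⟨ e1 L ⟩
    9 * (L * L)                              ≤⟨ *-monoʳ-≤ 9 (+-cancelʳ-≤ (L * L) (L * L) Λ' (≤-trans (≤-trans (m≤m+n _ (r * L)) (≤-reflexive (e2 L r))) (≤-reflexive (trans (cong (_* L) e) (sym val))))) ⟩
    9 * Λ'                                   ∎
    where
    open ≤-Reasoning
    Λ' = Σp (Norm.nrm (interval L) (interval-per L))
    L≤p : L ≤ p
    L≤p = ≤-trans (m≤m+n L L) 2L≤p
    val : Λ' + L * L ≡ p * L
    val = subst (λ l → Λ' + l * l ≡ p * l) (size-interval L≤p) (Smooth.Λ-value (sums []) (sums-per []) (interval L) (interval-per L))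
    e1 : ∀ L → 3 * L * (3 * L) ≡ 9 * (L * L)
    e1 = solveℕ
    e2 : ∀ L r → L * L + L * L + r * L ≡ (L + L + r) * L
    e2 = solveℕ

  -- Concentration of most elements on small integers

  module Concentrate (y Q κ : ℕ) .{{_ : NonZero y}} .{{_ : NonZero Q}} where

    Conclusion : ℕ → List ℤ → Set
    Conclusion m zs = ∃[ w ] ∃[ b ] ∃[ R₁ ] ∃[ R₂ ]
      (Unit b × zs ↭ R₁ ++ R₂ × y * length R₂ ≤ 7 * length zs × All (Small (Q ! * w) b) R₁ × m * w ≤ κ * length zs)

    module Run {m zs} (zsf : ZSF zs) (mult : Mult m zs) (parameters : Parameters y Q κ (length zs) p m) where
      N : ℕ
      N = length zs
      open Parameters parameters

      2≤p : 2 ≤ p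
      2≤p = ≤-trans (s≤s 1≤Q) Q<p

      ny≤p : ny ≤ p
      ny≤p = ≤-trans (≤-trans (m≤m*n ny y) ny*y≤N) (<⇒≤ (ZSF-length zs zsf 2≤p))

      room' : ∀ {n} → N ≤ n + (3 * ny + 3) → ny + 2 + ny + 16 * (m * k') < n
      room' {n} e = +-cancelʳ-< (3 * ny + 3) _ _ (≤-<-trans (≤-reflexive (e1 ny (16 * (m * k')))) (<-≤-trans room e))
        where
        e1 : ∀ n c → n + 2 + n + c + (3 * n + 3) ≡ 5 * n + 5 + c
        e1 = solveℕ

      phase₁ : ∃[ F ] ∃[ R ] (zs ↭ F ++ R × suc t ≤ ∣Σ F ∣ × length F ≤ ny + 2 + ny)
      phase₁ = growth ny (suc t) k' ny zsf mult 8k'≤ny ny≤p 2T₁≤p T₁≤ (room' (m≤m+n N _))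

      F₁ R₁ : List ℤ
      F₁ = proj₁ phase₁
      R₁ = proj₁ (proj₂ phase₁)

      -- The target `suc p` cannot be reached, so this stage ends only when all remaining elements
      -- have small norm.
      module S₂ = Stage (stage (suc k₂) (suc p) F₁ R₁)
      F₂ = S₂.F'
      R₂ = S₂.R'

      perm₂ : zs ↭ F₂ ++ R₂
      perm₂ = ↭-trans (proj₁ (proj₂ (proj₂ phase₁))) S₂.perm

      small₂ : All (λ z → nrmOf F₂ z ≤ suc k₂) R₂
      small₂ with S₂.goal
      ... | inj₁ l  = contradiction (∣Σ∣≤p F₂) (<⇒≱ l)
      ... | inj₂ al = AllL.map <⇒≤ al

      T₁≤F₂ : suc t ≤ ∣Σ F₂ ∣
      T₁≤F₂ = ≤-trans (proj₁ (proj₂ (proj₂ (proj₂ phase₁)))) S₂.mono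

      F₂≤ : length F₂ ≤ 3 * ny + 3
      F₂≤ = *-cancelʳ-≤ _ _ (suc k₂) (≤-trans S₂.cost (≤-trans (+-mono-≤ (*-monoˡ-≤ (suc k₂) (proj₂ (proj₂ (proj₂ (proj₂ phase₁))))) (+-monoˡ-≤ (suc k₂) k₂-lower)) (≤-reflexive (e ny (suc k₂)))))
        where
        e : ∀ n k → (n + 2 + n) * k + (n * k + k) ≡ (3 * n + 3) * k
        e = solveℕ

      N≡ : N ≡ length F₂ + length R₂
      N≡ = trans (↭-length perm₂) (++-length F₂)

      -- A second set with many sums, disjoint from `F₂`. Through `∣Σ∣-disjoint` it bounds the
      -- complement of the sums of `F₂` from below, see `t≤c`.
      phase₃ : ∃[ F ] ∃[ R ] (R₂ ↭ F ++ R × suc t ≤ ∣Σ F ∣ × length F ≤ ny + 2 + ny)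
      phase₃ = growth ny (suc t) k' ny (ZSF-++ʳ F₂ (ZSF-↭ perm₂ zsf)) (Mult-++ʳ F₂ (Mult-↭ perm₂ mult)) 8k'≤ny ny≤p 2T₁≤p T₁≤
        (room' (≤-trans (≤-reflexive (trans N≡ (+-comm (length F₂) _))) (+-monoʳ-≤ (length R₂) F₂≤)))

      F₃ R₃ : List ℤ
      F₃ = proj₁ phase₃
      R₃ = proj₁ (proj₂ phase₃)

      co : ∃[ c ] (∣Σ F₂ ∣ + c ≡ p)
      co = m≤n⇒∃[o]m+o≡n (∣Σ∣≤p F₂)

      c : ℕ
      c = proj₁ co

      t≤c : t ≤ c
      t≤c = ≤-pred (+-cancelˡ-≤ ∣Σ F₂ ∣ _ _ (≤-trans (+-monoʳ-≤ ∣Σ F₂ ∣ (proj₁ (proj₂ (proj₂ (proj₂ phase₃)))))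
        (≤-trans (∣Σ∣-disjoint F₂ F₃ (ZSF-++ˡ R₃ (ZSF-↭ (↭-trans perm₂ (↭-trans (↭P.++⁺ˡ F₂ (proj₁ (proj₂ (proj₂ phase₃)))) (↭-reflexive (sym (LP.++-assoc F₂ F₃ R₃))))) zsf)))
        (≤-reflexive (trans (cong (_+ 1) (sym (proj₂ co))) (trans (+-assoc ∣Σ F₂ ∣ c 1) (cong (∣Σ F₂ ∣ +_) (+-comm c 1))))))))

      L : ℕ
      L = p / 2

      1≤L : 1 ≤ L
      1≤L = m≥n⇒m/n>0 2≤p

      L+L≤p : L + L ≤ p
      L+L≤p = ≤-trans (≤-reflexive (e L)) (m/n*n≤m p 2)
        where
        e : ∀ L → L + L ≡ L * 2
        e = solveℕ

      p≤3L : p ≤ 3 * L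
      p≤3L = ≤-trans (≤-pred (≤-trans (div-upper p 2) (≤-reflexive (e L)))) (≤-trans (+-monoˡ-≤ (L * 2) 1≤L) (≤-reflexive (e' L)))
        where
        e : ∀ L → (1 + L) * 2 ≡ 1 + (1 + L * 2)
        e = solveℕ
        e' : ∀ L → L + L * 2 ≡ 3 * L
        e' = solveℕ

      module C = Choose (sums F₂) (sums-per F₂) (interval L) (interval-per L) (nrm-interval (≤-trans (m≤m+n L L) L+L≤p))
        R₂ (suc k₂) ny J Q (suc E) c (proj₂ co) 1≤ny 1≤J (∣Σ∣>0 F₂) small₂
        (weight (≤-trans (m≤n+m _ (length F₂)) (≤-reflexive (sym N≡))) (≤-trans (n≤1+n t) T₁≤F₂) t≤c)
        (smoothing t≤c (ΣnrmG≥ L L+L≤p p≤3L))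

      result : Conclusion m zs
      result =
        let (b , G , H , b-unit , perm , H≤ , sm) = C.concentrated W p≤QE Q<p W-bound
        in W , b , G , F₂ ++ H , b-unit
           , ↭-trans perm₂ (↭-trans (↭P.++⁺ˡ F₂ perm) (↭-trans (↭P.++-comm F₂ (G ++ H)) (↭-trans (↭-reflexive (LP.++-assoc G H F₂)) (↭P.++⁺ˡ G (↭P.++-comm H F₂)))))
           , small-part H≤ , sm , mW≤
        where
        e1 : ∀ y n → y * (3 * n + 3 + n) ≡ 4 * (n * y) + 3 * (1 * y)
        e1 = solveℕ
        e2 : ∀ N → 4 * N + 3 * N ≡ 7 * N
        e2 = solveℕ
        small-part : ∀ {H} → length H ≤ ny → y * length (F₂ ++ H) ≤ 7 * N
        small-part H≤ = ≤-trans (*-monoʳ-≤ y (≤-trans (≤-reflexive (++-length F₂)) (+-mono-≤ F₂≤ H≤))) (≤-trans (≤-reflexive (e1 y ny))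
          (≤-trans (+-mono-≤ (*-monoʳ-≤ 4 ny*y≤N) (*-monoʳ-≤ 3 (≤-trans (*-monoˡ-≤ y 1≤ny) ny*y≤N))) (≤-reflexive (e2 N))))

  -- Dilations of sequences and the excess over the extremal sequence

  -- A relation and not a map, because the dilated residues are to be represented by small integers
  -- instead of the products themselves.
  data Dilates (b : ℤ) : List ℤ → List ℤ → Set where
    []  : Dilates b [] []
    _∷_ : ∀ {z r zs rs} → b *ᶻ z ≈ r → Dilates b zs rs → Dilates b (z ∷ zs) (r ∷ rs)

  Dilates-map : ∀ b zs → Dilates b zs (map (b *ᶻ_) zs)
  Dilates-map b []       = []
  Dilates-map b (z ∷ zs) = ≈-refl ∷ Dilates-map b zs

  Dilates-++ : ∀ {b xs ys us vs} → Dilates b xs us → Dilates b ys vs → Dilates b (xs ++ ys) (us ++ vs)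
  Dilates-++ []      q = q
  Dilates-++ (e ∷ d) q = e ∷ Dilates-++ d q

  Dilates-length : ∀ {b xs us} → Dilates b xs us → length xs ≡ length us
  Dilates-length []      = refl
  Dilates-length (_ ∷ d) = cong suc (Dilates-length d)

  Dilates-↭ : ∀ {b zs rs rs'} → Dilates b zs rs → rs ↭ rs' → ∃[ zs' ] (zs ↭ zs' × Dilates b zs' rs')
  Dilates-↭ {zs = zs} d ↭refl = zs , ↭-refl , d
  Dilates-↭ {zs = z ∷ zs} (e ∷ d) (prep _ r) with Dilates-↭ d r
  ... | zs' , r' , d' = z ∷ zs' , prep z r' , e ∷ d'
  Dilates-↭ {zs = z ∷ w ∷ zs} (e ∷ e' ∷ d) (swap _ _ r) with Dilates-↭ d r
  ... | zs' , r' , d' = w ∷ z ∷ zs' , swap z w r' , e' ∷ e ∷ d'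
  Dilates-↭ d (↭trans r s) with Dilates-↭ d r
  ... | zs' , r' , d' with Dilates-↭ d' s
  ...   | zs'' , r'' , d'' = zs'' , ↭-trans r' r'' , d''

  Dilates-SS : ∀ {b zs rs v} → Dilates b zs rs → SS rs v → ∃[ w ] (SS zs w × b *ᶻ w ≈ v)
  Dilates-SS {b} [] [] = pos 0 , [] , ≈-reflexive (ℤP.*-zeroʳ b)
  Dilates-SS (_ ∷ d) (skip s) with Dilates-SS d s
  ... | w , t , e = w , skip t , e
  Dilates-SS {b} {z ∷ _} (e' ∷ d) (take s) with Dilates-SS d s
  ... | w , t , e = z +ᶻ w , take t , ≈-trans (≈-reflexive (ℤP.*-distribˡ-+ b z w)) (≈-+ e' e)

  Dilates-ZSF : ∀ {b zs rs} → Unit b → Dilates b zs rs → ZSF zs → ZSF rs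
  Dilates-ZSF {b} u d zsf {r} {rs'} {v} perm s e with Dilates-↭ d perm
  ... | z ∷ zs' , perm' , (dz ∷ d') with Dilates-SS d' s
  ...   | w , t , dw with (z +ᶻ w) ≈? pos 0
  ...     | yes q = zsf perm' t q
  ...     | no nq = Unit-* {b} {z +ᶻ w} u nq (≈-trans (≈-reflexive (ℤP.*-distribˡ-+ b z w)) (≈-trans (≈-+ dz dw) e))

  count : ℤ → List ℤ → ℕ
  count a = # (λ z → δ (z -ᶻ a))

  Dilates-Mult : ∀ {b zs rs m} → Unit b → Dilates b zs rs → Mult m zs → Mult m rs
  Dilates-Mult {b} {zs} {rs} {m} u d mu a with inverse u
  ... | w , bw = ≤-trans (≤-reflexive (go d)) (mu (a *ᶻ w))
    where
    wb : w *ᶻ b ≈ pos 1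
    wb = ≈-trans (≈-reflexive (ℤP.*-comm w b)) bw
    same : ∀ {z r} → b *ᶻ z ≈ r → δ (r -ᶻ a) ≡ δ (z -ᶻ a *ᶻ w)
    same {z} {r} e with r ≈? a
    ... | yes q = trans (δ-true (≈⇒≈0 q)) (sym (δ-true (≈⇒≈0 {z} {a *ᶻ w} (≈-trans (≈-sym (inverse-cancel b w bw z)) (≈-*ʳ w {z *ᶻ b} {a} (≈-trans (≈-reflexive (ℤP.*-comm z b)) (≈-trans e q)))))))
    ... | no nq = trans (δ-false (nq ∘ ≈0⇒≈)) (sym (δ-false (λ q → nq (≈-trans (≈-sym e) (≈-trans (≈-reflexive (ℤP.*-comm b z)) (≈-trans (≈-*ʳ b {z} {a *ᶻ w} (≈0⇒≈ {z} {a *ᶻ w} q)) (inverse-cancel w b wb a)))))))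
    go : ∀ {zs rs} → Dilates b zs rs → count a rs ≡ count (a *ᶻ w) zs
    go []      = refl
    go (e ∷ d) = cong₂ _+_ (cong ι (same e)) (go d)

  -- `Ex zs` is the least number of elements whose removal makes `zs` fit into the multiplicities
  -- `a₁`. `P` asks for a dilate whose excess satisfies `Q`. It is carried back along permutations
  -- and dilations, so the sequence may be replaced by a dilate at any moment.
  module Excess (a₁ : ℕ → ℕ) (Q : ℕ → Set) where
    Ex : List ℤ → ℕ
    Ex zs = Σp (λ v → count v zs ∸ a₁ (v %ℕ p))

    P : List ℤ → Set
    P zs = ∃[ b ] (Unit b × Q (Ex (map (b *ᶻ_) zs)))

    Ex-↭ : ∀ {xs ys} → xs ↭ ys → Ex xs ≡ Ex ys
    Ex-↭ r = Σp-cong (λ v → cong (_∸ a₁ (v %ℕ p)) (#-↭ _ r))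

    P-↭ : ∀ {xs ys} → xs ↭ ys → P ys → P xs
    P-↭ r (b , u , q) = b , u , subst Q (Ex-↭ (↭P.map⁺ (b *ᶻ_) (↭-sym r))) q

    P-dilate : ∀ {b zs rs} → Unit b → Dilates b zs rs → P rs → P zs
    P-dilate {b} {zs} {rs} u d (b' , u' , q) = b' *ᶻ b , Unit-* u' u , subst Q (Σp-cong (λ v → cong (_∸ a₁ (v %ℕ p)) (go v d))) q
      where
      go : ∀ v {zs rs} → Dilates b zs rs → count v (map (b' *ᶻ_) rs) ≡ count v (map ((b' *ᶻ b) *ᶻ_) zs)
      go v [] = refl
      go v {z ∷ zs} (e ∷ d) = cong₂ _+_ (cong ι (δ-per (≈-minus (≈-trans (≈-*ˡ b' (≈-sym e)) (≈-reflexive (sym (ℤP.*-assoc b' b z)))) (≈-refl {v})))) (go v d)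

  small-reps : ∀ {w b R} → All (Small w b) R → ∃[ G ] (Dilates b R G × All (λ r → ∣ r ∣ ≤ w) G)
  small-reps [] = [] , [] , []
  small-reps ((r , e , l) ∷ al) with small-reps al
  ... | G , d , al' = r ∷ G , e ∷ d , l ∷ al'

  Mult⇒VMult : ∀ {m R} → Mult m R → VMult m R
  Mult⇒VMult {m} {R} mu a = ≤-trans (∑ᴸ-mono (AllL.universal le R)) (mu a)
    where
    le : ∀ z → ι ⌊ z ≟ᶻ a ⌋ ≤ ι (δ (z -ᶻ a))
    le z with z ≟ᶻ a
    ... | yes refl = ≤-reflexive (sym (cong ι (δ-true (≈⇒≈0 {z} ≈-refl))))
    ... | no _     = z≤n

  ZSF-nonzero : ∀ {R} → ZSF R → All (λ r → 1 ≤ ∣ r ∣) R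
  ZSF-nonzero zsf = AllL.map (λ {r} u → n≢0⇒n>0 (λ e → u (≈-reflexive (ℤP.∣i∣≡0⇒i≡0 e)))) (ZSF-unit zsf)

  box : ∀ {W m R} → ZSF R → Mult m R → All (λ r → ∣ r ∣ ≤ W) R → Box W m R
  box {R = R} zsf mu al = record { bounded = al ; nonzero = ZSF-nonzero zsf ; mult = Mult⇒VMult {R = R} mu }

  Box-length : ∀ {W m R} → Box W m R → length R ≤ 2 * (m * W)
  Box-length {W} {m} {R} bx = begin
    length R                                                                        ≡⟨ trans (∑ᴸ-const 1 R) (*-identityʳ _) ⟨
    ∑ᴸ (λ _ → 1) R                                                                  ≤⟨ ∑ᴸ-mono (AllL.zipWith (λ {r} (a , b) → hit r a b) (Box.bounded bx , Box.nonzero bx)) ⟩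
    ∑ᴸ (λ r → ∑ W (λ i → ι ⌊ r ≟ᶻ pos (suc i) ⌋ + ι ⌊ r ≟ᶻ -[1+ i ] ⌋)) R           ≡⟨ ∑ᴸ-∑ W (λ r i → ι ⌊ r ≟ᶻ pos (suc i) ⌋ + ι ⌊ r ≟ᶻ -[1+ i ] ⌋) R ⟩
    ∑ W (λ i → ∑ᴸ (λ r → ι ⌊ r ≟ᶻ pos (suc i) ⌋ + ι ⌊ r ≟ᶻ -[1+ i ] ⌋) R)           ≤⟨ ∑-bound W (m + m) (λ i _ → ≤-trans (≤-reflexive (∑ᴸ-+ (λ r → ι ⌊ r ≟ᶻ pos (suc i) ⌋) (λ r → ι ⌊ r ≟ᶻ -[1+ i ] ⌋) R)) (+-mono-≤ (Box.mult bx (pos (suc i))) (Box.mult bx -[1+ i ]))) ⟩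
    W * (m + m)                                                                     ≡⟨ e W m ⟩
    2 * (m * W)                                                                     ∎
    where
    open ≤-Reasoning
    e : ∀ W m → W * (m + m) ≡ 2 * (m * W)
    e = solveℕ
    hit : ∀ r → ∣ r ∣ ≤ W → 1 ≤ ∣ r ∣ → 1 ≤ ∑ W (λ i → ι ⌊ r ≟ᶻ pos (suc i) ⌋ + ι ⌊ r ≟ᶻ -[1+ i ] ⌋)
    hit (pos (suc n)) l _ = ≤-trans (≤-trans (≤-reflexive (sym (ι-yes (pos (suc n) ≟ᶻ pos (suc n)) refl))) (m≤m+n _ _)) (term≤∑ W (λ i → ι ⌊ pos (suc n) ≟ᶻ pos (suc i) ⌋ + ι ⌊ pos (suc n) ≟ᶻ -[1+ i ] ⌋) n l)
    hit -[1+ n ]      l _ = ≤-trans (≤-trans (≤-reflexive (sym (ι-yes (-[1+ n ] ≟ᶻ -[1+ n ]) refl))) (m≤n+m _ _)) (term≤∑ W (λ i → ι ⌊ -[1+ n ] ≟ᶻ pos (suc i) ⌋ + ι ⌊ -[1+ n ] ≟ᶻ -[1+ i ] ⌋) n l)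

  -- Removal of common factors

  factor-search : ∀ t G C → (∃[ g ] (2 ≤ g × g ≤ C × # (nondiv g) G ≤ t)) ⊎ (∀ g → 2 ≤ g → g ≤ C → t < # (nondiv g) G)
  factor-search t G zero = inj₂ λ g 2≤g g≤ → contradiction (≤-trans 2≤g g≤) λ ()
  factor-search t G (suc C) with factor-search t G C
  ... | inj₁ (g , a , b , c) = inj₁ (g , a , ≤-trans b (n≤1+n C) , c)
  ... | inj₂ f with 2 ≤? suc C | # (nondiv (suc C)) G ≤? t
  ... | yes a | yes b = inj₁ (suc C , a , ≤-refl , b)
  ... | no na | _     = inj₂ λ g 2≤g g≤ → contradiction (≤-trans 2≤g g≤) na
  ... | yes _ | no nb = inj₂ λ g 2≤g g≤ → go g 2≤g (m≤n⇒m<n∨m≡n g≤)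
    where
    go : ∀ g → 2 ≤ g → (g < suc C) ⊎ (g ≡ suc C) → t < # (nondiv g) G
    go g 2≤g (inj₁ l)    = f g 2≤g (≤-pred l)
    go g 2≤g (inj₂ refl) = ≰⇒> nb

  quotients : ∀ {W w} g .{{_ : NonZero g}} {G} → pos g *ᶻ w ≈ pos 1 → All (λ r → ∣ r ∣ ≤ W) G → All (λ r → r %ℕ g ≡ 0) G →
    ∃[ G' ] (Dilates w G G' × All (λ r → ∣ r ∣ ≤ W / g) G')
  quotients g e [] [] = [] , [] , []
  quotients {W} {w} g {r ∷ G} e (l ∷ ls) (d ∷ ds) with quotients {W} {w} g {G} e ls ds
  ... | G' , dl , al = r /ℕ g ∷ G' , dil ∷ dl , bd ∷ al
    where
    r≡ : r ≡ (r /ℕ g) *ᶻ pos g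
    r≡ = trans (residue-eq r g) (trans (cong (λ v → pos v +ᶻ (r /ℕ g) *ᶻ pos g) d) (ℤP.+-identityˡ _))
    dil : w *ᶻ r ≈ r /ℕ g
    dil = ≈-trans (≈-reflexive (trans (cong (w *ᶻ_) r≡) (ℤP.*-comm w _))) (inverse-cancel (pos g) w e (r /ℕ g))
    bd : ∣ r /ℕ g ∣ ≤ W / g
    bd = ≤-trans (≤-reflexive (sym (m*n/n≡m ∣ r /ℕ g ∣ g))) (/-monoˡ-≤ g (≤-trans (≤-reflexive (trans (sym (ℤP.∣i*j∣≡∣i∣*∣j∣ (r /ℕ g) (pos g))) (cong ∣_∣ (sym r≡)))) l))

  -- As long as some g ≤ C divides almost all elements of G, everything is divided by g modulo p.
  module Normalise (a₁ : ℕ → ℕ) (Q : ℕ → Set) (m N C t h : ℕ) (C<p : C < p) (2h≤N : 2 * h ≤ N) where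
    open Excess a₁ Q

    record State (W : ℕ) (G H : List ℤ) : Set where
      field
        zsf   : ZSF (G ++ H)
        mult  : Mult m (G ++ H)
        total : length G + length H ≡ N
        small : All (λ r → ∣ r ∣ ≤ W) G

    divide : ∀ {W G H} g → 2 ≤ g → g ≤ C → # (nondiv g) G ≤ t → State W G H →
      ∃[ G' ] ∃[ H' ] (State (W / 2) G' H' × length H' ≤ t + length H × (P (G' ++ H') → P (G ++ H)))
    divide 1 (s≤s ())
    divide {W} {G} {H} g@(suc (suc g')) 2≤g g≤C nd≤ st with filterᴸ (nondiv g) G | inverse (small-unit {g} (s≤s z≤n) (≤-<-trans g≤C C<p))
    ... | nd , dv , r , _ , div , len | w , gw with quotients {W} {w} g gw (AllP.++⁻ʳ nd (All-↭ r (State.small st))) (AllL.map (λ {z} e → ⌊⌋-sound (z %ℕ g ≟ 0) (not-false e)) div)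
      where
      not-false : ∀ {b} → not b ≡ false → b ≡ true
      not-false {true} _ = refl
    -- The elements that `g` does not divide join the exceptional list, which is dilated by the
    -- inverse of `g` without any claim on its size.
    ... | G' , dG , small' = G' , map (w *ᶻ_) (nd ++ H) , st' , H'≤ , λ q → P-↭ perm (P-dilate w-unit dil q)
      where
      w-unit : Unit w
      w-unit e = 1≉0 (≈-trans (≈-sym gw) (≈-trans (≈-*ˡ (pos g) e) (≈-reflexive (ℤP.*-zeroʳ (pos g)))))
      perm : G ++ H ↭ dv ++ (nd ++ H)
      perm = ↭-trans (↭P.++⁺ʳ H (↭-trans r (↭P.++-comm nd dv))) (↭-reflexive (LP.++-assoc dv nd H))
      dil : Dilates w (dv ++ (nd ++ H)) (G' ++ map (w *ᶻ_) (nd ++ H))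
      dil = Dilates-++ dG (Dilates-map w (nd ++ H))
      H'≤ : length (map (w *ᶻ_) (nd ++ H)) ≤ t + length H
      H'≤ = ≤-trans (≤-reflexive (trans (LP.length-map _ (nd ++ H)) (LP.length-++ nd))) (+-monoˡ-≤ (length H) (≤-trans (≤-reflexive len) nd≤))
      st' : State (W / 2) G' (map (w *ᶻ_) (nd ++ H))
      st' = record
        { zsf = Dilates-ZSF w-unit dil (ZSF-↭ perm (State.zsf st))
        ; mult = Dilates-Mult w-unit dil (Mult-↭ perm (State.mult st))
        ; total = trans (sym (LP.length-++ G')) (trans (sym (Dilates-length dil)) (trans (sym (↭-length perm)) (trans (LP.length-++ G) (State.total st))))
        ; small = AllL.map (λ l → ≤-trans l (/-monoʳ-≤' W g' )) small' }
        where
        /-monoʳ-≤' : ∀ W g' → W / suc (suc g') ≤ W / 2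
        /-monoʳ-≤' W g' = /-mono-≤ (≤-refl {W}) (s≤s (s≤s z≤n))

    -- At most `2 m W` elements are nonzero integers of absolute value at most `W`, and the
    -- exceptional list has at most `N / 2`. So `W` cannot become arbitrarily small.
    G-large : ∀ {W G H} → State W G H → length H ≤ h → ¬ (4 * (m * W) < N)
    G-large {W} {G} {H} st H≤ lt = <-irrefl refl (begin-strict
      N                                 ≡⟨ State.total st ⟨
      length G + length H               ≤⟨ +-mono-≤ (Box-length (box {W} (ZSF-++ˡ H (State.zsf st)) (Mult-++ˡ {xs = G} H (State.mult st)) (State.small st))) H≤ ⟩
      2 * (m * W) + h                   <⟨ *-cancelˡ-< 2 _ _ (≤-<-trans (≤-reflexive (e1 (m * W) h)) (<-≤-trans (+-mono-<-≤ lt 2h≤N) (≤-reflexive (e2 N)))) ⟩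
      N                                 ∎)
      where
      open ≤-Reasoning
      e1 : ∀ a h → 2 * (2 * a + h) ≡ 4 * a + 2 * h
      e1 = solveℕ
      e2 : ∀ N → N + N ≡ 2 * N
      e2 = solveℕ

    -- `f` is the number of divisions still possible. Each halves `W`, which preserves
    -- `4 m W < 2 ^ f N`; at `f = 0` this contradicts `G-large`.
    normalise : ∀ f {W G H} → State W G H → length H + f * t ≤ h → 4 * (m * W) < 2 ^ f * N →
      (∀ {W' G' H'} → W' ≤ W → State W' G' H' → length H' ≤ h → (∀ g → 2 ≤ g → g ≤ C → t < # (nondiv g) G') → P (G' ++ H')) → P (G ++ H)
    normalise zero st H≤ lt _ = ⊥-elim (G-large st (≤-trans (m≤m+n _ _) H≤) (<-≤-trans lt (≤-reflexive (+-identityʳ N))))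
    normalise (suc f) {W} {G} {H} st H≤ lt final with factor-search t G C
    ... | inj₂ gen = final ≤-refl st (≤-trans (m≤m+n _ _) H≤) gen
    ... | inj₁ (g , 2≤g , g≤C , nd≤) with divide g 2≤g g≤C nd≤ st
    ... | G' , H' , st' , H'≤ , back = back (normalise f st' (≤-trans (+-monoˡ-≤ (f * t) H'≤) (≤-trans (≤-reflexive (e1 t (length H) (f * t))) H≤))
        (*-cancelˡ-< 2 _ _ (≤-<-trans (≤-reflexive (e2 m (W / 2))) (≤-<-trans (*-monoʳ-≤ 4 (*-monoʳ-≤ m (m/n*n≤m W 2))) (<-≤-trans lt (≤-reflexive (*-assoc 2 (2 ^ f) N))))))
        (λ W'≤ → final (≤-trans W'≤ (m/n≤m W 2))))
      where
      e1 : ∀ t h r → t + h + r ≡ h + (t + r)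
      e1 = solveℕ
      e2 : ∀ m w → 2 * (4 * (m * w)) ≡ 4 * (m * (w * 2))
      e2 = solveℕ

  -- From an interval of sums to the excess

  -- Exceptional elements need not have small representatives, but absolute value at most p / 2 is
  -- enough once the interval has at least this length.
  centred : ∀ z → ∃[ r ] (z ≈ r × 2 * ∣ r ∣ ≤ p)
  centred z with 2 * (z %ℕ p) ≤? p
  ... | yes l = pos (z %ℕ p) , ≈-residue z , l
  ... | no nl with m≤n⇒∃[o]m+o≡n (<⇒≤ (residue<p z))
  ...   | o , e = -ᶻ pos o , ≈-trans (≈-residue z) (pos 1 ⨾ trans (f (pos (z %ℕ p)) (pos o)) (cong (λ w → -ᶻ pos o +ᶻ pos 1 *ᶻ pos w) e))
      , ≤-trans (≤-reflexive (cong (2 *_) (ℤP.∣-i∣≡∣i∣ (pos o)))) (+-cancelˡ-≤ p _ _ (≤-trans (+-monoˡ-≤ (2 * o) (<⇒≤ (≰⇒> nl))) (≤-reflexive (trans (sym (*-distribˡ-+ 2 (z %ℕ p) o)) (trans (cong (2 *_) e) (cong (p +_) (+-identityʳ p)))))))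
    where
    f : ∀ r o → r ≡ -ᶻ o +ᶻ pos 1 *ᶻ (r +ᶻ o)
    f = solveℤ

  centre : ∀ H → ∃[ H' ] (Dilates (pos 1) H H' × All (λ r → 2 * ∣ r ∣ ≤ p) H')
  centre [] = [] , [] , []
  centre (z ∷ H) with centred z | centre H
  ... | r , e , l | H' , d , al = r ∷ H' , ≈-trans (≈-reflexive (ℤP.*-identityˡ z)) e ∷ d , l ∷ al

  Dilates-id : ∀ zs → Dilates (pos 1) zs zs
  Dilates-id []       = []
  Dilates-id (z ∷ zs) = ≈-reflexive (ℤP.*-identityˡ z) ∷ Dilates-id zs

  Dilates-neg : ∀ zs → Dilates (-ᶻ pos 1) zs (map -ᶻ_ zs)
  Dilates-neg []       = []
  Dilates-neg (z ∷ zs) = ≈-reflexive (e z) ∷ Dilates-neg zs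
    where
    e : ∀ z → (-ᶻ pos 1) *ᶻ z ≡ -ᶻ z
    e = solveℤ

  -- If the sums of L covered every residue, one of them would cancel a.
  no-cover : ∀ {a L u ℓ} → ZSF (a ∷ L) → Covers L u ℓ → suc ℓ < p
  no-cover {a} {L} {u} {ℓ} zsf cv = ≰⇒> λ p≤ → zsf ↭-refl (cv i (≤-pred (≤-trans (residue<p x) p≤)))
      (≈-trans (≈-+ (≈-refl {a}) (≈-+ (≈-refl {u}) (≈-sym (≈-residue x)))) (≈-reflexive (e a u)))
    where
    x = -ᶻ a -ᶻ u
    i = x %ℕ p
    e : ∀ a u → a +ᶻ (u +ᶻ (-ᶻ a -ᶻ u)) ≡ pos 0
    e = solveℤ

  -- A zero-sum-free list does not contain both `a` and `-a`, so passing to absolute values does not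
  -- add multiplicities.
  fold-mult : ∀ {m L} → ZSF L → Mult m L → ∀ i → histogram ∣_∣ 0 L i ≤ m
  fold-mult {m} {L} zsf mu i = ≤-trans (≤-reflexive split) (oneSign (first (λ r → ⌊ r ≟ᶻ pos (suc i) ⌋) L))
    where
    A B : ℤ → Bool
    A r = ⌊ r ≟ᶻ pos (suc i) ⌋
    B r = ⌊ r ≟ᶻ -[1+ i ] ⌋
    pw : ∀ r → ι ⌊ ∣ r ∣ ≟ suc i ⌋ ≡ ι (A r) + ι (B r)
    pw (pos n) with n ≟ suc i
    ... | yes refl = sym (trans (cong (_+ ι (B (pos n))) (ι-yes (pos n ≟ᶻ pos (suc i)) refl)) (cong suc (ι-no (pos n ≟ᶻ -[1+ i ]) λ ())))
    ... | no ne    = sym (cong₂ _+_ (ι-no (pos n ≟ᶻ pos (suc i)) (ne ∘ ℤP.+-injective)) (ι-no (pos n ≟ᶻ -[1+ i ]) λ ()))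
    pw -[1+ n ] with suc n ≟ suc i
    ... | yes refl = sym (cong₂ _+_ (ι-no (-[1+ n ] ≟ᶻ pos (suc i)) λ ()) (ι-yes (-[1+ n ] ≟ᶻ -[1+ i ]) refl))
    ... | no ne    = sym (cong₂ _+_ (ι-no (-[1+ n ] ≟ᶻ pos (suc i)) λ ()) (ι-no (-[1+ n ] ≟ᶻ -[1+ i ]) (ne ∘ cong suc ∘ ℤP.-[1+-injective)))
    split : histogram ∣_∣ 0 L i ≡ # A L + # B L
    split = trans (∑ᴸ-cong pw L) (∑ᴸ-+ (ι ∘ A) (ι ∘ B) L)
    vm : VMult m L
    vm = Mult⇒VMult {R = L} mu
    oneSign : (∃[ x ] ∃[ ys ] (L ↭ x ∷ ys × A x ≡ true)) ⊎ All (λ x → A x ≡ false) L → # A L + # B L ≤ m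
    oneSign (inj₂ none) = ≤-trans (≤-reflexive (cong (_+ # B L) (#-none A none))) (vm -[1+ i ])
    oneSign (inj₁ (x , ys , r , ax)) = ≤-trans (≤-reflexive (trans (cong (# A L +_) (trans (#-↭ B r) (cong₂ _+_ (cong ι bx) (noB (first B ys))))) (+-identityʳ _))) (vm (pos (suc i)))
      where
      x≡ : x ≡ pos (suc i)
      x≡ = ⌊⌋-sound (x ≟ᶻ pos (suc i)) ax
      bx : B x ≡ false
      bx = ⌊⌋-no (x ≟ᶻ -[1+ i ]) (λ e → contradiction (trans (sym x≡) e) λ ())
      noB : (∃[ z ] ∃[ zs ] (ys ↭ z ∷ zs × B z ≡ true)) ⊎ All (λ z → B z ≡ false) ys → # B ys ≡ 0
      noB (inj₂ none) = #-none B none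
      noB (inj₁ (z , zs , r' , bz)) = contradiction (≈-reflexive (trans (cong₂ (λ a b → a +ᶻ (b +ᶻ pos 0)) x≡ (⌊⌋-sound (z ≟ᶻ -[1+ i ]) bz)) (e (pos (suc i)))))
          (zsf r (SS-↭ (↭-sym r') (take (SS-empty zs))))
        where
        e : ∀ a → a +ᶻ (-ᶻ a +ᶻ pos 0) ≡ pos 0
        e = solveℤ

  module _ (a₁ : ℕ → ℕ) where
    open Excess a₁ (λ _ → ⊤) using (Ex)

    Σcount : ∀ zs → Σp (λ v → count v zs) ≡ length zs
    Σcount []       = trans (Σp-const 0) (*-zeroʳ p)
    Σcount (z ∷ zs) = trans (Σp-+ (λ v → ι (δ (z -ᶻ v))) (λ v → count v zs)) (cong₂ _+_ (trans (Σp-cong (λ v → cong ι (δ-sym z v))) (Σp-δ1 z)) (Σcount zs))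
      where
      δ-sym : ∀ z v → δ (z -ᶻ v) ≡ δ (v -ᶻ z)
      δ-sym z v with z ≈? v
      ... | yes e = trans (δ-true (≈⇒≈0 e)) (sym (δ-true (≈⇒≈0 (≈-sym e))))
      ... | no ne = trans (δ-false (ne ∘ ≈0⇒≈)) (sym (δ-false (λ q → ne (≈-sym (≈0⇒≈ q)))))

    -- Only the positive elements of R may fit into the prescribed multiplicities.
    Ex-bound : ∀ F R → All (λ r → 1 ≤ ∣ r ∣) R → All (λ r → ∣ r ∣ < p) R →
      Ex (F ++ R) ≤ length F + # (λ r → ⌊ 1 ≤? negpart r ⌋) R + ∑ p' (λ i → histogram ∣_∣ 0 R i ∸ a₁ (suc i))
    Ex-bound F R al₁ al₂ = begin
      Σp (λ v → count v (F ++ R) ∸ a₁ (v %ℕ p))                           ≡⟨ Σp-def (λ v → count v (F ++ R) ∸ a₁ (v %ℕ p)) ⟩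
      ∑ p (λ j → count (pos j) (F ++ R) ∸ a₁ (pos j %ℕ p))                ≤⟨ ∑-mono< p pw ⟩
      ∑ p (λ j → count (pos j) F + count (pos j) N + ex j)                ≡⟨ trans (∑-+ p (λ j → count (pos j) F + count (pos j) N) ex) (cong (_+ ∑ p ex) (∑-+ p (λ j → count (pos j) F) (λ j → count (pos j) N))) ⟩
      ∑ p (λ j → count (pos j) F) + ∑ p (λ j → count (pos j) N) + ∑ p ex  ≡⟨ cong (_+ ∑ p ex) (cong₂ _+_ (trans (sym (Σp-def (λ v → count v F))) (Σcount F)) (trans (sym (Σp-def (λ v → count v N))) (Σcount N))) ⟩
      length F + length N + ∑ p ex                                        ≡⟨ cong (λ t → length F + t + ∑ p ex) lenN ⟩
      length F + # neg R + ∑ p ex                                         ∎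
      where
      open ≤-Reasoning
      neg : ℤ → Bool
      neg r = ⌊ 1 ≤? negpart r ⌋
      parts' = filterᴸ neg R
      N P : List ℤ
      N = proj₁ parts'
      P = proj₁ (proj₂ parts')
      perm : R ↭ N ++ P
      perm = proj₁ (proj₂ (proj₂ parts'))
      Ppos : All (λ r → neg r ≡ false) P
      Ppos = proj₁ (proj₂ (proj₂ (proj₂ (proj₂ parts'))))
      lenN : length N ≡ # neg R
      lenN = proj₂ (proj₂ (proj₂ (proj₂ (proj₂ parts'))))
      ex : ℕ → ℕ
      ex zero    = 0
      ex (suc i) = histogram ∣_∣ 0 R i ∸ a₁ (suc i)
      pos-hit : ∀ {j} → j < p → ∀ r → neg r ≡ false → ∣ r ∣ < p → ι (δ (r -ᶻ pos j)) ≤ ι ⌊ ∣ r ∣ ≟ j ⌋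
      pos-hit {j} j<p (pos n) _ n<p with n ≟ j
      ... | yes _ = ι≤1 _
      ... | no ne = ≤-reflexive (cong ι (δ-false (λ e → ne (small-unique n<p j<p (≈0⇒≈ e)))))
      pos-hit j<p -[1+ n ] ()
      count≤ : ∀ j → j < p → ∀ P → All (λ r → neg r ≡ false) P → All (λ r → ∣ r ∣ < p) P → count (pos j) P ≤ # (λ r → ⌊ ∣ r ∣ ≟ j ⌋) P
      count≤ j j< [] [] [] = z≤n
      count≤ j j< (r ∷ P) (a ∷ as) (b ∷ bs) = +-mono-≤ (pos-hit j< r a b) (count≤ j j< P as bs)
      none : ∀ P → All (λ r → 1 ≤ ∣ r ∣) P → # (λ r → ⌊ ∣ r ∣ ≟ 0 ⌋) P ≡ 0
      none P al = #-none _ (AllL.map (λ {r} l → ⌊⌋-no (∣ r ∣ ≟ 0) (λ e → contradiction (subst (1 ≤_) e l) λ ())) al)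
      P≤ : ∀ j → j < p → count (pos j) P ∸ a₁ j ≤ ex j
      P≤ zero    j< = ≤-trans (m∸n≤m (count (pos 0) P) (a₁ 0)) (≤-trans (count≤ 0 j< P Ppos (AllP.++⁻ʳ N (All-↭ perm al₂))) (≤-reflexive (none P (AllP.++⁻ʳ N (All-↭ perm al₁)))))
      P≤ (suc i) j< = ∸-monoˡ-≤ (a₁ (suc i)) (≤-trans (count≤ (suc i) j< P Ppos (AllP.++⁻ʳ N (All-↭ perm al₂)))
         (≤-trans (m≤n+m _ (# (λ r → ⌊ ∣ r ∣ ≟ suc i ⌋) N)) (≤-reflexive (sym (trans (#-↭ _ perm) (#-++ _ N P))))))
      pw : ∀ j → j < p → count (pos j) (F ++ R) ∸ a₁ (pos j %ℕ p) ≤ count (pos j) F + count (pos j) N + ex j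
      pw j j< = begin
        count (pos j) (F ++ R) ∸ a₁ (pos j %ℕ p)                       ≡⟨ cong₂ _∸_ (trans (#-++ _ F R) (trans (cong (count (pos j) F +_) (trans (#-↭ _ perm) (#-++ _ N P))) (sym (+-assoc (count (pos j) F) _ _)))) (cong a₁ (residue-small j<)) ⟩
        count (pos j) F + count (pos j) N + count (pos j) P ∸ a₁ j     ≤⟨ m+n∸o≤m+[n∸o] (count (pos j) F + count (pos j) N) (count (pos j) P) (a₁ j) ⟩
        count (pos j) F + count (pos j) N + (count (pos j) P ∸ a₁ j)   ≤⟨ +-monoʳ-≤ _ (P≤ j j<) ⟩
        count (pos j) F + count (pos j) N + ex j                       ∎
        where
        m+n∸o≤m+[n∸o] : ∀ m n o → m + n ∸ o ≤ m + (n ∸ o)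
        m+n∸o≤m+[n∸o] m n       zero    = ≤-refl
        m+n∸o≤m+[n∸o] m zero    (suc o) = ≤-trans (m∸n≤m (m + 0) (suc o)) (≤-reflexive refl)
        m+n∸o≤m+[n∸o] m (suc n) (suc o) = ≤-trans (≤-reflexive (cong (_∸ suc o) (+-suc m n))) (m+n∸o≤m+[n∸o] m n o)

  map-neg-∑ᴸ : ∀ (w w' : ℤ → ℕ) → (∀ z → w (-ᶻ z) ≡ w' z) → ∀ xs → ∑ᴸ w (map -ᶻ_ xs) ≡ ∑ᴸ w' xs
  map-neg-∑ᴸ w w' e xs = trans (∑ᴸ-map w -ᶻ_ xs) (∑ᴸ-cong e xs)

  negpart-neg : ∀ z → negpart (-ᶻ z) ≡ pospart z
  negpart-neg (pos zero)    = refl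
  negpart-neg (pos (suc n)) = refl
  negpart-neg -[1+ n ]      = refl

  negpart≤ : ∀ z → negpart z ≤ ∣ z ∣
  negpart≤ z = ≤-trans (m≤m+n _ (pospart z)) (≤-reflexive (parts z))

  -- |A₁| = m n₁ + k with n = n₁ + 1, and E bounds the deviation of N from |A₁|.
  module Finish (a₁ : ℕ → ℕ) (Q : ℕ → Set) (m k n₁ o N W B E h : ℕ) (1≤m : 1 ≤ m)
    (n+o : suc n₁ + o ≡ p)
    (p≤ : p ≤ m * tri n₁ + suc k * suc n₁)
    (nN₁ : suc n₁ * (m * n₁ + k) < 2 * p)
    (a₁< : ∀ i → i < n₁ → a₁ (suc i) ≡ m) (a₁≡ : a₁ (suc n₁) ≡ k)
    (low : m * n₁ + k ≤ N + E) (high : N ≤ m * n₁ + k + E)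
    (few : 4 * (E + h + B + 2) ≤ m * n₁ + k)
    (hQ : ∀ x t X Y → x ≤ suc B + t + (E + Y + X) → t * t ≤ 2 * (m * (suc B * W)) →
      X * X ≤ 2 * (m * (suc n₁ * suc (E + suc B))) → Y * Y ≤ 2 * (m * (suc n₁ * suc (E + suc B))) → Q x) where
    open Excess a₁ Q

    N₁ : ℕ
    N₁ = m * n₁ + k

    instance
      m≢0 : NonZero m
      m≢0 = >-nonZero 1≤m

    -- The negative elements of `R` are few by `crowd²`, since their absolute values have a small
    -- sum; `Counting` controls the absolute values of all of `R`, and `F` counts as excess
    -- altogether.
    conclude : ∀ F R → ZSF R → Mult m R → ∑ᴸ ∣_∣ R < p → length F ≤ suc B → length F + length R ≡ N → ∑ᴸ negpart R ≤ suc B * W → Q (Ex (F ++ R))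
    conclude F R zsf mu S<p F≤ len neg≤ = hQ (Ex (F ++ R)) t C.X C.Y x≤ t² C.X² C.Y²
      where
      e : ∀ f r E → f + r + E ≡ r + (E + f)
      e = solveℕ
      c : ℕ → ℕ
      c = histogram ∣_∣ p R
      nz : All (λ r → 1 ≤ ∣ r ∣) R
      nz = ZSF-nonzero zsf
      all<p : All (λ r → ∣ r ∣ < p) R
      all<p = AllL.map (λ l → ≤-<-trans l S<p) (member≤∑ᴸ ∣_∣ R)
      all≤p : All (λ r → ∣ r ∣ ≤ p) R
      all≤p = AllL.map <⇒≤ all<p
      ∑c : ∑ (suc n₁ + o) c ≡ length R
      ∑c = trans (cong (λ w → ∑ w c) n+o) (trans (histogram-count ∣_∣ p all≤p) (#-all _ (AllL.map (λ {r} → ⌊⌋-yes (1 ≤? ∣ r ∣)) nz)))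
      module C = Counting m k n₁ o p E (E + suc B) 1≤m c (fold-mult zsf mu) p≤
        (subst (_< p) (sym (trans (cong (λ w → ∑ w (λ i → suc i * c i)) n+o) (histogram-sum ∣_∣ p all≤p))) S<p)
        (≤-trans low (≤-trans (≤-reflexive (trans (cong (_+ E) (sym len)) (e (length F) (length R) E))) (≤-trans (+-monoʳ-≤ (length R) (+-monoʳ-≤ E F≤)) (≤-reflexive (cong (_+ (E + suc B)) (sym ∑c))))))
        (≤-trans (≤-reflexive ∑c) (≤-trans (≤-trans (m≤n+m (length R) (length F)) (≤-reflexive len)) high))
      t : ℕ
      t = # (λ r → ⌊ 1 ≤? negpart r ⌋) R
      x≤ : Ex (F ++ R) ≤ suc B + t + (E + C.Y + C.X)
      x≤ = ≤-trans (Ex-bound a₁ F R nz all<p) (+-mono-≤ (+-monoˡ-≤ t F≤)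
        (≤-trans (∑-mono-len (λ i → c i ∸ a₁ (suc i)) (n≤1+n p')) (≤-trans (≤-reflexive (cong (λ w → ∑ w (λ i → c i ∸ a₁ (suc i))) (sym n+o))) (C.excess (λ i → a₁ (suc i)) a₁< a₁≡))))
      neg≤p : All (λ r → negpart r ≤ p) R
      neg≤p = AllL.map (λ {r} l → ≤-trans (negpart≤ r) l) all≤p
      d : ℕ → ℕ
      d = histogram negpart p R
      d≤m : ∀ i → d i ≤ m
      d≤m i = ≤-trans (∑ᴸ-mono (AllL.universal le R)) (Mult⇒VMult {R = R} mu -[1+ i ])
        where
        le : ∀ r → ι ⌊ negpart r ≟ suc i ⌋ ≤ ι ⌊ r ≟ᶻ -[1+ i ] ⌋
        le (pos n) = ≤-trans (≤-reflexive (ι-no (0 ≟ suc i) λ ())) z≤n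
        le -[1+ n ] with suc n ≟ suc i
        ... | yes refl = ≤-reflexive (sym (ι-yes (-[1+ n ] ≟ᶻ -[1+ n ]) refl))
        ... | no _     = z≤n
      t² : t * t ≤ 2 * (m * (suc B * W))
      t² = ≤-trans (≤-reflexive (sym (cong (λ w → w * w) (histogram-count negpart p neg≤p)))) (≤-trans (crowd² p m d d≤m)
        (*-monoʳ-≤ 2 (*-monoʳ-≤ m (≤-trans (≤-reflexive (histogram-sum negpart p neg≤p)) neg≤))))

    P-one : ∀ {zs} → Q (Ex zs) → P zs
    P-one {zs} q = pos 1 , 1≉0 , subst (λ l → Q (Ex l)) (sym (trans (LP.map-cong ℤP.*-identityˡ zs) (LP.map-id zs))) q

    P-signs : ∀ F R → ZSF (F ++ R) → Mult m (F ++ R) → ∑ᴸ ∣_∣ R < p → length F ≤ suc B → length F + length R ≡ N →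
      (∑ᴸ negpart R ≤ suc B * W) ⊎ (∑ᴸ pospart R ≤ suc B * W) → P (F ++ R)
    P-signs F R zsf mu S<p F≤ len (inj₁ l) = P-one {F ++ R} (conclude F R (ZSF-++ʳ F zsf) (Mult-++ʳ F mu) S<p F≤ len l)
    -- Dilation by -1 exchanges the signs, so the negative part may be assumed to be the small one.
    P-signs F R zsf mu S<p F≤ len (inj₂ l) = P-dilate -1-unit (Dilates-neg (F ++ R)) (P-one {map -ᶻ_ (F ++ R)} (subst (λ z → Q (Ex z)) (sym (LP.map-++ -ᶻ_ F R))
      (conclude (map -ᶻ_ F) (map -ᶻ_ R) (Dilates-ZSF -1-unit (Dilates-neg R) (ZSF-++ʳ F zsf)) (Dilates-Mult -1-unit (Dilates-neg R) (Mult-++ʳ F mu))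
        (subst (_< p) (sym (map-neg-∑ᴸ ∣_∣ ∣_∣ ℤP.∣-i∣≡∣i∣ R)) S<p)
        (≤-trans (≤-reflexive (LP.length-map -ᶻ_ F)) F≤)
        (trans (cong₂ _+_ (LP.length-map -ᶻ_ F) (LP.length-map -ᶻ_ R)) len)
        (≤-trans (≤-reflexive (map-neg-∑ᴸ negpart pospart negpart-neg R)) l))))

    -- An interval of sums around an integer of absolute value at most B W cannot contain -a.
    one-sided : ∀ a L u R (F : List ℤ) → ZSF (a ∷ L) → Covers L (u -ᶻ pos (∑ᴸ negpart R)) (W + ∑ᴸ ∣_∣ R) → ∣ a ∣ ≤ W → ∣ u ∣ ≤ length F * W → length F ≤ B →
      (∑ᴸ negpart R ≤ suc B * W) ⊎ (∑ᴸ pospart R ≤ suc B * W)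
    one-sided a L u R F zsf cv a≤ u≤ F≤ with ∑ᴸ negpart R ≤? suc B * W | ∑ᴸ pospart R ≤? suc B * W
    ... | yes l | _     = inj₁ l
    ... | no _  | yes l = inj₂ l
    ... | no nl | no nl' = ⊥-elim (absurd (shifted {suc B * W} (-ᶻ (a +ᶻ u)) (≤-trans (≤-reflexive (ℤP.∣-i∣≡∣i∣ (a +ᶻ u))) (≤-trans (ℤP.∣i+j∣≤∣i∣+∣j∣ a u) (+-mono-≤ a≤ (≤-trans u≤ (*-monoˡ-≤ W F≤))))))
        (m≤n⇒∃[o]m+o≡n (<⇒≤ (≰⇒> nl))))
      where
      M Z : ℕ
      M = ∑ᴸ negpart R
      Z = ∑ᴸ pospart R
      T = suc B * W
      S≡ : ∑ᴸ ∣_∣ R ≡ M + Z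
      S≡ = trans (∑ᴸ-cong (λ z → sym (parts z)) R) (∑ᴸ-+ negpart pospart R)
      e1 : ∀ a u T d v → -ᶻ (a +ᶻ u) +ᶻ T ≡ v → a +ᶻ (u -ᶻ (T +ᶻ d) +ᶻ (v +ᶻ d)) ≡ pos 0
      e1 a u T d v q = trans (cong (λ w → a +ᶻ (u -ᶻ (T +ᶻ d) +ᶻ (w +ᶻ d))) (sym q)) (e2 a u T d)
        where
        e2 : ∀ a u T d → a +ᶻ (u -ᶻ (T +ᶻ d) +ᶻ ((-ᶻ (a +ᶻ u) +ᶻ T) +ᶻ d)) ≡ pos 0
        e2 = solveℤ
      e3 : ∀ T d → 2 * T + d ≡ T + d + T
      e3 = solveℕ
      absurd : ∃[ v ] (v ≤ 2 * T × -ᶻ (a +ᶻ u) +ᶻ pos T ≡ pos v) → ∃[ d ] (T + d ≡ M) → ⊥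
      absurd (v , v≤ , ve) (d , de) = zsf ↭-refl (cv (v + d) i≤) (≈-reflexive (trans (cong (λ w → a +ᶻ (u -ᶻ pos w +ᶻ pos (v + d))) (sym de)) (e1 a u (pos T) (pos d) (pos v) ve)))
        where
        i≤ : v + d ≤ W + ∑ᴸ ∣_∣ R
        i≤ = ≤-trans (+-monoˡ-≤ d v≤) (≤-trans (≤-reflexive (trans (e3 T d) (cong (_+ T) de))) (≤-trans (+-monoʳ-≤ M (<⇒≤ (≰⇒> nl'))) (≤-trans (≤-reflexive (sym S≡)) (m≤n+m _ W))))

    -- `crowd` with `q = n₁` shows that each element missing from the size of A₁ lowers the least
    -- possible total by at most `n`. By `few` and `nN₁` these losses amount to at most p / 2.
    enough : ∀ {R} → ZSF R → Mult m R → ∑ᴸ ∣_∣ R ≤ p → N₁ ≤ length R + (E + h + B + 1) → p ≤ 2 * ∑ᴸ ∣_∣ R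
    enough {R} zsf mu S≤p N₁≤ = +-cancelʳ-≤ p _ _ (begin
      p + p                                          ≤⟨ +-mono-≤ p≤S p≤S ⟩
      (S + n * suc e) + (S + n * suc e)              ≡⟨ e1 S (n * suc e) ⟩
      2 * S + 2 * (n * suc e)                        ≤⟨ +-monoʳ-≤ (2 * S) (*-cancelˡ-≤ 2 (≤-trans (≤-reflexive (e2 n (E + h + B))) (≤-trans (*-monoʳ-≤ n few) (<⇒≤ nN₁)))) ⟩
      2 * S + p                                      ∎)
      where
      open ≤-Reasoning
      S = ∑ᴸ ∣_∣ R
      n = suc n₁
      e = E + h + B + 1
      c : ℕ → ℕ
      c = histogram ∣_∣ p R
      all≤p : All (λ r → ∣ r ∣ ≤ p) R
      all≤p = AllL.map (λ l → ≤-trans l S≤p) (member≤∑ᴸ ∣_∣ R)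
      e1 : ∀ s x → (s + x) + (s + x) ≡ 2 * s + 2 * x
      e1 = solveℕ
      e2 : ∀ n a → 2 * (2 * (n * suc (a + 1))) ≡ n * (4 * (a + 2))
      e2 = solveℕ
      e3 : ∀ m n₁ k → suc n₁ * suc (m * n₁ + k) ≡ m * (n₁ * suc n₁) + suc k * suc n₁
      e3 = solveℕ
      e4 : ∀ m t x → m * t + x + m * t ≡ m * (2 * t) + x
      e4 = solveℕ
      e5 : ∀ n r e → n * suc (r + e) ≡ n * r + n * suc e
      e5 = solveℕ
      e6 : ∀ s t x → s + t + x ≡ s + x + t
      e6 = solveℕ
      len : ∑ p c ≡ length R
      len = trans (histogram-count ∣_∣ p all≤p) (#-all _ (AllL.map (λ {r} → ⌊⌋-yes (1 ≤? ∣ r ∣)) (ZSF-nonzero zsf)))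
      p≤S : p ≤ S + n * suc e
      p≤S = +-cancelʳ-≤ (m * tri n₁) _ _ (begin
        p + m * tri n₁                                ≤⟨ +-monoˡ-≤ (m * tri n₁) p≤ ⟩
        m * tri n₁ + suc k * n + m * tri n₁           ≡⟨ e4 m (tri n₁) (suc k * n) ⟩
        m * (2 * tri n₁) + suc k * n                  ≡⟨ cong (λ w → m * w + suc k * n) (tri-double n₁) ⟩
        m * (n₁ * n) + suc k * n                      ≡⟨ e3 m n₁ k ⟨
        n * suc N₁                                    ≤⟨ *-monoʳ-≤ n (s≤s N₁≤) ⟩
        n * suc (length R + e)                        ≡⟨ e5 n (length R) e ⟩
        n * length R + n * suc e                      ≤⟨ +-monoˡ-≤ (n * suc e) (≤-trans (≤-reflexive (cong (n *_) (sym len))) (≤-trans (crowd p m n₁ c (fold-mult zsf mu)) (≤-reflexive (cong (_+ m * tri n₁) (histogram-sum ∣_∣ p all≤p))))) ⟩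
        S + m * tri n₁ + n * suc e                    ≡⟨ e6 S (m * tri n₁) (n * suc e) ⟩
        S + n * suc e + m * tri n₁                    ∎)

    finish : ∀ {G H F R'} → ZSF (G ++ H) → Mult m (G ++ H) → length G + length H ≡ N → All (λ r → ∣ r ∣ ≤ W) G → length H ≤ h →
      G ↭ F ++ R' → AP F 1 W → length F ≤ B → P (G ++ H)
    finish {G} {H} {F} {[]} zsf mu len sm H≤ r ap F≤ = contradiction few (<⇒≱ (begin-strict
      m * n₁ + k                 ≤⟨ low ⟩
      N + E                      ≡⟨ cong (_+ E) (sym len) ⟩
      length G + length H + E    ≤⟨ +-monoˡ-≤ E (+-mono-≤ (≤-trans (≤-reflexive (trans (↭-length r) (trans (LP.length-++ F {[]}) (+-identityʳ _)))) F≤) H≤) ⟩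
      B + h + E                  ≡⟨ e B h E ⟩
      E + h + B                  <⟨ m<m+n _ (s≤s z≤n) ⟩
      E + h + B + 2              ≤⟨ m≤n*m _ 4 ⟩
      4 * (E + h + B + 2)        ∎))
      where
      open ≤-Reasoning
      e : ∀ B h E → B + h + E ≡ E + h + B
      e = solveℕ
    -- `a` is the element kept in reserve. The small integers `R` are absorbed before the centred
    -- `H'`: only then is the interval long enough for the latter.
    finish {G} {H} {F} {a ∷ R} zsf mu len sm H≤ r (u , ap) F≤ with centre H
    ... | H' , dH , H'≤ = P-↭ perm (P-dilate 1≉0 dil (P-↭ perm' (P-signs (a ∷ F) (H' ++ R) (ZSF-↭ perm' zsf') (Mult-↭ perm' mu')
        (≤-<-trans (m≤n+m _ W) (<-trans (n<1+n _) full)) (s≤s F≤) len' (one-sided a (H' ++ (R ++ F)) u (H' ++ R) F zsf' cv₂' aW u≤ F≤))))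
      where
      open ≤-Reasoning
      perm : G ++ H ↭ a ∷ (H ++ (R ++ F))
      perm = ↭-trans (↭P.++⁺ʳ H (↭-trans r (↭-trans (↭P.shift a F R) (prep a (↭P.++-comm F R))))) (prep a (↭P.++-comm (R ++ F) H))
      dil : Dilates (pos 1) (a ∷ (H ++ (R ++ F))) (a ∷ (H' ++ (R ++ F)))
      dil = ≈-reflexive (ℤP.*-identityˡ a) ∷ Dilates-++ dH (Dilates-id (R ++ F))
      perm' : a ∷ (H' ++ (R ++ F)) ↭ (a ∷ F) ++ (H' ++ R)
      perm' = prep a (↭-trans (↭-reflexive (sym (LP.++-assoc H' R F))) (↭P.++-comm (H' ++ R) F))
      zsf' : ZSF (a ∷ (H' ++ (R ++ F)))
      zsf' = Dilates-ZSF 1≉0 dil (ZSF-↭ perm zsf)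
      mu' : Mult m (a ∷ (H' ++ (R ++ F)))
      mu' = Dilates-Mult 1≉0 dil (Mult-↭ perm mu)
      smF : All (λ r → ∣ r ∣ ≤ W) F
      smF = AllP.++⁻ˡ F (All-↭ r sm)
      aW : ∣ a ∣ ≤ W
      aW = AllL.head (AllP.++⁻ʳ F (All-↭ r sm))
      smR : All (λ r → ∣ r ∣ ≤ W) R
      smR = AllL.tail (AllP.++⁻ʳ F (All-↭ r sm))
      cv : Covers F u W
      cv i i≤ = SS-≡ (cong (λ w → u +ᶻ pos w) (*-identityʳ i)) (ap i i≤)
      u≤ : ∣ u ∣ ≤ length F * W
      u≤ = ≤-trans (≤-reflexive (cong ∣_∣ (sym (ℤP.+-identityʳ u)))) (SS-bound smF (cv 0 z≤n))
      S₁ S₂ : ℕ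
      S₁ = ∑ᴸ ∣_∣ R
      S₂ = ∑ᴸ ∣_∣ H'
      cv₁ : Covers (R ++ F) (u -ᶻ pos (∑ᴸ negpart R)) (W + S₁)
      cv₁ = covers-extend R {F} {W} {u} cv (AllL.map (λ l → ≤-trans l (n≤1+n W)) smR)
      zsfa : ZSF (a ∷ (R ++ F))
      zsfa = ZSF-++ʳ H' (ZSF-↭ (↭-sym (↭P.shift a H' (R ++ F))) zsf')
      part : suc (W + S₁) < p
      part = no-cover {a} {R ++ F} {u -ᶻ pos (∑ᴸ negpart R)} zsfa cv₁
      zsfR : ZSF R
      zsfR = ZSF-++ˡ F (ZSF-++ʳ (a ∷ []) zsfa)
      muR : Mult m R
      muR = Mult-++ˡ {xs = R} F (Mult-++ʳ H' (Mult-++ʳ (a ∷ []) {H' ++ (R ++ F)} mu'))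
      lenG : length G ≡ length F + suc (length R)
      lenG = trans (↭-length r) (LP.length-++ F)
      e1 : ∀ f r h E → f + suc r + h + E ≡ r + (E + h + f + 1)
      e1 = solveℕ
      half : p ≤ 2 * S₁
      half = enough zsfR muR (≤-trans (m≤n+m S₁ W) (≤-trans (n≤1+n _) (<⇒≤ part))) (≤-trans low (≤-trans (≤-reflexive (trans (cong (_+ E) (trans (sym len) (cong (_+ length H) lenG))) (e1 (length F) (length R) (length H) E)))
        (+-monoʳ-≤ (length R) (+-monoˡ-≤ 1 (+-mono-≤ (+-monoʳ-≤ E H≤) F≤)))))
      cv₂ : Covers (H' ++ (R ++ F)) (u -ᶻ pos (∑ᴸ negpart R) -ᶻ pos (∑ᴸ negpart H')) (W + S₁ + S₂)
      cv₂ = covers-extend H' {R ++ F} {W + S₁} {u -ᶻ pos (∑ᴸ negpart R)} cv₁ (AllL.map (λ l → ≤-trans (*-cancelˡ-≤ 2 (≤-trans l half)) (≤-trans (m≤n+m S₁ W) (n≤1+n _))) H'≤)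
      S≡ : S₂ + S₁ ≡ ∑ᴸ ∣_∣ (H' ++ R)
      S≡ = sym (∑ᴸ-++ ∣_∣ H' R)
      e2 : ∀ u x y → u -ᶻ x -ᶻ y ≡ u -ᶻ (y +ᶻ x)
      e2 = solveℤ
      cv₂' : Covers (H' ++ (R ++ F)) (u -ᶻ pos (∑ᴸ negpart (H' ++ R))) (W + ∑ᴸ ∣_∣ (H' ++ R))
      cv₂' i i≤ = SS-≡ (cong (_+ᶻ pos i) (trans (e2 u (pos (∑ᴸ negpart R)) (pos (∑ᴸ negpart H'))) (cong (λ w → u -ᶻ pos w) (sym (∑ᴸ-++ negpart H' R)))))
        (cv₂ i (≤-trans i≤ (≤-reflexive (trans (cong (W +_) (trans (sym S≡) (+-comm S₂ S₁))) (sym (+-assoc W S₁ S₂))))))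
      full : suc (W + ∑ᴸ ∣_∣ (H' ++ R)) < p
      full = no-cover {a} {H' ++ (R ++ F)} {u -ᶻ pos (∑ᴸ negpart (H' ++ R))} zsf' cv₂'
      len' : suc (length F) + length (H' ++ R) ≡ N
      len' = trans (cong (suc (length F) +_) (trans (LP.length-++ H') (cong (_+ length R) (sym (Dilates-length dH))))) (trans (e3 (length F) (length H) (length R)) (trans (cong (_+ length H) (sym lenG)) len))
        where
        e3 : ∀ f h r → suc f + (h + r) ≡ f + suc r + h
        e3 = solveℕ

  -- Assembly for a list of integers

  -- Here N = |A|, and |A₁| = m n₁ + k with n = n₁ + 1.
  module Main (y : ℕ) (100≤y : 100 ≤ y) (T : Toolbox y) (a₁ : ℕ → ℕ) (m k n₁ o N E : ℕ) (1≤m : 1 ≤ m)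
    (n+o : suc n₁ + o ≡ p)
    (p≤ : p ≤ m * tri n₁ + suc k * suc n₁)
    (nN₁ : suc n₁ * (m * n₁ + k) < 2 * p)
    (a₁< : ∀ i → i < n₁ → a₁ (suc i) ≡ m) (a₁≡ : a₁ (suc n₁) ≡ k)
    (low : m * n₁ + k ≤ N + E) (high : N ≤ m * n₁ + k + E)
    (yE≤N : y * E ≤ N) (pm≤ : p * m ≤ 4 * (N * N)) (m≤2N : m ≤ 2 * N) (N≤2p : N ≤ 2 * p)
    (N₀≤N : Scale.N₀ y 100≤y T ≤ N) where

    open Scale y 100≤y T renaming (Q to Q₀)
    open Large N N₀≤N

    -- `h` will be the integral root of the final bound `W` on the small integers. It is existential
    -- because `W` depends on the common factors found on the way.
    Q : ℕ → Set
    Q x = ∃[ h ] (m * (h * h) ≤ τ * N × x * x ≤ 16 * ((8 + 2 * τ) * (N * (E + K * suc h + 2))))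

    open Excess a₁ Q

    100≤ : ∀ {x} → y * x ≤ N → 100 * x ≤ N
    100≤ {x} l = ≤-trans (*-monoˡ-≤ x 100≤y) l

    ft≤ : 100 * (f * t) ≤ N
    ft≤ = 100≤ t-small

    t≤ft : t ≤ f * t
    t≤ft = m≤n*m t f

    module Tail {W h₀ : ℕ} (h₀≤ : 100 * h₀ ≤ 8 * N) (mW≤ : m * W ≤ τ * N) (1≤W : 1 ≤ W) {G H : List ℤ}
      (zsf : ZSF (G ++ H)) (mult : Mult m (G ++ H)) (len : length G + length H ≡ N) (sm : All (λ r → ∣ r ∣ ≤ W) G) (H≤ : length H ≤ h₀)
      (generic : ∀ g → 2 ≤ g → g ≤ C → t < # (nondiv g) G) where

      root : ∃[ h ] (h * h ≤ W × W < suc h * suc h)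
      root = isqrt W

      h B : ℕ
      h = proj₁ root
      B = K * suc h

      mhh≤ : m * (h * h) ≤ τ * N
      mhh≤ = ≤-trans (*-monoʳ-≤ m (proj₁ (proj₂ root))) mW≤

      hh≤ : h * h ≤ τ * N
      hh≤ = ≤-trans (≤-trans (≤-reflexive (sym (*-identityˡ (h * h)))) (*-monoˡ-≤ (h * h) 1≤m)) mhh≤

      B+1≤t : B + C * C + 1 ≤ t
      B+1≤t = t-large h hh≤

      B+1≤ft : B + 1 ≤ f * t
      B+1≤ft = ≤-trans (+-monoˡ-≤ 1 (m≤m+n B (C * C))) (≤-trans B+1≤t t≤ft)

      N≤2G : N ≤ 2 * length G
      N≤2G = +-cancelˡ-≤ N _ _ (begin
        N + N                          ≡⟨ cong₂ _+_ (sym len) (sym len) ⟩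
        length G + length H + (length G + length H) ≡⟨ e (length G) (length H) ⟩
        2 * length H + 2 * length G    ≤⟨ +-monoˡ-≤ (2 * length G) 2H≤N ⟩
        N + 2 * length G               ∎)
        where
        open ≤-Reasoning
        e : ∀ g h → g + h + (g + h) ≡ 2 * h + 2 * g
        e = solveℕ
        e' : ∀ h → 50 * (2 * h) ≡ 100 * h
        e' = solveℕ
        2H≤N : 2 * length H ≤ N
        2H≤N = *-cancelˡ-≤ 50 (≤-trans (≤-reflexive (e' (length H))) (≤-trans (*-monoʳ-≤ 100 H≤) (≤-trans h₀≤ (*-monoˡ-≤ N (≤ᵇ⇒≤ 8 50 _)))))

      few : 4 * (E + h₀ + B + 2) ≤ m * n₁ + k
      few = *-cancelˡ-≤ 100 (+-cancelʳ-≤ N _ _ (begin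
        100 * (4 * (E + h₀ + B + 2)) + N                                         ≤⟨ +-monoˡ-≤ N (*-monoʳ-≤ 100 (*-monoʳ-≤ 4 (+-monoʳ-≤ (E + h₀ + B) (≤-trans (≤-reflexive refl) two≤)))) ⟩
        100 * (4 * (E + h₀ + B + (f * t + 1))) + N                               ≡⟨ e1 E h₀ B (f * t) N ⟩
        4 * (100 * E) + 4 * (100 * h₀) + 4 * (100 * (B + 1)) + 4 * (100 * (f * t)) + N ≤⟨ +-monoˡ-≤ N (+-mono-≤ (+-mono-≤ (+-mono-≤ (*-monoʳ-≤ 4 (100≤ yE≤N)) (*-monoʳ-≤ 4 h₀≤)) (*-monoʳ-≤ 4 (≤-trans (*-monoʳ-≤ 100 B+1≤ft) ft≤))) (*-monoʳ-≤ 4 ft≤)) ⟩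
        4 * N + 4 * (8 * N) + 4 * N + 4 * N + N                                  ≡⟨ e2 N ⟩
        45 * N                                                                   ≤⟨ *-monoˡ-≤ N (≤ᵇ⇒≤ 45 100 _) ⟩
        100 * N                                                                  ≤⟨ *-monoʳ-≤ 100 high ⟩
        100 * (m * n₁ + k + E)                                                   ≡⟨ *-distribˡ-+ 100 (m * n₁ + k) E ⟩
        100 * (m * n₁ + k) + 100 * E                                             ≤⟨ +-monoʳ-≤ (100 * (m * n₁ + k)) (100≤ yE≤N) ⟩
        100 * (m * n₁ + k) + N                                                   ∎))
        where
        open ≤-Reasoning
        two≤ : 2 ≤ f * t + 1
        two≤ = +-monoˡ-≤ 1 (≤-trans (m≤n+m 1 B) B+1≤ft)
        e1 : ∀ E h B x N → 100 * (4 * (E + h + B + (x + 1))) + N ≡ 4 * (100 * E) + 4 * (100 * h) + 4 * (100 * (B + 1)) + 4 * (100 * x) + N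
        e1 = solveℕ
        e2 : ∀ N → 4 * N + 4 * (8 * N) + 4 * N + 4 * N + N ≡ 45 * N
        e2 = solveℕ

      e₀ : ℕ
      e₀ = E + B + 2

      e₀≤N : e₀ ≤ N
      e₀≤N = *-cancelˡ-≤ 100 (begin
        100 * (E + B + 2)                           ≡⟨ e E B ⟩
        100 * E + 100 * (B + 1) + 100 * 1           ≤⟨ +-mono-≤ (+-mono-≤ (100≤ yE≤N) (≤-trans (*-monoʳ-≤ 100 B+1≤ft) ft≤)) (≤-trans (*-monoʳ-≤ 100 (≤-trans (m≤n+m 1 B) B+1≤ft)) ft≤) ⟩
        N + N + N                                   ≤⟨ ≤-reflexive (e' N) ⟩
        3 * N                                       ≤⟨ *-monoˡ-≤ N (≤ᵇ⇒≤ 3 100 _) ⟩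
        100 * N                                     ∎)
        where
        open ≤-Reasoning
        e : ∀ E B → 100 * (E + B + 2) ≡ 100 * E + 100 * (B + 1) + 100 * 1
        e = solveℕ
        e' : ∀ N → N + N + N ≡ 3 * N
        e' = solveℕ

      E≤N : E ≤ N
      E≤N = ≤-trans (≤-trans (m≤m+n E B) (m≤m+n (E + B) 2)) e₀≤N

      mn≤4N : m * suc n₁ ≤ 4 * N
      mn≤4N = begin
        m * suc n₁                ≡⟨ *-suc m n₁ ⟩
        m + m * n₁                ≤⟨ +-mono-≤ m≤2N (≤-trans (m≤m+n (m * n₁) k) (≤-trans low (+-monoʳ-≤ N E≤N))) ⟩
        2 * N + (N + N)           ≡⟨ e N ⟩
        4 * N                     ∎
        where
        open ≤-Reasoning
        e : ∀ N → 2 * N + (N + N) ≡ 4 * N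
        e = solveℕ

      -- Four contributions, namely the losses `e₀`, the negative elements `t`, the vacancies `Y`
      -- and the elements `X` beyond n, each have a square of at most `(8 + 2 * τ) * (N * e₀)`;
      -- adding four terms costs the factor 16.
      hQ : ∀ x t X Y → x ≤ suc B + t + (E + Y + X) → t * t ≤ 2 * (m * (suc B * W)) →
        X * X ≤ 2 * (m * (suc n₁ * suc (E + suc B))) → Y * Y ≤ 2 * (m * (suc n₁ * suc (E + suc B))) → Q x
      hQ x t X Y x≤ t² X² Y² = h , mhh≤ , four-sq {x} {e₀} {t} {Y} {X} (≤-trans x≤ (≤-trans (≤-reflexive (r1 B t E Y X)) (+-monoˡ-≤ (Y + X) (+-monoˡ-≤ t (≤-trans (n≤1+n _) (≤-reflexive (r2 E B)))))))
          (≤-trans (*-monoˡ-≤ e₀ e₀≤N) (≤-trans (≤-reflexive (sym (*-identityˡ (N * e₀)))) (*-monoˡ-≤ (N * e₀) {1} {8 + 2 * τ} (s≤s z≤n)))) t²' (XY {Y} Y²) (XY {X} X²)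
        where
        open ≤-Reasoning
        r1 : ∀ B t E Y X → suc B + t + (E + Y + X) ≡ (E + suc B) + t + (Y + X)
        r1 = solveℕ
        r2 : ∀ E B → suc (E + suc B) ≡ E + B + 2
        r2 = solveℕ
        r3 : ∀ m b w → 2 * (m * (b * w)) ≡ 2 * (b * (m * w))
        r3 = solveℕ
        r4 : ∀ τ N e → 2 * (e * (τ * N)) ≡ 2 * τ * (N * e)
        r4 = solveℕ
        r5 : ∀ m n e → 2 * (m * (n * e)) ≡ 2 * (m * n * e)
        r5 = solveℕ
        r6 : ∀ N e → 2 * (4 * N * e) ≡ 8 * (N * e)
        r6 = solveℕ
        t²' : t * t ≤ (8 + 2 * τ) * (N * e₀)
        t²' = begin
          t * t                              ≤⟨ t² ⟩
          2 * (m * (suc B * W))              ≡⟨ r3 m (suc B) W ⟩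
          2 * (suc B * (m * W))              ≤⟨ *-monoʳ-≤ 2 (*-mono-≤ (≤-trans (m≤n+m (suc B) E) (≤-trans (n≤1+n _) (≤-reflexive (r2 E B)))) mW≤) ⟩
          2 * (e₀ * (τ * N))                ≡⟨ r4 τ N e₀ ⟩
          2 * τ * (N * e₀)                  ≤⟨ *-monoˡ-≤ (N * e₀) (m≤n+m (2 * τ) 8) ⟩
          (8 + 2 * τ) * (N * e₀)            ∎
        XY : ∀ {X} → X * X ≤ 2 * (m * (suc n₁ * suc (E + suc B))) → X * X ≤ (8 + 2 * τ) * (N * e₀)
        XY {X} X² = begin
          X * X                                        ≤⟨ X² ⟩
          2 * (m * (suc n₁ * suc (E + suc B)))         ≡⟨ cong (λ w → 2 * (m * (suc n₁ * w))) (r2 E B) ⟩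
          2 * (m * (suc n₁ * e₀))                      ≡⟨ r5 m (suc n₁) e₀ ⟩
          2 * (m * suc n₁ * e₀)                        ≤⟨ *-monoʳ-≤ 2 (*-monoˡ-≤ e₀ mn≤4N) ⟩
          2 * (4 * N * e₀)                             ≡⟨ r6 N e₀ ⟩
          8 * (N * e₀)                                 ≤⟨ *-monoˡ-≤ (N * e₀) (m≤m+n 8 (2 * τ)) ⟩
          (8 + 2 * τ) * (N * e₀)                      ∎

      found : ∃[ F ] ∃[ R' ] (G ↭ F ++ R' × AP F 1 W × length F ≤ B)
      found = intervals (box (ZSF-++ˡ H zsf) (Mult-++ˡ {xs = G} H mult) sm) 1≤m 1≤W
        (≤-trans mW≤ (≤-trans (*-monoʳ-≤ τ N≤2G) (≤-reflexive (d τ (length G)))))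
        (proj₁ (proj₂ root)) (proj₂ (proj₂ root)) long (λ g 2≤g g≤C → ≤-<-trans (≤-trans (m≤m+n _ 1) B+1≤t) (generic g 2≤g g≤C))
        where
        open ≤-Reasoning
        d : ∀ τ g → τ * (2 * g) ≡ 2 * τ * g
        d = solveℕ
        d' : ∀ b → 50 * (2 * b) ≡ 100 * b
        d' = solveℕ
        long : 2 * B ≤ length G
        long = *-cancelˡ-≤ 50 (begin
          50 * (2 * B)          ≡⟨ d' B ⟩
          100 * B               ≤⟨ ≤-trans (*-monoʳ-≤ 100 (≤-trans (m≤m+n B 1) B+1≤ft)) ft≤ ⟩
          N                     ≤⟨ N≤2G ⟩
          2 * length G          ≤⟨ *-monoˡ-≤ (length G) (≤ᵇ⇒≤ 2 50 _) ⟩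
          50 * length G         ∎)

      done : P (G ++ H)
      done = conclude-with found
        where
        conclude-with : ∃[ F ] ∃[ R' ] (G ↭ F ++ R' × AP F 1 W × length F ≤ B) → P (G ++ H)
        conclude-with (F , R' , r , ap , F≤) = Finish.finish a₁ Q m k n₁ o N W B E h₀ 1≤m n+o p≤ nN₁ a₁< a₁≡ low high few hQ
          {G} {H} {F} {R'} zsf mult len sm H≤ r ap F≤

    C<p : C < p
    C<p = *-cancelˡ-< 2 C p (<-≤-trans 2C<N N≤2p)
      where
      open ≤-Reasoning
      C≤CC : ∀ c → c ≤ c * c
      C≤CC zero    = z≤n
      C≤CC (suc c) = m≤m*n (suc c) (suc c)
      2C<N : 2 * C < N
      2C<N = begin-strict
        2 * C                                     ≤⟨ *-monoʳ-≤ 2 (≤-trans (≤-trans (C≤CC C) (m≤n+m (C * C) (K * 1))) (m≤m+n (K * 1 + C * C) 1)) ⟩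
        2 * (K * 1 + C * C + 1)                   ≤⟨ *-monoʳ-≤ 2 (≤-trans (t-large 0 z≤n) t≤ft) ⟩
        2 * (f * t)                               <⟨ *-monoˡ-< (f * t) {{>-nonZero (≤-trans (m≤n+m 1 _) (≤-trans (t-large 0 z≤n) t≤ft))}} (≤ᵇ⇒≤ 3 100 _) ⟩
        100 * (f * t)                             ≤⟨ ft≤ ⟩
        N                                         ∎

    main : ∀ zs → length zs ≡ N → ZSF zs → Mult m zs → P zs
    main zs refl zsf mult = from-concentration (Concentrate.Run.result y Q₀ κ {{y≢0}} {{>-nonZero 1≤Q}} zsf mult
        (parameters N p m (≤-trans (m≤m+n N₁ _) N₀≤N) 1≤m pm≤ m≤2N N≤2p))
      where
      from-concentration : Concentrate.Conclusion y Q₀ κ {{y≢0}} {{>-nonZero 1≤Q}} m zs → P zs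
      from-concentration (w , b , R₁ , R₂ , u , perm , R₂≤ , sm , mw≤) = from-reps (small-reps sm)
        where
        H : List ℤ
        H = map (b *ᶻ_) R₂
        W₀ : ℕ
        W₀ = Q₀ ! * w
        mW₀≤ : m * W₀ ≤ τ * N
        mW₀≤ = begin
          m * (Q₀ ! * w)             ≡⟨ d m (Q₀ !) w ⟩
          Q₀ ! * (m * w)             ≤⟨ *-monoʳ-≤ (Q₀ !) mw≤ ⟩
          Q₀ ! * (κ * N)             ≡⟨ *-assoc (Q₀ !) κ N ⟨
          Q₀ ! * κ * N               ≤⟨ *-monoˡ-≤ N Q!κ≤τ ⟩
          τ * N                      ∎
          where
          open ≤-Reasoning
          d : ∀ m q w → m * (q * w) ≡ q * (m * w)
          d = solveℕ
        from-reps : ∃[ G ] (Dilates b R₁ G × All (λ r → ∣ r ∣ ≤ W₀) G) → P zs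
        from-reps (G , dG , sm') = P-↭ perm (P-dilate u dil (Nm.normalise f {W₀} {G} {H} state ≤-refl wide
            (λ {W'} {G'} {H'} W'≤ st H'≤ gen → Tail.done {W'} {h₀} 100h₀≤ (≤-trans (*-monoʳ-≤ m W'≤) mW₀≤) (1≤W' W' st H'≤) (Nm.State.zsf st) (Nm.State.mult st) (Nm.State.total st) (Nm.State.small st) H'≤ gen)))
          where
          dil : Dilates b (R₁ ++ R₂) (G ++ H)
          dil = Dilates-++ dG (Dilates-map b R₂)
          -- A bound for all exceptional elements: those of the concentration, at most `7 N / y`,
          -- and `t` for each of the `f` divisions, at most `N / y` together. As `y` is at least 100
          -- this is at most 8 percent of `N`.
          h₀ : ℕ
          h₀ = length H + f * t
          100h₀≤ : 100 * h₀ ≤ 8 * N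
          100h₀≤ = begin
            100 * (length H + f * t)             ≡⟨ *-distribˡ-+ 100 (length H) (f * t) ⟩
            100 * length H + 100 * (f * t)       ≤⟨ +-mono-≤ (≤-trans (*-monoˡ-≤ (length H) 100≤y) (≤-trans (≤-reflexive (cong (y *_) (LP.length-map _ R₂))) R₂≤)) ft≤ ⟩
            7 * N + N                            ≡⟨ +-comm (7 * N) N ⟩
            8 * N                                ∎
            where open ≤-Reasoning
          2h₀≤N : 2 * h₀ ≤ N
          2h₀≤N = *-cancelˡ-≤ 50 (≤-trans (≤-reflexive (d h₀)) (≤-trans 100h₀≤ (*-monoˡ-≤ N (≤ᵇ⇒≤ 8 50 _))))
            where
            d : ∀ h → 50 * (2 * h) ≡ 100 * h
            d = solveℕ
          module Nm = Normalise a₁ Q m N C t h₀ C<p 2h₀≤N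
          state : Nm.State W₀ G H
          state = record
            { zsf = Dilates-ZSF u dil (ZSF-↭ perm zsf)
            ; mult = Dilates-Mult u dil (Mult-↭ perm mult)
            ; total = trans (sym (LP.length-++ G)) (trans (sym (Dilates-length dil)) (sym (↭-length perm)))
            ; small = sm' }
          wide : 4 * (m * W₀) < 2 ^ f * N
          wide = ≤-<-trans (≤-trans (*-monoʳ-≤ 4 mW₀≤) (≤-reflexive (sym (*-assoc 4 τ N)))) (*-monoˡ-< N {{>-nonZero 1≤N}} (n<2^n f))
          1≤W' : ∀ W' {G' H'} → Nm.State W' G' H' → length H' ≤ h₀ → 1 ≤ W'
          1≤W' zero    st H'≤ = ⊥-elim (Nm.G-large st H'≤ (≤-trans (≤-reflexive (cong suc (cong (4 *_) (*-zeroʳ m)))) 1≤N))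
          1≤W' (suc W) _  _   = s≤s z≤n

  -- Multiplicity functions and lists

  seqList : ∀ n → (Fin n → ℕ) → (Fin n → ℕ) → List ℤ
  seqList zero    f h = []
  seqList (suc n) f h = replicate (f Fin.zero) (pos (h Fin.zero)) ++ seqList n (λ i → f (Fin.suc i)) (λ i → h (Fin.suc i))

  seqList-length : ∀ n f h → length (seqList n f h) ≡ sumFin n f
  seqList-length zero    f h = refl
  seqList-length (suc n) f h = trans (LP.length-++ (replicate (f Fin.zero) (pos (h Fin.zero)))) (cong₂ _+_ (LP.length-replicate (f Fin.zero)) (seqList-length n _ _))

  ∑ᴸ-replicate : ∀ {X : Set} (g : X → ℕ) k x → ∑ᴸ g (replicate k x) ≡ k * g x
  ∑ᴸ-replicate g zero    x = refl
  ∑ᴸ-replicate g (suc k) x = cong (g x +_) (∑ᴸ-replicate g k x)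

  seqList-∑ᴸ : ∀ n f h (g : ℤ → ℕ) → ∑ᴸ g (seqList n f h) ≡ sumFin n (λ i → f i * g (pos (h i)))
  seqList-∑ᴸ zero    f h g = refl
  seqList-∑ᴸ (suc n) f h g = trans (∑ᴸ-++ g (replicate (f Fin.zero) (pos (h Fin.zero))) _) (cong₂ _+_ (∑ᴸ-replicate g (f Fin.zero) _) (seqList-∑ᴸ n _ _ g))

  sumFin-∑ : ∀ n {f : Fin n → ℕ} {F : ℕ → ℕ} → (∀ i → f i ≡ F (toℕ i)) → sumFin n f ≡ ∑ n F
  sumFin-∑ zero    e = refl
  sumFin-∑ (suc n) e = cong₂ _+_ (e Fin.zero) (sumFin-∑ n (λ i → e (Fin.suc i)))

  -- `SS` with the number of summands, which is needed to recognise the corresponding sub-multiset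
  -- as non-empty.
  data SSc : List ℤ → ℕ → ℤ → Set where
    []   : SSc [] 0 (pos 0)
    skip : ∀ {z zs c v} → SSc zs c v → SSc (z ∷ zs) c v
    take : ∀ {z zs c v} → SSc zs c v → SSc (z ∷ zs) (suc c) (z +ᶻ v)

  SS-count : ∀ {zs v} → SS zs v → ∃[ c ] SSc zs c v
  SS-count [] = 0 , []
  SS-count (skip s) with SS-count s
  ... | c , t = c , skip t
  SS-count (take s) with SS-count s
  ... | c , t = suc c , take t

  SSc-↭ : ∀ {xs ys c v} → xs ↭ ys → SSc xs c v → SSc ys c v
  SSc-↭ ↭refl s = s
  SSc-↭ (prep x r) (skip s) = skip (SSc-↭ r s)
  SSc-↭ (prep x r) (take s) = take (SSc-↭ r s)
  SSc-↭ (swap x y r) (skip (skip s)) = skip (skip (SSc-↭ r s))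
  SSc-↭ (swap x y r) (skip (take s)) = take (skip (SSc-↭ r s))
  SSc-↭ (swap x y r) (take (skip s)) = skip (take (SSc-↭ r s))
  SSc-↭ (swap x y r) (take (take {c = c} {v} s)) = subst (SSc _ _) (e x y v) (take (take (SSc-↭ r s)))
    where
    e : ∀ x y v → y +ᶻ (x +ᶻ v) ≡ x +ᶻ (y +ᶻ v)
    e = solveℤ
  SSc-↭ (↭trans r r') s = SSc-↭ r' (SSc-↭ r s)

  SSc-replicate : ∀ k x {ys c v} → SSc (replicate k (pos x) ++ ys) c v → ∃[ j ] ∃[ c' ] ∃[ v' ] (j ≤ k × SSc ys c' v' × c ≡ j + c' × v ≡ pos (j * x) +ᶻ v')
  SSc-replicate zero    x {c = c} {v} s = 0 , c , v , z≤n , s , refl , sym (ℤP.+-identityˡ v)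
  SSc-replicate (suc k) x (skip s) with SSc-replicate k x s
  ... | j , c' , v' , l , t , e , e' = j , c' , v' , ≤-trans l (n≤1+n k) , t , e , e'
  SSc-replicate (suc k) x (take s) with SSc-replicate k x s
  ... | j , c' , v' , l , t , refl , refl = suc j , c' , v' , s≤s l , t , refl , sym (ℤP.+-assoc (pos x) (pos (j * x)) v')

  SSc-seqList : ∀ n f h {c v} → SSc (seqList n f h) c v → ∃[ B ] ((∀ i → B i ≤ f i) × sumFin n B ≡ c × v ≡ pos (sumFin n (λ i → B i * h i)))
  SSc-seqList zero    f h [] = (λ ()) , (λ ()) , refl , refl
  SSc-seqList (suc n) f h s with SSc-replicate (f Fin.zero) (h Fin.zero) s
  ... | j , c' , v' , l , t , refl , refl with SSc-seqList n _ _ t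
  ...   | B , B≤ , refl , refl = B' , B'≤ , refl , refl
    where
    B' : Fin (suc n) → ℕ
    B' Fin.zero    = j
    B' (Fin.suc i) = B i
    B'≤ : ∀ i → B' i ≤ f i
    B'≤ Fin.zero    = l
    B'≤ (Fin.suc i) = B≤ i

  module Convert (A : Seq p) where
    Â : ℕ → ℕ
    Â j with j <? p
    ... | yes l = A (fromℕ< l)
    ... | no _  = 0

    Â-toℕ : ∀ x → A x ≡ Â (toℕ x)
    Â-toℕ x with toℕ x <? p
    ... | yes l = cong A (sym (fromℕ<-toℕ x l))
    ... | no nl = contradiction (toℕ<n x) nl

    zs : List ℤ
    zs = seqList p A toℕ

    zs-length : length zs ≡ card A
    zs-length = seqList-length p A toℕ

    zs-count : ∀ (P : ℤ → Bool) → # P zs ≡ ∑ p (λ j → Â j * ι (P (pos j)))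
    zs-count P = trans (seqList-∑ᴸ p A toℕ (ι ∘ P)) (sumFin-∑ p {F = λ j → Â j * ι (P (pos j))} (λ i → cong (_* ι (P (pos (toℕ i)))) (Â-toℕ i)))

    zs-Mult : ∀ {m} → maxMultAtMost A m → Mult m zs
    zs-Mult {m} mx a = begin
      count a zs                                   ≡⟨ zs-count (λ z → δ (z -ᶻ a)) ⟩
      ∑ p (λ j → Â j * ι (δ (pos j -ᶻ a)))         ≤⟨ ∑-mono p (λ j → *-monoˡ-≤ (ι (δ (pos j -ᶻ a))) (Â≤ j)) ⟩
      ∑ p (λ j → m * ι (δ (pos j -ᶻ a)))           ≡⟨ trans (∑-*ˡ p m (λ j → ι (δ (pos j -ᶻ a)))) (cong (m *_) (trans (sym (Σp-def (λ x → ι (δ (x -ᶻ a))))) (Σp-δ1 a))) ⟩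
      m * 1                                        ≡⟨ *-identityʳ m ⟩
      m                                            ∎
      where
      open ≤-Reasoning
      Â≤ : ∀ j → Â j ≤ m
      Â≤ j with j <? p
      ... | yes l = mx (fromℕ< l)
      ... | no _  = z≤n

    zs-ZSF : ZeroSumFree A → ZSF zs
    zs-ZSF zsf {z} {zs'} {v} r s e with SS-count s
    ... | c , t with SSc-seqList p A toℕ (SSc-↭ (↭-sym r) (take {z} t))
    ...   | B , B≤ , cardB , v≡ = zsf B B≤ (λ q → contradiction (trans (sym cardB) q) λ ()) (residue-cong {pos (seqSum B)} {pos 0} (≈-trans (≈-reflexive (sym v≡)) e))

    module _ (a₁ : ℕ → ℕ) (b : ℤ) (u : Unit b) where
      open Excess a₁ (λ _ → ⊤) using (Ex)

      -- Multiplication by the unit `b` permutes the residues, so the excess of the dilate may be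
      -- summed over the preimages `j`.
      excess≤Ex : ∑ p (λ j → Â j ∸ a₁ ((pos j *ᶻ b) %ℕ p)) ≤ Ex (map (b *ᶻ_) zs)
      excess≤Ex = begin
        ∑ p (λ j → Â j ∸ a₁ ((pos j *ᶻ b) %ℕ p))         ≤⟨ ∑-mono< p (λ j l → ∸-monoˡ-≤ (a₁ ((pos j *ᶻ b) %ℕ p)) (hit j l)) ⟩
        ∑ p (λ j → g (pos j *ᶻ b))                       ≡⟨ Σp-def (λ x → g (x *ᶻ b)) ⟨
        Σp (λ x → g (x *ᶻ b))                            ≡⟨ Σp-dilate {g} g-per u ⟩
        Σp g                                             ∎
        where
        open ≤-Reasoning
        g : ℤ → ℕ
        g v = count v (map (b *ᶻ_) zs) ∸ a₁ (v %ℕ p)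
        g-per : Per g
        g-per e = cong₂ _∸_ (∑ᴸ-cong (λ z → cong ι (δ-per (≈-minus (≈-refl {z}) e))) (map (b *ᶻ_) zs)) (cong a₁ (residue-cong e))
        hit : ∀ j → j < p → Â j ≤ count (pos j *ᶻ b) (map (b *ᶻ_) zs)
        hit j l = begin
          Â j                                                           ≡⟨ *-identityʳ (Â j) ⟨
          Â j * 1                                                       ≡⟨ cong (λ w → Â j * ι w) (δ-true {b *ᶻ pos j -ᶻ pos j *ᶻ b} (≈-reflexive (e b (pos j)))) ⟨
          Â j * ι (δ (b *ᶻ pos j -ᶻ pos j *ᶻ b))                        ≤⟨ term≤∑ p (λ i → Â i * ι (δ (b *ᶻ pos i -ᶻ pos j *ᶻ b))) j l ⟩
          ∑ p (λ i → Â i * ι (δ (b *ᶻ pos i -ᶻ pos j *ᶻ b)))            ≡⟨ zs-count (λ z → δ (b *ᶻ z -ᶻ pos j *ᶻ b)) ⟨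
          # (λ z → δ (b *ᶻ z -ᶻ pos j *ᶻ b)) zs                         ≡⟨ ∑ᴸ-map (λ z → ι (δ (z -ᶻ pos j *ᶻ b))) (b *ᶻ_) zs ⟨
          count (pos j *ᶻ b) (map (b *ᶻ_) zs)                           ∎
          where
          e : ∀ b j → b *ᶻ j -ᶻ j *ᶻ b ≡ pos 0
          e = solveℤ

      bFin : Fin p
      bFin = fromℕ< (residue<p b)

      bFin≡ : toℕ bFin ≡ b %ℕ p
      bFin≡ = toℕ-fromℕ< (residue<p b)

      bFin≢0 : ¬ (toℕ bFin ≡ 0)
      bFin≢0 e = u (residue-≈ {b} {pos 0} (trans (sym bFin≡) e))

      product : ∀ j → (toℕ bFin * j) % p ≡ (pos j *ᶻ b) %ℕ p
      product j = residue-cong {pos (toℕ bFin * j)} {pos j *ᶻ b} (≈-trans (≈-reflexive (trans (cong (λ w → pos (w * j)) bFin≡) (trans (ℤP.pos-* (b %ℕ p) j) (ℤP.*-comm (pos (b %ℕ p)) (pos j))))) (≈-*ˡ (pos j) (≈-sym (≈-residue b))))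

      -- The copies of `x` beyond the multiplicity of `b x` in A₁: the smallest part that has to be
      -- removed for this `b`.
      Aflat : Seq p
      Aflat x = A x ∸ a₁ ((toℕ bFin * toℕ x) % p)

      Aflat⊑ : Aflat ⊑ A
      Aflat⊑ x = m∸n≤m (A x) (a₁ ((toℕ bFin * toℕ x) % p))

      card-Aflat : card Aflat ≤ Ex (map (b *ᶻ_) zs)
      card-Aflat = ≤-trans (≤-reflexive (sumFin-∑ p {F = λ j → Â j ∸ a₁ ((pos j *ᶻ b) %ℕ p)} (λ i → cong₂ (λ x y → x ∸ a₁ y) (Â-toℕ i) (product (toℕ i))))) excess≤Ex

      if-≤ : ∀ {P : Set} (d : Dec P) {x y} → (P → x ≤ y) → (if ⌊ d ⌋ then x else 0) ≤ y * ι ⌊ d ⌋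
      if-≤ (yes q) {y = y} h = ≤-trans (h q) (≤-reflexive (sym (*-identityʳ y)))
      if-≤ (no _)  _ = z≤n

      scaled : ∀ y → scale bFin (A ∖ Aflat) y ≤ a₁ (toℕ y)
      scaled y = begin
        scale bFin (A ∖ Aflat) y                                   ≤⟨ sumFin-mono p (λ x → if-≤ ((toℕ bFin * toℕ x) % p ≟ toℕ y) (λ e → ≤-trans (keep (A x) _) (≤-reflexive (cong a₁ e)))) ⟩
        sumFin p (λ x → a₁ (toℕ y) * ι ⌊ (toℕ bFin * toℕ x) % p ≟ toℕ y ⌋) ≡⟨ sumFin-∑ p {F = λ j → a₁ (toℕ y) * ι ⌊ (pos j *ᶻ b) %ℕ p ≟ toℕ y ⌋} (λ i → cong (λ w → a₁ (toℕ y) * ι ⌊ w ≟ toℕ y ⌋) (product (toℕ i))) ⟩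
        ∑ p (λ j → a₁ (toℕ y) * ι ⌊ (pos j *ᶻ b) %ℕ p ≟ toℕ y ⌋)   ≡⟨ ∑-*ˡ p (a₁ (toℕ y)) (λ j → ι ⌊ (pos j *ᶻ b) %ℕ p ≟ toℕ y ⌋) ⟩
        a₁ (toℕ y) * ∑ p (λ j → ι ⌊ (pos j *ᶻ b) %ℕ p ≟ toℕ y ⌋)   ≡⟨ cong (a₁ (toℕ y) *_) one ⟩
        a₁ (toℕ y) * 1                                             ≡⟨ *-identityʳ _ ⟩
        a₁ (toℕ y)                                                 ∎
        where
        open ≤-Reasoning
        sumFin-mono : ∀ n {f g : Fin n → ℕ} → (∀ i → f i ≤ g i) → sumFin n f ≤ sumFin n g
        sumFin-mono zero    h = z≤n
        sumFin-mono (suc n) h = +-mono-≤ (h Fin.zero) (sumFin-mono n (λ i → h (Fin.suc i)))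
        keep : ∀ a c → a ∸ (a ∸ c) ≤ c
        keep a c with ≤-total a c
        ... | inj₁ l = ≤-trans (m∸n≤m a (a ∸ c)) l
        ... | inj₂ l = ≤-reflexive (m∸[m∸n]≡n l)
        hits : ∀ x → ι ⌊ x %ℕ p ≟ toℕ y ⌋ ≡ ι (δ (x -ᶻ pos (toℕ y)))
        hits x with x %ℕ p ≟ toℕ y
        ... | yes e = sym (cong ι (δ-true (≈⇒≈0 {x} {pos (toℕ y)} (≈-trans (≈-residue x) (≈-reflexive (cong pos e))))))
        ... | no ne = sym (cong ι (δ-false (λ e → ne (trans (residue-cong (≈0⇒≈ {x} {pos (toℕ y)} e)) (residue-small (toℕ<n y))))))
        one : ∑ p (λ j → ι ⌊ (pos j *ᶻ b) %ℕ p ≟ toℕ y ⌋) ≡ 1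
        one = trans (sym (Σp-def (λ x → ι ⌊ (x *ᶻ b) %ℕ p ≟ toℕ y ⌋))) (trans (Σp-dilate {λ x → ι ⌊ x %ℕ p ≟ toℕ y ⌋} (λ e → cong (λ w → ι ⌊ w ≟ toℕ y ⌋) (residue-cong e)) u)
          (trans (Σp-cong hits) (Σp-δ1 (pos (toℕ y)))))

-- The theorem for multiplicity functions

-- With α = a / q, taking `q`-th powers clears the exponent of the hypothesis. The exponent of the
-- conclusion is (α + 1/2) / 2 = (2 a + q) / (4 q), which explains the powers there.
Theorem : ℕ → ℕ → ℕ → ℕ → Set
Theorem a q C D = (p : ℕ) → .{{_ : NonZero p}} → Prime p →
    (m : ℕ) → 1 ≤ m → m ≤ p →
    (k n : ℕ) → A1Params p m k n →
    (A : Seq p) → ZeroSumFree A → maxMultAtMost A m →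
    ∣ card (A1 p m k n) - card A ∣ ^ q ≤ C ^ q * (p * m) ^ a →
    Σ (Fin p) λ b → ¬ (toℕ b ≡ 0) ×
    Σ (Seq p) λ Aflat → Aflat ⊑ A ×
    card Aflat ^ (4 * q) ≤ D ^ (4 * q) * (p * m) ^ (2 * a + q) ×
    scale b (A ∖ Aflat) ⊑ A1 p m k n

module Proof (a q : ℕ) (6q<13a : 6 * q < 13 * a) (2a<q : 2 * a < q) (C : ℕ) (y : ℕ) (100≤y : 100 ≤ y) (T : Toolbox y) where
  open Toolbox T using (τ; K; 1≤τ)
  N₀ : ℕ
  N₀ = Scale.N₀ y 100≤y T
  open Sizes q a C τ K 6q<13a 2a<q 1≤τ

  -- For `p * m` beyond `P₀` the sequence has more than `N₀` elements, and beyond the second summand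
  -- of `P₁` its deviation from |A₁| is negligible. The finitely many smaller values of `p * m` are
  -- absorbed by the constant `D`.
  c P₀ P₁ D : ℕ
  c  = 4 * suc y
  P₀ = 2 * ((2 * N₀ + 16) * (2 * N₀ + 16))
  P₁ = P₀ + (c * C) ^ (2 * q)
  D  = D₀ + P₁

  module _ (p' : ℕ) (pr : Prime (suc p')) (m : ℕ) (1≤m : 1 ≤ m) (m≤p : m ≤ suc p') where
    open Residues p' pr using (p; 1≉0)

    1≤pm : 1 ≤ p * m
    1≤pm = *-mono-≤ {1} {p} {1} (s≤s z≤n) 1≤m

    Goal : ℕ → ℕ → Seq p → Set
    Goal k n A = Σ (Fin p) λ b → ¬ (toℕ b ≡ 0) ×
      Σ (Seq p) λ Aflat → Aflat ⊑ A ×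
      card Aflat ^ (4 * q) ≤ D ^ (4 * q) * (p * m) ^ (2 * a + q) ×
      scale b (A ∖ Aflat) ⊑ A1 p m k n

    card≤pm : ∀ {A : Seq p} → maxMultAtMost A m → card A ≤ p * m
    card≤pm {A} mx = go p A mx
      where
      go : ∀ n (f : Fin n → ℕ) → (∀ i → f i ≤ m) → sumFin n f ≤ n * m
      go zero    f h = z≤n
      go (suc n) f h = +-mono-≤ (h Fin.zero) (go n (λ i → f (Fin.suc i)) (λ i → h (Fin.suc i)))

    -- The whole of `A` is discarded: it has at most `p * m ≤ P₁ ≤ D` elements.
    small-case : ∀ k n A → maxMultAtMost A m → p * m ≤ P₁ → Goal k n A
    small-case k n A mx pm≤ = Residues.Convert.bFin p' pr A (λ _ → 0) (pos 1) 1≉0 , Residues.Convert.bFin≢0 p' pr A (λ _ → 0) (pos 1) 1≉0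
      , A , (λ x → ≤-refl)
      , ≤-trans (^-monoˡ-≤ (4 * q) (≤-trans (card≤pm {A} mx) (≤-trans pm≤ (m≤n+m P₁ D₀)))) (m≤m*n (D ^ (4 * q)) ((p * m) ^ (2 * a + q)) {{>-nonZero (1≤^ (p * m) (2 * a + q) 1≤pm)}})
      , λ x → ≤-trans (≤-reflexive (zeros p (λ i → none (A i) ((toℕ (Residues.Convert.bFin p' pr A (λ _ → 0) (pos 1) 1≉0) * toℕ i) % p ≟ toℕ x)))) z≤n
      where
      zeros : ∀ n {f : Fin n → ℕ} → (∀ i → f i ≡ 0) → sumFin n f ≡ 0
      zeros zero    h = refl
      zeros (suc n) h = cong₂ _+_ (h Fin.zero) (zeros n (λ i → h (Fin.suc i)))
      none : ∀ {P : Set} x (d : Dec P) → (if ⌊ d ⌋ then x ∸ x else 0) ≡ 0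
      none x (yes _) = n∸n≡0 x
      none x (no _)  = refl

    module Big (k n₁ : ℕ) (1≤k : 1 ≤ k) (k≤m : k ≤ m) (p> : m * tri n₁ + k * suc n₁ < p) (p≤ : p ≤ m * tri n₁ + suc k * suc n₁)
      (A : Seq p) (zsf : ZeroSumFree A) (mx : maxMultAtMost A m) (dev : ∣ card (A1 p m k (suc n₁)) - card A ∣ ^ q ≤ C ^ q * (p * m) ^ a) (big : P₁ < p * m) where
      open Residues.Convert p' pr A
      a₁ : ℕ → ℕ
      a₁ = extremal m k (suc n₁)

      n<p : suc n₁ < p
      n<p = ≤-<-trans (≤-trans (≤-trans (≤-reflexive (sym (+-identityʳ (suc n₁)))) (*-monoˡ-≤ (suc n₁) 1≤k)) (m≤n+m (k * suc n₁) (m * tri n₁))) p>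

      gap : ∃[ o ] (suc n₁ + o ≡ p')
      gap = m≤n⇒∃[o]m+o≡n (≤-pred n<p)

      o N E : ℕ
      o = proj₁ gap
      N = length zs
      E = ∣ card (A1 p m k (suc n₁)) - card A ∣

      card-A1 : card (A1 p m k (suc n₁)) ≡ m * n₁ + k
      card-A1 = trans (Residues.sumFin-∑ p' pr p {F = a₁} (A1≡extremal p m k (suc n₁))) (trans (cong (λ w → ∑ (suc w) a₁) (sym (proj₂ gap))) (extremal-total m k n₁ o))

      open Extremal p m k n₁ 1≤m m≤p k≤m p> p≤

      low : N₁ ≤ N + E
      low = subst₂ (λ x z → x ≤ z + E) card-A1 (sym zs-length) (m≤n+∣m-n∣ (card (A1 p m k (suc n₁))) (card A))

      high : N ≤ N₁ + E
      high = subst₂ (λ z x → z ≤ x + E) (sym zs-length) card-A1 (m≤n+∣n-m∣ (card A) (card (A1 p m k (suc n₁))))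

      E-small : (c * E) * (c * E) ≤ p * m
      E-small = deviation-small q a C c E (p * m) 2a<q 1≤pm dev (≤-trans (m≤n+m _ P₀) (<⇒≤ big))

      open Near N E N₀ y 100≤y low high E-small (≤-<-trans (m≤m+n P₀ _) big)

      1<p : 1 < p
      1<p = ≤-<-trans (s≤s z≤n) n<p

      N≤2p : N ≤ 2 * p
      N≤2p = ≤-trans (<⇒≤ (Residues.ZSF-length p' pr zs (zs-ZSF zsf) 1<p)) (m≤m+n p (p + 0))

      module M = Residues.Main p' pr y 100≤y T a₁ m k n₁ (suc o) N E 1≤m (trans (+-suc (suc n₁) o) (cong suc (proj₂ gap))) p≤ nN₁
        (extremal-< m k n₁) (extremal-≡ m k n₁) low high yE≤N pm≤4NN m≤2N N≤2p (≤-trans (m≤m+n N₀ 7) (<⇒≤ N-large))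

      from-main : Residues.Excess.P p' pr a₁ M.Q zs → Goal k (suc n₁) A
      from-main (b , u , h , mhh , sq≤) = bFin a₁ b u , bFin≢0 a₁ b u , Aflat a₁ b u , Aflat⊑ a₁ b u
        , final-bound {card (Aflat a₁ b u)} {E} {h} {N} {p * m} {m} {D} 1≤m 1≤pm dev mhh NN≤8pm (≤-trans (*-mono-≤ (card-Aflat a₁ b u) (card-Aflat a₁ b u)) sq≤) (m≤m+n D₀ P₁)
        , λ x → ≤-trans (scaled a₁ b u x) (≤-reflexive (sym (A1≡extremal p m k (suc n₁) x)))

      big-case : Goal k (suc n₁) A
      big-case = from-main (M.main zs refl (zs-ZSF zsf) (zs-Mult mx))

  proof : Theorem a q C D
  -- For `n = 0` the upper bound on `p` in `A1Params` reads `p ≤ 0`.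
  proof (suc p') pr m 1≤m m≤p k zero (_ , _ , _ , p≤) A zsf mx dev = contradiction (≤-trans p≤ (≤-reflexive (trans (cong₂ _+_ (*-zeroʳ m) (*-zeroʳ k)) refl))) λ ()
  proof (suc p') pr m 1≤m m≤p k (suc n₁) (1≤k , k≤m , p> , p≤) A zsf mx dev with P₁ <? suc p' * m
  ... | yes big = Big.big-case p' pr m 1≤m m≤p k n₁ 1≤k k≤m p> p≤ A zsf mx dev big
  ... | no nbig = small-case p' pr m 1≤m m≤p k (suc n₁) A mx (≮⇒≥ nbig)

theorem3p1 : (a q : ℕ) → 6 * q < 13 * a → 2 * a < q →
    (C : ℕ) → Σ ℕ λ D →
    (p : ℕ) → .{{_ : NonZero p}} → Prime p →
    (m : ℕ) → 1 ≤ m → m ≤ p →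
    (k n : ℕ) → A1Params p m k n →
    (A : Seq p) → ZeroSumFree A → maxMultAtMost A m →
    ∣ card (A1 p m k n) - card A ∣ ^ q ≤ C ^ q * (p * m) ^ a →
    Σ (Fin p) λ b → ¬ (toℕ b ≡ 0) ×
    Σ (Seq p) λ Aflat → Aflat ⊑ A ×
    card Aflat ^ (4 * q) ≤ D ^ (4 * q) * (p * m) ^ (2 * a + q) ×
    scale b (A ∖ Aflat) ⊑ A1 p m k n
theorem3p1 a q 6q<13a 2a<q C = with-constant 100 ≤-refl
  where
  -- Abstracting the constant 100 prevents the evaluation of huge numerals.
  with-constant : ∀ y → 100 ≤ y → Σ ℕ (Theorem a q C)
  with-constant y 100≤y = Proof.D a q 6q<13a 2a<q C y 100≤y T , Proof.proof a q 6q<13a 2a<q C y 100≤y T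
    where
    T : Toolbox y
    T = toolbox y (≤-trans (≤ᵇ⇒≤ 8 100 _) 100≤y)
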